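{- Let ${\boldsymbol{\nu}}$ be any $k$-tuple of skew shapes with $\mathrm{diam}({\boldsymbol{\nu}})\le 3$, and $n=|{\boldsymbol{\nu}}|$. Then \[G_{\boldsymbol{\nu}}(X;q)=\sum_{\lambda\vdash n}\;\sum_{{\bf T}\in{\bf T}({\boldsymbol{\nu}},\lambda)} q^{\mathrm{inv}_k({\bf T})}\,s_\lambda .\]
   Context: Diagrams are in French notation in $\mathbb Z^2$: a cell in column $j$ and row $i$ has content $c=j-i$. Let ${\boldsymbol{\nu}}=(\nu^{(0)},\dots,\nu^{(k-1)})$ be a $k$-tuple of skew shapes with $n$ cells in total. A standard filling ${\bf T}=(T^{(0)},\dots,T^{(k-1)})$ of ${\boldsymbol{\nu}}$ is a bijective assignment of $1,\dots,n$ to the cells such that each $T^{(i)}$ increases from left to right along rows and from bottom to top along columns; $\mathrm{SYT}({\boldsymbol{\nu}})$ is the set of these. The shifted content of a cell $x$ of $\nu^{(i)}$ is $\tilde c(x)=k\,c(x)+i$. The shifted content word of ${\bf T}$ lists its entries in order of increasing shifted content, cells of equal shifted content (which lie on one diagonal of one $\nu^{(i)}$) being read from southwest to northeast. $\sigma({\bf T})\in\{\pm1\}^{n-1}$ is the signature of this word $w$: $\sigma_i=+1$ if $i$ appears before $i+1$ in $w$, else $-1$. $\mathrm{inv}_k({\bf T})$ is the number of pairs of cells $(x,y)$ with $0<\tilde c(y)-\tilde c(x)<k$ and ${\bf T}(x)>{\bf T}(y)$. $\mathrm{diam}({\boldsymbol{\nu}})$ is the maximum size of a set $R$ of distinct shifted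 contents of cells of ${\boldsymbol{\nu}}$ with $|x-y|\le k$ for all $x,y\in R$. For $\sigma\in\{\pm1\}^{n-1}$, $F_\sigma(X)=\sum x_{i_1}\cdots x_{i_n}$ over $i_1\le\dots\le i_n$ with $i_j=i_{j+1}\Rightarrow\sigma_j=+1$. The LLT polynomial is $G_{\boldsymbol{\nu}}(X;q)=\sum_{{\bf T}\in\mathrm{SYT}({\boldsymbol{\nu}})}q^{\mathrm{inv}_k({\bf T})}F_{\sigma({\bf T})}(X)$. $s_\lambda$ is the Schur function. $P(w)$ is the Robinson–Schensted insertion tableau of $w\in S_n$; $U_\lambda$ is the standard tableau of shape $\lambda$ filled with $1,\dots,n$ row by row from the bottom row up, each row left to right; $\mathrm{SYam}(\lambda)=\{w\in S_n: P(w)=U_\lambda\}$. Finally ${\bf T}({\boldsymbol{\nu}},\lambda)=\{{\bf T}\in\mathrm{SYT}({\boldsymbol{\nu}}):\text{the shifted content word of }{\bf T}\text{ lies in }\mathrm{SYam}(\lambda)\}$. -}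

module Defs where

open import Data.Bool using (Bool; true; false; _∧_; _∨_; not; if_then_else_)
open import Data.Nat as ℕ using (ℕ; zero; suc; _+_; _∸_; _≤_; _≥_; _≡ᵇ_; _<ᵇ_; _≤ᵇ_)
open import Data.Integer as ℤ using (ℤ; +_; ∣_∣)
open import Data.Fin using (Fin; toℕ)
open import Data.List using (List; []; _∷_; length; map; concatMap; zip; upTo; applyUpTo; filterᵇ; foldl; allFin)
open import Data.Nat.ListAction using (sum)
open import Data.List.Relation.Unary.All using (All)
open import Data.List.Relation.Unary.Linked using (Linked)
open import Data.List.Relation.Unary.Unique.Propositional using (Unique)
open import Data.List.Membership.Propositional using (_∈_)
open import Data.List.Properties using (≡-dec)
open import Data.Maybe using (Maybe; just; nothing)
open import Data.Product using (_×_; _,_; proj₁; proj₂)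
open import Relation.Nullary using (does)

count : {A : Set} → (A → Bool) → List A → ℕ
count p xs = length (filterᵇ p xs)

pairs : {A : Set} → List A → List (A × A)
pairs xs = concatMap (λ x → map (λ y → (x , y)) xs) xs

allWords : ℕ → ℕ → List (List ℕ)
allWords m zero = [] ∷ []
allWords m (suc n) = concatMap (λ v → map (v ∷_) (allWords m n)) (upTo m)

insertEverywhere : {A : Set} → A → List A → List (List A)
insertEverywhere x [] = (x ∷ []) ∷ []
insertEverywhere x (y ∷ ys) = (x ∷ y ∷ ys) ∷ map (y ∷_) (insertEverywhere x ys)

perms : {A : Set} → List A → List (List A)
perms [] = [] ∷ []
perms (x ∷ xs) = concatMap (insertEverywhere x) (perms xs)

part : List ℕ → ℕ → ℕ
part [] i = 0
part (x ∷ xs) zero = x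
part (x ∷ xs) (suc i) = part xs i

-- position of the first occurrence of a in a list (length if absent)
indexOf : ℕ → List ℕ → ℕ
indexOf a [] = 0
indexOf a (x ∷ xs) = if a ≡ᵇ x then 0 else suc (indexOf a xs)

occ : ℕ → List ℕ → ℕ
occ v xs = count (λ x → v ≡ᵇ x) xs

-- the word s has content α: value v occurs exactly α_v times, for v < length α
-- (values ≥ length α cannot occur in words over the alphabet {0..length α - 1})
hasContent : List ℕ → List ℕ → Bool
hasContent s α = go 0 α
  where
  go : ℕ → List ℕ → Bool
  go v [] = true
  go v (a ∷ as) = (occ v s ≡ᵇ a) ∧ go (suc v) as

-- A skew shape λ/μ, translated by (dx , dy) in Z^2.  Row r (r = 0 the
-- bottom row of the shape) has the cells in columns inner_r ≤ j < outer_r.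
-- Cell (r , j) of λ/μ sits at row dy + r and column dx + j of Z^2.
record SkewShape : Set where
  field
    outer    : List ℕ
    inner    : List ℕ
    dx       : ℤ
    dy       : ℤ
    outerDec : Linked _≥_ outer
    innerDec : Linked _≥_ inner
    contained : ∀ i → part inner i ≤ part outer i

open SkewShape public

shapeCells : SkewShape → List (ℤ × ℤ)
shapeCells s =
  concatMap (λ r → map (λ j → (dy s ℤ.+ + r , dx s ℤ.+ + j))
                       (applyUpTo (λ t → part (inner s) r + t)
                                  (part (outer s) r ∸ part (inner s) r)))
            (upTo (length (outer s)))

Cell : ℕ → Set
Cell k = Fin k × ℤ × ℤ

cells : (k : ℕ) → (Fin k → SkewShape) → List (Cell k)
cells k ν = concatMap (λ i → map (λ rc → (i , rc)) (shapeCells (ν i))) (allFin k)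

row col : {k : ℕ} → Cell k → ℤ
row (_ , r , _) = r
col (_ , _ , c) = c

comp : {k : ℕ} → Cell k → ℕ
comp (i , _ , _) = toℕ i

content : {k : ℕ} → Cell k → ℤ
content x = col x ℤ.- row x

scont : (k : ℕ) → Cell k → ℤ
scont k x = + k ℤ.* content x ℤ.+ + comp x

size : (k : ℕ) → (Fin k → SkewShape) → ℕ
size k ν = length (cells k ν)

Diam≤3 : (k : ℕ) → (Fin k → SkewShape) → Set
Diam≤3 k ν = (R : List ℤ) → Unique R →
  All (λ z → z ∈ map (scont k) (cells k ν)) R →
  All (λ x → All (λ y → ∣ x ℤ.- y ∣ ≤ k) R) R →
  length R ≤ 3

-- Standard fillings.  A filling is a list T of the same length as
-- cells k ν, T_p being the entry of the p-th cell; it is a bijection onto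
-- {1..n} iff T is an ordering of [1..n].

_==ℤ_ : ℤ → ℤ → Bool
a ==ℤ b = does (a Data.Integer.≟ b)
  where import Data.Integer

_<ℤ_ : ℤ → ℤ → Bool
a <ℤ b = does (a Data.Integer.<? b)
  where import Data.Integer

sameComp : {k : ℕ} → Cell k → Cell k → Bool
sameComp x y = comp x ≡ᵇ comp y

labelled : (k : ℕ) → (Fin k → SkewShape) → List ℕ → List (Cell k × ℕ)
labelled k ν T = zip (cells k ν) T

isStandardB : (k : ℕ) → (Fin k → SkewShape) → List ℕ → Bool
isStandardB k ν T = go (pairs (labelled k ν T))
  where
  ok : (Cell k × ℕ) × (Cell k × ℕ) → Bool
  ok ((x , a) , (y , b)) =
    (not (sameComp x y ∧ (row x ==ℤ row y) ∧ (col x <ℤ col y)) ∨ (a <ᵇ b))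
    ∧ (not (sameComp x y ∧ (col x ==ℤ col y) ∧ (row x <ℤ row y)) ∨ (a <ᵇ b))
  go : List ((Cell k × ℕ) × (Cell k × ℕ)) → Bool
  go [] = true
  go (p ∷ ps) = ok p ∧ go ps

SYT : (k : ℕ) → (Fin k → SkewShape) → List (List ℕ)
SYT k ν = filterᵇ (isStandardB k ν) (perms (applyUpTo suc (size k ν)))

invk : (k : ℕ) → (Fin k → SkewShape) → List ℕ → ℕ
invk k ν T = count ok (pairs (labelled k ν T))
  where
  ok : (Cell k × ℕ) × (Cell k × ℕ) → Bool
  ok ((x , a) , (y , b)) =
    let d = scont k y ℤ.- scont k x in
    ((+ 0) <ℤ d) ∧ (d <ℤ (+ k)) ∧ (b <ᵇ a)

-- shifted content reading order: increasing shifted content, ties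
-- (same diagonal of one component) read southwest to northeast (increasing row)
readsBefore : (k : ℕ) → Cell k → Cell k → Bool
readsBefore k x y =
  (scont k x <ℤ scont k y) ∨ ((scont k x ==ℤ scont k y) ∧ (row x <ℤ row y))

insertCell : (k : ℕ) → Cell k × ℕ → List (Cell k × ℕ) → List (Cell k × ℕ)
insertCell k p [] = p ∷ []
insertCell k p (q ∷ qs) =
  if readsBefore k (proj₁ p) (proj₁ q) then p ∷ q ∷ qs else q ∷ insertCell k p qs

sortCells : (k : ℕ) → List (Cell k × ℕ) → List (Cell k × ℕ)
sortCells k [] = []
sortCells k (p ∷ ps) = insertCell k p (sortCells k ps)

scWord : (k : ℕ) → (Fin k → SkewShape) → List ℕ → List ℕ
scWord k ν T = map proj₂ (sortCells k (labelled k ν T))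

-- signature of a word w ∈ S_n, encoded as a list of n-1 booleans
-- (true = +1 : i appears before i+1)
signature : ℕ → List ℕ → List Bool
signature n w = map (λ i → indexOf (suc i) w <ᵇ indexOf (suc (suc i)) w) (upTo (n ∸ 1))

-- Fundamental quasisymmetric functions and Schur functions, through their
-- coefficients.  A monomial x_1^{α_1} ... x_m^{α_m} is given by α : List ℕ
-- (m = length α); variable x_{v+1} is encoded by the letter v.

weakInc : List ℕ → Bool
weakInc (a ∷ b ∷ s) = (a ≤ᵇ b) ∧ weakInc (b ∷ s)
weakInc _ = true

sigOK : List ℕ → List Bool → Bool
sigOK (a ∷ b ∷ s) (t ∷ σ) = (not (a ≡ᵇ b) ∨ t) ∧ sigOK (b ∷ s) σ
sigOK _ _ = true

coeffF : ℕ → List Bool → List ℕ → ℕ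
coeffF n σ α =
  count (λ s → weakInc s ∧ sigOK s σ ∧ hasContent s α) (allWords (length α) n)

youngCells : List ℕ → List (ℕ × ℕ)
youngCells sh = concatMap (λ r → map (λ j → (r , j)) (upTo (part sh r))) (upTo (length sh))

coeffS : List ℕ → List ℕ → ℕ
coeffS sh α = count isSSYT (allWords (length α) (length (youngCells sh)))
  where
  ok : ((ℕ × ℕ) × ℕ) × ((ℕ × ℕ) × ℕ) → Bool
  ok (((r , j) , a) , ((r' , j') , b)) =
    (not ((r ≡ᵇ r') ∧ (j <ᵇ j')) ∨ (a ≤ᵇ b))
    ∧ (not ((j ≡ᵇ j') ∧ (r <ᵇ r')) ∨ (a <ᵇ b))
  allOk : List (((ℕ × ℕ) × ℕ) × ((ℕ × ℕ) × ℕ)) → Bool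
  allOk [] = true
  allOk (p ∷ ps) = ok p ∧ allOk ps
  isSSYT : List ℕ → Bool
  isSSYT f = allOk (pairs (zip (youngCells sh) f)) ∧ hasContent f α

isPartitionOf : ℕ → List ℕ → Bool
isPartitionOf n l = (sum l ≡ᵇ n) ∧ pos l ∧ dec l
  where
  pos : List ℕ → Bool
  pos [] = true
  pos (a ∷ as) = (0 <ᵇ a) ∧ pos as
  dec : List ℕ → Bool
  dec (a ∷ b ∷ s) = (b ≤ᵇ a) ∧ dec (b ∷ s)
  dec _ = true

partitions : ℕ → List (List ℕ)
partitions n = filterᵇ (isPartitionOf n) (concatMap (allWords (suc n)) (upTo (suc n)))

-- Robinson–Schensted insertion.  A tableau is a list of rows, bottom row first.

bump : ℕ → List ℕ → Maybe ℕ × List ℕ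
bump x [] = nothing , x ∷ []
bump x (y ∷ ys) with x <ᵇ y
... | true = just y , x ∷ ys
... | false with bump x ys
...   | (m , ys') = m , y ∷ ys'

rsInsert : ℕ → List (List ℕ) → List (List ℕ)
rsInsert x [] = (x ∷ []) ∷ []
rsInsert x (r ∷ rs) with bump x r
... | (nothing , r') = r' ∷ rs
... | (just y , r') = r' ∷ rsInsert y rs

Ptab : List ℕ → List (List ℕ)
Ptab w = foldl (λ t x → rsInsert x t) [] w

Utab : List ℕ → List (List ℕ)
Utab sh = go 0 sh
  where
  go : ℕ → List ℕ → List (List ℕ)
  go s [] = []
  go s (r ∷ rs) = applyUpTo (λ j → s + suc j) r ∷ go (s + r) rs

inSYam : List ℕ → List ℕ → Bool
inSYam sh w = does (≡-dec (≡-dec ℕ._≟_) (Ptab w) (Utab sh))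

Tνλ : (k : ℕ) → (Fin k → SkewShape) → List ℕ → List (List ℕ)
Tνλ k ν sh = filterᵇ (λ T → inSYam sh (scWord k ν T)) (SYT k ν)

-- The two sides, as coefficients of q^d x^α

LLTcoeff : (k : ℕ) → (Fin k → SkewShape) → List ℕ → ℕ → ℕ
LLTcoeff k ν α d =
  sum (map (λ T → if invk k ν T ≡ᵇ d
                  then coeffF (size k ν) (signature (size k ν) (scWord k ν T)) α
                  else 0)
           (SYT k ν))

SchurSideCoeff : (k : ℕ) → (Fin k → SkewShape) → List ℕ → ℕ → ℕ
SchurSideCoeff k ν α d =
  sum (map (λ sh → sum (map (λ T → if invk k ν T ≡ᵇ d then coeffS sh α else 0)
                            (Tνλ k ν sh)))
           (partitions (size k ν)))

{-# OPTIONS --safe #-}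
module Submission where

{-
A standard filling is an ordering o of the cells; reading off contents gives a word.  For fixed d, let
f(v) be the number of standard orderings with word v and inv = d.  Exchanging adjacent cells of o shows
that f is compatible with the following relations on the letters u_1 < u_2 < … (the distinct contents):
u_i and u_j commute for j - i ≥ 3, which is what diam ≤ 3 provides; u_c u_a u_b + u_b u_a u_c =
u_a u_c u_b + u_b u_c u_a for consecutive a < b < c; and u_a Y u_a = 0 unless Y has letters on both sides
of a.

Let h_p be the sum of the increasing words of length p.  The relations give
[u_c , h_p] = h_{p-1} [u_c , h_1] in the letters below c, hence the h_p commute.  The coefficient of x^α on
the left hand side is f(h_{α_1} h_{α_2} …).  Stembridge's proof of the Littlewood–Richardson rule now
applies: pairing with an alternating function, all tuples of blocks that violate the lattice condition
cancel.  The violation occurs at a letter c where the first block has no c + 1, so its larger letters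
commute with those below c in the second block, and the two blocks can be exchanged below c.

For a single straight shape the same argument applies to s_λ, where the only good tuple is the filling of
row r by r.  Subtracting the s_λ with the right multiplicities leaves a symmetric function without good
tuples, which vanishes by triangularity of the alternants.  Finally, by invariance under Knuth moves the
good tuples are the fillings whose word w has P(w) = U_λ.
-}

open import Defs
open import Data.Bool using (Bool; true; false; _∧_; _∨_; not; if_then_else_; T; T?)
open import Data.Nat as ℕ using (ℕ; zero; suc; _∸_; _≤_; _<_; _≥_; z≤n; s≤s; _≡ᵇ_; _<ᵇ_; _≤ᵇ_)
import Data.Nat.Properties as ℕP
open import Data.Integer as ℤ using (ℤ; 0ℤ; 1ℤ; -1ℤ; _+_; _*_; -_; _-_; ∣_∣) renaming (+_ to pos)
import Data.Integer.Properties as ℤP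
open import Data.Integer.Tactic.RingSolver using (solve-∀)
open import Data.Fin as Fin using (Fin; toℕ)
open import Data.List as List using (List; []; _∷_; _++_; [_]; _∷ʳ_; length; map; concat; concatMap; zip; upTo; applyUpTo; filterᵇ; foldl; allFin; replicate)
import Data.List.Properties as LP
open import Data.Nat.ListAction using (sum)
open import Data.Nat.ListAction.Properties using (sum-↭; sum-++)
open import Data.List.Membership.DecPropositional ℕ._≟_ using () renaming (_∈?_ to _∈ℕ?_)
import Data.Nat.Tactic.RingSolver as ℕSolver
open import Data.List.Relation.Unary.All as All using (All; []; _∷_)
import Data.List.Relation.Unary.All.Properties as AllP
open import Data.List.Relation.Unary.Any as Any using (Any; here; there)
open import Data.List.Relation.Unary.AllPairs as AllPairs using (AllPairs; []; _∷_)
import Data.List.Relation.Unary.AllPairs.Properties as APP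
open import Data.List.Relation.Unary.Linked using (Linked; []; [-]; _∷_)
open import Data.List.Relation.Unary.Unique.Propositional using (Unique)
import Data.List.Relation.Unary.Unique.Propositional.Properties as UP
open import Data.List.Membership.Propositional using (_∈_; find; lose)
import Data.List.Membership.Propositional.Properties as MP
open import Data.List.Relation.Binary.Permutation.Propositional as Perm using (_↭_; ↭-refl; ↭-sym; ↭-trans)
import Data.List.Relation.Binary.Permutation.Propositional.Properties as PP
open import Data.Maybe using (Maybe; just; nothing)
open import Data.Product using (∃; _×_; _,_; proj₁; proj₂)
open import Data.Sum using (_⊎_; inj₁; inj₂)
import Data.Product.Properties as ×P
import Data.Fin.Properties as FinP
import Data.List.Relation.Unary.Unique.DecPropositional.Properties ℤ._≟_ as DecU
open import Data.Empty using (⊥; ⊥-elim)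
open import Data.Unit using (⊤; tt)
open import Function using (_∘_; id)
open import Relation.Nullary using (¬_; Dec; yes; no; does; ¬?; _×-dec_; _⊎-dec_)
open import Relation.Binary.Definitions using (tri<; tri≈; tri>)
open import Relation.Binary.PropositionalEquality hiding ([_])

-- Finite sums

-- No relation between single words holds for every triple of neighbouring contents `a < b < c`. If
-- `c - a` exceeds `k`, the outer letters commute and there are two Knuth moves; otherwise each swap
-- of neighbours changes the inversion number, and only rotations are left. The four-term relation
-- is what both cases share. Since it equates sums, the cancellation is not an involution on tuples:
-- whole sums over blocks of given lengths are exchanged, with signs, which is why everything lives
-- in ℤ. The quotient algebra is never formed. Its role is played by functionals on words that
-- vanish on the ideal; fixing `d` removes `q`. The gap of 3 reappears at a violation: the letters
-- to be exchanged are at least `c + 2` on one side and at most `c - 1` on the other. Entries become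
-- positions of the ordering, so the content word is read along the inverse permutation. The
-- coefficient of x^α in a fundamental quasisymmetric function then asks that consecutive pieces of
-- lengths α increase, and the rows of `U_λ` are such pieces for α = λ. Monomial coefficients and
-- Schur multiplicities are thus read off the same tuples of blocks.

∑ : {A : Set} → List A → (A → ℤ) → ℤ
∑ []       F = 0ℤ
∑ (x ∷ xs) F = F x + ∑ xs F

∑-congᴬ : {A : Set} {xs : List A} {F G : A → ℤ} → All (λ x → F x ≡ G x) xs → ∑ xs F ≡ ∑ xs G
∑-congᴬ []         = refl
∑-congᴬ (eq ∷ eqs) = cong₂ _+_ eq (∑-congᴬ eqs)

∑-cong : {A : Set} (xs : List A) {F G : A → ℤ} → (∀ x → F x ≡ G x) → ∑ xs F ≡ ∑ xs G
∑-cong []       eq = refl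
∑-cong (x ∷ xs) eq = cong₂ _+_ (eq x) (∑-cong xs eq)

∑-cong-∈ : {A : Set} (xs : List A) {F G : A → ℤ} → (∀ {x} → x ∈ xs → F x ≡ G x) → ∑ xs F ≡ ∑ xs G
∑-cong-∈ xs eq = ∑-congᴬ (All.tabulate eq)

∑-zeroᴬ : {A : Set} {xs : List A} {F : A → ℤ} → All (λ x → F x ≡ 0ℤ) xs → ∑ xs F ≡ 0ℤ
∑-zeroᴬ []         = refl
∑-zeroᴬ (eq ∷ eqs) = cong₂ _+_ eq (∑-zeroᴬ eqs)

∑-zero : {A : Set} (xs : List A) {F : A → ℤ} → (∀ x → F x ≡ 0ℤ) → ∑ xs F ≡ 0ℤ
∑-zero xs eq = ∑-zeroᴬ {xs = xs} (All.universal eq xs)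

∑-zero-∈ : {A : Set} (xs : List A) {F : A → ℤ} → (∀ {x} → x ∈ xs → F x ≡ 0ℤ) → ∑ xs F ≡ 0ℤ
∑-zero-∈ xs eq = ∑-zeroᴬ (All.tabulate eq)

∑-++ : {A : Set} (xs ys : List A) (F : A → ℤ) → ∑ (xs ++ ys) F ≡ ∑ xs F + ∑ ys F
∑-++ []       ys F = sym (ℤP.+-identityˡ _)
∑-++ (x ∷ xs) ys F = trans (cong (F x +_) (∑-++ xs ys F)) (sym (ℤP.+-assoc (F x) (∑ xs F) (∑ ys F)))

∑-map : {A B : Set} (h : A → B) (xs : List A) (F : B → ℤ) → ∑ (map h xs) F ≡ ∑ xs (F ∘ h)
∑-map h []       F = refl
∑-map h (x ∷ xs) F = cong (F (h x) +_) (∑-map h xs F)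

∑-concatMap : {A B : Set} (h : A → List B) (xs : List A) (F : B → ℤ) →
  ∑ (concatMap h xs) F ≡ ∑ xs (λ x → ∑ (h x) F)
∑-concatMap h []       F = refl
∑-concatMap h (x ∷ xs) F =
  trans (∑-++ (h x) (concatMap h xs) F) (cong (∑ (h x) F +_) (∑-concatMap h xs F))

+-interchange : ∀ a b c d → (a + b) + (c + d) ≡ (a + c) + (b + d)
+-interchange = solve-∀

∑-+ : {A : Set} (xs : List A) (F G : A → ℤ) → ∑ xs (λ x → F x + G x) ≡ ∑ xs F + ∑ xs G
∑-+ []       F G = refl
∑-+ (x ∷ xs) F G =
  trans (cong (_+_ (F x + G x)) (∑-+ xs F G)) (+-interchange (F x) (G x) (∑ xs F) (∑ xs G))

∑-*ˡ : {A : Set} (xs : List A) (a : ℤ) (F : A → ℤ) → ∑ xs (λ x → a * F x) ≡ a * ∑ xs F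
∑-*ˡ []       a F = sym (ℤP.*-zeroʳ a)
∑-*ˡ (x ∷ xs) a F =
  trans (cong (_+_ (a * F x)) (∑-*ˡ xs a F)) (sym (ℤP.*-distribˡ-+ a (F x) (∑ xs F)))

∑-*ʳ : {A : Set} (xs : List A) (a : ℤ) (F : A → ℤ) → ∑ xs (λ x → F x * a) ≡ ∑ xs F * a
∑-*ʳ xs a F = trans (∑-cong xs (λ x → ℤP.*-comm (F x) a)) (trans (∑-*ˡ xs a F) (ℤP.*-comm a _))

∑-neg : {A : Set} (xs : List A) (F : A → ℤ) → ∑ xs (λ x → - F x) ≡ - ∑ xs F
∑-neg []       F = refl
∑-neg (x ∷ xs) F =
  trans (cong (_+_ (- F x)) (∑-neg xs F)) (sym (ℤP.neg-distrib-+ (F x) (∑ xs F)))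

∑-swap : {A B : Set} (xs : List A) (ys : List B) (F : A → B → ℤ) →
  ∑ xs (λ x → ∑ ys (F x)) ≡ ∑ ys (λ y → ∑ xs (λ x → F x y))
∑-swap []       ys F = sym (∑-zero ys (λ _ → refl))
∑-swap (x ∷ xs) ys F =
  trans (cong (∑ ys (F x) +_) (∑-swap xs ys F)) (sym (∑-+ ys (F x) (λ y → ∑ xs (λ x → F x y))))

∑-↭ : {A : Set} {xs ys : List A} (F : A → ℤ) → xs ↭ ys → ∑ xs F ≡ ∑ ys F
∑-↭ F Perm.refl          = refl
∑-↭ F (Perm.prep x p)    = cong (F x +_) (∑-↭ F p)
∑-↭ F (Perm.swap {xs} {ys} x y p) =
  trans (exchange (F x) (F y) (∑ xs F)) (cong (λ s → F y + (F x + s)) (∑-↭ F p))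
  where
  exchange : ∀ a b c → a + (b + c) ≡ b + (a + c)
  exchange = solve-∀
∑-↭ F (Perm.trans p q)   = trans (∑-↭ F p) (∑-↭ F q)

∑-single : {A : Set} {xs : List A} {x : A} (F : A → ℤ) → Unique xs → x ∈ xs →
  (∀ {y} → y ∈ xs → y ≢ x → F y ≡ 0ℤ) → ∑ xs F ≡ F x
∑-single {x = x} F (x∉ ∷ uniq) (here refl) vanish =
  trans (cong (F x +_) (∑-zero-∈ _ (λ y∈ → vanish (there y∈) (λ { refl → All.lookup x∉ y∈ refl }))))
        (ℤP.+-identityʳ (F x))
∑-single {x = x} F (y∉ ∷ uniq) (there x∈) vanish =
  trans (cong₂ _+_ (vanish (here refl) (λ { refl → All.lookup y∉ x∈ refl }))
                   (∑-single F uniq x∈ (λ y∈ → vanish (there y∈))))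
        (ℤP.+-identityˡ (F x))

ind : {P : Set} → Dec P → ℤ
ind d = if does d then 1ℤ else 0ℤ

ind-yes : {P : Set} (d : Dec P) → P → ind d ≡ 1ℤ
ind-yes (yes _) p = refl
ind-yes (no ¬p) p = ⊥-elim (¬p p)

ind-no : {P : Set} (d : Dec P) → ¬ P → ind d ≡ 0ℤ
ind-no (yes p) ¬p = ⊥-elim (¬p p)
ind-no (no _)  ¬p = refl

ind-iff : {P Q : Set} (d : Dec P) (e : Dec Q) → (P → Q) → (Q → P) → ind d ≡ ind e
ind-iff (yes p) e f g = sym (ind-yes e (f p))
ind-iff (no ¬p) e f g = sym (ind-no e (¬p ∘ g))

-- Switchboards: words modulo the relations of the u_i

Word : Set
Word = List ℕ

-- A function on words stands for a linear functional on the free algebra. The fields hold in every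
-- context `x`, `y`, so they say that the functional kills the two-sided ideal of the relations.
record Switchboard (f : Word → ℤ) : Set where
  field
    far  : ∀ x y {i j} → 3 ℕ.+ i ≤ j → f (x ++ i ∷ j ∷ y) ≡ f (x ++ j ∷ i ∷ y)
    four : ∀ x y i →
      f (x ++ suc (suc i) ∷ i ∷ suc i ∷ y) + f (x ++ suc i ∷ i ∷ suc (suc i) ∷ y)
      ≡ f (x ++ i ∷ suc (suc i) ∷ suc i ∷ y) + f (x ++ suc i ∷ suc (suc i) ∷ i ∷ y)
    sq≤  : ∀ x y a Y → All (_≤ a) Y → f (x ++ a ∷ Y ++ a ∷ y) ≡ 0ℤ
    sq≥  : ∀ x y a Y → All (a ≤_) Y → f (x ++ a ∷ Y ++ a ∷ y) ≡ 0ℤ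

open Switchboard public

-- The ideal is two-sided, so fixing a prefix or a suffix gives a functional of the same kind.
-- Relations are applied inside a word by changing the functional.
underˡ : ∀ {f} z → Switchboard f → Switchboard (λ w → f (z ++ w))
underˡ {f} z S = record
  { far  = λ x y i≤j → subst₂ (λ u v → f u ≡ f v) (LP.++-assoc z x _) (LP.++-assoc z x _) (far S (z ++ x) y i≤j)
  ; four = λ x y i → subst₂ _≡_
      (cong₂ _+_ (as x) (as x)) (cong₂ _+_ (as x) (as x)) (four S (z ++ x) y i)
  ; sq≤  = λ x y a Y p → trans (sym (as x)) (sq≤ S (z ++ x) y a Y p)
  ; sq≥  = λ x y a Y p → trans (sym (as x)) (sq≥ S (z ++ x) y a Y p)
  }
  where
  as : ∀ x {u} → f ((z ++ x) ++ u) ≡ f (z ++ x ++ u)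
  as x = cong f (LP.++-assoc z x _)

underʳ : ∀ {f} z → Switchboard f → Switchboard (λ w → f (w ++ z))
underʳ {f} z S = record
  { far  = λ x y i≤j → trans (as x _) (trans (far S x (y ++ z) i≤j) (sym (as x _)))
  ; four = λ x y i → subst₂ _≡_
      (cong₂ _+_ (sym (as x _)) (sym (as x _))) (cong₂ _+_ (sym (as x _)) (sym (as x _))) (four S x (y ++ z) i)
  ; sq≤  = λ x y a Y p → trans (as′ x a Y y) (sq≤ S x (y ++ z) a Y p)
  ; sq≥  = λ x y a Y p → trans (as′ x a Y y) (sq≥ S x (y ++ z) a Y p)
  }
  where
  as : ∀ x u → f ((x ++ u) ++ z) ≡ f (x ++ u ++ z)
  as x u = cong f (LP.++-assoc x u z)
  as′ : ∀ x a Y y → f ((x ++ a ∷ Y ++ a ∷ y) ++ z) ≡ f (x ++ a ∷ Y ++ a ∷ y ++ z)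
  as′ x a Y y = trans (as x _) (cong (λ u → f (x ++ a ∷ u)) (LP.++-assoc Y (a ∷ y) z))

far-word : ∀ {f} → Switchboard f → ∀ i {Z} → All (3 ℕ.+ i ≤_) Z → ∀ y → f (Z ++ i ∷ y) ≡ f (i ∷ Z ++ y)
far-word S i []                 y = refl
far-word {f} S i (_∷_ {j} i≤j Z≥) y =
  trans (far-word (underˡ [ j ] S) i Z≥ y) (sym (far S [] _ i≤j))

-- Letters of `Z` are at least `c + 2` and letters of `L` at most `c - 1`; the difference 3 is just
-- enough for `far`.
far-words : ∀ {f} → Switchboard f → ∀ {Z L} c → All (suc (suc c) ≤_) Z → All (_< c) L →
  ∀ y → f (Z ++ L ++ y) ≡ f (L ++ Z ++ y)
far-words S c Z≥ []                 y = refl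
far-words {f} S {Z} c Z≥ (_∷_ {l} {L} l<c L<) y =
  trans (far-word S l (All.map (ℕP.≤-trans (s≤s (s≤s l<c))) Z≥) (L ++ y))
        (far-words (underˡ [ l ] S) c Z≥ L< y)

far-wordʳ : ∀ {f} → Switchboard f → ∀ j {L} → All (λ i → 3 ℕ.+ i ≤ j) L → ∀ y → f (j ∷ L ++ y) ≡ f (L ++ j ∷ y)
far-wordʳ S j []           y = refl
far-wordʳ S j (_∷_ {i} i≤j L≤) y =
  trans (sym (far S [] _ i≤j)) (far-wordʳ (underˡ [ i ] S) j L≤ y)

-- The sums h_p of increasing words and their commutators

incr : ℕ → ℕ → List Word
incr c       zero    = [] ∷ []
incr zero    (suc p) = []
incr (suc c) (suc p) = incr c (suc p) ++ map (_∷ʳ c) (incr c p)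

-- incr⁻ t c p has the words of length p - t, and is empty when p < t.
incr⁻ : ℕ → ℕ → ℕ → List Word
incr⁻ zero    c p       = incr c p
incr⁻ (suc t) c zero    = []
incr⁻ (suc t) c (suc p) = incr⁻ t c p

incr-bounded : ∀ c p → All (All (_< c)) (incr c p)
incr-bounded c       zero    = [] ∷ []
incr-bounded zero    (suc p) = []
incr-bounded (suc c) (suc p) = AllP.++⁺
  (All.map (All.map ℕP.m<n⇒m<1+n) (incr-bounded c (suc p)))
  (AllP.map⁺ (All.map (λ w< → AllP.∷ʳ⁺ (All.map ℕP.m<n⇒m<1+n w<) (ℕP.n<1+n c)) (incr-bounded c p)))

incr⁻-bounded : ∀ t c p → All (All (_< c)) (incr⁻ t c p)
incr⁻-bounded zero    c p       = incr-bounded c p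
incr⁻-bounded (suc t) c zero    = []
incr⁻-bounded (suc t) c (suc p) = incr⁻-bounded t c p

incr⁻-step : ∀ t c p (F : Word → ℤ) →
  ∑ (incr⁻ t (suc c) p) F ≡ ∑ (incr⁻ t c p) F + ∑ (incr⁻ (suc t) c p) (λ w → F (w ∷ʳ c))
incr⁻-step zero    c zero    F = sym (ℤP.+-identityʳ _)
incr⁻-step zero    c (suc p) F =
  trans (∑-++ (incr c (suc p)) _ F) (cong (∑ (incr c (suc p)) F +_) (∑-map (_∷ʳ c) (incr c p) F))
incr⁻-step (suc t) c zero    F = refl
incr⁻-step (suc t) c (suc p) F = incr⁻-step t c p F

-- The commutator [u_c , u_0 + … + u_{c-1}]; by far commutation only two letters below c matter.
bracketWords : ℕ → List (ℤ × Word)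
bracketWords 0             = []
bracketWords 1             = (1ℤ , 1 ∷ 0 ∷ []) ∷ (-1ℤ , 0 ∷ 1 ∷ []) ∷ []
bracketWords (suc (suc i)) =
  (1ℤ , suc (suc i) ∷ i ∷ []) ∷ (1ℤ , suc (suc i) ∷ suc i ∷ []) ∷
  (-1ℤ , i ∷ suc (suc i) ∷ []) ∷ (-1ℤ , suc i ∷ suc (suc i) ∷ []) ∷ []

bracket : ℕ → (Word → ℤ) → ℤ
bracket c h = ∑ (bracketWords c) (λ sw → proj₁ sw * h (proj₂ sw))

bracket₁ : ∀ h → bracket 1 h ≡ h (1 ∷ 0 ∷ []) - h (0 ∷ 1 ∷ [])
bracket₁ h = eval (h (1 ∷ 0 ∷ [])) (h (0 ∷ 1 ∷ []))
  where
  eval : ∀ a b → 1ℤ * a + (-1ℤ * b + 0ℤ) ≡ a - b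
  eval = solve-∀

bracket₂ : ∀ i h → bracket (suc (suc i)) h
  ≡ (h (suc (suc i) ∷ i ∷ []) + h (suc (suc i) ∷ suc i ∷ [])) - (h (i ∷ suc (suc i) ∷ []) + h (suc i ∷ suc (suc i) ∷ []))
bracket₂ i h = eval (h (suc (suc i) ∷ i ∷ [])) (h (suc (suc i) ∷ suc i ∷ [])) (h (i ∷ suc (suc i) ∷ [])) (h (suc i ∷ suc (suc i) ∷ []))
  where
  eval : ∀ a b c d → 1ℤ * a + (1ℤ * b + (-1ℤ * c + (-1ℤ * d + 0ℤ))) ≡ (a + b) - (c + d)
  eval = solve-∀

module _ {f : Word → ℤ} (S : Switchboard f) (i : ℕ) where
  private
    a = i
    b = suc i
    c = suc (suc i)

  module _ {L : Word} (L< : All (_< i) L) where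

    private
      h : Word → ℤ
      h w = f (L ++ w)
      H : Switchboard h
      H = underˡ L S
      L≤ : All (λ l → 3 ℕ.+ l ≤ c) L
      L≤ = All.map (λ l<i → s≤s (s≤s l<i)) L<
      pull : ∀ y → f (c ∷ L ++ y) ≡ h (c ∷ y)
      pull y = far-wordʳ S c L≤ y
      z≤ : ∀ x w y Y → All (_≤ w) Y → h (x ++ w ∷ Y ++ w ∷ y) ≡ 0ℤ
      z≤ x w y Y = sq≤ H x y w Y
      z≥ : ∀ x w y Y → All (w ≤_) Y → h (x ++ w ∷ Y ++ w ∷ y) ≡ 0ℤ
      z≥ x w y Y = sq≥ H x y w Y
      a≤b : a ≤ b
      a≤b = ℕP.n≤1+n i
      b≤c : b ≤ c
      b≤c = ℕP.n≤1+n b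
      a≤c : a ≤ c
      a≤c = ℕP.≤-trans a≤b b≤c

    -- An increasing word in the letters below `c` is `L`, `L a`, `L b` or `L a b`, with `L` far
    -- from `c`. The four lemmas are the components of the commutator formula according to the
    -- occurrence of `a` and `b`.
    commutator-degree₀ : f (c ∷ L) ≡ f (L ∷ʳ c)
    commutator-degree₀ = trans (cong (λ w → f (c ∷ w)) (sym (LP.++-identityʳ L))) (pull [])

    commutator-degree₁ : f (c ∷ L ++ [ a ]) + f (c ∷ L ++ [ b ])
      ≡ (f ((L ∷ʳ a) ∷ʳ c) + f ((L ∷ʳ b) ∷ʳ c)) + bracket c h
    commutator-degree₁ = begin
      f (c ∷ L ++ [ a ]) + f (c ∷ L ++ [ b ])
        ≡⟨ cong₂ _+_ (pull [ a ]) (pull [ b ]) ⟩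
      h (c ∷ a ∷ []) + h (c ∷ b ∷ [])
        ≡⟨ eval (h (c ∷ a ∷ [])) (h (c ∷ b ∷ [])) (h (a ∷ c ∷ [])) (h (b ∷ c ∷ [])) ⟩
      (h (a ∷ c ∷ []) + h (b ∷ c ∷ [])) + ((h (c ∷ a ∷ []) + h (c ∷ b ∷ [])) - (h (a ∷ c ∷ []) + h (b ∷ c ∷ [])))
        ≡⟨ cong₂ _+_ (cong₂ _+_ (cong f (sym (LP.++-assoc L _ _))) (cong f (sym (LP.++-assoc L _ _)))) (sym (bracket₂ i h)) ⟩
      (f ((L ∷ʳ a) ∷ʳ c) + f ((L ∷ʳ b) ∷ʳ c)) + bracket c h ∎
      where
      open ≡-Reasoning
      eval : ∀ p q r s → p + q ≡ (r + s) + ((p + q) - (r + s))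
      eval = solve-∀

    -- Here `four` enters: it turns `c a b` into `a c b + b c a - b a c`. The two brackets
    -- contribute these three words and `- a b c`, which the leading term compensates; their
    -- remaining words `a c a`, `a a c`, `b c b`, `b b c` vanish by the square relations.
    commutator-degree₂ : f (c ∷ (L ∷ʳ a) ∷ʳ b)
      ≡ f (((L ∷ʳ a) ∷ʳ b) ∷ʳ c)
        + (bracket c (λ w → f ((L ∷ʳ a) ++ w)) + bracket c (λ w → f ((L ∷ʳ b) ++ w)))
    commutator-degree₂ = begin
      f (c ∷ (L ∷ʳ a) ∷ʳ b)
        ≡⟨ cong (λ w → f (c ∷ w)) (LP.++-assoc L _ _) ⟩
      f (c ∷ L ++ a ∷ b ∷ [])
        ≡⟨ pull _ ⟩
      h (c ∷ a ∷ b ∷ [])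
        ≡⟨ isolate (h (c ∷ a ∷ b ∷ [])) (h (b ∷ a ∷ c ∷ [])) ⟩
      (h (c ∷ a ∷ b ∷ []) + h (b ∷ a ∷ c ∷ [])) - h (b ∷ a ∷ c ∷ [])
        ≡⟨ cong (_- h (b ∷ a ∷ c ∷ [])) (four H [] [] i) ⟩
      (h (a ∷ c ∷ b ∷ []) + h (b ∷ c ∷ a ∷ [])) - h (b ∷ a ∷ c ∷ [])
        ≡⟨ eval (h (a ∷ c ∷ b ∷ [])) (h (b ∷ c ∷ a ∷ [])) (h (b ∷ a ∷ c ∷ [])) (h (a ∷ b ∷ c ∷ [])) ⟩
      h (a ∷ b ∷ c ∷ []) +
        (((0ℤ + h (a ∷ c ∷ b ∷ [])) - (0ℤ + h (a ∷ b ∷ c ∷ []))) +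
         ((h (b ∷ c ∷ a ∷ []) + 0ℤ) - (h (b ∷ a ∷ c ∷ []) + 0ℤ)))
        ≡⟨ cong₂ _+_ (cong f (sym (trans (cong (_∷ʳ c) (LP.++-assoc L _ _)) (LP.++-assoc L _ _))))
             (cong₂ _+_
               (cong₂ _-_ (cong₂ _+_ (sym (z≥ [] a [] (c ∷ []) (a≤c ∷ []))) refl)
                          (cong₂ _+_ (sym (z≤ [] a (c ∷ []) [] [])) refl))
               (cong₂ _-_ (cong (_+_ (h (b ∷ c ∷ a ∷ []))) (sym (z≥ [] b [] (c ∷ []) (b≤c ∷ []))))
                          (cong (_+_ (h (b ∷ a ∷ c ∷ []))) (sym (z≤ [] b (c ∷ []) [] []))))) ⟩
      f (((L ∷ʳ a) ∷ʳ b) ∷ʳ c) +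
        (((h (a ∷ c ∷ a ∷ []) + h (a ∷ c ∷ b ∷ [])) - (h (a ∷ a ∷ c ∷ []) + h (a ∷ b ∷ c ∷ []))) +
         ((h (b ∷ c ∷ a ∷ []) + h (b ∷ c ∷ b ∷ [])) - (h (b ∷ a ∷ c ∷ []) + h (b ∷ b ∷ c ∷ []))))
        ≡⟨ cong (_+_ (f (((L ∷ʳ a) ∷ʳ b) ∷ʳ c))) (cong₂ _+_
             (sym (trans (bracket₂ i (λ w → f ((L ∷ʳ a) ++ w))) (cong₂ _-_ (cong₂ _+_ as as) (cong₂ _+_ as as))))
             (sym (trans (bracket₂ i (λ w → f ((L ∷ʳ b) ++ w))) (cong₂ _-_ (cong₂ _+_ as as) (cong₂ _+_ as as))))) ⟩
      f (((L ∷ʳ a) ∷ʳ b) ∷ʳ c)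
        + (bracket c (λ w → f ((L ∷ʳ a) ++ w)) + bracket c (λ w → f ((L ∷ʳ b) ++ w))) ∎
      where
      open ≡-Reasoning
      as : ∀ {u v} → f ((L ++ u) ++ v) ≡ f (L ++ u ++ v)
      as = cong f (LP.++-assoc L _ _)
      isolate : ∀ p q → p ≡ (p + q) - q
      isolate = solve-∀
      eval : ∀ p q r s → (p + q) - r ≡ s + (((0ℤ + p) - (0ℤ + s)) + ((q + 0ℤ) - (r + 0ℤ)))
      eval = solve-∀

    -- Each word of the bracket repeats `a` or `b`, and no letter between the two copies is smaller
    -- than they are.
    commutator-degree₃ : bracket c (λ w → f (((L ∷ʳ a) ∷ʳ b) ++ w)) ≡ 0ℤ
    commutator-degree₃ = trans (bracket₂ i (λ w → f (((L ∷ʳ a) ∷ʳ b) ++ w)))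
      (cong₂ _-_
        (cong₂ _+_ (trans as (z≥ [] a [] (b ∷ c ∷ []) (a≤b ∷ a≤c ∷ [])))
                   (trans as (z≥ (a ∷ []) b [] (c ∷ []) (b≤c ∷ []))))
        (cong₂ _+_ (trans as (z≥ [] a (c ∷ []) (b ∷ []) (a≤b ∷ [])))
                   (trans as (z≤ (a ∷ []) b (c ∷ []) [] []))))
      where
      as : ∀ {v} → f (((L ∷ʳ a) ∷ʳ b) ++ v) ≡ h (a ∷ b ∷ v)
      as = cong f (trans (LP.++-assoc (L ∷ʳ a) _ _) (LP.++-assoc L _ _))

∑-congᵇ : ∀ t c p {F G : Word → ℤ} → (∀ {L} → All (_< c) L → F L ≡ G L) → ∑ (incr⁻ t c p) F ≡ ∑ (incr⁻ t c p) G
∑-congᵇ t c p eq = ∑-congᴬ (All.map eq (incr⁻-bounded t c p))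

∑-zeroᵇ : ∀ t c p {F : Word → ℤ} → (∀ {L} → All (_< c) L → F L ≡ 0ℤ) → ∑ (incr⁻ t c p) F ≡ 0ℤ
∑-zeroᵇ t c p eq = ∑-zeroᴬ (All.map eq (incr⁻-bounded t c p))

commutator : ∀ {f} → Switchboard f → ∀ c p →
  ∑ (incr c p) (λ L → f (c ∷ L))
  ≡ ∑ (incr c p) (λ L → f (L ∷ʳ c)) + ∑ (incr⁻ 1 c p) (λ L → bracket c (λ w → f (L ++ w)))
commutator {f} S 0 zero    = sym (ℤP.+-identityʳ _)
commutator {f} S 0 (suc p) = sym (trans (ℤP.+-identityˡ _) (∑-zero (incr 0 p) (λ _ → refl)))
commutator {f} S 1 p = begin
  ∑ (incr 1 p) (λ L → f (1 ∷ L))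
    ≡⟨ incr⁻-step 0 0 p _ ⟩
  ∑ (incr 0 p) (λ L → f (1 ∷ L)) + ∑ (incr⁻ 1 0 p) (λ L → f (1 ∷ L ++ [ 0 ]))
    ≡⟨ cong₂ _+_ (∑-congᵇ 0 0 p (λ { [] → refl })) (trans (∑-congᵇ 1 0 p (λ { [] → degree₁ })) (∑-+ (incr⁻ 1 0 p) _ _)) ⟩
  ∑ (incr 0 p) (λ L → f (L ∷ʳ 1)) +
    (∑ (incr⁻ 1 0 p) (λ L → f ((L ∷ʳ 0) ∷ʳ 1)) + ∑ (incr⁻ 1 0 p) (λ L → bracket 1 (λ w → f (L ++ w))))
    ≡⟨ regroup (∑ (incr 0 p) (λ L → f (L ∷ʳ 1))) (∑ (incr⁻ 1 0 p) (λ L → f ((L ∷ʳ 0) ∷ʳ 1))) (∑ (incr⁻ 1 0 p) (λ L → bracket 1 (λ w → f (L ++ w)))) ⟩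
  (∑ (incr 0 p) (λ L → f (L ∷ʳ 1)) + ∑ (incr⁻ 1 0 p) (λ L → f ((L ∷ʳ 0) ∷ʳ 1))) +
    (∑ (incr⁻ 1 0 p) (λ L → bracket 1 (λ w → f (L ++ w))) + 0ℤ)
    ≡⟨ cong₂ _+_ (sym (incr⁻-step 0 0 p _))
         (trans (cong (_+_ (∑ (incr⁻ 1 0 p) (λ L → bracket 1 (λ w → f (L ++ w))))) (sym (∑-zeroᵇ 2 0 p (λ { [] → degree₂ }))))
                (sym (incr⁻-step 1 0 p _))) ⟩
  ∑ (incr 1 p) (λ L → f (L ∷ʳ 1)) + ∑ (incr⁻ 1 1 p) (λ L → bracket 1 (λ w → f (L ++ w))) ∎
  where
  open ≡-Reasoning
  regroup : ∀ x y z → x + (y + z) ≡ (x + y) + (z + 0ℤ)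
  regroup = solve-∀
  degree₁ : f (1 ∷ 0 ∷ []) ≡ f (0 ∷ 1 ∷ []) + bracket 1 f
  degree₁ = trans (eval (f (1 ∷ 0 ∷ [])) (f (0 ∷ 1 ∷ []))) (cong (_+_ (f (0 ∷ 1 ∷ []))) (sym (bracket₁ f)))
    where
    eval : ∀ x y → x ≡ y + (x - y)
    eval = solve-∀
  degree₂ : bracket 1 (λ w → f (0 ∷ w)) ≡ 0ℤ
  degree₂ = trans (bracket₁ (λ w → f (0 ∷ w)))
    (cong₂ _-_ (sq≥ S [] [] 0 (1 ∷ []) (z≤n ∷ [])) (sq≤ S [] (1 ∷ []) 0 [] []))
commutator {f} S (suc (suc i)) p = begin
  ∑ (incr c p) (λ L → f (c ∷ L))
    ≡⟨ split₂ 0 (λ L → f (c ∷ L)) ⟩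
  (I 0 (λ L → f (c ∷ L)) + I 1 (λ L → f (c ∷ L ++ [ i ])))
    + (I 1 (λ L → f (c ∷ L ++ [ b ])) + I 2 (λ L → f (c ∷ (L ∷ʳ i) ++ [ b ])))
    ≡⟨ group (I 0 (λ L → f (c ∷ L))) (I 1 (λ L → f (c ∷ L ++ [ i ]))) (I 1 (λ L → f (c ∷ L ++ [ b ]))) (I 2 (λ L → f (c ∷ (L ∷ʳ i) ++ [ b ]))) ⟩
  I 0 (λ L → f (c ∷ L)) + (I 1 (λ L → f (c ∷ L ++ [ i ])) + I 1 (λ L → f (c ∷ L ++ [ b ]))) + I 2 (λ L → f (c ∷ (L ∷ʳ i) ++ [ b ]))
    ≡⟨ cong₂ _+_ (cong₂ _+_
         (∑-congᵇ 0 i p (commutator-degree₀ S i))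
         (trans (sym (∑-+ (incr⁻ 1 i p) _ _)) (trans (∑-congᵇ 1 i p (commutator-degree₁ S i))
           (trans (∑-+ (incr⁻ 1 i p) _ _) (cong (_+ I 1 B) (∑-+ (incr⁻ 1 i p) _ _))))))
         (trans (∑-congᵇ 2 i p (commutator-degree₂ S i))
           (trans (∑-+ (incr⁻ 2 i p) _ _) (cong (_+_ (I 2 (λ L → R ((L ∷ʳ i) ∷ʳ b)))) (∑-+ (incr⁻ 2 i p) _ _)))) ⟩
  I 0 R + ((I 1 (λ L → R (L ∷ʳ i)) + I 1 (λ L → R (L ∷ʳ b))) + I 1 B) +
    (I 2 (λ L → R ((L ∷ʳ i) ∷ʳ b)) + (I 2 (λ L → B (L ∷ʳ i)) + I 2 (λ L → B (L ∷ʳ b))))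
    ≡⟨ regroup (I 0 R) (I 1 (λ L → R (L ∷ʳ i))) (I 1 (λ L → R (L ∷ʳ b))) (I 1 B) (I 2 (λ L → R ((L ∷ʳ i) ∷ʳ b))) (I 2 (λ L → B (L ∷ʳ i))) (I 2 (λ L → B (L ∷ʳ b))) ⟩
  ((I 0 R + I 1 (λ L → R (L ∷ʳ i))) + (I 1 (λ L → R (L ∷ʳ b)) + I 2 (λ L → R ((L ∷ʳ i) ∷ʳ b)))) +
    ((I 1 B + I 2 (λ L → B (L ∷ʳ i))) + (I 2 (λ L → B (L ∷ʳ b)) + 0ℤ))
    ≡⟨ cong₂ _+_ (sym (split₂ 0 R))
         -- The component of h_{p-1} that contains both `a` and `b` contributes 0; adding it
         -- completes the sum over all letters below `c`.
         (trans (cong (λ z → (I 1 B + I 2 (λ L → B (L ∷ʳ i))) + (I 2 (λ L → B (L ∷ʳ b)) + z))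
                  (sym (∑-zeroᵇ 3 i p (commutator-degree₃ S i))))
                (sym (split₂ 1 B))) ⟩
  ∑ (incr c p) R + ∑ (incr⁻ 1 c p) B ∎
  where
  open ≡-Reasoning
  b = suc i
  c = suc (suc i)
  R B : Word → ℤ
  R L = f (L ∷ʳ c)
  B L = bracket c (λ w → f (L ++ w))
  I : ℕ → (Word → ℤ) → ℤ
  I t = ∑ (incr⁻ t i p)
  split₂ : ∀ t F → ∑ (incr⁻ t c p) F ≡ (I t F + I (suc t) (λ L → F (L ∷ʳ i)))
    + (I (suc t) (λ L → F (L ∷ʳ b)) + I (suc (suc t)) (λ L → F ((L ∷ʳ i) ∷ʳ b)))
  split₂ t F = trans (incr⁻-step t b p F) (cong₂ _+_ (incr⁻-step t i p F) (incr⁻-step (suc t) i p _))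
  group : ∀ u v w x → (u + v) + (w + x) ≡ u + (v + w) + x
  group = solve-∀
  regroup : ∀ r₀ ra rb b₁ rab ba bb → r₀ + ((ra + rb) + b₁) + (rab + (ba + bb))
    ≡ ((r₀ + ra) + (rb + rab)) + ((b₁ + ba) + (bb + 0ℤ))
  regroup = solve-∀

∑∑ : List Word → List Word → (Word → ℤ) → ℤ
∑∑ Vs Ls f = ∑ Vs (λ V → ∑ Ls (λ L → f (V ++ L)))

∑∑-bracket : ∀ c Vs Ls (f : Word → ℤ) → ∑∑ Vs Ls (λ u → bracket c (λ w → f (u ++ w)))
  ≡ bracket c (λ w → ∑∑ Vs Ls (λ u → f (u ++ w)))
∑∑-bracket c Vs Ls f =
  trans (∑-cong Vs (λ V → ∑-swap Ls (bracketWords c) (λ L sw → proj₁ sw * f ((V ++ L) ++ proj₂ sw))))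
  (trans (∑-swap Vs (bracketWords c) (λ V sw → ∑ Ls (λ L → proj₁ sw * f ((V ++ L) ++ proj₂ sw))))
  (∑-cong (bracketWords c) (λ sw →
    trans (∑-cong Vs (λ V → ∑-*ˡ Ls (proj₁ sw) (λ L → f ((V ++ L) ++ proj₂ sw))))
          (∑-*ˡ Vs (proj₁ sw) (λ V → ∑ Ls (λ L → f ((V ++ L) ++ proj₂ sw)))))))

incr-comm⇒incr⁻-comm : ∀ (f : Word → ℤ) c → (∀ p q → ∑∑ (incr c p) (incr c q) f ≡ ∑∑ (incr c q) (incr c p) f) →
  ∀ s t p q → ∑∑ (incr⁻ s c p) (incr⁻ t c q) f ≡ ∑∑ (incr⁻ t c q) (incr⁻ s c p) f
incr-comm⇒incr⁻-comm f c comm zero    zero    p       q       = comm p q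
incr-comm⇒incr⁻-comm f c comm (suc s) t       zero    q       = sym (∑-zero (incr⁻ t c q) (λ _ → refl))
incr-comm⇒incr⁻-comm f c comm (suc s) t       (suc p) q       = incr-comm⇒incr⁻-comm f c comm s t p q
incr-comm⇒incr⁻-comm f c comm zero    (suc t) p       zero    = ∑-zero (incr c p) (λ _ → refl)
incr-comm⇒incr⁻-comm f c comm zero    (suc t) p       (suc q) = incr-comm⇒incr⁻-comm f c comm zero t p q

-- Induction on the alphabet: terms with one letter c are brought to the form V L c by the commutator
-- formula, and terms with two vanish by sq≤.
incr-comm : ∀ c {f} → Switchboard f → ∀ p q → ∑∑ (incr c p) (incr c q) f ≡ ∑∑ (incr c q) (incr c p) f
incr⁻-comm : ∀ c {f} → Switchboard f → ∀ s t p q →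
  ∑∑ (incr⁻ s c p) (incr⁻ t c q) f ≡ ∑∑ (incr⁻ t c q) (incr⁻ s c p) f

incr⁻-comm c {f} S = incr-comm⇒incr⁻-comm f c (incr-comm c S)

incr-comm zero    {f} S zero    zero    = refl
incr-comm zero    {f} S zero    (suc q) = refl
incr-comm zero    {f} S (suc p) zero    = refl
incr-comm zero    {f} S (suc p) (suc q) = refl
incr-comm (suc c) {f} S p q = trans (expand p q) (trans symmetric (sym (expand q p)))
  where
  open ≡-Reasoning
  fc : Word → ℤ
  fc w = f (w ∷ʳ c)
  Sc : Switchboard fc
  Sc = underʳ [ c ] S
  fB : Word → ℤ
  fB u = bracket c (λ w → f (u ++ w))
  X : ℕ → ℕ → (Word → ℤ) → ℕ → ℕ → ℤ
  X s t g p q = ∑∑ (incr⁻ s c p) (incr⁻ t c q) g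

  fixV : ∀ q {V} → All (_< c) V →
    ∑ (incr (suc c) q) (λ L → f ((V ∷ʳ c) ++ L))
    ≡ ∑ (incr c q) (λ L → fc (V ++ L)) + ∑ (incr⁻ 1 c q) (λ L → fB (V ++ L))
  fixV q {V} V< = begin
    ∑ (incr (suc c) q) (λ L → f ((V ∷ʳ c) ++ L))
      ≡⟨ incr⁻-step 0 c q _ ⟩
    ∑ (incr c q) (λ L → f ((V ∷ʳ c) ++ L)) + ∑ (incr⁻ 1 c q) (λ L → f ((V ∷ʳ c) ++ L ∷ʳ c))
      ≡⟨ cong₂ _+_ (∑-cong (incr c q) (λ L → cong f (LP.++-assoc V _ _)))
           (∑-zeroᵇ 1 c q (λ {L} L< → trans (cong f (LP.++-assoc V _ _)) (sq≤ S V [] c L (All.map ℕP.<⇒≤ L<)))) ⟩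
    ∑ (incr c q) (λ L → f (V ++ c ∷ L)) + 0ℤ
      ≡⟨ ℤP.+-identityʳ _ ⟩
    ∑ (incr c q) (λ L → f (V ++ c ∷ L))
      ≡⟨ commutator (underˡ V S) c q ⟩
    ∑ (incr c q) (λ L → f (V ++ L ∷ʳ c)) + ∑ (incr⁻ 1 c q) (λ L → bracket c (λ w → f (V ++ L ++ w)))
      ≡⟨ cong₂ _+_ (∑-cong (incr c q) (λ L → cong f (sym (LP.++-assoc V L _))))
           (∑-cong (incr⁻ 1 c q) (λ L → ∑-cong (bracketWords c) (λ sw → cong (λ u → proj₁ sw * f u) (sym (LP.++-assoc V L _))))) ⟩
    ∑ (incr c q) (λ L → fc (V ++ L)) + ∑ (incr⁻ 1 c q) (λ L → fB (V ++ L)) ∎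

  expand : ∀ p q → ∑∑ (incr (suc c) p) (incr (suc c) q) f
    ≡ (X 0 0 f p q + X 0 1 fc p q) + (X 1 0 fc p q + X 1 1 fB p q)
  expand p q = trans (incr⁻-step 0 c p _) (cong₂ _+_
    (trans (∑-cong (incr c p) (λ V → trans (incr⁻-step 0 c q _)
             (cong (_+_ (∑ (incr c q) (λ L → f (V ++ L)))) (∑-cong (incr⁻ 1 c q) (λ L → cong f (sym (LP.++-assoc V L _)))))))
           (∑-+ (incr c p) _ _))
    (trans (∑-congᵇ 1 c p (fixV q)) (∑-+ (incr⁻ 1 c p) _ _)))

  bracket-comm : X 1 1 fB p q ≡ X 1 1 fB q p
  bracket-comm = trans (∑∑-bracket c (incr⁻ 1 c p) (incr⁻ 1 c q) f)
    (trans (∑-cong (bracketWords c) (λ sw → cong (_*_ (proj₁ sw)) (incr⁻-comm c {λ u → f (u ++ proj₂ sw)} (underʳ (proj₂ sw) S) 1 1 p q)))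
           (sym (∑∑-bracket c (incr⁻ 1 c q) (incr⁻ 1 c p) f)))

  symmetric : (X 0 0 f p q + X 0 1 fc p q) + (X 1 0 fc p q + X 1 1 fB p q)
    ≡ (X 0 0 f q p + X 0 1 fc q p) + (X 1 0 fc q p + X 1 1 fB q p)
  symmetric = begin
    (X 0 0 f p q + X 0 1 fc p q) + (X 1 0 fc p q + X 1 1 fB p q)
      ≡⟨ cong₂ _+_ (cong₂ _+_ (incr⁻-comm c S 0 0 p q) (incr⁻-comm c Sc 0 1 p q))
                   (cong₂ _+_ (incr⁻-comm c Sc 1 0 p q) bracket-comm) ⟩
    (X 0 0 f q p + X 1 0 fc q p) + (X 0 1 fc q p + X 1 1 fB q p)
      ≡⟨ +-interchange (X 0 0 f q p) (X 1 0 fc q p) (X 0 1 fc q p) (X 1 1 fB q p) ⟩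
    (X 0 0 f q p + X 0 1 fc q p) + (X 1 0 fc q p + X 1 1 fB q p) ∎

-- The letters of Z are far from those of L, and c Z c cancels because Z has no letter below c.
flagged-comm : ∀ c {f} → Switchboard f → ∀ {Z} → All (suc (suc c) ≤_) Z → ∀ p q →
  ∑ (incr (suc c) p) (λ V → ∑ (incr c q) (λ L → f (V ++ Z ++ L ++ [ c ])))
  ≡ ∑ (incr (suc c) q) (λ V → ∑ (incr c p) (λ L → f (V ++ Z ++ L ++ [ c ])))
flagged-comm c {f} S {Z} Z≥ p q = trans (expand p q) (trans
  (cong₂ _+_ (incr⁻-comm c SZ 0 0 p q) bracket-comm) (sym (expand q p)))
  where
  open ≡-Reasoning
  fZ : Word → ℤ
  fZ w = f (w ++ Z ++ [ c ])
  SZ : Switchboard fZ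
  SZ = underʳ (Z ++ [ c ]) S
  fB : Word → ℤ
  fB u = bracket c (λ w → fZ (u ++ w))
  X : ℕ → ℕ → (Word → ℤ) → ℕ → ℕ → ℤ
  X s t g p q = ∑∑ (incr⁻ s c p) (incr⁻ t c q) g

  slide : ∀ V {L} → All (_< c) L → f (V ++ Z ++ L ++ [ c ]) ≡ fZ (V ++ L)
  slide V {L} L< = trans (far-words (underˡ V S) c Z≥ L< [ c ]) (cong f (sym (LP.++-assoc V L _)))

  c≤Z : All (c ≤_) Z
  c≤Z = All.map (ℕP.≤-trans (ℕP.m≤n+m c 2)) Z≥

  fixV : ∀ q V → ∑ (incr c q) (λ L → f ((V ∷ʳ c) ++ Z ++ L ++ [ c ])) ≡ ∑ (incr⁻ 1 c q) (λ L → fB (V ++ L))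
  fixV q V = begin
    ∑ (incr c q) (λ L → f ((V ∷ʳ c) ++ Z ++ L ++ [ c ]))
      ≡⟨ ∑-congᵇ 0 c q (λ L< → slide (V ∷ʳ c) L<) ⟩
    ∑ (incr c q) (λ L → fZ ((V ∷ʳ c) ++ L))
      ≡⟨ ∑-cong (incr c q) (λ L → cong fZ (LP.++-assoc V _ _)) ⟩
    ∑ (incr c q) (λ L → fZ (V ++ c ∷ L))
      ≡⟨ commutator (underˡ V SZ) c q ⟩
    ∑ (incr c q) (λ L → fZ (V ++ L ∷ʳ c)) + ∑ (incr⁻ 1 c q) (λ L → bracket c (λ w → fZ (V ++ L ++ w)))
      ≡⟨ cong₂ _+_ (∑-zero (incr c q) (λ L → trans (cong f (reassoc V L)) (sq≥ S (V ++ L) [] c Z c≤Z)))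
           (∑-cong (incr⁻ 1 c q) (λ L → ∑-cong (bracketWords c) (λ sw → cong (λ u → proj₁ sw * fZ u) (sym (LP.++-assoc V L _))))) ⟩
    0ℤ + ∑ (incr⁻ 1 c q) (λ L → fB (V ++ L))
      ≡⟨ ℤP.+-identityˡ _ ⟩
    ∑ (incr⁻ 1 c q) (λ L → fB (V ++ L)) ∎
    where
    reassoc : ∀ V L → (V ++ L ++ [ c ]) ++ Z ++ [ c ] ≡ (V ++ L) ++ c ∷ Z ++ [ c ]
    reassoc V L = trans (cong (_++ Z ++ [ c ]) (sym (LP.++-assoc V L [ c ]))) (LP.++-assoc (V ++ L) [ c ] _)

  expand : ∀ p q → ∑ (incr (suc c) p) (λ V → ∑ (incr c q) (λ L → f (V ++ Z ++ L ++ [ c ])))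
    ≡ X 0 0 fZ p q + X 1 1 fB p q
  expand p q = trans (incr⁻-step 0 c p _) (cong₂ _+_
    (∑-cong (incr c p) (λ V → ∑-congᵇ 0 c q (slide V)))
    (∑-cong (incr⁻ 1 c p) (fixV q)))

  bracket-comm : X 1 1 fB p q ≡ X 1 1 fB q p
  bracket-comm = trans (∑∑-bracket c (incr⁻ 1 c p) (incr⁻ 1 c q) fZ)
    (trans (∑-cong (bracketWords c) (λ sw → cong (_*_ (proj₁ sw)) (incr⁻-comm c {λ u → fZ (u ++ proj₂ sw)} (underʳ (proj₂ sw) SZ) 1 1 p q)))
           (sym (∑∑-bracket c (incr⁻ 1 c q) (incr⁻ 1 c p) fZ)))

-- Cancellation of the tuples violating the lattice condition

count-true : {A : Set} (p : A → Bool) {x : A} (xs : List A) → p x ≡ true → count p (x ∷ xs) ≡ suc (count p xs)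
count-true p xs eq rewrite eq = refl

count-false : {A : Set} (p : A → Bool) {x : A} (xs : List A) → p x ≡ false → count p (x ∷ xs) ≡ count p xs
count-false p xs eq rewrite eq = refl

count-++ : {A : Set} (p : A → Bool) (xs ys : List A) → count p (xs ++ ys) ≡ count p xs ℕ.+ count p ys
count-++ p []       ys = refl
count-++ p (x ∷ xs) ys with p x
... | true  = cong suc (count-++ p xs ys)
... | false = count-++ p xs ys

count-all : {A : Set} (p : A → Bool) {xs : List A} → All (λ x → p x ≡ true) xs → count p xs ≡ length xs
count-all p []                  = refl
count-all p (_∷_ {x} {xs} eq eqs) = trans (count-true p xs eq) (cong suc (count-all p eqs))

count-none : {A : Set} (p : A → Bool) {xs : List A} → All (λ x → p x ≡ false) xs → count p xs ≡ 0
count-none p []                  = refl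
count-none p (_∷_ {x} {xs} eq eqs) = trans (count-false p xs eq) (count-none p eqs)

true≢false : true ≢ false
true≢false ()

T⇒≡ : ∀ {b} → T b → b ≡ true
T⇒≡ {true} _ = refl

¬T⇒≡ : ∀ {b} → ¬ T b → b ≡ false
¬T⇒≡ {true}  ¬t = ⊥-elim (¬t tt)
¬T⇒≡ {false} _  = refl

≤⇒≤ᵇ≡ : ∀ {m n} → m ≤ n → (m ≤ᵇ n) ≡ true
≤⇒≤ᵇ≡ m≤n = T⇒≡ (ℕP.≤⇒≤ᵇ m≤n)

≰⇒≤ᵇ≡ : ∀ {m n} → ¬ m ≤ n → (m ≤ᵇ n) ≡ false
≰⇒≤ᵇ≡ m≰n = ¬T⇒≡ (m≰n ∘ ℕP.≤ᵇ⇒≤ _ _)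

<⇒<ᵇ≡ : ∀ {m n} → m < n → (m <ᵇ n) ≡ true
<⇒<ᵇ≡ m<n = T⇒≡ (ℕP.<⇒<ᵇ m<n)

≮⇒<ᵇ≡ : ∀ {m n} → ¬ m < n → (m <ᵇ n) ≡ false
≮⇒<ᵇ≡ m≮n = ¬T⇒≡ (m≮n ∘ ℕP.<ᵇ⇒< _ _)

x≡-x⇒x≡0 : ∀ {x} → x ≡ - x → x ≡ 0ℤ
x≡-x⇒x≡0 {pos zero} _ = refl

incr-length : ∀ c p → All (λ w → length w ≡ p) (incr c p)
incr-length c       zero    = refl ∷ []
incr-length zero    (suc p) = []
incr-length (suc c) (suc p) = AllP.++⁺ (incr-length c (suc p))
  (AllP.map⁺ (All.map (λ {w} eq → trans (LP.length-++ w) (trans (ℕP.+-comm (length w) 1) (cong suc eq))) (incr-length c p)))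

subwords : ℕ → List Word
subwords zero    = [] ∷ []
subwords (suc c) = subwords c ++ map (_∷ʳ c) (subwords c)

subwords-bounded : ∀ c → All (All (_< c)) (subwords c)
subwords-bounded zero    = [] ∷ []
subwords-bounded (suc c) = AllP.++⁺ (All.map weaken (subwords-bounded c))
  (AllP.map⁺ (All.map (λ w< → AllP.∷ʳ⁺ (weaken w<) (ℕP.n<1+n c)) (subwords-bounded c)))
  where
  weaken : ∀ {w} → All (_< c) w → All (_< suc c) w
  weaken = All.map ℕP.m<n⇒m<1+n

∑-subwords-suc : ∀ c (F : Word → ℤ) → ∑ (subwords (suc c)) F ≡ ∑ (subwords c) F + ∑ (subwords c) (λ L → F (L ∷ʳ c))
∑-subwords-suc c F = trans (∑-++ (subwords c) _ F) (cong (_+_ (∑ (subwords c) F)) (∑-map (_∷ʳ c) (subwords c) F))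

∑-upTo-suc : ∀ n (F : ℕ → ℤ) → ∑ (upTo (suc n)) F ≡ F 0 + ∑ (upTo n) (F ∘ suc)
∑-upTo-suc n F = cong (_+_ (F 0)) (shift id n)
  where
  shift : ∀ h n → ∑ (applyUpTo (suc ∘ h) n) F ≡ ∑ (applyUpTo h n) (F ∘ suc)
  shift h zero    = refl
  shift h (suc n) = cong (_+_ (F (suc (h 0)))) (shift (h ∘ suc) n)

∑-incr-suc : ∀ M c (F : Word → ℤ) →
  ∑ (upTo M) (λ p → ∑ (incr⁻ 1 c p) F) ≡ ∑ (upTo (ℕ.pred M)) (λ p → ∑ (incr c p) F)
∑-incr-suc zero    c F = refl
∑-incr-suc (suc M) c F = trans (∑-upTo-suc M (λ p → ∑ (incr⁻ 1 c p) F)) (ℤP.+-identityˡ _)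

∑-subwords : ∀ c M → c ≤ M → ∀ (F : Word → ℤ) → ∑ (subwords c) F ≡ ∑ (upTo (suc M)) (λ p → ∑ (incr c p) F)
∑-subwords zero M z≤n F = sym (trans (∑-upTo-suc M (λ p → ∑ (incr 0 p) F))
  (trans (cong (_+_ (F [] + 0ℤ)) (∑-zero (upTo M) (λ _ → refl))) (ℤP.+-identityʳ _)))
∑-subwords (suc c) (suc M) (s≤s c≤M) F = begin
  ∑ (subwords (suc c)) F
    ≡⟨ ∑-subwords-suc c F ⟩
  ∑ (subwords c) F + ∑ (subwords c) F′
    ≡⟨ cong₂ _+_ (∑-subwords c (suc M) (ℕP.m≤n⇒m≤1+n c≤M) F) (∑-subwords c M c≤M F′) ⟩
  ∑ (upTo (suc (suc M))) (λ p → ∑ (incr c p) F) + ∑ (upTo (suc M)) (λ p → ∑ (incr c p) F′)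
    ≡⟨ cong (_+_ (∑ (upTo (suc (suc M))) (λ p → ∑ (incr c p) F))) (sym (∑-incr-suc (suc (suc M)) c F′)) ⟩
  ∑ (upTo (suc (suc M))) (λ p → ∑ (incr c p) F) + ∑ (upTo (suc (suc M))) (λ p → ∑ (incr⁻ 1 c p) F′)
    ≡⟨ sym (∑-+ (upTo (suc (suc M))) (λ p → ∑ (incr c p) F) (λ p → ∑ (incr⁻ 1 c p) F′)) ⟩
  ∑ (upTo (suc (suc M))) (λ p → ∑ (incr c p) F + ∑ (incr⁻ 1 c p) F′)
    ≡⟨ ∑-cong (upTo (suc (suc M))) (λ p → sym (incr⁻-step 0 c p F)) ⟩
  ∑ (upTo (suc (suc M))) (λ p → ∑ (incr (suc c) p) F) ∎
  where
  open ≡-Reasoning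
  F′ : Word → ℤ
  F′ L = F (L ∷ʳ c)

-- g is an antisymmetric function of α + (m-1 , … , 1 , 0), stated without the shift.
Alternating : (List ℕ → ℤ) → Set
Alternating g = ∀ xs p q ys → g (xs ++ p ∷ suc q ∷ ys) ≡ - g (xs ++ q ∷ suc p ∷ ys)

∑-sym-alt : (is : List ℕ) (E γ : ℕ → ℕ → ℤ) → (∀ p q → E p q ≡ E q p) → (∀ p q → γ p q ≡ - γ q p) →
  ∑ is (λ p → ∑ is (λ q → E p q * γ p q)) ≡ 0ℤ
∑-sym-alt is E γ sy al = x≡-x⇒x≡0 (begin
  ∑ is (λ p → ∑ is (λ q → E p q * γ p q))
    ≡⟨ ∑-swap is is (λ p q → E p q * γ p q) ⟩
  ∑ is (λ q → ∑ is (λ p → E p q * γ p q))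
    ≡⟨ ∑-cong is (λ q → trans (∑-cong is (λ p → flip p q)) (∑-neg is (λ p → E q p * γ q p))) ⟩
  ∑ is (λ q → - ∑ is (λ p → E q p * γ q p))
    ≡⟨ ∑-neg is (λ q → ∑ is (λ p → E q p * γ q p)) ⟩
  - ∑ is (λ q → ∑ is (λ p → E q p * γ q p)) ∎)
  where
  open ≡-Reasoning
  flip : ∀ p q → E p q * γ p q ≡ - (E q p * γ q p)
  flip p q = trans (cong₂ _*_ (sy p q) (al p q)) (sym (ℤP.neg-distribʳ-* (E q p) (γ q p)))

weigh : (Word → ℤ) → (List ℕ → ℤ) → List Word → ℤ
weigh f g Bs = f (concat Bs) * g (map length Bs)

-- The shape of a violation at `c`: the second block has one more letter from `c` on than the first
-- has letters above `c`. The first block is still free up to and including `c`, the second one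
-- below `c`, because only this double sum cancels.
ViolationFree : (List Word → ℤ) → Set
ViolationFree k = ∀ c pre U U′ post → length U ≡ length U′ → All (suc c <_) U → All (c <_) U′ →
  ∑ (subwords (suc c)) (λ L → ∑ (subwords c) (λ L′ → k (pre ++ (L ++ U) ∷ (L′ ++ c ∷ U′) ∷ post))) ≡ 0ℤ

-- For free parts of fixed lengths `p` and `q` the sum of the words is symmetric in `p` and `q` by
-- `flagged-comm`. The block lengths `p + u` and `q + u + 1` are in the position in which
-- `Alternating` changes the sign when `p` and `q` are exchanged.
weigh-violationFree : ∀ {f g} → Switchboard f → Alternating g → ViolationFree (weigh f g)
weigh-violationFree {f} {g} S alt c pre U U′ post |U|≡|U′| U> _ = begin
  ∑ (subwords (suc c)) (λ L → ∑ (subwords c) (λ L′ → k L L′))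
    ≡⟨ ∑-subwords (suc c) (suc c) ℕP.≤-refl (λ L → ∑ (subwords c) (k L)) ⟩
  ∑ is (λ p → ∑ (incr (suc c) p) (λ L → ∑ (subwords c) (λ L′ → k L L′)))
    ≡⟨ ∑-cong is (λ p → trans (∑-cong (incr (suc c) p) (λ L → ∑-subwords c (suc c) (ℕP.n≤1+n c) (k L)))
         (∑-swap (incr (suc c) p) is (λ L q → ∑ (incr c q) (k L)))) ⟩
  ∑ is (λ p → ∑ is (λ q → ∑ (incr (suc c) p) (λ L → ∑ (incr c q) (λ L′ → k L L′))))
    ≡⟨ ∑-cong is (λ p → ∑-cong is (λ q → trans
         (∑-congᴬ (All.map (λ {L} |L| → trans (∑-congᴬ (All.map (λ {L′} |L′| → value L L′ p q |L| |L′|) (incr-length c q)))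
            (∑-*ʳ (incr c q) (γ p q) (e L))) (incr-length (suc c) p)))
         (∑-*ʳ (incr (suc c) p) (γ p q) (λ L → ∑ (incr c q) (e L))))) ⟩
  ∑ is (λ p → ∑ is (λ q → E p q * γ p q))
    ≡⟨ ∑-sym-alt is E γ (flagged-comm c (underˡ x (underʳ y S)) U>) (λ p q → alt (map length pre) _ _ _) ⟩
  0ℤ ∎
  where
  open ≡-Reasoning
  is = upTo (suc (suc c))
  x = concat pre
  y = U′ ++ concat post
  u = length U
  k : Word → Word → ℤ
  k L L′ = weigh f g (pre ++ (L ++ U) ∷ (L′ ++ c ∷ U′) ∷ post)
  e : Word → Word → ℤ
  e L L′ = f ((x ++ L ++ U ++ L′ ++ [ c ]) ++ y)
  E γ : ℕ → ℕ → ℤ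
  E p q = ∑ (incr (suc c) p) (λ L → ∑ (incr c q) (e L))
  γ p q = g (map length pre ++ (p ℕ.+ u) ∷ suc (q ℕ.+ u) ∷ map length post)
  word : ∀ L L′ → concat (pre ++ (L ++ U) ∷ (L′ ++ c ∷ U′) ∷ post) ≡ (x ++ L ++ U ++ L′ ++ [ c ]) ++ y
  word L L′ = begin
    concat (pre ++ (L ++ U) ∷ (L′ ++ c ∷ U′) ∷ post)
      ≡⟨ sym (LP.concat-++ pre _) ⟩
    x ++ (L ++ U) ++ (L′ ++ c ∷ U′) ++ concat post
      ≡⟨ cong (x ++_) (LP.++-assoc L U _) ⟩
    x ++ L ++ U ++ (L′ ++ c ∷ U′) ++ concat post
      ≡⟨ cong (λ w → x ++ L ++ U ++ w) (trans (LP.++-assoc L′ _ _) (sym (LP.++-assoc L′ [ c ] y))) ⟩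
    x ++ L ++ U ++ (L′ ++ [ c ]) ++ y
      ≡⟨ cong (λ w → x ++ L ++ w) (sym (LP.++-assoc U _ y)) ⟩
    x ++ L ++ (U ++ L′ ++ [ c ]) ++ y
      ≡⟨ cong (x ++_) (sym (LP.++-assoc L _ y)) ⟩
    x ++ (L ++ U ++ L′ ++ [ c ]) ++ y
      ≡⟨ sym (LP.++-assoc x _ y) ⟩
    (x ++ L ++ U ++ L′ ++ [ c ]) ++ y ∎
  lengths : ∀ L L′ p q → length L ≡ p → length L′ ≡ q →
    map length (pre ++ (L ++ U) ∷ (L′ ++ c ∷ U′) ∷ post)
    ≡ map length pre ++ (p ℕ.+ u) ∷ suc (q ℕ.+ u) ∷ map length post
  lengths L L′ p q refl refl = trans (LP.map-++ length pre _)
    (cong (map length pre ++_) (cong₂ _∷_ (LP.length-++ L) (cong (_∷ map length post)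
      (trans (LP.length-++ L′) (trans (ℕP.+-suc (length L′) (length U′)) (cong (λ n → suc (length L′ ℕ.+ n)) (sym |U|≡|U′|)))))))
  value : ∀ L L′ p q → length L ≡ p → length L′ ≡ q → k L L′ ≡ f ((x ++ L ++ U ++ L′ ++ [ c ]) ++ y) * γ p q
  value L L′ p q |L| |L′| = cong₂ _*_ (cong f (word L L′)) (cong g (lengths L L′ p q |L| |L′|))

All-concatMap : {A B : Set} {P : B → Set} (h : A → List B) {xs : List A} → All (λ x → All P (h x)) xs → All P (concatMap h xs)
All-concatMap h ps = AllP.concat⁺ (AllP.map⁺ ps)

hd : List Word → Word
hd []      = []
hd (B ∷ _) = B

-- The ballot condition of the Littlewood-Richardson rule between two neighbouring blocks, when the
-- block numbers are read from the largest letter down.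
Fits : Word → Word → Set
Fits A B = All (λ c → count (c ≤ᵇ_) B ≤ count (c <ᵇ_) A) B

data Good : List Word → Set where
  []  : Good []
  _∷_ : ∀ {A Bs} → Fits A (hd Bs) → Good Bs → Good (A ∷ Bs)

fits? : ∀ A B → Dec (Fits A B)
fits? A B = All.all? (λ c → count (c ≤ᵇ_) B ℕP.≤? count (c <ᵇ_) A) B

good? : ∀ Bs → Dec (Good Bs)
good? []       = yes []
good? (A ∷ Bs) with fits? A (hd Bs) | good? Bs
... | yes p | yes q = yes (p ∷ q)
... | yes p | no ¬q = no (λ { (_ ∷ q) → ¬q q })
... | no ¬p | _     = no (λ { (p ∷ _) → ¬p p })

count-≤-length : {A : Set} (p : A → Bool) (xs : List A) → count p xs ≤ length xs
count-≤-length p []       = z≤n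
count-≤-length p (x ∷ xs) with p x
... | true  = s≤s (count-≤-length p xs)
... | false = ℕP.m≤n⇒m≤1+n (count-≤-length p xs)

count-∷-≤ : {A : Set} (p : A → Bool) (x : A) (xs : List A) → count p xs ≤ count p (x ∷ xs)
count-∷-≤ p x xs with p x
... | true  = ℕP.n≤1+n _
... | false = ℕP.≤-refl

-- The state of the cancellation argument: letters from `c` on have been placed in the blocks, and
-- the sum runs over all completions by letters below `c`.
Tot : ℕ → List Word → (List Word → ℤ) → ℤ
Tot c []       k = k []
Tot c (U ∷ Us) k = ∑ (subwords c) (λ L → Tot c Us (λ Bs → k ((L ++ U) ∷ Bs)))

Tot-cong : ∀ c Us {k k′ : List Word → ℤ} → (∀ Bs → k Bs ≡ k′ Bs) → Tot c Us k ≡ Tot c Us k′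
Tot-cong c []       eq = eq []
Tot-cong c (U ∷ Us) eq = ∑-cong (subwords c) (λ L → Tot-cong c Us (λ Bs → eq ((L ++ U) ∷ Bs)))

Tot-zero : ∀ c Us {k : List Word → ℤ} → (∀ Bs → k Bs ≡ 0ℤ) → Tot c Us k ≡ 0ℤ
Tot-zero c []       eq = eq []
Tot-zero c (U ∷ Us) eq = ∑-zero (subwords c) (λ L → Tot-zero c Us (λ Bs → eq ((L ++ U) ∷ Bs)))

∑-Tot : ∀ {A : Set} (xs : List A) c Us (k : A → List Word → ℤ) →
  ∑ xs (λ x → Tot c Us (k x)) ≡ Tot c Us (λ Bs → ∑ xs (λ x → k x Bs))
∑-Tot xs c []       k = refl
∑-Tot xs c (U ∷ Us) k =
  trans (∑-swap xs (subwords c) (λ x L → Tot c Us (λ Bs → k x ((L ++ U) ∷ Bs))))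
        (∑-cong (subwords c) (λ L → ∑-Tot xs c Us (λ x Bs → k x ((L ++ U) ∷ Bs))))

-- Letters are placed from the largest down, so the blocks of Us have only letters above c.
extend : ℕ → List Word → List (List Word)
attach : ℕ → Word → List Word → List (List Word)
extend c []       = [] ∷ []
extend c (U ∷ Us) = concatMap (attach c U) (extend c Us)
attach c U Us′ with length (hd Us′) ℕP.≤? length U
... | yes _ = (U ∷ Us′) ∷ ((c ∷ U) ∷ Us′) ∷ []
... | no  _ = []

-- The invariant after placing the letters down to `c` without violation. The condition on lengths
-- carries the argument: a block as long as its right neighbour has not received `c`. If the next
-- lower letter then violates, the letter just above it is missing in the left block, which is the
-- gap that `ViolationFree` asks for.
data Dominant (c : ℕ) : List Word → Set where
  []   : Dominant c []
  cons : ∀ {U Us} → All (c ≤_) U →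
         (length (hd Us) < length U) ⊎ (length (hd Us) ≡ length U × All (c <_) U) →
         Fits U (hd Us) → Dominant c Us → Dominant c (U ∷ Us)

dominant⇒good : ∀ {c Us} → Dominant c Us → Good Us
dominant⇒good []             = []
dominant⇒good (cons _ _ f d) = f ∷ dominant⇒good d

dominant-hd : ∀ {c Us} → Dominant c Us → All (c ≤_) (hd Us)
dominant-hd []             = []
dominant-hd (cons U≥ _ _ _) = U≥

HeadExtends : ℕ → List Word → List Word → Set
HeadExtends c Us Us′ = (hd Us′ ≡ hd Us) ⊎ (∃ λ Us″ → Us′ ≡ (c ∷ hd Us) ∷ Us″)

fits-∷ʳ : ∀ {c A B} → All (suc c ≤_) A → All (suc c ≤_) B → Fits A B → suc (length B) ≤ length A → Fits A (c ∷ B)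
fits-∷ʳ {c} {A} {B} A> B> fits |B|<|A| =
  ℕP.≤-trans (count-≤-length (c ≤ᵇ_) (c ∷ B))
    (ℕP.≤-trans |B|<|A| (ℕP.≤-reflexive (sym (count-all (c <ᵇ_) (All.map <⇒<ᵇ≡ A>)))))
  ∷ All.zipWith (λ {d} (d> , le) → ℕP.≤-trans
      (ℕP.≤-reflexive (count-false (d ≤ᵇ_) B (≰⇒≤ᵇ≡ (ℕP.<⇒≱ d>)))) le) (B> , fits)

fits-∷ˡ : ∀ {c A B} → Fits A B → Fits (c ∷ A) B
fits-∷ˡ {c} {A} = All.map (λ {d} le → ℕP.≤-trans le (count-∷-≤ (d <ᵇ_) c A))

extend-dominant : ∀ {c Us} → Dominant (suc c) Us →
  All (λ Us′ → Dominant c Us′ × HeadExtends c Us Us′) (extend c Us)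
extend-dominant {c} {[]}     []                    = ([] , inj₁ refl) ∷ []
extend-dominant {c} {U ∷ Us} (cons U> lens fits dom) =
  All-concatMap (attach c U) (All.map attach-dominant (extend-dominant dom))
  where
  U≥ : All (c ≤_) U
  U≥ = All.map ℕP.<⇒≤ U>
  attach-dominant : ∀ {Us′} → Dominant c Us′ × HeadExtends c Us Us′ →
    All (λ Vs → Dominant c Vs × HeadExtends c (U ∷ Us) Vs) (attach c U Us′)
  attach-dominant {Us′} (dom′ , ext) with length (hd Us′) ℕP.≤? length U
  ... | no  _  = []
  ... | yes le = (cons U≥ tight (fitsU ext le) dom′ , inj₁ refl)
               ∷ (cons (ℕP.≤-refl ∷ U≥) (inj₁ (s≤s le)) (fits-∷ˡ {c} {U} {hd Us′} (fitsU ext le)) dom′ , inj₂ (Us′ , refl)) ∷ []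
    where
    tight : (length (hd Us′) < length U) ⊎ (length (hd Us′) ≡ length U × All (c <_) U)
    tight with ℕP.m≤n⇒m<n∨m≡n le
    ... | inj₁ lt = inj₁ lt
    ... | inj₂ eq = inj₂ (eq , U>)
    fitsU : ∀ {Us′} → HeadExtends c Us Us′ → length (hd Us′) ≤ length U → Fits U (hd Us′)
    fitsU (inj₁ eq)         le = subst (Fits U) (sym eq) fits
    fitsU (inj₂ (_ , refl)) le = fits-∷ʳ U> (dominant-hd dom) fits le

-- Stembridge's cancellation: among the ways to place c that violate Fits, consider those whose last
-- violation is between U and the block after it.  The two have the same length, so vf applies.
Tot-step : ∀ {c Us} → Dominant (suc c) Us → ∀ {k} → ViolationFree k →
  Tot (suc c) Us k ≡ ∑ (extend c Us) (λ Us′ → Tot c Us′ k)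
Tot-step {c} {[]}     _                           {k} vf = sym (ℤP.+-identityʳ (k []))
Tot-step {c} {U ∷ Us} (cons U> lens fits dom) {k} vf = begin
  ∑ (subwords (suc c)) (λ L → Tot (suc c) Us (kL L))
    ≡⟨ ∑-cong (subwords (suc c)) (λ L → Tot-step dom (λ c′ pre → vf c′ ((L ++ U) ∷ pre))) ⟩
  ∑ (subwords (suc c)) (λ L → ∑ (extend c Us) (λ Us′ → Tot c Us′ (kL L)))
    ≡⟨ ∑-swap (subwords (suc c)) (extend c Us) (λ L Us′ → Tot c Us′ (kL L)) ⟩
  ∑ (extend c Us) (λ Us′ → ∑ (subwords (suc c)) (λ L → Tot c Us′ (kL L)))
    ≡⟨ ∑-congᴬ (All.map (λ {Us′} p → attach-sum Us′ (proj₂ p)) (extend-dominant dom)) ⟩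
  ∑ (extend c Us) (λ Us′ → ∑ (attach c U Us′) (λ Vs → Tot c Vs k))
    ≡⟨ sym (∑-concatMap (attach c U) (extend c Us) (λ Vs → Tot c Vs k)) ⟩
  ∑ (concatMap (attach c U) (extend c Us)) (λ Vs → Tot c Vs k) ∎
  where
  open ≡-Reasoning
  kL : Word → List Word → ℤ
  kL L Bs = k ((L ++ U) ∷ Bs)
  violated : ∀ Us′ → HeadExtends c Us Us′ →
    (length (hd Us) < length U) ⊎ (length (hd Us) ≡ length U × All (suc c <_) U) → ¬ length (hd Us′) ≤ length U →
    ∑ (subwords (suc c)) (λ L → Tot c Us′ (kL L)) ≡ 0ℤ
  violated Us′ (inj₁ eq) (inj₁ lt)      ¬le = ⊥-elim (¬le (subst (λ B → length B ≤ length U) (sym eq) (ℕP.<⇒≤ lt)))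
  violated Us′ (inj₁ eq) (inj₂ (e , _)) ¬le = ⊥-elim (¬le (subst (λ B → length B ≤ length U) (sym eq) (ℕP.≤-reflexive e)))
  violated _ (inj₂ (_ , refl)) (inj₁ lt) ¬le = ⊥-elim (¬le lt)
  violated _ (inj₂ (Us″ , refl)) (inj₂ (e , U≫)) ¬le = begin
    ∑ (subwords (suc c)) (λ L → ∑ (subwords c) (λ L′ → Tot c Us″ (λ Bs → k ((L ++ U) ∷ (L′ ++ c ∷ hd Us) ∷ Bs))))
      ≡⟨ ∑-cong (subwords (suc c)) (λ L → ∑-Tot (subwords c) c Us″ (λ L′ Bs → k ((L ++ U) ∷ (L′ ++ c ∷ hd Us) ∷ Bs))) ⟩
    ∑ (subwords (suc c)) (λ L → Tot c Us″ (λ Bs → ∑ (subwords c) (λ L′ → k ((L ++ U) ∷ (L′ ++ c ∷ hd Us) ∷ Bs))))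
      ≡⟨ ∑-Tot (subwords (suc c)) c Us″ (λ L Bs → ∑ (subwords c) (λ L′ → k ((L ++ U) ∷ (L′ ++ c ∷ hd Us) ∷ Bs))) ⟩
    Tot c Us″ (λ Bs → ∑ (subwords (suc c)) (λ L → ∑ (subwords c) (λ L′ → k ((L ++ U) ∷ (L′ ++ c ∷ hd Us) ∷ Bs))))
      ≡⟨ Tot-zero c Us″ (λ Bs → vf c [] U (hd Us) Bs (sym e) U≫ (dominant-hd dom)) ⟩
    0ℤ ∎
  attach-sum : ∀ Us′ → HeadExtends c Us Us′ →
    ∑ (subwords (suc c)) (λ L → Tot c Us′ (kL L)) ≡ ∑ (attach c U Us′) (λ Vs → Tot c Vs k)
  attach-sum Us′ ext with length (hd Us′) ℕP.≤? length U
  ... | yes le = trans (∑-subwords-suc c (λ L → Tot c Us′ (kL L)))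
    (cong (_+_ (∑ (subwords c) (λ L → Tot c Us′ (kL L))))
      (trans (∑-cong (subwords c) (λ L → Tot-cong c Us′ (λ Bs → cong (λ B → k (B ∷ Bs)) (LP.++-assoc L (c ∷ []) U))))
             (sym (ℤP.+-identityʳ _))))
  ... | no ¬le = violated Us′ ext lens ¬le

-- Letters are placed one value at a time, and each step discards the sums at a violation. Once no
-- letter is left, only good tuples remain.
Tot-vanishes : ∀ c {Us} → Dominant c Us → ∀ {k} → ViolationFree k → (∀ {Bs} → Good Bs → k Bs ≡ 0ℤ) → Tot c Us k ≡ 0ℤ
Tot-vanishes zero    {Us} dom {k} vf vanish = trans (Tot₀ Us k) (vanish (dominant⇒good dom))
  where
  Tot₀ : ∀ Us (k : List Word → ℤ) → Tot 0 Us k ≡ k Us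
  Tot₀ []       k = refl
  Tot₀ (U ∷ Us) k = trans (ℤP.+-identityʳ _) (Tot₀ Us (λ Bs → k (U ∷ Bs)))
Tot-vanishes (suc c) {Us} dom vf vanish =
  trans (Tot-step dom vf) (∑-zeroᴬ (All.map (λ p → Tot-vanishes c (proj₁ p) vf vanish) (extend-dominant dom)))

-- Letters of `L` are at most `c` and do not count in the first block; letters of `L′` can only
-- raise the count in the second. The failure at `c` therefore does not depend on the completion.
violation⇒bad : ∀ c pre U U′ post {L L′} → All (_< suc c) L → length U ≡ length U′ → All (c <_) U′ →
  ¬ Good (pre ++ (L ++ U) ∷ (L′ ++ c ∷ U′) ∷ post)
violation⇒bad c (P ∷ pre) U U′ post L< |U| U′> (_ ∷ good) = violation⇒bad c pre U U′ post L< |U| U′> good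
violation⇒bad c [] U U′ post {L} {L′} L< |U| U′> (fits ∷ _) = ℕP.<-irrefl refl (begin-strict
  length U′
    <⟨ ℕP.≤-reflexive (sym (trans (count-true (c ≤ᵇ_) U′ (≤⇒≤ᵇ≡ {c} ℕP.≤-refl)) (cong suc (count-all (c ≤ᵇ_) (All.map (≤⇒≤ᵇ≡ ∘ ℕP.<⇒≤) U′>))))) ⟩
  count (c ≤ᵇ_) (c ∷ U′)
    ≤⟨ ℕP.m≤n+m _ (count (c ≤ᵇ_) L′) ⟩
  count (c ≤ᵇ_) L′ ℕ.+ count (c ≤ᵇ_) (c ∷ U′)
    ≡⟨ sym (count-++ (c ≤ᵇ_) L′ (c ∷ U′)) ⟩
  count (c ≤ᵇ_) (L′ ++ c ∷ U′)
    ≤⟨ All.lookup fits (MP.∈-insert L′) ⟩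
  count (c <ᵇ_) (L ++ U)
    ≡⟨ count-++ (c <ᵇ_) L U ⟩
  count (c <ᵇ_) L ℕ.+ count (c <ᵇ_) U
    ≡⟨ cong (ℕ._+ count (c <ᵇ_) U) (count-none (c <ᵇ_) (All.map (λ l< → ≮⇒<ᵇ≡ (ℕP.≤⇒≯ (ℕP.≤-pred l<))) L<)) ⟩
  count (c <ᵇ_) U
    ≤⟨ count-≤-length (c <ᵇ_) U ⟩
  length U
    ≡⟨ |U| ⟩
  length U′ ∎)
  where open ℕP.≤-Reasoning

onBad : (List Word → ℤ) → List Word → ℤ
onBad k Bs = if does (good? Bs) then 0ℤ else k Bs

onGood : (List Word → ℤ) → List Word → ℤ
onGood k Bs = if does (good? Bs) then k Bs else 0ℤ

onBad-good : ∀ k {Bs} → Good Bs → onBad k Bs ≡ 0ℤ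
onBad-good k {Bs} good with good? Bs
... | yes _    = refl
... | no ¬good = ⊥-elim (¬good good)

onBad-bad : ∀ k {Bs} → ¬ Good Bs → onBad k Bs ≡ k Bs
onBad-bad k {Bs} ¬good with good? Bs
... | yes good = ⊥-elim (¬good good)
... | no _     = refl

onBad-violationFree : ∀ {k} → ViolationFree k → ViolationFree (onBad k)
onBad-violationFree {k} vf c pre U U′ post |U| U> U′> =
  trans (∑-congᴬ (All.map (λ L< → ∑-cong (subwords c) (λ L′ → onBad-bad k (violation⇒bad c pre U U′ post L< |U| U′>)))
          (subwords-bounded (suc c))))
        (vf c pre U U′ post |U| U> U′>)

replicate-dominant : ∀ N m → Dominant N (replicate m [])
replicate-dominant N zero          = []
replicate-dominant N (suc zero)    = cons [] (inj₂ (refl , [])) [] []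
replicate-dominant N (suc (suc m)) = cons [] (inj₂ (refl , [])) [] (replicate-dominant N (suc m))

tuples : ℕ → List ℕ → List (List Word)
tuples N []      = [] ∷ []
tuples N (a ∷ α) = concatMap (λ B → map (B ∷_) (tuples N α)) (incr N a)

∑-tuples : ∀ N a α (k : List Word → ℤ) →
  ∑ (tuples N (a ∷ α)) k ≡ ∑ (incr N a) (λ B → ∑ (tuples N α) (λ Bs → k (B ∷ Bs)))
∑-tuples N a α k = trans (∑-concatMap (λ B → map (B ∷_) (tuples N α)) (incr N a) k)
  (∑-cong (incr N a) (λ B → ∑-map (B ∷_) (tuples N α) k))

tuples-lengths : ∀ N α → All (λ Bs → map length Bs ≡ α) (tuples N α)
tuples-lengths N []      = refl ∷ []
tuples-lengths N (a ∷ α) = All-concatMap (λ B → map (B ∷_) (tuples N α))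
  (All.map (λ |B| → AllP.map⁺ (All.map (cong₂ _∷_ |B|) (tuples-lengths N α))) (incr-length N a))

box : ℕ → ℕ → List (List ℕ)
box N zero    = [] ∷ []
box N (suc m) = concatMap (λ p → map (p ∷_) (box N m)) (upTo (suc N))

Tot-box : ∀ N m k → Tot N (replicate m []) k ≡ ∑ (box N m) (λ α → ∑ (tuples N α) k)
Tot-box N zero    k = sym (trans (ℤP.+-identityʳ _) (ℤP.+-identityʳ _))
Tot-box N (suc m) k = begin
  ∑ (subwords N) (λ L → Tot N (replicate m []) (λ Bs → k ((L ++ []) ∷ Bs)))
    ≡⟨ ∑-subwords N N ℕP.≤-refl _ ⟩
  ∑ (upTo (suc N)) (λ p → ∑ (incr N p) (λ L → Tot N (replicate m []) (λ Bs → k ((L ++ []) ∷ Bs))))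
    ≡⟨ ∑-cong (upTo (suc N)) (λ p → trans (∑-cong (incr N p) (λ L →
         trans (Tot-cong N (replicate m []) (λ Bs → cong (λ B → k (B ∷ Bs)) (LP.++-identityʳ L))) (Tot-box N m (λ Bs → k (L ∷ Bs)))))
         (∑-swap (incr N p) (box N m) (λ L α → ∑ (tuples N α) (λ Bs → k (L ∷ Bs))))) ⟩
  ∑ (upTo (suc N)) (λ p → ∑ (box N m) (λ α → ∑ (incr N p) (λ L → ∑ (tuples N α) (λ Bs → k (L ∷ Bs)))))
    ≡⟨ ∑-cong (upTo (suc N)) (λ p → ∑-cong (box N m) (λ α → sym (∑-tuples N p α k))) ⟩
  ∑ (upTo (suc N)) (λ p → ∑ (box N m) (λ α → ∑ (tuples N (p ∷ α)) k))
    ≡⟨ sym (trans (∑-concatMap (λ p → map (p ∷_) (box N m)) (upTo (suc N)) (λ α → ∑ (tuples N α) k))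
         (∑-cong (upTo (suc N)) (λ p → ∑-map (p ∷_) (box N m) (λ α → ∑ (tuples N α) k)))) ⟩
  ∑ (box N (suc m)) (λ α → ∑ (tuples N α) k) ∎
  where open ≡-Reasoning

-- Restricting the weight to bad tuples leaves the cancelling sums intact, since every term in them
-- is bad, and it makes the weight 0 on the good tuples that survive the placement.
bad-cancel : ∀ {f g} → Switchboard f → Alternating g → ∀ N m →
  ∑ (box N m) (λ α → ∑ (tuples N α) (onBad (f ∘ concat)) * g α) ≡ 0ℤ
bad-cancel {f} {g} S alt N m = begin
  ∑ (box N m) (λ α → ∑ (tuples N α) (onBad (f ∘ concat)) * g α)
    ≡⟨ ∑-cong (box N m) (λ α → trans (sym (∑-*ʳ (tuples N α) (g α) (onBad (f ∘ concat))))
         (∑-congᴬ (All.map (λ {Bs} |Bs| → trans (cong (λ β → onBad (f ∘ concat) Bs * g β) (sym |Bs|)) (pull Bs)) (tuples-lengths N α)))) ⟩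
  ∑ (box N m) (λ α → ∑ (tuples N α) (onBad (weigh f g)))
    ≡⟨ sym (Tot-box N m (onBad (weigh f g))) ⟩
  Tot N (replicate m []) (onBad (weigh f g))
    ≡⟨ Tot-vanishes N (replicate-dominant N m) (onBad-violationFree {weigh f g} (weigh-violationFree {f} {g} S alt)) (onBad-good (weigh f g)) ⟩
  0ℤ ∎
  where
  open ≡-Reasoning
  pull : ∀ Bs → onBad (f ∘ concat) Bs * g (map length Bs) ≡ onBad (weigh f g) Bs
  pull Bs with good? Bs
  ... | yes _ = refl
  ... | no _  = refl

-- Alternants

sorted-↭⇒≡ : {A : Set} {R : A → A → Set} → (∀ {x y} → R x y → ¬ R y x) → ∀ {xs ys} →
  AllPairs R xs → AllPairs R ys → xs ↭ ys → xs ≡ ys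
sorted-↭⇒≡ asym []         qs p = sym (PP.↭-empty-inv (↭-sym p))
sorted-↭⇒≡ asym (_ ∷ _)    [] p = ⊥-elim (PP.¬x∷xs↭[] p)
sorted-↭⇒≡ asym {x ∷ xs} {y ∷ ys} (rx ∷ ps) (ry ∷ qs) p
  with PP.∈-resp-↭ p (here refl) | PP.∈-resp-↭ (↭-sym p) (here refl)
... | here refl | _         = cong (x ∷_) (sorted-↭⇒≡ asym ps qs (PP.drop-∷ p))
... | there _   | here refl = cong (x ∷_) (sorted-↭⇒≡ asym ps qs (PP.drop-∷ p))
... | there x∈  | there y∈  = ⊥-elim (asym (All.lookup rx y∈) (All.lookup ry x∈))

_↭?_ : (xs ys : List ℕ) → Dec (xs ↭ ys)
[]       ↭? []       = yes ↭-refl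
[]       ↭? (y ∷ ys) = no (PP.¬x∷xs↭[] ∘ ↭-sym)
(x ∷ xs) ↭? ys with x ∈ℕ? ys
... | no x∉ = no (λ p → x∉ (PP.∈-resp-↭ p (here refl)))
... | yes x∈ with MP.∈-∃++ x∈
...   | ys₁ , ys₂ , refl with xs ↭? (ys₁ ++ ys₂)
...     | yes p = yes (↭-trans (Perm.prep x p) (↭-sym (PP.shift x ys₁ ys₂)))
...     | no ¬p = no (λ p → ¬p (PP.drop-mid [] ys₁ p))

norm : List ℕ → ℕ
norm α = sum (map (λ a → a ℕ.* a) α)

norm-↭ : ∀ {α β} → α ↭ β → norm α ≡ norm β
norm-↭ p = sum-↭ (PP.map⁺ (λ a → a ℕ.* a) p)

norm-≤ : ∀ {N α} → All (_≤ N) α → norm α ≤ length α ℕ.* (N ℕ.* N)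
norm-≤ []         = z≤n
norm-≤ (a≤N ∷ as) = ℕP.+-mono-≤ (ℕP.*-mono-≤ a≤N a≤N) (norm-≤ as)

norm-++ : ∀ α β → norm (α ++ β) ≡ norm α ℕ.+ norm β
norm-++ α β = trans (cong sum (LP.map-++ (λ a → a ℕ.* a) α β)) (sum-++ (map (λ a → a ℕ.* a) α) _)

Descending : List ℕ → Set
Descending = AllPairs _≥_

insertDesc : ∀ a {α} → Descending α → ∃ λ β → β ↭ a ∷ α × Descending β
insertDesc a []               = a ∷ [] , ↭-refl , [] ∷ []
insertDesc a {b ∷ α} (b≥ ∷ d) with ℕP.≤-total b a
... | inj₁ b≤a = a ∷ b ∷ α , ↭-refl , (b≤a ∷ All.map (λ le → ℕP.≤-trans le b≤a) b≥) ∷ b≥ ∷ d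
... | inj₂ a≤b with insertDesc a d
...   | β , p , dβ = b ∷ β , ↭-trans (Perm.prep b p) (Perm.swap b a ↭-refl) ,
                     PP.All-resp-↭ (↭-sym p) (a≤b ∷ b≥) ∷ dβ

sortDesc : ∀ α → ∃ λ β → β ↭ α × Descending β
sortDesc []      = [] , ↭-refl , []
sortDesc (a ∷ α) with sortDesc α
... | β , p , d with insertDesc a d
...   | γ , q , d′ = γ , ↭-trans q (Perm.prep a p) , d′

-- α + (m - 1, ..., 1, 0) for α of length m, the exponents in an alternant.
stair : List ℕ → List ℕ
stair []      = []
stair (a ∷ α) = a ℕ.+ length α ∷ stair α

stair-++ : ∀ (xs zs : List ℕ) → ∃ λ ys → ∀ zs′ → length zs′ ≡ length zs → stair (xs ++ zs′) ≡ ys ++ stair zs′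
stair-++ []       zs = [] , λ _ _ → refl
stair-++ (x ∷ xs) zs with stair-++ xs zs
... | ys , eq = x ℕ.+ length (xs ++ zs) ∷ ys , λ zs′ len →
  cong₂ _∷_ (cong (x ℕ.+_) (trans (LP.length-++ xs) (trans (cong (length xs ℕ.+_) len) (sym (LP.length-++ xs))))) (eq zs′ len)

stair-injective : ∀ α β → stair α ≡ stair β → α ≡ β
stair-injective []      []      eq = refl
stair-injective (a ∷ α) (b ∷ β) eq with LP.∷-injective eq
... | h , t with stair-injective α β t
...   | refl = cong (_∷ α) (ℕP.+-cancelʳ-≡ (length α) a b h)

stair-< : ∀ {b α} → All (_≤ b) α → All (_< b ℕ.+ length α) (stair α)
stair-< []                        = []
stair-< {b} (_∷_ {a} {α} a≤b as) =
  ℕP.≤-<-trans (ℕP.+-monoˡ-≤ (length α) a≤b) (ℕP.+-monoʳ-< b (ℕP.n<1+n _)) ∷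
  All.map (λ lt → ℕP.<-trans lt (ℕP.+-monoʳ-< b (ℕP.n<1+n _))) (stair-< as)

stair-strict : ∀ {α} → Descending α → AllPairs ℕ._>_ (stair α)
stair-strict []       = []
stair-strict (b≥ ∷ d) = stair-< b≥ ∷ stair-strict d

signum : ℕ → ℕ → ℤ
signum zero    zero    = 0ℤ
signum zero    (suc y) = -1ℤ
signum (suc x) zero    = 1ℤ
signum (suc x) (suc y) = signum x y

signum-anti : ∀ x y → signum x y ≡ - signum y x
signum-anti zero    zero    = refl
signum-anti zero    (suc y) = refl
signum-anti (suc x) zero    = refl
signum-anti (suc x) (suc y) = signum-anti x y

signum-> : ∀ {x y} → x ℕ.> y → signum x y ≡ 1ℤ
signum-> {suc x} {zero}  _       = refl
signum-> {suc x} {suc y} (s≤s p) = signum-> p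

signs : ℕ → List ℕ → ℤ
signs x []       = 1ℤ
signs x (y ∷ ys) = signum x y * signs x ys

signs-↭ : ∀ x {xs ys} → xs ↭ ys → signs x xs ≡ signs x ys
signs-↭ x Perm.refl         = refl
signs-↭ x (Perm.prep y p)   = cong (signum x y *_) (signs-↭ x p)
signs-↭ x (Perm.swap {xs} {ys} y z p) =
  trans (rearrange (signum x y) (signum x z) (signs x xs)) (cong (λ s → signum x z * (signum x y * s)) (signs-↭ x p))
  where
  rearrange : ∀ a b c → a * (b * c) ≡ b * (a * c)
  rearrange = solve-∀
signs-↭ x (Perm.trans p q)  = trans (signs-↭ x p) (signs-↭ x q)

-- The product of the signs of all differences: the sign of the permutation that sorts the list into
-- decreasing order, and 0 if an entry is repeated.
vandermonde : List ℕ → ℤ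
vandermonde []       = 1ℤ
vandermonde (x ∷ xs) = signs x xs * vandermonde xs

vandermonde-swap : ∀ xs a b ys → vandermonde (xs ++ a ∷ b ∷ ys) ≡ - vandermonde (xs ++ b ∷ a ∷ ys)
vandermonde-swap (x ∷ xs) a b ys =
  trans (cong₂ _*_ (signs-↭ x (PP.++⁺ˡ xs (Perm.swap a b ↭-refl))) (vandermonde-swap xs a b ys))
        (sym (ℤP.neg-distribʳ-* (signs x (xs ++ b ∷ a ∷ ys)) _))
vandermonde-swap [] a b ys = trans (cong (λ s → (s * signs a ys) * (signs b ys * vandermonde ys)) (signum-anti a b))
  (rearrange (signum b a) (signs a ys) (signs b ys) (vandermonde ys))
  where
  rearrange : ∀ s p q v → ((- s) * p) * (q * v) ≡ - ((s * q) * (p * v))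
  rearrange = solve-∀

vandermonde-strict : ∀ {xs} → AllPairs ℕ._>_ xs → vandermonde xs ≡ 1ℤ
vandermonde-strict []       = refl
vandermonde-strict (x> ∷ d) = cong₂ _*_ (signs-1 x>) (vandermonde-strict d)
  where
  signs-1 : ∀ {x xs} → All (x ℕ.>_) xs → signs x xs ≡ 1ℤ
  signs-1 []       = refl
  signs-1 (p ∷ ps) = cong₂ _*_ (signum-> p) (signs-1 ps)

-- The coefficients of the antisymmetric polynomial with exponents `stair μ`, moved back by the
-- staircase so that they can be paired with monomial coefficients.
alternant : List ℕ → List ℕ → ℤ
alternant μ β = ind (stair β ↭? stair μ) * vandermonde (stair β)

alternant-alternating : ∀ μ → Alternating (alternant μ)
alternant-alternating μ xs p q ys with stair-++ xs (p ∷ suc q ∷ ys)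
... | zs , eq = trans (cong₂ _*_
        (ind-iff (stair β ↭? stair μ) (stair β′ ↭? stair μ) (↭-trans (↭-sym swapped)) (↭-trans swapped))
        (trans (cong vandermonde β≡) (trans (vandermonde-swap zs _ _ _) (cong -_ (cong vandermonde (sym β′≡))))))
      (sym (ℤP.neg-distribʳ-* (ind (stair β′ ↭? stair μ)) (vandermonde (stair β′))))
  where
  β = xs ++ p ∷ suc q ∷ ys
  β′ = xs ++ q ∷ suc p ∷ ys
  l = length ys
  β≡ : stair β ≡ zs ++ (p ℕ.+ suc l) ∷ (suc q ℕ.+ l) ∷ stair ys
  β≡ = eq (p ∷ suc q ∷ ys) refl
  β′≡ : stair β′ ≡ zs ++ (suc q ℕ.+ l) ∷ (p ℕ.+ suc l) ∷ stair ys
  β′≡ = trans (eq (q ∷ suc p ∷ ys) refl) (cong₂ (λ a b → zs ++ a ∷ b ∷ stair ys) (ℕP.+-suc q l) (sym (ℕP.+-suc p l)))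
  swapped : stair β ↭ stair β′
  swapped = subst₂ _↭_ (sym β≡) (sym β′≡) (PP.++⁺ˡ zs (Perm.swap _ _ ↭-refl))

alternant-diag : ∀ {μ} → Descending μ → alternant μ μ ≡ 1ℤ
alternant-diag {μ} d = cong₂ _*_ (ind-yes (stair μ ↭? stair μ) ↭-refl) (vandermonde-strict (stair-strict d))

ascent? : ∀ β → Descending β ⊎ (∃ λ xs → ∃ λ p → ∃ λ q → ∃ λ ys → (β ≡ xs ++ p ∷ suc q ∷ ys) × p ≤ q)
ascent? []          = inj₁ []
ascent? (a ∷ [])    = inj₁ ([] ∷ [])
ascent? (a ∷ b ∷ β) with ascent? (b ∷ β)
... | inj₂ (xs , p , q , ys , eq , p≤q) = inj₂ (a ∷ xs , p , q , ys , cong (a ∷_) eq , p≤q)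
... | inj₁ (b≥ ∷ d) with b ℕP.≤? a
...   | yes b≤a = inj₁ ((b≤a ∷ All.map (λ le → ℕP.≤-trans le b≤a) b≥) ∷ b≥ ∷ d)
...   | no  b≰a with b | ℕP.≰⇒> b≰a
...     | suc b′ | s≤s a≤b′ = inj₂ ([] , a , b′ , β , refl , a≤b′)

-- The two norms differ by 2(q - p).
norm-straighten : ∀ xs ys {p q} → p < q → norm (xs ++ q ∷ suc p ∷ ys) < norm (xs ++ p ∷ suc q ∷ ys)
norm-straighten xs ys {p} {q} p<q = subst₂ _<_ (sym (norm-++ xs _)) (sym (norm-++ xs _)) (ℕP.+-monoʳ-< (norm xs) (begin-strict
  q ℕ.* q ℕ.+ (suc p ℕ.* suc p ℕ.+ n)
    ≡⟨ left p q n ⟩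
  (p ℕ.+ p) ℕ.+ (p ℕ.* p ℕ.+ (q ℕ.* q ℕ.+ suc n))
    <⟨ ℕP.+-monoˡ-< _ (ℕP.+-mono-< p<q p<q) ⟩
  (q ℕ.+ q) ℕ.+ (p ℕ.* p ℕ.+ (q ℕ.* q ℕ.+ suc n))
    ≡⟨ right p q n ⟩
  p ℕ.* p ℕ.+ (suc q ℕ.* suc q ℕ.+ n) ∎))
  where
  open ℕP.≤-Reasoning
  n = norm ys
  left : ∀ p q n → q ℕ.* q ℕ.+ (suc p ℕ.* suc p ℕ.+ n) ≡ (p ℕ.+ p) ℕ.+ (p ℕ.* p ℕ.+ (q ℕ.* q ℕ.+ suc n))
  left = ℕSolver.solve-∀
  right : ∀ p q n → (q ℕ.+ q) ℕ.+ (p ℕ.* p ℕ.+ (q ℕ.* q ℕ.+ suc n)) ≡ p ℕ.* p ℕ.+ (suc q ℕ.* suc q ℕ.+ n)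
  right = ℕSolver.solve-∀

-- Straightening β to a partition decreases the norm, so μ has the least norm in the support of its alternant.
alternant-support : ∀ {μ} → Descending μ → ∀ n β → norm β ≤ n → alternant μ β ≢ 0ℤ → (β ≡ μ) ⊎ (norm μ < norm β)
alternant-support {μ} dμ n β β≤n nz with ascent? β
... | inj₁ dβ = inj₁ (stair-injective β μ (sorted-↭⇒≡ (λ x>y y>x → ℕP.<-asym x>y y>x) (stair-strict dβ) (stair-strict dμ) perm))
  where
  perm : stair β ↭ stair μ
  perm with stair β ↭? stair μ
  ... | yes p = p
  ... | no ¬p = ⊥-elim (nz refl)
... | inj₂ (xs , p , q , ys , refl , p≤q) with ℕP.m≤n⇒m<n∨m≡n p≤q
...   | inj₂ refl = ⊥-elim (nz (x≡-x⇒x≡0 (alternant-alternating μ xs p q ys)))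
...   | inj₁ p<q  = inj₂ (descend n β≤n)
  where
  smaller = norm-straighten xs ys p<q
  nz′ : alternant μ (xs ++ q ∷ suc p ∷ ys) ≢ 0ℤ
  nz′ eq = nz (trans (alternant-alternating μ xs p q ys) (cong -_ eq))
  descend : ∀ n → norm (xs ++ p ∷ suc q ∷ ys) ≤ n → norm μ < norm (xs ++ p ∷ suc q ∷ ys)
  descend zero    le = ⊥-elim (ℕP.n≮0 (ℕP.<-≤-trans smaller le))
  descend (suc n) le with alternant-support dμ n (xs ++ q ∷ suc p ∷ ys) (ℕP.≤-pred (ℕP.<-≤-trans smaller le)) nz′
  ... | inj₁ eq = subst (λ γ → norm γ < norm (xs ++ p ∷ suc q ∷ ys)) eq smaller
  ... | inj₂ lt = ℕP.<-trans lt smaller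

-- Monomial coefficients of a functional, and when they vanish

coefficient : ℕ → (Word → ℤ) → List ℕ → ℤ
coefficient N F α = ∑ (tuples N α) (F ∘ concat)

coefficient-↭ : ∀ N {F} → Switchboard F → ∀ {α β} → α ↭ β → coefficient N F α ≡ coefficient N F β
coefficient-↭ N S Perm.refl = refl
coefficient-↭ N {F} S (Perm.prep {xs} {ys} a p) =
  trans (∑-tuples N a xs (F ∘ concat))
    (trans (∑-cong (incr N a) (λ B → coefficient-↭ N (underˡ B S) p)) (sym (∑-tuples N a ys (F ∘ concat))))
coefficient-↭ N S (Perm.trans p q) = trans (coefficient-↭ N S p) (coefficient-↭ N S q)
coefficient-↭ N {F} S (Perm.swap {xs} {ys} a b p) = begin
  coefficient N F (a ∷ b ∷ xs)
    ≡⟨ expand a b xs ⟩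
  ∑ (tuples N xs) (λ Bs → ∑∑ (incr N a) (incr N b) (λ u → F (u ++ concat Bs)))
    ≡⟨ ∑-cong (tuples N xs) (λ Bs → incr-comm N (underʳ (concat Bs) S) a b) ⟩
  ∑ (tuples N xs) (λ Bs → ∑∑ (incr N b) (incr N a) (λ u → F (u ++ concat Bs)))
    ≡⟨ sym (expand b a xs) ⟩
  coefficient N F (b ∷ a ∷ xs)
    ≡⟨ expand′ b a xs ⟩
  ∑ (incr N b) (λ V → ∑ (incr N a) (λ L → coefficient N (λ w → F (V ++ L ++ w)) xs))
    ≡⟨ ∑-cong (incr N b) (λ V → ∑-cong (incr N a) (λ L → coefficient-↭ N (underˡ L (underˡ V S)) p)) ⟩
  ∑ (incr N b) (λ V → ∑ (incr N a) (λ L → coefficient N (λ w → F (V ++ L ++ w)) ys))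
    ≡⟨ sym (expand′ b a ys) ⟩
  coefficient N F (b ∷ a ∷ ys) ∎
  where
  open ≡-Reasoning
  expand′ : ∀ a b xs → coefficient N F (a ∷ b ∷ xs)
    ≡ ∑ (incr N a) (λ V → ∑ (incr N b) (λ L → coefficient N (λ w → F (V ++ L ++ w)) xs))
  expand′ a b xs = trans (∑-tuples N a (b ∷ xs) (F ∘ concat))
    (∑-cong (incr N a) (λ V → ∑-tuples N b xs (λ Bs → F (V ++ concat Bs))))
  expand : ∀ a b xs → coefficient N F (a ∷ b ∷ xs)
    ≡ ∑ (tuples N xs) (λ Bs → ∑∑ (incr N a) (incr N b) (λ u → F (u ++ concat Bs)))
  expand a b xs = trans (expand′ a b xs)
    (trans (∑-cong (incr N a) (λ V → ∑-swap (incr N b) (tuples N xs) (λ L Bs → F (V ++ L ++ concat Bs))))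
    (trans (∑-swap (incr N a) (tuples N xs) (λ V Bs → ∑ (incr N b) (λ L → F (V ++ L ++ concat Bs))))
    (∑-cong (tuples N xs) (λ Bs → ∑-cong (incr N a) (λ V → ∑-cong (incr N b) (λ L →
      cong F (sym (LP.++-assoc V L (concat Bs)))))))))

incr-empty : ∀ c p → c < p → incr c p ≡ []
incr-empty zero    (suc p) _       = refl
incr-empty (suc c) (suc p) (s≤s lt) = cong₂ (λ xs ys → xs ++ map (_∷ʳ c) ys)
  (incr-empty c (suc p) (ℕP.m<n⇒m<1+n lt)) (incr-empty c p lt)

∑-tuples-large : ∀ N {α} k → ¬ All (_≤ N) α → ∑ (tuples N α) k ≡ 0ℤ
∑-tuples-large N {[]}    k ¬le = ⊥-elim (¬le [])
∑-tuples-large N {a ∷ α} k ¬le with a ℕP.≤? N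
... | no a≰N  = trans (∑-tuples N a α k)
  (cong (λ Bs → ∑ Bs (λ B → ∑ (tuples N α) (λ Bs → k (B ∷ Bs)))) (incr-empty N a (ℕP.≰⇒> a≰N)))
... | yes a≤N = trans (∑-tuples N a α k) (∑-zero (incr N a) (λ B → ∑-tuples-large N (λ Bs → k (B ∷ Bs)) (λ les → ¬le (a≤N ∷ les))))

unique-concatMap : {A B : Set} (h : A → List B) {xs : List A} → Unique xs → (∀ {x} → x ∈ xs → Unique (h x)) →
  (∀ {x y b} → x ∈ xs → y ∈ xs → b ∈ h x → b ∈ h y → x ≡ y) → Unique (concatMap h xs)
unique-concatMap h []           uh inj = []
unique-concatMap h {x ∷ xs} (x∉ ∷ u) uh inj =
  UP.++⁺ (uh (here refl)) (unique-concatMap h u (uh ∘ there) (λ p q → inj (there p) (there q))) disjoint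
  where
  disjoint : ∀ {b} → ¬ (b ∈ h x × b ∈ concatMap h xs)
  disjoint (b∈ , b∈′) with find (MP.∈-concatMap⁻ h b∈′)
  ... | y , y∈ , b∈y = All.lookup x∉ y∈ (inj (here refl) (there y∈) b∈ b∈y)

∈-map-∷ : {A : Set} {x : A} {y : List A} {xss : List (List A)} → y ∈ map (x ∷_) xss → ∃ λ ys → y ≡ x ∷ ys × ys ∈ xss
∈-map-∷ y∈ with MP.∈-map⁻ _ y∈
... | ys , ys∈ , eq = ys , eq , ys∈

box-unique : ∀ N m → Unique (box N m)
box-unique N zero    = [] ∷ []
box-unique N (suc m) = unique-concatMap (λ p → map (p ∷_) (box N m)) (UP.upTo⁺ (suc N))
  (λ _ → UP.map⁺ LP.∷-injectiveʳ (box-unique N m)) (λ _ _ → same)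
  where
  same : ∀ {p q α} → α ∈ map (p ∷_) (box N m) → α ∈ map (q ∷_) (box N m) → p ≡ q
  same α∈ α∈′ with ∈-map-∷ α∈ | ∈-map-∷ α∈′
  ... | _ , refl , _ | _ , refl , _ = refl

∈-box : ∀ {N m α} → length α ≡ m → All (_≤ N) α → α ∈ box N m
∈-box {m = zero}  {[]}    refl []            = here refl
∈-box {N} {suc m} {a ∷ α} refl (a≤N ∷ les) =
  MP.∈-concatMap⁺ (λ p → map (p ∷_) (box N m)) (lose (MP.∈-upTo⁺ (s≤s a≤N)) (MP.∈-map⁺ (a ∷_) (∈-box refl les)))

box-length : ∀ N m → All (λ α → length α ≡ m) (box N m)
box-length N zero    = refl ∷ []
box-length N (suc m) = All-concatMap (λ p → map (p ∷_) (box N m))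
  (All.universal (λ p → AllP.map⁺ (All.map (cong suc) (box-length N m))) (upTo (suc N)))

onGood+onBad : ∀ k Bs → k Bs ≡ onGood k Bs + onBad k Bs
onGood+onBad k Bs with good? Bs
... | yes _ = sym (ℤP.+-identityʳ (k Bs))
... | no _  = sym (ℤP.+-identityˡ (k Bs))

goodCoefficient : ℕ → (Word → ℤ) → List ℕ → ℤ
goodCoefficient N F α = ∑ (tuples N α) (onGood (F ∘ concat))

-- Downward induction on the norm. Pairing with the alternant of a partition μ gives the coefficient
-- at μ plus multiples of coefficients of larger norm, which vanish already. The induction starts
-- above m N², where some part exceeds `N` and no increasing word of that length exists.
coefficient-vanishes : ∀ {F} → Switchboard F → ∀ N m → (∀ α → length α ≡ m → goodCoefficient N F α ≡ 0ℤ) →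
  ∀ α → length α ≡ m → coefficient N F α ≡ 0ℤ
coefficient-vanishes {F} S N m good≡0 α |α| = go (suc (m ℕ.* (N ℕ.* N))) α |α| (ℕP.m≤n+m _ (norm α))
  where
  open ≡-Reasoning
  pairing : ∀ {g} → Alternating g → ∑ (box N m) (λ β → coefficient N F β * g β) ≡ 0ℤ
  pairing {g} alt = trans (∑-congᴬ (All.map (λ {β} |β| → cong (_* g β) (begin
      coefficient N F β
        ≡⟨ ∑-cong (tuples N β) (onGood+onBad (F ∘ concat)) ⟩
      ∑ (tuples N β) (λ Bs → onGood (F ∘ concat) Bs + onBad (F ∘ concat) Bs)
        ≡⟨ ∑-+ (tuples N β) (onGood (F ∘ concat)) (onBad (F ∘ concat)) ⟩
      goodCoefficient N F β + ∑ (tuples N β) (onBad (F ∘ concat))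
        ≡⟨ cong (_+ ∑ (tuples N β) (onBad (F ∘ concat))) (good≡0 β |β|) ⟩
      0ℤ + ∑ (tuples N β) (onBad (F ∘ concat))
        ≡⟨ ℤP.+-identityˡ _ ⟩
      ∑ (tuples N β) (onBad (F ∘ concat)) ∎)) (box-length N m)))
    (bad-cancel {F} {g} S alt N m)

  go : ∀ t α → length α ≡ m → suc (m ℕ.* (N ℕ.* N)) ≤ norm α ℕ.+ t → coefficient N F α ≡ 0ℤ
  go zero α |α| big = ∑-tuples-large N {α} (F ∘ concat) (λ les → ℕP.<-irrefl refl (ℕP.<-≤-trans
    (subst (suc (m ℕ.* (N ℕ.* N)) ≤_) (ℕP.+-identityʳ _) big)
    (subst (λ l → norm α ≤ l ℕ.* (N ℕ.* N)) |α| (norm-≤ {N} {α} les))))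
  go (suc t) α |α| big with sortDesc α
  ... | μ , μ↭α , dμ with All.all? (ℕP._≤? N) μ
  ...   | no ¬le = trans (sym (coefficient-↭ N S μ↭α)) (∑-tuples-large N (F ∘ concat) ¬le)
  ...   | yes les = begin
    coefficient N F α
      ≡⟨ sym (coefficient-↭ N S μ↭α) ⟩
    coefficient N F μ
      ≡⟨ sym (ℤP.*-identityʳ _) ⟩
    coefficient N F μ * 1ℤ
      ≡⟨ cong (coefficient N F μ *_) (sym (alternant-diag dμ)) ⟩
    coefficient N F μ * alternant μ μ
      ≡⟨ sym (∑-single (λ β → coefficient N F β * alternant μ β) (box-unique N m) (∈-box |μ| les) others) ⟩
    ∑ (box N m) (λ β → coefficient N F β * alternant μ β)
      ≡⟨ pairing {alternant μ} (alternant-alternating μ) ⟩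
    0ℤ ∎
    where
    |μ| : length μ ≡ m
    |μ| = trans (PP.↭-length μ↭α) |α|
    others : ∀ {β} → β ∈ box N m → β ≢ μ → coefficient N F β * alternant μ β ≡ 0ℤ
    others {β} β∈ β≢μ with alternant μ β ℤP.≟ 0ℤ
    ... | yes eq = trans (cong (coefficient N F β *_) eq) (ℤP.*-zeroʳ (coefficient N F β))
    ... | no nz with alternant-support dμ (norm β) β ℕP.≤-refl nz
    ...   | inj₁ eq = ⊥-elim (β≢μ eq)
    ...   | inj₂ lt = cong (_* alternant μ β) (go t β (All.lookup (box-length N m) β∈)
      (ℕP.≤-trans big (subst (λ n → n ℕ.+ suc t ≤ norm β ℕ.+ t) (norm-↭ μ↭α)
        (subst (_≤ norm β ℕ.+ t) (sym (ℕP.+-suc (norm μ) t)) (ℕP.+-monoˡ-≤ t lt)))))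

-- Orderings of a finite poset

insertEverywhere⁻ : {A : Set} (x : A) (ys : List A) {zs : List A} → zs ∈ insertEverywhere x ys →
  ∃ λ X → ∃ λ Y → ys ≡ X ++ Y × zs ≡ X ++ x ∷ Y
insertEverywhere⁻ x []       (here refl) = [] , [] , refl , refl
insertEverywhere⁻ x (y ∷ ys) (here refl) = [] , y ∷ ys , refl , refl
insertEverywhere⁻ x (y ∷ ys) (there zs∈) with ∈-map-∷ zs∈
... | zs′ , refl , zs′∈ with insertEverywhere⁻ x ys zs′∈
...   | X , Y , refl , refl = y ∷ X , Y , refl , refl

insertEverywhere⁺ : {A : Set} (x : A) (X Y : List A) → X ++ x ∷ Y ∈ insertEverywhere x (X ++ Y)
insertEverywhere⁺ x []      []      = here refl
insertEverywhere⁺ x []      (y ∷ Y) = here refl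
insertEverywhere⁺ x (y ∷ X) Y       = there (MP.∈-map⁺ (y ∷_) (insertEverywhere⁺ x X Y))

perms⇒↭ : {A : Set} (xs : List A) {o : List A} → o ∈ perms xs → o ↭ xs
perms⇒↭ []       (here refl) = ↭-refl
perms⇒↭ (x ∷ xs) o∈ with find (MP.∈-concatMap⁻ (insertEverywhere x) {xs = perms xs} o∈)
... | ys , ys∈ , o∈ys with insertEverywhere⁻ x ys o∈ys
...   | X , Y , refl , refl = ↭-trans (PP.shift x X Y) (Perm.prep x (perms⇒↭ xs ys∈))

↭⇒perms : {A : Set} (xs : List A) {o : List A} → o ↭ xs → o ∈ perms xs
↭⇒perms []       p with PP.↭-empty-inv p
... | refl = here refl
↭⇒perms (x ∷ xs) p with MP.∈-∃++ (PP.∈-resp-↭ (↭-sym p) (here refl))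
... | X , Y , refl = MP.∈-concatMap⁺ (insertEverywhere x)
  (lose (↭⇒perms xs (PP.drop-mid X [] p)) (insertEverywhere⁺ x X Y))

unique-↭ : {A : Set} {xs ys : List A} → xs ↭ ys → Unique xs → Unique ys
unique-↭ Perm.refl         u                        = u
unique-↭ (Perm.prep x p)   (x∉ ∷ u)                 = PP.All-resp-↭ p x∉ ∷ unique-↭ p u
unique-↭ (Perm.swap x y p) ((x≢y ∷ x∉) ∷ (y∉ ∷ u)) =
  ((x≢y ∘ sym) ∷ PP.All-resp-↭ p y∉) ∷ PP.All-resp-↭ p x∉ ∷ unique-↭ p u
unique-↭ (Perm.trans p q)  u                        = unique-↭ q (unique-↭ p u)

split-unique : {A : Set} {x : A} (X X′ : List A) {Y Y′ : List A} → Unique (X ++ x ∷ Y) → X ++ x ∷ Y ≡ X′ ++ x ∷ Y′ → X ≡ X′ × Y ≡ Y′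
split-unique []      []       u       eq = refl , LP.∷-injectiveʳ eq
split-unique []      (z ∷ X′) (x∉ ∷ _) eq with LP.∷-injective eq
... | refl , refl = ⊥-elim (All.lookup x∉ (MP.∈-insert X′) refl)
split-unique (z ∷ X) []       (z∉ ∷ _) eq with LP.∷-injective eq
... | refl , _ = ⊥-elim (All.lookup z∉ (MP.∈-insert X) refl)
split-unique (z ∷ X) (z′ ∷ X′) (_ ∷ u) eq with LP.∷-injective eq
... | refl , eq′ with split-unique X X′ u eq′
...   | refl , refl = refl , refl

perms-unique : {A : Set} {xs : List A} → Unique xs → Unique (perms xs)
perms-unique []                     = [] ∷ []
perms-unique {A} {x ∷ xs} (x∉ ∷ u) = unique-concatMap (insertEverywhere x) (perms-unique u)
  (λ {ys} ys∈ → inserted ys (x∉perm ys∈)) same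
  where
  x∉perm : ∀ {ys} → ys ∈ perms xs → All (x ≢_) ys
  x∉perm ys∈ = PP.All-resp-↭ (↭-sym (perms⇒↭ xs ys∈)) x∉
  inserted : ∀ ys → All (x ≢_) ys → Unique (insertEverywhere x ys)
  inserted []       _          = [] ∷ []
  inserted (y ∷ ys) (x≢y ∷ x∉) =
    AllP.map⁺ (All.universal (λ zs eq → x≢y (LP.∷-injectiveˡ eq)) _) ∷ UP.map⁺ LP.∷-injectiveʳ (inserted ys x∉)
  same : ∀ {ys ys′ zs} → ys ∈ perms xs → ys′ ∈ perms xs → zs ∈ insertEverywhere x ys → zs ∈ insertEverywhere x ys′ → ys ≡ ys′
  same {ys} {ys′} ys∈ _ zs∈ zs∈′ with insertEverywhere⁻ x ys zs∈ | insertEverywhere⁻ x ys′ zs∈′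
  ... | X , Y , refl , refl | X′ , Y′ , refl , eq with split-unique X X′
    (unique-↭ (↭-sym (PP.shift x X Y)) (x∉perm ys∈ ∷ unique-↭ (↭-sym (perms⇒↭ xs ys∈)) u)) eq
  ...   | refl , refl = refl

unique-≈⇒↭ : {A : Set} {xs ys : List A} → Unique xs → Unique ys →
  (∀ {x} → x ∈ xs → x ∈ ys) → (∀ {x} → x ∈ ys → x ∈ xs) → xs ↭ ys
unique-≈⇒↭ {xs = []}     {[]}     _ _ _ _ = ↭-refl
unique-≈⇒↭ {xs = []}     {y ∷ ys} _ _ _ g with g (here refl)
... | ()
unique-≈⇒↭ {xs = x ∷ xs} {ys} (x∉ ∷ u) v f g with MP.∈-∃++ (f (here refl))
... | Y₁ , Y₂ , refl with unique-↭ (PP.shift x Y₁ Y₂) v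
...   | x∉′ ∷ v′ = ↭-trans (Perm.prep x (unique-≈⇒↭ u v′ f′ g′)) (↭-sym (PP.shift x Y₁ Y₂))
  where
  f′ : ∀ {z} → z ∈ xs → z ∈ Y₁ ++ Y₂
  f′ z∈ with PP.∈-resp-↭ (PP.shift x Y₁ Y₂) (f (there z∈))
  ... | here refl = ⊥-elim (All.lookup x∉ z∈ refl)
  ... | there z∈′ = z∈′
  g′ : ∀ {z} → z ∈ Y₁ ++ Y₂ → z ∈ xs
  g′ z∈ with g (PP.∈-resp-↭ (↭-sym (PP.shift x Y₁ Y₂)) (there z∈))
  ... | here refl = ⊥-elim (All.lookup x∉′ z∈ refl)
  ... | there z∈′ = z∈′

swapAt : {A : Set} → ℕ → List A → List A
swapAt zero    (x ∷ y ∷ o) = y ∷ x ∷ o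
swapAt (suc n) (x ∷ o)     = x ∷ swapAt n o
swapAt _       o           = o

swapAt-↭ : {A : Set} (n : ℕ) (o : List A) → swapAt n o ↭ o
swapAt-↭ zero    []          = ↭-refl
swapAt-↭ zero    (x ∷ [])    = ↭-refl
swapAt-↭ zero    (x ∷ y ∷ o) = Perm.swap y x ↭-refl
swapAt-↭ (suc n) []          = ↭-refl
swapAt-↭ (suc n) (x ∷ o)     = Perm.prep x (swapAt-↭ n o)

swapAt-involutive : {A : Set} (n : ℕ) (o : List A) → swapAt n (swapAt n o) ≡ o
swapAt-involutive zero    []          = refl
swapAt-involutive zero    (x ∷ [])    = refl
swapAt-involutive zero    (x ∷ y ∷ o) = refl
swapAt-involutive (suc n) []          = refl
swapAt-involutive (suc n) (x ∷ o)     = cong (x ∷_) (swapAt-involutive n o)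

map-swapAt : {A B : Set} (h : A → B) (n : ℕ) (o : List A) → map h (swapAt n o) ≡ swapAt n (map h o)
map-swapAt h zero    []          = refl
map-swapAt h zero    (x ∷ [])    = refl
map-swapAt h zero    (x ∷ y ∷ o) = refl
map-swapAt h (suc n) []          = refl
map-swapAt h (suc n) (x ∷ o)     = cong (h x ∷_) (map-swapAt h n o)

swapAt-++ : {A : Set} (X : List A) {x y : A} {Y : List A} → swapAt (length X) (X ++ x ∷ y ∷ Y) ≡ X ++ y ∷ x ∷ Y
swapAt-++ []      = refl
swapAt-++ (z ∷ X) = cong (z ∷_) (swapAt-++ X)

∑-perms-swapAt : {A : Set} {C : List A} → Unique C → ∀ n (F : List A → ℤ) → ∑ (perms C) F ≡ ∑ (perms C) (F ∘ swapAt n)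
∑-perms-swapAt {A} {C} u n F = trans (∑-↭ F (↭-sym same)) (∑-map (swapAt n) (perms C) F)
  where
  closed : ∀ {o} → o ∈ perms C → swapAt n o ∈ perms C
  closed o∈ = ↭⇒perms C (↭-trans (swapAt-↭ n _) (perms⇒↭ C o∈))
  same : map (swapAt n) (perms C) ↭ perms C
  same = unique-≈⇒↭ (UP.map⁺ (λ {x} {y} eq → trans (sym (swapAt-involutive n x)) (trans (cong (swapAt n) eq) (swapAt-involutive n y))) (perms-unique u))
    (perms-unique u)
    (λ z∈ → let (o , o∈ , eq) = MP.∈-map⁻ (swapAt n) z∈ in subst (_∈ perms C) (sym eq) (closed o∈))
    (λ {z} z∈ → subst (_∈ map (swapAt n) (perms C)) (swapAt-involutive n z) (MP.∈-map⁺ (swapAt n) (closed z∈)))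

map-split : {A B : Set} (h : A → B) (o : List A) (X : List B) {Y : List B} → map h o ≡ X ++ Y →
  ∃ λ o₁ → ∃ λ o₂ → o ≡ o₁ ++ o₂ × map h o₁ ≡ X × map h o₂ ≡ Y
map-split h o       []      eq = [] , o , refl , refl , eq
map-split h (x ∷ o) (z ∷ X) eq with LP.∷-injective eq
... | refl , eq′ with map-split h o X eq′
...   | o₁ , o₂ , refl , refl , refl = x ∷ o₁ , o₂ , refl , refl , refl

_≟ʷ_ : (v w : Word) → Dec (v ≡ w)
_≟ʷ_ = LP.≡-dec ℕ._≟_

-- A finite poset with letters idx and inversion weights; a standard ordering lists the poset
-- along a linear extension (the entry of a cell is its position in the list).
record Poset : Set₁ where
  infix 4 _≺_
  field
    A        : Set
    C        : List A
    C-unique : Unique C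
    _≺_      : A → A → Set
    _≺?_     : ∀ x y → Dec (x ≺ y)
    ≺-irrefl : ∀ {x} → ¬ x ≺ x
    ≺-trans  : ∀ {x y z} → x ≺ y → y ≺ z → x ≺ z
    idx      : A → ℕ
    w        : A → A → ℕ

  Standard : List A → Set
  Standard = AllPairs (λ x y → ¬ y ≺ x)

  standard? : ∀ o → Dec (Standard o)
  standard? = AllPairs.allPairs? (λ x y → ¬? (y ≺? x))

  weightAfter : A → List A → ℕ
  weightAfter x []      = 0
  weightAfter x (y ∷ o) = w x y ℕ.+ weightAfter x o

  inv : List A → ℕ
  inv []      = 0
  inv (x ∷ o) = weightAfter x o ℕ.+ inv o

  -- `φ` takes the place of the power of `q`; for the LLT polynomial it becomes the indicator of
  -- inversion number `d`.
  words : (ℕ → ℤ) → Word → ℤ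
  words φ v = ∑ (perms C) (λ o → ind (standard? o) * φ (inv o) * ind (map idx o ≟ʷ v))

  NonCover : A → A → Set
  NonCover x y = x ≺ y → ∃ λ z → z ∈ C × x ≺ z × z ≺ y

  SwappableLetters : ℕ → ℕ → ℕ → ℕ → Set
  SwappableLetters i j a b = ∀ {x y} → x ∈ C → y ∈ C → idx x ≡ i → idx y ≡ j →
    NonCover x y × NonCover y x × w x y ≡ a × w y x ≡ b

  -- Every linear extension lists `p`, `r`, `q` in this order. If `p` and `q` carry the same letter,
  -- a larger and a smaller letter are thus forced between the two copies.
  Sandwich : A → A → Set
  Sandwich p q = (∃ λ r → r ∈ C × p ≺ r × r ≺ q × idx p < idx r) × (∃ λ r → r ∈ C × p ≺ r × r ≺ q × idx r < idx p)

record Switchable (P : Poset) : Set where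
  open Poset P
  field
    commute   : ∀ {i j} → 3 ℕ.+ i ≤ j → SwappableLetters i j 0 0
    -- either Knuth relations (the outer letters commute) or the rotations bac = acb, cab = bca
    triple    : ∀ i → SwappableLetters i (suc (suc i)) 0 0 ⊎
                      (SwappableLetters i (suc i) 0 1 × SwappableLetters (suc i) (suc (suc i)) 0 1)
    sandwich  : ∀ {p q} → p ∈ C → q ∈ C → p ≢ q → idx p ≡ idx q → Sandwich p q ⊎ Sandwich q p

module _ (P : Poset) where
  open Poset P

  weightAfter-swap : ∀ z X {x y Y} → weightAfter z (X ++ x ∷ y ∷ Y) ≡ weightAfter z (X ++ y ∷ x ∷ Y)
  weightAfter-swap z []      {x} {y} {Y} = rearrange (w z x) (w z y) (weightAfter z Y)
    where
    rearrange : ∀ a b c → a ℕ.+ (b ℕ.+ c) ≡ b ℕ.+ (a ℕ.+ c)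
    rearrange = ℕSolver.solve-∀
  weightAfter-swap z (u ∷ X) = cong (w z u ℕ.+_) (weightAfter-swap z X)

  inv-swap : ∀ X {x y Y} → ∃ λ n → inv (X ++ x ∷ y ∷ Y) ≡ w x y ℕ.+ n × inv (X ++ y ∷ x ∷ Y) ≡ w y x ℕ.+ n
  inv-swap []      {x} {y} {Y} = weightAfter x Y ℕ.+ (weightAfter y Y ℕ.+ inv Y) , first (w x y) (weightAfter x Y) (weightAfter y Y) (inv Y) , second (w y x) (weightAfter x Y) (weightAfter y Y) (inv Y)
    where
    first : ∀ a b c d → (a ℕ.+ b) ℕ.+ (c ℕ.+ d) ≡ a ℕ.+ (b ℕ.+ (c ℕ.+ d))
    first = ℕSolver.solve-∀
    second : ∀ a b c d → (a ℕ.+ c) ℕ.+ (b ℕ.+ d) ≡ a ℕ.+ (b ℕ.+ (c ℕ.+ d))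
    second = ℕSolver.solve-∀
  inv-swap (z ∷ X) {x} {y} {Y} with inv-swap X {x} {y} {Y}
  ... | n , eq , eq′ = weightAfter z (X ++ x ∷ y ∷ Y) ℕ.+ n ,
    trans (cong (weightAfter z (X ++ x ∷ y ∷ Y) ℕ.+_) eq) (rearrange _ (w x y) n) ,
    trans (cong₂ ℕ._+_ (sym (weightAfter-swap z X)) eq′) (rearrange _ (w y x) n)
    where
    rearrange : ∀ a b c → a ℕ.+ (b ℕ.+ c) ≡ b ℕ.+ (a ℕ.+ c)
    rearrange = ℕSolver.solve-∀

  standard-swap : ∀ X {x y Y} → ¬ x ≺ y → Standard (X ++ x ∷ y ∷ Y) → Standard (X ++ y ∷ x ∷ Y)
  standard-swap []      x⊀y ((_ ∷ px) ∷ py ∷ s) = (x⊀y ∷ py) ∷ px ∷ s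
  standard-swap (z ∷ X) x⊀y (pz ∷ s) =
    PP.All-resp-↭ (PP.++⁺ˡ X (Perm.swap _ _ ↭-refl)) pz ∷ standard-swap X x⊀y s

  standard-between : ∀ X {x y} Y {Z z} → Standard (X ++ x ∷ Y ++ y ∷ Z) → z ∈ X ++ x ∷ Y ++ y ∷ Z →
    x ≺ z → z ≺ y → z ∈ Y
  standard-between (u ∷ X) Y (pu ∷ s) (here refl) x≺z z≺y = ⊥-elim (All.lookup pu (MP.∈-insert X) x≺z)
  standard-between (u ∷ X) Y (pu ∷ s) (there z∈)  x≺z z≺y = standard-between X Y s z∈ x≺z z≺y
  standard-between []      Y (px ∷ s) (here refl) x≺z z≺y = ⊥-elim (≺-irrefl x≺z)
  standard-between []      Y (px ∷ s) (there z∈)  x≺z z≺y = go Y s z∈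
    where
    go : ∀ Y {Z} → Standard (Y ++ _ ∷ Z) → _ ∈ Y ++ _ ∷ Z → _ ∈ Y
    go []      (py ∷ s) (here refl) = ⊥-elim (≺-irrefl z≺y)
    go []      (py ∷ s) (there z∈)  = ⊥-elim (All.lookup py z∈ z≺y)
    go (v ∷ Y) (pv ∷ s) (here refl) = here refl
    go (v ∷ Y) (pv ∷ s) (there z∈)  = there (go Y s z∈)

  standard-before : ∀ X {x y} Y {Z} → Standard (X ++ x ∷ Y ++ y ∷ Z) → ¬ y ≺ x
  standard-before []      Y (px ∷ s) = All.lookup px (MP.∈-insert Y)
  standard-before (u ∷ X) Y (pu ∷ s) = standard-before X Y s

  -- If `x ≺ y` is not a cover, an element strictly between them would have to stand between two
  -- neighbours of the list.
  adjacent-incomparable : ∀ X {x y Y} → X ++ x ∷ y ∷ Y ↭ C → NonCover x y → Standard (X ++ x ∷ y ∷ Y) → ¬ x ≺ y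
  adjacent-incomparable X p nc s x≺y with nc x≺y
  ... | z , z∈ , x≺z , z≺y with standard-between X [] s (PP.∈-resp-↭ (↭-sym p) z∈) x≺z z≺y
  ...   | ()

  -- Exchanging the two neighbours at this place is an involution on orderings. They are
  -- incomparable, so standardness is kept; the inversion number changes only through this pair, and
  -- passing from `φ` to `ψ` absorbs the change.
  words-swap : ∀ {i j a b} → SwappableLetters i j a b → ∀ {φ ψ} → (∀ n → φ (a ℕ.+ n) ≡ ψ (b ℕ.+ n)) →
    ∀ X Y → words φ (X ++ i ∷ j ∷ Y) ≡ words ψ (X ++ j ∷ i ∷ Y)
  words-swap {i} {j} {a} {b} swappable {φ} {ψ} φψ X Y = trans (∑-cong-∈ (perms C) (λ o∈ → pointwise (perms⇒↭ C o∈)))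
    (sym (∑-perms-swapAt C-unique n (λ o → ind (standard? o) * ψ (inv o) * ind (map idx o ≟ʷ v′))))
    where
    n = length X
    v = X ++ i ∷ j ∷ Y
    v′ = X ++ j ∷ i ∷ Y
    back : ∀ {o} → map idx (swapAt n o) ≡ v′ → map idx o ≡ v
    back {o} eq = trans (sym (swapAt-involutive n (map idx o)))
      (trans (cong (swapAt n) (trans (sym (map-swapAt idx n o)) eq)) (swapAt-++ X))
    forth : ∀ {o} → map idx o ≡ v → map idx (swapAt n o) ≡ v′
    forth {o} eq = trans (map-swapAt idx n o) (trans (cong (swapAt n) eq) (swapAt-++ X))
    pointwise : ∀ {o} → o ↭ C → ind (standard? o) * φ (inv o) * ind (map idx o ≟ʷ v)
      ≡ ind (standard? (swapAt n o)) * ψ (inv (swapAt n o)) * ind (map idx (swapAt n o) ≟ʷ v′)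
    pointwise {o} p with map idx o ≟ʷ v
    ... | no ≢v = trans (ℤP.*-zeroʳ (ind (standard? o) * φ (inv o))) (sym
      (trans (cong (ind (standard? (swapAt n o)) * ψ (inv (swapAt n o)) *_) (ind-no (map idx (swapAt n o) ≟ʷ v′) (≢v ∘ back)))
             (ℤP.*-zeroʳ (ind (standard? (swapAt n o)) * ψ (inv (swapAt n o))))))
    ... | yes ≡v with map-split idx o X ≡v
    ...   | o₁ , x ∷ y ∷ o₂ , refl , refl , eq₂ with LP.∷-injective eq₂
    ...     | refl , eq₃ with LP.∷-injective eq₃
    ...       | refl , refl with swappable (PP.∈-resp-↭ p (MP.∈-insert o₁)) (PP.∈-resp-↭ p (MP.∈-++⁺ʳ o₁ (there (here refl)))) refl refl
    ...         | ncxy , ncyx , refl , refl with inv-swap o₁ {x} {y} {o₂}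
    ...           | m , inv≡ , inv≡′ = begin
      ind (standard? (o₁ ++ x ∷ y ∷ o₂)) * φ (inv (o₁ ++ x ∷ y ∷ o₂)) * 1ℤ
        ≡⟨ cong₂ (λ s t → s * t * 1ℤ)
             (ind-iff (standard? (o₁ ++ x ∷ y ∷ o₂)) (standard? (o₁ ++ y ∷ x ∷ o₂))
               (λ s → standard-swap o₁ (adjacent-incomparable o₁ p ncxy s) s)
               (λ s → standard-swap o₁ (adjacent-incomparable o₁ p′ ncyx s) s))
             (trans (cong φ inv≡) (trans (φψ m) (cong ψ (sym inv≡′)))) ⟩
      ind (standard? (o₁ ++ y ∷ x ∷ o₂)) * ψ (inv (o₁ ++ y ∷ x ∷ o₂)) * 1ℤ
        ≡⟨ cong₂ (λ o s → ind (standard? o) * ψ (inv o) * s) (sym swapped)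
             (sym (ind-yes (map idx (swapAt n (o₁ ++ x ∷ y ∷ o₂)) ≟ʷ v′) (forth {o₁ ++ x ∷ y ∷ o₂} ≡v))) ⟩
      ind (standard? (swapAt n (o₁ ++ x ∷ y ∷ o₂))) * ψ (inv (swapAt n (o₁ ++ x ∷ y ∷ o₂)))
        * ind (map idx (swapAt n (o₁ ++ x ∷ y ∷ o₂)) ≟ʷ v′) ∎
      where
      open ≡-Reasoning
      p′ : o₁ ++ y ∷ x ∷ o₂ ↭ C
      p′ = ↭-trans (PP.++⁺ˡ o₁ (Perm.swap y x ↭-refl)) p
      swapped : swapAt n (o₁ ++ x ∷ y ∷ o₂) ≡ o₁ ++ y ∷ x ∷ o₂
      swapped = subst (λ l → swapAt l (o₁ ++ x ∷ y ∷ o₂) ≡ o₁ ++ y ∷ x ∷ o₂) (sym (LP.length-map idx o₁)) (swapAt-++ o₁)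

  module _ (S : Switchable P) where
    open Switchable S

    -- The two cells that carry `a` are sandwiched, so the letters between them would have to lie on
    -- both sides of `a`; `M` has one of the sides empty.
    words-square : ∀ φ X Y a M → (∀ {r} → idx r ∈ M → a < idx r → ⊥) ⊎ (∀ {r} → idx r ∈ M → idx r < a → ⊥) →
      words φ (X ++ a ∷ M ++ a ∷ Y) ≡ 0ℤ
    words-square φ X Y a M bound = ∑-zero-∈ (perms C) (λ o∈ → pointwise (perms⇒↭ C o∈))
      where
      impossible : ∀ {o} → o ↭ C → map idx o ≡ X ++ a ∷ M ++ a ∷ Y → ¬ Standard o
      impossible {o} p eq s with map-split idx o X eq
      ... | o₁ , p₀ ∷ o₂ , refl , refl , eq₂ with LP.∷-injective eq₂
      ...   | refl , eq₃ with map-split idx o₂ M eq₃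
      ...     | o₃ , q₀ ∷ o₄ , refl , refl , eq₄ with LP.∷-injective eq₄
      ...       | q≡p , refl = contra (sandwich p∈ q∈ p≢q (sym q≡p)) bound
        where
        p∈ : p₀ ∈ C
        p∈ = PP.∈-resp-↭ p (MP.∈-insert o₁)
        q∈ : q₀ ∈ C
        q∈ = PP.∈-resp-↭ p (MP.∈-++⁺ʳ o₁ (there (MP.∈-insert o₃)))
        p≢q : p₀ ≢ q₀
        p≢q refl with unique-↭ (PP.shift p₀ o₁ _) (unique-↭ (↭-sym p) C-unique)
        ... | p∉ ∷ _ = All.lookup p∉ (MP.∈-++⁺ʳ o₁ (MP.∈-insert o₃)) refl
        contra : Sandwich p₀ q₀ ⊎ Sandwich q₀ p₀ →
          (∀ {r} → idx r ∈ map idx o₃ → idx p₀ < idx r → ⊥) ⊎ (∀ {r} → idx r ∈ map idx o₃ → idx r < idx p₀ → ⊥) → ⊥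
        contra (inj₂ ((r , _ , q≺r , r≺p , _) , _)) _ = standard-before o₁ o₃ s (≺-trans q≺r r≺p)
        contra (inj₁ ((r , r∈ , p≺r , r≺q , lt) , _)) (inj₁ b) =
          b (MP.∈-map⁺ idx (standard-between o₁ o₃ s (PP.∈-resp-↭ (↭-sym p) r∈) p≺r r≺q)) lt
        contra (inj₁ (_ , (r , r∈ , p≺r , r≺q , lt))) (inj₂ b) =
          b (MP.∈-map⁺ idx (standard-between o₁ o₃ s (PP.∈-resp-↭ (↭-sym p) r∈) p≺r r≺q)) lt
      pointwise : ∀ {o} → o ↭ C → ind (standard? o) * φ (inv o) * ind (map idx o ≟ʷ (X ++ a ∷ M ++ a ∷ Y)) ≡ 0ℤ
      pointwise {o} p with map idx o ≟ʷ (X ++ a ∷ M ++ a ∷ Y)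
      ... | no _   = ℤP.*-zeroʳ (ind (standard? o) * φ (inv o))
      ... | yes eq = cong (λ s → s * φ (inv o) * 1ℤ) (ind-no (standard? o) (impossible p eq))

    words-four : ∀ φ x y i →
      words φ (x ++ suc (suc i) ∷ i ∷ suc i ∷ y) + words φ (x ++ suc i ∷ i ∷ suc (suc i) ∷ y)
      ≡ words φ (x ++ i ∷ suc (suc i) ∷ suc i ∷ y) + words φ (x ++ suc i ∷ suc (suc i) ∷ i ∷ y)
    words-four φ x y i with triple i
    ... | inj₁ outer = cong₂ _+_
      (sym (words-swap outer {φ} {φ} (λ _ → refl) x (suc i ∷ y)))
      (shift x (suc i) (words-swap outer {φ} {φ} (λ _ → refl) (x ++ [ suc i ]) y))
      where
      shift : ∀ x b {u v} → words φ ((x ++ [ b ]) ++ u) ≡ words φ ((x ++ [ b ]) ++ v) → words φ (x ++ b ∷ u) ≡ words φ (x ++ b ∷ v)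
      shift x b = subst₂ (λ u v → words φ u ≡ words φ v) (LP.++-assoc x [ b ] _) (LP.++-assoc x [ b ] _)
    -- The rotation `b a c = a c b` passes through `a b c`, which has one inversion less, hence
    -- `φ ∘ suc`; `c a b = b c a` passes through `c b a`, which has one more, hence `φ ∘ pred`.
    ... | inj₂ (lower , upper) = trans (ℤP.+-comm (words φ (x ++ suc (suc i) ∷ i ∷ suc i ∷ y)) _) (cong₂ _+_
      (trans (sym (words-swap lower {φ ∘ suc} {φ} (λ _ → refl) x (suc (suc i) ∷ y)))
             (shift (φ ∘ suc) φ x i (words-swap upper {φ ∘ suc} {φ} (λ _ → refl) (x ++ [ i ]) y)))
      (trans (shift φ (φ ∘ ℕ.pred) x (suc (suc i)) (words-swap lower {φ} {φ ∘ ℕ.pred} (λ _ → refl) (x ++ [ suc (suc i) ]) y))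
             (sym (words-swap upper {φ} {φ ∘ ℕ.pred} (λ _ → refl) x (i ∷ y)))))
      where
      shift : ∀ φ ψ x b {u v} → words φ ((x ++ [ b ]) ++ u) ≡ words ψ ((x ++ [ b ]) ++ v) → words φ (x ++ b ∷ u) ≡ words ψ (x ++ b ∷ v)
      shift φ ψ x b = subst₂ (λ u v → words φ u ≡ words ψ v) (LP.++-assoc x [ b ] _) (LP.++-assoc x [ b ] _)

    words-switchboard : ∀ φ → Switchboard (words φ)
    words-switchboard φ = record
      { far  = λ x y i≤j → words-swap (commute i≤j) {φ} {φ} (λ _ → refl) x y
      ; four = words-four φ
      ; sq≤  = λ x y a Y Y≤ → words-square φ x y a Y (inj₁ (λ r∈ lt → ℕP.<⇒≱ lt (All.lookup Y≤ r∈)))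
      ; sq≥  = λ x y a Y Y≥ → words-square φ x y a Y (inj₂ (λ r∈ lt → ℕP.<⇒≱ lt (All.lookup Y≥ r∈)))
      }

-- Reformulation of the local functions in the definitions

allᵇ : {A : Set} → (A → Bool) → List A → Bool
allᵇ p []       = true
allᵇ p (x ∷ xs) = p x ∧ allᵇ p xs

count-cong : {A : Set} {p q : A → Bool} → (∀ x → p x ≡ q x) → ∀ xs → count p xs ≡ count q xs
count-cong             eq []       = refl
count-cong {p = p} {q} eq (x ∷ xs) with p x | q x | eq x
... | true  | _ | refl = cong suc (count-cong eq xs)
... | false | _ | refl = count-cong eq xs

contentFrom : List ℕ → ℕ → List ℕ → Bool
contentFrom s v []       = true
contentFrom s v (a ∷ as) = (occ v s ≡ᵇ a) ∧ contentFrom s (suc v) as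

-- The recursive helpers of Defs live in where blocks.  Abstracting their arguments in the goal lets
-- Agda infer the type of a lemma about such a helper, which is then proved by recursion.
hasContent-go : ∀ s (α₀ : List ℕ) (v : ℕ) (α : List ℕ) → _
hasContent-unfold : ∀ s α → hasContent s α ≡ contentFrom s 0 α
hasContent-unfold s []      = refl
hasContent-unfold s (a ∷ α) with List._∷_ a α | 1
... | α₀ | v = cong ((occ 0 s ≡ᵇ a) ∧_) (hasContent-go s α₀ v α)
hasContent-go s α₀ v []      = refl
hasContent-go s α₀ v (a ∷ α) = cong ((occ v s ≡ᵇ a) ∧_) (hasContent-go s α₀ (suc v) α)

LabelledPair : ℕ → Set
LabelledPair k = (Cell k × ℕ) × (Cell k × ℕ)

okStandard : ∀ {k} → LabelledPair k → Bool
okStandard ((x , a) , (y , b)) =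
  (not (sameComp x y ∧ (row x ==ℤ row y) ∧ (col x <ℤ col y)) ∨ (a <ᵇ b))
  ∧ (not (sameComp x y ∧ (col x ==ℤ col y) ∧ (row x <ℤ row y)) ∨ (a <ᵇ b))

isStandardB-go : ∀ k ν (T : List ℕ) (ps : List (LabelledPair k)) → _
isStandardB-unfold : ∀ k ν T → isStandardB k ν T ≡ allᵇ okStandard (pairs (labelled k ν T))
isStandardB-unfold k ν T with pairs (labelled k ν T)
... | ps = isStandardB-go k ν T ps
isStandardB-go k ν T []       = refl
isStandardB-go k ν T (p ∷ ps) = cong (okStandard p ∧_) (isStandardB-go k ν T ps)

okInv : ∀ {k} → LabelledPair k → Bool
okInv {k} ((x , a) , (y , b)) =
  let d = scont k y - scont k x in (0ℤ <ℤ d) ∧ (d <ℤ pos k) ∧ (b <ᵇ a)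

okTableau : ((ℕ × ℕ) × ℕ) × ((ℕ × ℕ) × ℕ) → Bool
okTableau (((r , j) , a) , ((r′ , j′) , b)) =
  (not ((r ≡ᵇ r′) ∧ (j <ᵇ j′)) ∨ (a ≤ᵇ b))
  ∧ (not ((j ≡ᵇ j′) ∧ (r <ᵇ r′)) ∨ (a <ᵇ b))

isTableau : List ℕ → List ℕ → List ℕ → Bool
isTableau sh α f = allᵇ okTableau (pairs (zip (youngCells sh) f)) ∧ contentFrom f 0 α

isTableau-go : ∀ (sh α : List ℕ) (ps : List (((ℕ × ℕ) × ℕ) × ((ℕ × ℕ) × ℕ))) → _
isTableau-unfold : ∀ (sh α f : List ℕ) → _
coeffS-unfold : ∀ sh α → coeffS sh α ≡ count (isTableau sh α) (allWords (length α) (length (youngCells sh)))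
coeffS-unfold sh α = count-cong (isTableau-unfold sh α) (allWords (length α) (length (youngCells sh)))
isTableau-unfold sh α f with pairs (zip (youngCells sh) f)
... | ps = cong₂ _∧_ (isTableau-go sh α ps) (hasContent-unfold f α)
isTableau-go sh α []       = refl
isTableau-go sh α (p ∷ ps) = cong (okTableau p ∧_) (isTableau-go sh α ps)

descendingᵇ : List ℕ → Bool
descendingᵇ (a ∷ b ∷ s) = (b ≤ᵇ a) ∧ descendingᵇ (b ∷ s)
descendingᵇ _           = true

isPartitionOf-pos : ∀ (n : ℕ) (l₀ l : List ℕ) → _
isPartitionOf-dec : ∀ (n : ℕ) (l₀ l : List ℕ) → _
isPartitionOf-unfold : ∀ n l → isPartitionOf n l ≡ (sum l ≡ᵇ n) ∧ allᵇ (0 <ᵇ_) l ∧ descendingᵇ l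
isPartitionOf-unfold n []       = refl
isPartitionOf-unfold n (a ∷ []) = refl
isPartitionOf-unfold n (a ∷ b ∷ s) with List._∷_ a (b ∷ s)
... | l₀ with List._∷_ b s
...   | t = cong₂ (λ p d → (a ℕ.+ (b ℕ.+ sum s) ≡ᵇ n) ∧ ((0 <ᵇ a) ∧ (0 <ᵇ b) ∧ p) ∧ (b ≤ᵇ a) ∧ d)
  (isPartitionOf-pos n l₀ s) (isPartitionOf-dec n l₀ t)
isPartitionOf-pos n l₀ []      = refl
isPartitionOf-pos n l₀ (a ∷ l) = cong ((0 <ᵇ a) ∧_) (isPartitionOf-pos n l₀ l)
isPartitionOf-dec n l₀ []          = refl
isPartitionOf-dec n l₀ (a ∷ [])    = refl
isPartitionOf-dec n l₀ (a ∷ b ∷ l) = cong ((b ≤ᵇ a) ∧_) (isPartitionOf-dec n l₀ (b ∷ l))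

standardRows : ℕ → List ℕ → List (List ℕ)
standardRows s []       = []
standardRows s (r ∷ rs) = applyUpTo (λ j → s ℕ.+ suc j) r ∷ standardRows (s ℕ.+ r) rs

Utab-go : ∀ (sh : List ℕ) (s : ℕ) (rs : List ℕ) → _
Utab-unfold : ∀ sh → Utab sh ≡ standardRows 0 sh
Utab-unfold []       = refl
Utab-unfold (r ∷ rs) with List._∷_ r rs
... | sh = cong (applyUpTo suc r ∷_) (Utab-go sh r rs)
Utab-go sh s []       = refl
Utab-go sh s (r ∷ rs) = cong (applyUpTo (λ j → s ℕ.+ suc j) r ∷_) (Utab-go sh (s ℕ.+ r) rs)

-- Words cut into increasing runs

Increasing : Word → Set
Increasing = AllPairs _<_

AllPairs-∷ʳ : {A : Set} {R : A → A → Set} {xs : List A} {y : A} → AllPairs R xs → All (λ x → R x y) xs → AllPairs R (xs ∷ʳ y)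
AllPairs-∷ʳ ps rs = APP.++⁺ ps ([] ∷ []) (All.map (λ r → r ∷ []) rs)

AllPairs-++⁻ : {A : Set} {R : A → A → Set} (xs : List A) {ys : List A} → AllPairs R (xs ++ ys) →
  AllPairs R xs × AllPairs R ys × All (λ x → All (R x) ys) xs
AllPairs-++⁻ []       p        = [] , p , []
AllPairs-++⁻ (x ∷ xs) (px ∷ p) with AllPairs-++⁻ xs p | AllP.++⁻ xs px
... | p₁ , p₂ , p₁₂ | q₁ , q₂ = q₁ ∷ p₁ , p₂ , q₂ ∷ p₁₂

incr-increasing : ∀ c p → All Increasing (incr c p)
incr-increasing c       zero    = [] ∷ []
incr-increasing zero    (suc p) = []
incr-increasing (suc c) (suc p) = AllP.++⁺ (incr-increasing c (suc p))
  (AllP.map⁺ (All.zipWith (λ (inc , bnd) → AllPairs-∷ʳ inc bnd) (incr-increasing c p , incr-bounded c p)))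

∈-incr : ∀ c {B} → All (_< c) B → Increasing B → B ∈ incr c (length B)
∈-incr zero    {[]}    []       _   = here refl
∈-incr zero    {_ ∷ _} (() ∷ _) _
∈-incr (suc c) {B} bnd inc with List.initLast B
... | [] = here refl
... | B′ List.∷ʳ′ z with AllPairs-++⁻ B′ inc | AllP.∷ʳ⁻ bnd | z ℕP.≟ c
...   | inc′ , _ , below | bnd′ , _ | yes refl =
  subst (λ l → B′ ∷ʳ c ∈ incr (suc c) l) (sym (trans (LP.length-++ B′) (ℕP.+-comm (length B′) 1)))
    (MP.∈-++⁺ʳ (incr c (suc (length B′))) (MP.∈-map⁺ (_∷ʳ c) (∈-incr c (All.map All.head below) inc′)))
...   | inc′ , _ , below | bnd′ , z< | no z≢c = weaken (length (B′ ∷ʳ z)) (∈-incr c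
    (AllP.∷ʳ⁺ (All.map (λ lt → ℕP.<-trans (All.head lt) z<c) below) z<c) inc)
  where
  z<c : z < c
  z<c = ℕP.≤∧≢⇒< (ℕP.≤-pred z<) z≢c
  weaken : ∀ p {B} → B ∈ incr c p → B ∈ incr (suc c) p
  weaken zero    B∈ = B∈
  weaken (suc p) B∈ = MP.∈-++⁺ˡ B∈

incr-unique : ∀ c p → Unique (incr c p)
incr-unique c       zero    = [] ∷ []
incr-unique zero    (suc p) = []
incr-unique (suc c) (suc p) = UP.++⁺ (incr-unique c (suc p)) (UP.map⁺ (LP.∷ʳ-injectiveˡ _ _) (incr-unique c p)) disjoint
  where
  disjoint : ∀ {B} → ¬ (B ∈ incr c (suc p) × B ∈ map (_∷ʳ c) (incr c p))
  disjoint (B∈ , B∈′) with MP.∈-map⁻ (_∷ʳ c) B∈′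
  ... | B′ , _ , refl = ℕP.<-irrefl refl (proj₂ (AllP.∷ʳ⁻ (All.lookup (incr-bounded c (suc p)) B∈)))

tuples-unique : ∀ N α → Unique (tuples N α)
tuples-unique N []      = [] ∷ []
tuples-unique N (a ∷ α) = unique-concatMap (λ B → map (B ∷_) (tuples N α)) (incr-unique N a)
  (λ _ → UP.map⁺ LP.∷-injectiveʳ (tuples-unique N α)) (λ _ _ → same)
  where
  same : ∀ {B B′ Bs} → Bs ∈ map (B ∷_) (tuples N α) → Bs ∈ map (B′ ∷_) (tuples N α) → B ≡ B′
  same p q with ∈-map-∷ p | ∈-map-∷ q
  ... | _ , refl , _ | _ , refl , _ = refl

∈-tuples : ∀ N {Bs} → All Increasing Bs → All (_< N) (concat Bs) → Bs ∈ tuples N (map length Bs)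
∈-tuples N []                   _   = here refl
∈-tuples N (_∷_ {B} {Bs} inc incs) bnd with AllP.++⁻ B bnd
... | bnd₁ , bnd₂ = MP.∈-concatMap⁺ (λ B → map (B ∷_) (tuples N (map length Bs)))
  (lose (∈-incr N bnd₁ inc) (MP.∈-map⁺ (B ∷_) (∈-tuples N incs bnd₂)))

tuples-increasing : ∀ N α → All (All Increasing) (tuples N α)
tuples-increasing N []      = [] ∷ []
tuples-increasing N (a ∷ α) = All-concatMap (λ B → map (B ∷_) (tuples N α))
  (All.map (λ inc → AllP.map⁺ (All.map (inc ∷_) (tuples-increasing N α))) (incr-increasing N a))

chop : {A : Set} → List ℕ → List A → List (List A)
chop []      v = []
chop (a ∷ α) v = List.take a v ∷ chop α (List.drop a v)

take-++ : {A : Set} (xs ys : List A) → List.take (length xs) (xs ++ ys) ≡ xs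
take-++ []       ys = refl
take-++ (x ∷ xs) ys = cong (x ∷_) (take-++ xs ys)

drop-++ : {A : Set} (xs ys : List A) → List.drop (length xs) (xs ++ ys) ≡ ys
drop-++ []       ys = refl
drop-++ (x ∷ xs) ys = drop-++ xs ys

chop-concat : {A : Set} (Bs : List (List A)) → chop (map length Bs) (concat Bs) ≡ Bs
chop-concat []       = refl
chop-concat (B ∷ Bs) = cong₂ _∷_ (take-++ B (concat Bs))
  (trans (cong (chop (map length Bs)) (drop-++ B (concat Bs))) (chop-concat Bs))

concat-chop : {A : Set} (α : List ℕ) (v : List A) → length v ≡ sum α → concat (chop α v) ≡ v × map length (chop α v) ≡ α
concat-chop []      []      eq = refl , refl
concat-chop (a ∷ α) v       eq with concat-chop α (List.drop a v)
  (trans (LP.length-drop a v) (trans (cong (_∸ a) eq) (ℕP.m+n∸m≡n a (sum α))))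
... | c , l = trans (cong (List.take a v ++_) c) (LP.take++drop≡id a v) ,
              cong₂ _∷_ (trans (LP.length-take a v) (ℕP.m≤n⇒m⊓n≡m (subst (a ≤_) (sym eq) (ℕP.m≤m+n a (sum α))))) l

length-concat : {A : Set} (Bs : List (List A)) → length (concat Bs) ≡ sum (map length Bs)
length-concat []       = refl
length-concat (B ∷ Bs) = trans (LP.length-++ B) (cong (length B ℕ.+_) (length-concat Bs))

-- `chop` truncates silently, so the total length has to be part of the condition.
Runs : List ℕ → Word → Set
Runs α v = length v ≡ sum α × All Increasing (chop α v)

increasing? : ∀ B → Dec (Increasing B)
increasing? = AllPairs.allPairs? ℕP._<?_

runs? : ∀ α v → Dec (Runs α v)
runs? α v with length v ℕP.≟ sum α | All.all? increasing? (chop α v)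
... | yes p | yes q = yes (p , q)
... | yes p | no ¬q = no (¬q ∘ proj₂)
... | no ¬p | _     = no (¬p ∘ proj₁)

-- A word of the right length is the concatenation of exactly one tuple of pieces with these
-- lengths, so at most one term of the sum is nonzero.
∑-tuples-concat : ∀ N α v → All (_< N) v → (K : List Word → ℤ) →
  ∑ (tuples N α) (λ Bs → ind (v ≟ʷ concat Bs) * K Bs) ≡ ind (runs? α v) * K (chop α v)
∑-tuples-concat N α v bnd K with runs? α v
... | yes (len , inc) = trans
  (∑-single (λ Bs → ind (v ≟ʷ concat Bs) * K Bs) (tuples-unique N α)
    (subst (λ β → chop α v ∈ tuples N β) lens (∈-tuples N inc (subst (All (_< N)) (sym whole) bnd)))
    (λ {Bs} Bs∈ ≢ → cong (_* K Bs) (ind-no (v ≟ʷ concat Bs) (λ { refl → ≢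
      (trans (sym (chop-concat Bs)) (cong (λ β → chop β (concat Bs)) (All.lookup (tuples-lengths N α) Bs∈))) }))))
  (cong (_* K (chop α v)) (ind-yes (v ≟ʷ concat (chop α v)) (sym whole)))
  where
  whole = proj₁ (concat-chop α v len)
  lens = proj₂ (concat-chop α v len)
... | no ¬runs = ∑-zero-∈ (tuples N α) (λ {Bs} Bs∈ → cong (_* K Bs) (ind-no (v ≟ʷ concat Bs)
  (λ { refl → ¬runs (subst (λ β → Runs β (concat Bs)) (All.lookup (tuples-lengths N α) Bs∈)
    (length-concat Bs , subst (All Increasing) (sym (chop-concat Bs)) (All.lookup (tuples-increasing N α) Bs∈))) })))

module _ (P : Poset) where
  open Poset P

  private
    ∑-words : ∀ φ {N} → (∀ {x} → x ∈ C → idx x < N) → ∀ α (K : List Word → ℤ) →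
      ∑ (tuples N α) (λ Bs → words φ (concat Bs) * K Bs)
      ≡ ∑ (perms C) (λ o → ind (standard? o) * φ (inv o) * (ind (runs? α (map idx o)) * K (chop α (map idx o))))
    ∑-words φ {N} bound α K = begin
      ∑ (tuples N α) (λ Bs → words φ (concat Bs) * K Bs)
        ≡⟨ ∑-cong (tuples N α) (λ Bs → trans (sym (∑-*ʳ (perms C) (K Bs) (λ o → a o * ind (map idx o ≟ʷ concat Bs))))
             (∑-cong (perms C) (λ o → ℤP.*-assoc (a o) (ind (map idx o ≟ʷ concat Bs)) (K Bs)))) ⟩
      ∑ (tuples N α) (λ Bs → ∑ (perms C) (λ o → a o * (ind (map idx o ≟ʷ concat Bs) * K Bs)))
        ≡⟨ ∑-swap (tuples N α) (perms C) (λ Bs o → a o * (ind (map idx o ≟ʷ concat Bs) * K Bs)) ⟩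
      ∑ (perms C) (λ o → ∑ (tuples N α) (λ Bs → a o * (ind (map idx o ≟ʷ concat Bs) * K Bs)))
        ≡⟨ ∑-cong-∈ (perms C) (λ {o} o∈ → trans (∑-*ˡ (tuples N α) (a o) (λ Bs → ind (map idx o ≟ʷ concat Bs) * K Bs))
             (cong (a o *_) (∑-tuples-concat N α (map idx o)
               (AllP.map⁺ (All.tabulate (λ x∈ → bound (PP.∈-resp-↭ (perms⇒↭ C o∈) x∈)))) K))) ⟩
      ∑ (perms C) (λ o → a o * (ind (runs? α (map idx o)) * K (chop α (map idx o)))) ∎
      where
      open ≡-Reasoning
      a : List A → ℤ
      a o = ind (standard? o) * φ (inv o)

  coefficient-words : ∀ φ {N} → (∀ {x} → x ∈ C → idx x < N) → ∀ α → coefficient N (words φ) α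
    ≡ ∑ (perms C) (λ o → ind (standard? o) * φ (inv o) * ind (runs? α (map idx o)))
  coefficient-words φ {N} bound α =
    trans (∑-cong (tuples N α) (λ Bs → sym (ℤP.*-identityʳ (words φ (concat Bs)))))
    (trans (∑-words φ bound α (λ _ → 1ℤ))
    (∑-cong (perms C) (λ o → cong (_*_ (ind (standard? o) * φ (inv o))) (ℤP.*-identityʳ (ind (runs? α (map idx o)))))))

  goodCoefficient-words : ∀ φ {N} → (∀ {x} → x ∈ C → idx x < N) → ∀ α → goodCoefficient N (words φ) α
    ≡ ∑ (perms C) (λ o → ind (standard? o) * φ (inv o) * (ind (runs? α (map idx o)) * ind (good? (chop α (map idx o)))))
  goodCoefficient-words φ {N} bound α =
    trans (∑-cong (tuples N α) onGood≡) (∑-words φ bound α (λ Bs → ind (good? Bs)))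
    where
    onGood≡ : ∀ Bs → onGood (words φ ∘ concat) Bs ≡ words φ (concat Bs) * ind (good? Bs)
    onGood≡ Bs with good? Bs
    ... | yes _ = sym (ℤP.*-identityʳ (words φ (concat Bs)))
    ... | no _  = sym (ℤP.*-zeroʳ (words φ (concat Bs)))

-- Knuth moves and Yamanouchi words

bit : {P : Set} → Dec P → ℕ
bit d = if does d then 1 else 0

bit-yes : {P : Set} (d : Dec P) → P → bit d ≡ 1
bit-yes (yes _) p = refl
bit-yes (no ¬p) p = ⊥-elim (¬p p)

bit-no : {P : Set} (d : Dec P) → ¬ P → bit d ≡ 0
bit-no (yes p) ¬p = ⊥-elim (¬p p)
bit-no (no _)  ¬p = refl

δ : ℕ → ℕ → ℕ
δ j b = bit (b ℕP.≟ j)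

-- `blk` groups the values into intervals. In the application a value is sent to the number of its
-- row in `U_λ`.
module Knuth (blk : ℕ → ℕ) (blk-mono : ∀ {x y} → x ≤ y → blk x ≤ blk y) where

  blk-reflects-< : ∀ {x y} → blk x < blk y → x < y
  blk-reflects-< lt = ℕP.≰⇒> (λ y≤x → ℕP.<⇒≱ lt (blk-mono y≤x))

  cnt : ℕ → List ℕ → ℕ
  cnt j []      = 0
  cnt j (x ∷ s) = δ j (blk x) ℕ.+ cnt j s

  cnt-same : ∀ {j x} s → blk x ≡ j → cnt j (x ∷ s) ≡ suc (cnt j s)
  cnt-same {j} s eq = cong (ℕ._+ cnt j s) (bit-yes (blk _ ℕP.≟ j) eq)

  cnt-diff : ∀ {j x} s → blk x ≢ j → cnt j (x ∷ s) ≡ cnt j s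
  cnt-diff {j} s ≢j = cong (ℕ._+ cnt j s) (bit-no (blk _ ℕP.≟ j) ≢j)

  cnt-∷-≤ : ∀ j x s → cnt j s ≤ cnt j (x ∷ s)
  cnt-∷-≤ j x s = ℕP.m≤n+m (cnt j s) (δ j (blk x))

  cnt-↭ : ∀ j {s t} → s ↭ t → cnt j s ≡ cnt j t
  cnt-↭ j Perm.refl         = refl
  cnt-↭ j (Perm.prep x p)   = cong (δ j (blk x) ℕ.+_) (cnt-↭ j p)
  cnt-↭ j (Perm.swap {s} {t} x y p) = trans (rearrange (δ j (blk x)) (δ j (blk y)) (cnt j s))
    (cong (λ n → δ j (blk y) ℕ.+ (δ j (blk x) ℕ.+ n)) (cnt-↭ j p))
    where
    rearrange : ∀ a b c → a ℕ.+ (b ℕ.+ c) ≡ b ℕ.+ (a ℕ.+ c)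
    rearrange = ℕSolver.solve-∀
  cnt-↭ j (Perm.trans p q)  = trans (cnt-↭ j p) (cnt-↭ j q)

  cnt-++ : ∀ j s t → cnt j (s ++ t) ≡ cnt j s ℕ.+ cnt j t
  cnt-++ j []      t = refl
  cnt-++ j (x ∷ s) t = trans (cong (δ j (blk x) ℕ.+_) (cnt-++ j s t)) (sym (ℕP.+-assoc (δ j (blk x)) (cnt j s) (cnt j t)))

  cnt-all : ∀ j {s} → All (λ x → blk x ≡ j) s → cnt j s ≡ length s
  cnt-all j []                = refl
  cnt-all j (_∷_ {xs = s} eq eqs) = trans (cnt-same s eq) (cong suc (cnt-all j eqs))

  cnt-none : ∀ j {s} → All (λ x → blk x ≢ j) s → cnt j s ≡ 0
  cnt-none j []                = refl
  cnt-none j (_∷_ {xs = s} ≢j ≢js) = trans (cnt-diff s ≢j) (cnt-none j ≢js)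

  cnt-witness : ∀ j s → 1 ≤ cnt j s → ∃ λ x → x ∈ s × blk x ≡ j
  cnt-witness j (x ∷ s) le with blk x ℕP.≟ j
  ... | yes eq = x , here refl , eq
  ... | no ≢j with cnt-witness j s (subst (1 ≤_) (cnt-diff s ≢j) le)
  ...   | y , y∈ , eq = y , there y∈ , eq

  LatticeStep : ℕ → List ℕ → Set
  LatticeStep b s = ∀ j → b ≡ suc j → suc (cnt (suc j) s) ≤ cnt j s

  Lattice : List ℕ → Set
  Lattice []      = ⊤
  Lattice (x ∷ s) = LatticeStep (blk x) s × Lattice s

  BlocksIncrease : List ℕ → Set
  BlocksIncrease = AllPairs (λ x y → blk x ≡ blk y → x < y)

  -- `w` is the standardisation of its word of block numbers, and in every suffix of that word `j`
  -- occurs at least as often as `j + 1`.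
  Yam : List ℕ → Set
  Yam w = BlocksIncrease w × Lattice w

  lattice-cnt : ∀ s → Lattice s → ∀ j → cnt (suc j) s ≤ cnt j s
  lattice-cnt []      _         j = z≤n
  lattice-cnt (x ∷ s) (st , la) j with blk x ℕP.≟ suc j
  ... | yes eq = subst (_≤ cnt j (x ∷ s)) (sym (cnt-same s eq)) (ℕP.≤-trans (st j eq) (cnt-∷-≤ j x s))
  ... | no ≢   = subst (_≤ cnt j (x ∷ s)) (sym (cnt-diff s ≢)) (ℕP.≤-trans (lattice-cnt s la j) (cnt-∷-≤ j x s))

  step-↭ : ∀ b {s t} → s ↭ t → LatticeStep b s → LatticeStep b t
  step-↭ b p st j eq = subst₂ (λ m n → suc m ≤ n) (cnt-↭ (suc j) p) (cnt-↭ j p) (st j eq)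

  yam-prefix : ∀ X {u v} → u ↭ v → (Yam u → Yam v) → Yam (X ++ u) → Yam (X ++ v)
  yam-prefix []      p f y = f y
  yam-prefix (x ∷ X) p f (bx ∷ bi , st , la) with yam-prefix X p f (bi , la)
  ... | bi′ , la′ = PP.All-resp-↭ (PP.++⁺ˡ X p) bx ∷ bi′ , step-↭ (blk x) (PP.++⁺ˡ X p) st , la′

  yam-suffix : ∀ X {u} → Yam (X ++ u) → Yam u
  yam-suffix []      y                   = y
  yam-suffix (x ∷ X) (_ ∷ bi , _ , la) = yam-suffix X (bi , la)

  step-add-higher : ∀ b c s → b < blk c → LatticeStep b s → LatticeStep b (c ∷ s)
  step-add-higher b c s b<c st j refl =
    subst (λ n → suc n ≤ cnt j (c ∷ s)) (sym (cnt-diff s (ℕP.>⇒≢ b<c))) (ℕP.≤-trans (st j refl) (cnt-∷-≤ j c s))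

  step-drop-higher : ∀ b c s → b < blk c → LatticeStep b (c ∷ s) → LatticeStep b s
  step-drop-higher b c s b<c st j refl =
    subst₂ (λ m n → suc m ≤ n) (cnt-diff s (ℕP.>⇒≢ b<c)) (cnt-diff s (ℕP.>⇒≢ (ℕP.<-trans (ℕP.n<1+n j) b<c))) (st j refl)

  step-add-lower : ∀ c a s → blk a < c → LatticeStep c s → LatticeStep c (a ∷ s)
  step-add-lower c a s a<c st j refl =
    subst (λ n → suc n ≤ cnt j (a ∷ s)) (sym (cnt-diff s (ℕP.<⇒≢ a<c))) (ℕP.≤-trans (st j refl) (cnt-∷-≤ j a s))

  module _ {a b c : ℕ} (a<b : a < b) (b<c : b < c) (Y : List ℕ) where
    private
      a≤b = blk-mono (ℕP.<⇒≤ a<b)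
      b≤c = blk-mono (ℕP.<⇒≤ b<c)

    -- Only the step of `c` is at risk, because `a` no longer stands behind it. This matters when
    -- `a` lies one block below `c`; then `b` shares the block of `c`, and the step of `b`, taken
    -- with both `c` and `a` behind it, supplies the missing unit.
    knuth₁→ : Yam (b ∷ c ∷ a ∷ Y) → Yam (b ∷ a ∷ c ∷ Y)
    knuth₁→ (((bc ∷ ba ∷ bY) ∷ (_ ∷ cY) ∷ aY ∷ bi) , stb , stc , sta , la) =
      ((ba ∷ bc ∷ bY) ∷ ((λ _ → ℕP.<-trans a<b b<c) ∷ aY) ∷ cY ∷ bi) ,
      step-↭ (blk b) (Perm.swap c a (↭-refl {x = Y})) stb , step-add-higher (blk a) c Y A<C sta , stepC , la
      where
      A<B : blk a < blk b
      A<B = ℕP.≤∧≢⇒< a≤b (λ eq → ℕP.<-asym a<b (ba (sym eq)))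
      A<C : blk a < blk c
      A<C = ℕP.<-≤-trans A<B b≤c
      stepC : LatticeStep (blk c) Y
      stepC j eq with blk a ℕP.≟ j
      ... | no a≢j  = ℕP.≤-trans (s≤s (cnt-∷-≤ (suc j) a Y)) (ℕP.≤-trans (stc j eq) (ℕP.≤-reflexive (cnt-diff Y a≢j)))
      ... | yes a≡j = ℕP.≤-pred (subst₂ (λ m n → suc m ≤ n)
              (trans (cnt-same (a ∷ Y) eq) (cong suc (cnt-diff Y (λ eq′ → ℕP.<⇒≢ A<C (trans eq′ (sym eq))))))
              (trans (cnt-diff (a ∷ Y) (λ eq′ → ℕP.<⇒≢ A<C (trans a≡j (sym eq′)))) (cnt-same Y a≡j))
              (stb j B≡))
        where
        B≡ : blk b ≡ suc j
        B≡ = ℕP.≤-antisym (subst (blk b ≤_) eq b≤c) (subst (λ n → suc n ≤ blk b) a≡j A<B)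

    knuth₁← : Yam (b ∷ a ∷ c ∷ Y) → Yam (b ∷ c ∷ a ∷ Y)
    knuth₁← (((ba ∷ bc ∷ bY) ∷ (_ ∷ aY) ∷ cY ∷ bi) , stb , sta , stc , la) =
      ((bc ∷ ba ∷ bY) ∷ ((λ eq → ⊥-elim (ℕP.<⇒≢ A<C (sym eq))) ∷ cY) ∷ aY ∷ bi) ,
      step-↭ (blk b) (Perm.swap a c (↭-refl {x = Y})) stb , step-add-lower (blk c) a Y A<C stc , step-drop-higher (blk a) c Y A<C sta , la
      where
      A<C : blk a < blk c
      A<C = ℕP.<-≤-trans (ℕP.≤∧≢⇒< a≤b (λ eq → ℕP.<-asym a<b (ba (sym eq)))) b≤c

    knuth₂→ : Yam (a ∷ c ∷ b ∷ Y) → Yam (c ∷ a ∷ b ∷ Y)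
    knuth₂→ (((_ ∷ ab ∷ aY) ∷ (cb ∷ cY) ∷ bY ∷ bi) , sta , stc , stb , la) =
      (((λ eq → ⊥-elim (ℕP.<⇒≢ A<C (sym eq))) ∷ cb ∷ cY) ∷ (ab ∷ aY) ∷ bY ∷ bi) ,
      step-add-lower (blk c) a (b ∷ Y) A<C stc , step-drop-higher (blk a) c (b ∷ Y) A<C sta , stb , la
      where
      A<C : blk a < blk c
      A<C = ℕP.≤-<-trans a≤b (ℕP.≤∧≢⇒< b≤c (λ eq → ℕP.<-asym b<c (cb (sym eq))))

    -- Again only `c` loses `a` behind it. If `a` lies one block below `c`, then so does `b`, which
    -- still stands behind `c` and takes over the role of `a`.
    knuth₂← : Yam (c ∷ a ∷ b ∷ Y) → Yam (a ∷ c ∷ b ∷ Y)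
    knuth₂← (((_ ∷ cb ∷ cY) ∷ (ab ∷ aY) ∷ bY ∷ bi) , stc , sta , stb , la) =
      (((λ _ → ℕP.<-trans a<b b<c) ∷ ab ∷ aY) ∷ (cb ∷ cY) ∷ bY ∷ bi) ,
      step-add-higher (blk a) c (b ∷ Y) A<C sta , stepC , stb , la
      where
      B<C : blk b < blk c
      B<C = ℕP.≤∧≢⇒< b≤c (λ eq → ℕP.<-asym b<c (cb (sym eq)))
      A<C : blk a < blk c
      A<C = ℕP.≤-<-trans a≤b B<C
      stepC : LatticeStep (blk c) (b ∷ Y)
      stepC j eq with blk a ℕP.≟ j
      ... | no a≢j  = ℕP.≤-trans (s≤s (cnt-∷-≤ (suc j) a (b ∷ Y))) (ℕP.≤-trans (stc j eq) (ℕP.≤-reflexive (cnt-diff (b ∷ Y) a≢j)))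
      ... | yes a≡j = subst₂ (λ m n → suc m ≤ n)
              (sym (cnt-diff Y (λ eq′ → ℕP.<⇒≢ B<C (trans eq′ (sym eq))))) (sym (cnt-same Y B≡)) (s≤s (lattice-cnt Y la j))
        where
        B≡ : blk b ≡ j
        B≡ = ℕP.≤-antisym (ℕP.≤-pred (subst (blk b <_) eq B<C)) (subst (_≤ blk b) a≡j a≤b)

  infix 4 _≈_
  data _≈_ : List ℕ → List ℕ → Set where
    ≈-refl  : ∀ {u} → u ≈ u
    ≈-trans : ∀ {u v w} → u ≈ v → v ≈ w → u ≈ w
    knuth₁  : ∀ X {a b c} Y → a < b → b < c → X ++ b ∷ c ∷ a ∷ Y ≈ X ++ b ∷ a ∷ c ∷ Y
    knuth₂  : ∀ X {a b c} Y → a < b → b < c → X ++ a ∷ c ∷ b ∷ Y ≈ X ++ c ∷ a ∷ b ∷ Y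

  ≈⇒↭ : ∀ {u v} → u ≈ v → u ↭ v
  ≈⇒↭ ≈-refl            = ↭-refl
  ≈⇒↭ (≈-trans p q)     = ↭-trans (≈⇒↭ p) (≈⇒↭ q)
  ≈⇒↭ (knuth₁ X Y _ _)  = PP.++⁺ˡ X (Perm.prep _ (Perm.swap _ _ ↭-refl))
  ≈⇒↭ (knuth₂ X Y _ _)  = PP.++⁺ˡ X (Perm.swap _ _ ↭-refl)

  yam-≈→ : ∀ {u v} → u ≈ v → Yam u → Yam v
  yam-≈→ ≈-refl                 = id
  yam-≈→ (≈-trans p q)          = yam-≈→ q ∘ yam-≈→ p
  yam-≈→ (knuth₁ X Y a<b b<c)   = yam-prefix X (Perm.prep _ (Perm.swap _ _ ↭-refl)) (knuth₁→ a<b b<c Y)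
  yam-≈→ (knuth₂ X Y a<b b<c)   = yam-prefix X (Perm.swap _ _ ↭-refl) (knuth₂→ a<b b<c Y)

  yam-≈← : ∀ {u v} → u ≈ v → Yam v → Yam u
  yam-≈← ≈-refl                 = id
  yam-≈← (≈-trans p q)          = yam-≈← p ∘ yam-≈← q
  yam-≈← (knuth₁ X Y a<b b<c)   = yam-prefix X (Perm.prep _ (Perm.swap _ _ ↭-refl)) (knuth₁← a<b b<c Y)
  yam-≈← (knuth₂ X Y a<b b<c)   = yam-prefix X (Perm.swap _ _ ↭-refl) (knuth₂← a<b b<c Y)

  ≈-++ˡ : ∀ Z {u v} → u ≈ v → Z ++ u ≈ Z ++ v
  ≈-++ˡ Z ≈-refl        = ≈-refl
  ≈-++ˡ Z (≈-trans p q) = ≈-trans (≈-++ˡ Z p) (≈-++ˡ Z q)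
  ≈-++ˡ Z (knuth₁ X Y a<b b<c) = subst₂ _≈_ (LP.++-assoc Z X _) (LP.++-assoc Z X _) (knuth₁ (Z ++ X) Y a<b b<c)
  ≈-++ˡ Z (knuth₂ X Y a<b b<c) = subst₂ _≈_ (LP.++-assoc Z X _) (LP.++-assoc Z X _) (knuth₂ (Z ++ X) Y a<b b<c)

  ≈-++ʳ : ∀ Z {u v} → u ≈ v → u ++ Z ≈ v ++ Z
  ≈-++ʳ Z ≈-refl        = ≈-refl
  ≈-++ʳ Z (≈-trans p q) = ≈-trans (≈-++ʳ Z p) (≈-++ʳ Z q)
  ≈-++ʳ Z (knuth₁ X Y a<b b<c) = subst₂ _≈_ (sym (LP.++-assoc X _ Z)) (sym (LP.++-assoc X _ Z)) (knuth₁ X (Y ++ Z) a<b b<c)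
  ≈-++ʳ Z (knuth₂ X Y a<b b<c) = subst₂ _≈_ (sym (LP.++-assoc X _ Z)) (sym (LP.++-assoc X _ Z)) (knuth₂ X (Y ++ Z) a<b b<c)

-- Robinson-Schensted insertion as a chain of Knuth moves

data BumpSpec (x : ℕ) (r : List ℕ) : Maybe ℕ × List ℕ → Set where
  appended : All (_< x) r → BumpSpec x r (nothing , r ++ [ x ])
  bumped   : ∀ R₁ y R₂ → r ≡ R₁ ++ y ∷ R₂ → All (_< x) R₁ → x < y → BumpSpec x r (just y , R₁ ++ x ∷ R₂)

bump-spec : ∀ x r → All (x ≢_) r → BumpSpec x r (bump x r)
bump-spec x []      _ = appended []
bump-spec x (z ∷ r) (x≢z ∷ x∉) with x <ᵇ z in eq
... | true  = bumped [] z r refl [] (ℕP.<ᵇ⇒< x z (subst T (sym eq) tt))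
... | false with bump x r | bump-spec x r x∉
...   | _ | appended r<            = appended (z<x ∷ r<)
  where z<x = ℕP.≤∧≢⇒< (ℕP.≮⇒≥ (λ lt → subst T eq (ℕP.<⇒<ᵇ lt))) (x≢z ∘ sym)
...   | _ | bumped R₁ y R₂ refl R₁< x<y = bumped (z ∷ R₁) y R₂ refl (z<x ∷ R₁<) x<y
  where z<x = ℕP.≤∧≢⇒< (ℕP.≮⇒≥ (λ lt → subst T eq (ℕP.<⇒<ᵇ lt))) (x≢z ∘ sym)

reading : List (List ℕ) → List ℕ
reading []       = []
reading (r ∷ rs) = reading rs ++ r

-- Of the columns only the first is required to increase. This much can be carried through insertion
-- row by row, and it suffices to locate the rows of a Yamanouchi word.
data Tableau (m : ℕ) : List (List ℕ) → Set where
  []   : Tableau m []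
  cons : ∀ {h t rs} → m ≤ h → Increasing (h ∷ t) → Tableau (suc h) rs → Tableau m ((h ∷ t) ∷ rs)

tableau-weaken : ∀ {m m′ P} → m′ ≤ m → Tableau m P → Tableau m′ P
tableau-weaken le []              = []
tableau-weaken le (cons m≤h i ts) = cons (ℕP.≤-trans le m≤h) i ts

unique-++ˡ : {A : Set} (xs : List A) {ys : List A} → Unique (xs ++ ys) → Unique xs
unique-++ˡ xs u = proj₁ (AllPairs-++⁻ xs u)

unique-++ʳ : {A : Set} (xs : List A) {ys : List A} → Unique (xs ++ ys) → Unique ys
unique-++ʳ xs u = proj₁ (proj₂ (AllPairs-++⁻ xs u))

module Insertion (blk : ℕ → ℕ) (blk-mono : ∀ {x y} → x ≤ y → blk x ≤ blk y) where
  open Knuth blk blk-mono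

  slideˡ : ∀ b R {x} → Increasing (b ∷ R) → x < b → b ∷ R ++ [ x ] ≈ b ∷ x ∷ R
  slideˡ b []      inc x<b = ≈-refl
  slideˡ b (c ∷ R) ((b<c ∷ _) ∷ inc) x<b =
    ≈-trans (≈-++ˡ [ b ] (slideˡ c R inc (ℕP.<-trans x<b b<c))) (knuth₁ [] R x<b b<c)

  slideʳ : ∀ R {x y} Z → Increasing R → All (_< x) R → x < y → R ++ y ∷ x ∷ Z ≈ y ∷ R ++ x ∷ Z
  slideʳ []          Z _   _        x<y = ≈-refl
  slideʳ (r ∷ [])    Z _   (r<x ∷ _) x<y = knuth₂ [] Z r<x x<y
  slideʳ (r ∷ r′ ∷ R) {x} Z ((r<r′ ∷ _) ∷ inc) (_ ∷ r′<x ∷ R<) x<y =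
    ≈-trans (≈-++ˡ [ r ] (slideʳ (r′ ∷ R) Z inc (r′<x ∷ R<) x<y))
            (knuth₂ [] (R ++ x ∷ Z) r<r′ (ℕP.<-trans r′<x x<y))

  -- First `x` moves left through `R₂` by `knuth₁`, with the letter on its left as witness, until it
  -- is next to `y`; then `y` moves left through the smaller letters `R₁` by `knuth₂`.
  bump-≈ : ∀ R₁ y R₂ {x} → Increasing (R₁ ++ y ∷ R₂) → All (_< x) R₁ → x < y →
    (R₁ ++ y ∷ R₂) ++ [ x ] ≈ y ∷ R₁ ++ x ∷ R₂
  bump-≈ R₁ y R₂ {x} inc R₁< x<y = ≈-trans
    (subst (_≈ R₁ ++ y ∷ x ∷ R₂) (sym (LP.++-assoc R₁ (y ∷ R₂) [ x ]))
      (≈-++ˡ R₁ (slideˡ y R₂ (proj₁ (proj₂ parts)) x<y)))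
    (slideʳ R₁ R₂ (proj₁ parts) R₁< x<y)
    where parts = AllPairs-++⁻ R₁ inc

  bump-increasing : ∀ R₁ {y} R₂ {x} → Increasing (R₁ ++ y ∷ R₂) → All (_< x) R₁ → x < y → Increasing (R₁ ++ x ∷ R₂)
  bump-increasing R₁ R₂ inc R₁< x<y with AllPairs-++⁻ R₁ inc
  ... | i₁ , y< ∷ i₂ , i₁₂ = APP.++⁺ i₁ (All.map (ℕP.<-trans x<y) y< ∷ i₂)
    (All.zipWith (λ { (r<x , _ ∷ r<R₂) → r<x ∷ r<R₂ }) (R₁< , i₁₂))

  rsInsert-spec : ∀ {m} x P → Tableau m P → m ≤ x → Unique (reading P ++ [ x ]) →
    Tableau m (rsInsert x P) × (reading P ++ [ x ] ≈ reading (rsInsert x P))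
  rsInsert-spec x [] [] m≤x u = cons m≤x ([] ∷ []) [] , ≈-refl
  rsInsert-spec {m} x ((h ∷ t) ∷ rs) (cons m≤h inc tab) m≤x u
    with bump x (h ∷ t) | bump-spec x (h ∷ t) x∉r
    where
    x∉r : All (x ≢_) (h ∷ t)
    x∉r = All.map (λ p eq → All.head p (sym eq)) (proj₂ (proj₂ (AllPairs-++⁻ (h ∷ t)
      (unique-++ʳ (reading rs) (subst Unique (LP.++-assoc (reading rs) (h ∷ t) [ x ]) u)))))
  ... | _ | appended r< = cons m≤h (AllPairs-∷ʳ inc r<) tab ,
    subst ((reading rs ++ h ∷ t) ++ [ x ] ≈_) (LP.++-assoc (reading rs) (h ∷ t) [ x ]) ≈-refl
  -- The head of the row itself is bumped. The first column still increases because the old head `y`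
  -- goes to the rows above, and those only have to stay above the new head `x`.
  ... | _ | bumped [] y R₂ refl _ x<y =
    cons m≤x (bump-increasing [] R₂ inc [] x<y) tab′ , ≈-trans
      (subst (_≈ (reading rs ++ [ y ]) ++ x ∷ R₂) (sym (LP.++-assoc (reading rs) (y ∷ R₂) [ x ]))
        (subst (reading rs ++ (y ∷ R₂) ++ [ x ] ≈_) (sym (LP.++-assoc (reading rs) [ y ] (x ∷ R₂)))
          (≈-++ˡ (reading rs) (bump-≈ [] y R₂ inc [] x<y))))
      (≈-++ʳ (x ∷ R₂) eq)
    where
    u′ : Unique (reading rs ++ [ y ])
    u′ = unique-++ˡ (reading rs ++ [ y ]) (subst Unique (trans (LP.++-assoc (reading rs) (y ∷ R₂) [ x ]) (sym (LP.++-assoc (reading rs) [ y ] (R₂ ++ [ x ])))) u)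
    rec = rsInsert-spec {suc x} y rs (tableau-weaken (ℕP.m≤n⇒m≤1+n x<y) tab) x<y u′
    tab′ : Tableau (suc x) (rsInsert y rs)
    tab′ = proj₁ rec
    eq = proj₂ rec
  ... | _ | bumped (_ ∷ R₁) y R₂ refl R₁< x<y =
    cons m≤h (bump-increasing (h ∷ R₁) R₂ inc R₁< x<y) (proj₁ rec) , ≈-trans
      (subst (_≈ (reading rs ++ [ y ]) ++ h ∷ R₁ ++ x ∷ R₂) (sym (LP.++-assoc (reading rs) (h ∷ R₁ ++ y ∷ R₂) [ x ]))
        (subst (reading rs ++ (h ∷ R₁ ++ y ∷ R₂) ++ [ x ] ≈_) (sym (LP.++-assoc (reading rs) [ y ] (h ∷ R₁ ++ x ∷ R₂)))
          (≈-++ˡ (reading rs) (bump-≈ (h ∷ R₁) y R₂ inc R₁< x<y))))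
      (≈-++ʳ (h ∷ R₁ ++ x ∷ R₂) (proj₂ rec))
    where
    h<y : h < y
    h<y = ℕP.<-trans (All.head R₁<) x<y
    u′ : Unique (reading rs ++ [ y ])
    u′ = unique-++ˡ (reading rs ++ [ y ]) (unique-↭
      (↭-trans (PP.++⁺ˡ (reading rs) (PP.shift y (h ∷ R₁) R₂))
        (subst (reading rs ++ y ∷ h ∷ R₁ ++ R₂ ↭_) (sym (LP.++-assoc (reading rs) [ y ] (h ∷ R₁ ++ R₂))) ↭-refl))
      (unique-++ˡ (reading rs ++ h ∷ R₁ ++ y ∷ R₂) u))
    rec = rsInsert-spec {suc h} y rs tab h<y u′

  foldl-spec : ∀ w P → Tableau 0 P → Unique (reading P ++ w) →
    Tableau 0 (foldl (λ t x → rsInsert x t) P w) × (reading P ++ w ≈ reading (foldl (λ t x → rsInsert x t) P w))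
  foldl-spec []      P tab u = tab , subst (reading P ++ [] ≈_) (LP.++-identityʳ _) ≈-refl
  foldl-spec (x ∷ w) P tab u = proj₁ rec , ≈-trans
      (subst (_≈ reading (rsInsert x P) ++ w) (LP.++-assoc (reading P) [ x ] w) (≈-++ʳ w (proj₂ ins))) (proj₂ rec)
    where
    u′ : Unique ((reading P ++ [ x ]) ++ w)
    u′ = subst Unique (sym (LP.++-assoc (reading P) [ x ] w)) u
    ins = rsInsert-spec x P tab z≤n (unique-++ˡ (reading P ++ [ x ]) u′)
    rec = foldl-spec w (rsInsert x P) (proj₁ ins) (unique-↭ (PP.++⁺ʳ w (≈⇒↭ (proj₂ ins))) u′)

  Ptab-spec : ∀ w → Unique w → Tableau 0 (Ptab w) × (w ≈ reading (Ptab w))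
  Ptab-spec w = foldl-spec w [] []

-- Positions 0, 1, 2, ... are cut into consecutive intervals whose lengths are the entries of the
-- list; the value is the number of the interval that contains `i`.
block : List ℕ → ℕ → ℕ
block []       i = 0
block (r ∷ rs) i = if does (i ℕP.<? r) then 0 else suc (block rs (i ∸ r))

block-< : ∀ r rs {i} → i < r → block (r ∷ rs) i ≡ 0
block-< r rs {i} i<r = cong (λ b → if b then 0 else suc (block rs (i ∸ r))) (<⇒<ᵇ≡ i<r)

block-≥ : ∀ r rs {i} → ¬ i < r → block (r ∷ rs) i ≡ suc (block rs (i ∸ r))
block-≥ r rs {i} i≮r = cong (λ b → if b then 0 else suc (block rs (i ∸ r))) (≮⇒<ᵇ≡ i≮r)

block-mono : ∀ α {i j} → i ≤ j → block α i ≤ block α j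
block-mono []       i≤j = z≤n
block-mono (r ∷ rs) {i} {j} i≤j with i ℕP.<? r
... | yes i<r = subst (_≤ block (r ∷ rs) j) (sym (block-< r rs i<r)) z≤n
... | no  i≮r = subst₂ _≤_ (sym (block-≥ r rs i≮r)) (sym (block-≥ r rs (λ j<r → i≮r (ℕP.≤-<-trans i≤j j<r))))
  (s≤s (block-mono rs (ℕP.∸-monoˡ-≤ r i≤j)))

-- For `v = 0`, the weakly increasing word with content α.
expand : ℕ → List ℕ → List ℕ
expand v []       = []
expand v (a ∷ as) = replicate a v ++ expand (suc v) as

applyUpTo-cong : {A : Set} {f g : ℕ → A} → (∀ i → f i ≡ g i) → ∀ n → applyUpTo f n ≡ applyUpTo g n
applyUpTo-cong eq zero    = refl
applyUpTo-cong eq (suc n) = cong₂ _∷_ (eq 0) (applyUpTo-cong (eq ∘ suc) n)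

applyUpTo-cong-< : {A : Set} {f g : ℕ → A} → ∀ n → (∀ {i} → i < n → f i ≡ g i) → applyUpTo f n ≡ applyUpTo g n
applyUpTo-cong-< zero    eq = refl
applyUpTo-cong-< (suc n) eq = cong₂ _∷_ (eq (s≤s z≤n)) (applyUpTo-cong-< n (eq ∘ s≤s))

applyUpTo-+ : {A : Set} (f : ℕ → A) (m n : ℕ) → applyUpTo f (m ℕ.+ n) ≡ applyUpTo f m ++ applyUpTo (λ j → f (m ℕ.+ j)) n
applyUpTo-+ f zero    n = refl
applyUpTo-+ f (suc m) n = cong (f 0 ∷_) (applyUpTo-+ (f ∘ suc) m n)

applyUpTo-const : {A : Set} (x : A) (n : ℕ) → applyUpTo (λ _ → x) n ≡ replicate n x
applyUpTo-const x zero    = refl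
applyUpTo-const x (suc n) = cong (x ∷_) (applyUpTo-const x n)

applyUpTo-block : ∀ v α → applyUpTo (λ i → v ℕ.+ block α i) (sum α) ≡ expand v α
applyUpTo-block v []      = refl
applyUpTo-block v (a ∷ α) = trans (applyUpTo-+ (λ i → v ℕ.+ block (a ∷ α) i) a (sum α)) (cong₂ _++_
  (trans (applyUpTo-cong-< a (λ i<a → trans (cong (v ℕ.+_) (block-< a α i<a)) (ℕP.+-identityʳ v))) (applyUpTo-const v a))
  (trans (applyUpTo-cong (λ j → trans (cong (v ℕ.+_) (trans (block-≥ a α (ℕP.m+n≮m a j)) (cong (suc ∘ block α) (ℕP.m+n∸m≡n a j))))
                                      (ℕP.+-suc v (block α j))) (sum α))
         (applyUpTo-block (suc v) α)))

expand-≥ : ∀ v α → All (v ≤_) (expand v α)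
expand-≥ v []      = []
expand-≥ v (a ∷ α) = AllP.++⁺ (AllP.replicate⁺ a ℕP.≤-refl) (All.map ℕP.<⇒≤ (expand-≥ (suc v) α))

length-expand : ∀ v α → length (expand v α) ≡ sum α
length-expand v []      = refl
length-expand v (a ∷ α) = trans (LP.length-++ (replicate a v)) (cong₂ ℕ._+_ (LP.length-replicate a) (length-expand (suc v) α))

≡ᵇ-refl : ∀ n → (n ≡ᵇ n) ≡ true
≡ᵇ-refl n = T⇒≡ (ℕP.≡⇒≡ᵇ n n refl)

≢⇒≡ᵇ≡ : ∀ {m n} → m ≢ n → (m ≡ᵇ n) ≡ false
≢⇒≡ᵇ≡ ≢ = ¬T⇒≡ (≢ ∘ ℕP.≡ᵇ⇒≡ _ _)

occ-expand : ∀ v a α → occ v (expand v (a ∷ α)) ≡ a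
occ-expand v a α = trans (count-++ (v ≡ᵇ_) (replicate a v) (expand (suc v) α)) (trans (cong₂ ℕ._+_
  (trans (count-all (v ≡ᵇ_) (AllP.replicate⁺ a (≡ᵇ-refl v))) (LP.length-replicate a))
  (count-none (v ≡ᵇ_) (All.map (λ lt → ≢⇒≡ᵇ≡ (ℕP.<⇒≢ lt)) (expand-≥ (suc v) α)))) (ℕP.+-identityʳ a))

expand-∷ : ∀ v {a b α β} → expand v (a ∷ α) ≡ expand v (b ∷ β) → a ≡ b × expand (suc v) α ≡ expand (suc v) β
expand-∷ v {a} {b} {α} {β} eq with trans (sym (occ-expand v a α)) (trans (cong (occ v) eq) (occ-expand v b β))
... | refl = refl , LP.++-cancelˡ (replicate a v) _ _ eq

expand-injective : ∀ v {α β} → All (0 <_) α → All (0 <_) β → expand v α ≡ expand v β → α ≡ β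
expand-injective v []      []      eq = refl
expand-injective v []      (_∷_ {suc b} {β} _ _) ()
expand-injective v (_∷_ {suc a} _ _) []      ()
expand-injective v (_∷_ {a} {α} _ pα) (_∷_ {b} {β} _ pβ) eq with expand-∷ v {a} {b} {α} {β} eq
... | refl , eq′ = cong (a ∷_) (expand-injective (suc v) pα pβ eq′)

standardRows-concat : ∀ s sh → concat (standardRows s sh) ≡ applyUpTo (λ j → s ℕ.+ suc j) (sum sh)
standardRows-concat s []       = refl
standardRows-concat s (r ∷ rs) = trans
  (cong (applyUpTo (λ j → s ℕ.+ suc j) r ++_) (trans (standardRows-concat (s ℕ.+ r) rs)
    (applyUpTo-cong (λ j → trans (ℕP.+-assoc s r (suc j)) (cong (s ℕ.+_) (ℕP.+-suc r j))) (sum rs))))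
  (sym (applyUpTo-+ (λ j → s ℕ.+ suc j) r (sum rs)))

standardRows-lengths : ∀ s sh → map length (standardRows s sh) ≡ sh
standardRows-lengths s []       = refl
standardRows-lengths s (r ∷ rs) = cong₂ _∷_ (LP.length-applyUpTo (λ j → s ℕ.+ suc j) r) (standardRows-lengths (s ℕ.+ r) rs)

concat-lengths-injective : {A : Set} {Xs Ys : List (List A)} → concat Xs ≡ concat Ys → map length Xs ≡ map length Ys → Xs ≡ Ys
concat-lengths-injective {Xs = Xs} {Ys} c l = trans (sym (chop-concat Xs)) (trans (cong₂ chop l c) (chop-concat Ys))

applyUpTo-increasing : ∀ {f : ℕ → ℕ} → (∀ {i j} → i < j → f i < f j) → ∀ n → Increasing (applyUpTo f n)
applyUpTo-increasing mono n = APP.applyUpTo⁺₁ _ n (λ i<j _ → mono i<j)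

-- Rows of a tableau with Yamanouchi reading word

module Rows (blk : ℕ → ℕ) (blk-mono : ∀ {x y} → x ≤ y → blk x ≤ blk y) where
  open Knuth blk blk-mono
  open Insertion blk blk-mono

  data RowsInBlocks (i : ℕ) : List (List ℕ) → Set where
    []  : RowsInBlocks i []
    _∷_ : ∀ {R Rs} → All (λ x → blk x ≡ i) R → RowsInBlocks (suc i) Rs → RowsInBlocks i (R ∷ Rs)

  -- If the last letter of the row lies in block `j + 1`, its lattice step needs a letter of block
  -- `j` in `S`, where all blocks are below `i`. The rest of the row is smaller.
  row-upper : ∀ {i S} R → Increasing R → Yam (R ++ S) → (∀ {x} → x ∈ S → blk x < i) → All (λ x → blk x ≤ i) R
  row-upper R inc yam S< with List.initLast R
  ... | [] = []
  row-upper {i} {S} _ inc yam S< | R′ List.∷ʳ′ z =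
    AllP.∷ʳ⁺ (All.map (λ lt → ℕP.≤-trans (blk-mono (ℕP.<⇒≤ (All.head lt))) z≤i) (proj₂ (proj₂ (AllPairs-++⁻ R′ inc)))) z≤i
    where
    suffix : Yam (z ∷ S)
    suffix = yam-suffix R′ (subst Yam (LP.++-assoc R′ [ z ] S) yam)
    z≤i : blk z ≤ i
    z≤i with blk z in eq
    ... | zero  = z≤n
    ... | suc j with cnt-witness j S (ℕP.≤-trans (s≤s z≤n) (proj₁ (proj₂ suffix) j eq))
    ...   | x , x∈ , refl = S< x∈

  -- `S` collects the rows below, which come later in the reading word. A head in a block `j < i`
  -- would exceed the head of row `j` found in `S`, although both lie in the same block and it is
  -- read earlier; `heads` keeps these lower heads available.
  yam⇒rowsInBlocks : ∀ i {m Hi S} → Tableau m Hi → Yam (reading Hi ++ S) → (∀ {x} → x ∈ S → blk x < i) →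
    (∀ {j} → j < i → ∃ λ h → h ∈ S × blk h ≡ j × h < m) → RowsInBlocks i Hi
  yam⇒rowsInBlocks i [] _ _ _ = []
  yam⇒rowsInBlocks i {m} {_} {S} (cons {h} {t} {rs} m≤h inc tab) yam S< heads =
    inBlock ∷ yam⇒rowsInBlocks (suc i) tab yam′ S′< heads′
    where
    R = h ∷ t
    yam′ : Yam (reading rs ++ R ++ S)
    yam′ = subst Yam (LP.++-assoc (reading rs) R S) yam
    yamR : Yam (R ++ S)
    yamR = yam-suffix (reading rs) yam′
    upper : All (λ x → blk x ≤ i) R
    upper = row-upper R inc yamR S<
    i≤h : i ≤ blk h
    i≤h = ℕP.≮⇒≥ λ lt → let (h′ , h′∈ , eq , h′<m) = heads lt in
      ℕP.<-asym (ℕP.<-≤-trans h′<m m≤h) (All.lookup (AllPairs.head (proj₁ yamR)) (MP.∈-++⁺ʳ t h′∈) (sym eq))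
    lower : All (λ x → i ≤ blk x) R
    lower = i≤h ∷ All.map (λ lt → ℕP.≤-trans i≤h (blk-mono (ℕP.<⇒≤ lt))) (AllPairs.head inc)
    inBlock : All (λ x → blk x ≡ i) R
    inBlock = All.zipWith (λ (p , q) → ℕP.≤-antisym p q) (upper , lower)
    S′< : ∀ {x} → x ∈ R ++ S → blk x < suc i
    S′< x∈ with MP.∈-++⁻ R x∈
    ... | inj₁ x∈R = s≤s (All.lookup upper x∈R)
    ... | inj₂ x∈S = ℕP.m<n⇒m<1+n (S< x∈S)
    heads′ : ∀ {j} → j < suc i → ∃ λ h′ → h′ ∈ R ++ S × blk h′ ≡ j × h′ < suc h
    heads′ {j} j<1+i with ℕP.m≤n⇒m<n∨m≡n (ℕP.≤-pred j<1+i)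
    ... | inj₂ refl = h , here refl , All.head inBlock , ℕP.n<1+n h
    ... | inj₁ j<i with heads j<i
    ...   | h′ , h′∈ , eq , h′<m = h′ , MP.∈-++⁺ʳ R h′∈ , eq , ℕP.m<n⇒m<1+n (ℕP.<-≤-trans h′<m m≤h)

  tableau-increasing : ∀ {m P} → Tableau m P → All Increasing P
  tableau-increasing []             = []
  tableau-increasing (cons _ i tab) = i ∷ tableau-increasing tab

  tableau-positive : ∀ {m P} → Tableau m P → All (0 <_) (map length P)
  tableau-positive []             = []
  tableau-positive (cons _ _ tab) = s≤s z≤n ∷ tableau-positive tab

  rows-above : ∀ {i P} → RowsInBlocks i P → All (λ x → i ≤ blk x) (concat P)
  rows-above []         = []
  rows-above (eqs ∷ rb) = AllP.++⁺ (All.map (ℕP.≤-reflexive ∘ sym) eqs) (All.map ℕP.<⇒≤ (rows-above rb))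

  rows-concat-increasing : ∀ {i P} → All Increasing P → RowsInBlocks i P → Increasing (concat P)
  rows-concat-increasing []           []         = []
  rows-concat-increasing (inc ∷ incs) (eqs ∷ rb) = APP.++⁺ inc (rows-concat-increasing incs rb)
    (All.map (λ { refl → All.map blk-reflects-< (rows-above rb) }) eqs)

  rows-blocks : ∀ {i P} → RowsInBlocks i P → map blk (concat P) ≡ expand i (map length P)
  rows-blocks []                      = refl
  rows-blocks {i} (_∷_ {R} {Rs} eqs rb) = trans (LP.map-++ blk R (concat Rs)) (cong₂ _++_ (const-map R eqs) (rows-blocks rb))
    where
    const-map : ∀ R → All (λ x → blk x ≡ i) R → map blk R ≡ replicate (length R) i
    const-map []      []         = refl
    const-map (x ∷ R) (eq ∷ eqs) = cong₂ _∷_ eq (const-map R eqs)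

  reading-↭ : ∀ P → reading P ↭ concat P
  reading-↭ []       = ↭-refl
  reading-↭ (R ∷ Rs) = ↭-trans (PP.++-comm (reading Rs) R) (PP.++⁺ˡ R (reading-↭ Rs))

  reading-blocksIncrease : ∀ {i P} → All Increasing P → RowsInBlocks i P → BlocksIncrease (reading P)
  reading-blocksIncrease []           []         = []
  reading-blocksIncrease {i} (_∷_ {R} {Rs} inc incs) (eqs ∷ rb) = APP.++⁺ (reading-blocksIncrease incs rb)
    (AllPairs.map (λ lt _ → lt) inc)
    (PP.All-resp-↭ (↭-sym (reading-↭ Rs))
      (All.map (λ i< → All.map (λ { refl eq → ⊥-elim (ℕP.<⇒≢ i< (sym eq)) }) eqs) (rows-above rb)))

  firstLength : List (List ℕ) → ℕ
  firstLength []      = 0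
  firstLength (R ∷ _) = length R

  -- A row is no longer than the row below it, and that whole row stands behind it in the reading
  -- word.
  reading-lattice : ∀ i P S → RowsInBlocks i P → Descending (map length P) → Lattice S → All (λ x → blk x < i) S →
    (∀ j → i ≡ suc j → firstLength P ≤ cnt j S) → Lattice (reading P ++ S)
  reading-lattice i []       S _          _        la S< enough = la
  reading-lattice i (R ∷ Rs) S (eqs ∷ rb) (le ∷ d) la S< enough =
    subst Lattice (sym (LP.++-assoc (reading Rs) R S))
      (reading-lattice (suc i) Rs (R ++ S) rb d (rowLattice R eqs ℕP.≤-refl)
        (AllP.++⁺ (All.map (λ { refl → ℕP.n<1+n _ }) eqs) (All.map ℕP.m<n⇒m<1+n S<)) next)
    where
    cnt-row : ∀ R′ → All (λ x → blk x ≡ i) R′ → ∀ j → i ≡ suc j → cnt j (R′ ++ S) ≡ cnt j S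
    cnt-row R′ eqs j refl = trans (cnt-++ j R′ S)
      (cong (ℕ._+ cnt j S) (cnt-none j (All.map (λ eq eq′ → ℕP.1+n≢n (trans (sym eq) eq′)) eqs)))
    cnt-row-i : ∀ R′ → All (λ x → blk x ≡ i) R′ → cnt i (R′ ++ S) ≡ length R′
    cnt-row-i R′ eqs = trans (cnt-++ i R′ S)
      (trans (cong₂ ℕ._+_ (cnt-all i eqs) (cnt-none i (All.map ℕP.<⇒≢ S<))) (ℕP.+-identityʳ (length R′)))
    rowLattice : ∀ R′ → All (λ x → blk x ≡ i) R′ → length R′ ≤ length R → Lattice (R′ ++ S)
    rowLattice []       _          _  = la
    rowLattice (x ∷ R′) (eq ∷ eqs) le = (λ { j eq′ → subst₂ (λ m n → suc m ≤ n)
        (sym (trans (cong (λ b → cnt b (R′ ++ S)) (trans (sym eq′) eq)) (cnt-row-i R′ eqs))) (sym (cnt-row R′ eqs j (trans (sym eq) eq′)))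
        (ℕP.≤-trans le (enough j (trans (sym eq) eq′))) }) ,
      rowLattice R′ eqs (ℕP.≤-trans (ℕP.n≤1+n _) le)
    next : ∀ j → suc i ≡ suc j → firstLength Rs ≤ cnt j (R ++ S)
    next j refl = subst (firstLength Rs ≤_) (sym (cnt-row-i R eqs)) (bound Rs le)
      where
      bound : ∀ Rs → All (length R ≥_) (map length Rs) → firstLength Rs ≤ length R
      bound []      _        = z≤n
      bound (_ ∷ _) (le ∷ _) = le

valueBlock : List ℕ → ℕ → ℕ
valueBlock sh y = block sh (ℕ.pred y)

valueBlock-mono : ∀ sh {x y} → x ≤ y → valueBlock sh x ≤ valueBlock sh y
valueBlock-mono sh x≤y = block-mono sh (ℕP.pred-mono-≤ x≤y)

module _ (sh : List ℕ) (positive : All (0 <_) sh) (descending : Descending sh) {w : List ℕ} (w↭ : w ↭ applyUpTo suc (sum sh)) where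
  open Knuth (valueBlock sh) (valueBlock-mono sh)
  open Insertion (valueBlock sh) (valueBlock-mono sh)
  open Rows (valueBlock sh) (valueBlock-mono sh)

  private
    n = sum sh
    w-unique : Unique w
    w-unique = unique-↭ (↭-sym w↭) (UP.applyUpTo⁺₁ suc n (λ i<j _ eq → ℕP.<⇒≢ i<j (ℕP.suc-injective eq)))

  -- The reading word of P(w) is Knuth equivalent to `w`, hence Yamanouchi, so row `i` lies in block
  -- `i`. The concatenated rows are then 1, ..., n in order, and the block numbers along them give
  -- the row lengths.
  yam⇒Ptab : Yam w → Ptab w ≡ Utab sh
  yam⇒Ptab yam = trans (concat-lengths-injective
      (trans whole (sym (standardRows-concat 0 sh)))
      (trans (expand-injective 0 (tableau-positive tab) positive
        (trans (sym (rows-blocks rows)) (trans (cong (map (valueBlock sh)) whole)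
          (trans (LP.map-applyUpTo suc (valueBlock sh) n) (applyUpTo-block 0 sh)))))
        (sym (standardRows-lengths 0 sh))))
    (sym (Utab-unfold sh))
    where
    tab = proj₁ (Ptab-spec w w-unique)
    w≈ = proj₂ (Ptab-spec w w-unique)
    rows : RowsInBlocks 0 (Ptab w)
    rows = yam⇒rowsInBlocks 0 tab (subst Yam (sym (LP.++-identityʳ _)) (yam-≈→ w≈ yam)) (λ ()) (λ ())
    whole : concat (Ptab w) ≡ applyUpTo suc n
    whole = sorted-↭⇒≡ ℕP.<-asym (rows-concat-increasing (tableau-increasing tab) rows) (applyUpTo-increasing s≤s n)
      (↭-trans (↭-sym (reading-↭ (Ptab w))) (↭-trans (↭-sym (≈⇒↭ w≈)) w↭))

  Ptab⇒yam : Ptab w ≡ Utab sh → Yam w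
  Ptab⇒yam eq = yam-≈← (proj₂ (Ptab-spec w w-unique)) (subst (Yam ∘ reading) (sym (trans eq (Utab-unfold sh)))
    (reading-blocksIncrease incs rows , subst Lattice (LP.++-identityʳ _)
      (reading-lattice 0 (standardRows 0 sh) [] rows (subst Descending (sym (standardRows-lengths 0 sh)) descending) tt [] (λ _ ()))))
    where
    incs : All Increasing (standardRows 0 sh)
    incs = go 0 sh
      where
      go : ∀ s sh → All Increasing (standardRows s sh)
      go s []       = []
      go s (r ∷ rs) = applyUpTo-increasing (λ lt → ℕP.+-monoʳ-< s (s≤s lt)) r ∷ go (s ℕ.+ r) rs
    rowsIn : ∀ i Rs → map (valueBlock sh) (concat Rs) ≡ expand i (map length Rs) → RowsInBlocks i Rs
    rowsIn i []       _  = []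
    rowsIn i (R ∷ Rs) eq with trans (sym (LP.map-++ (valueBlock sh) R (concat Rs))) eq
    ... | eq′ = allEq R (proj₁ parts) ∷ rowsIn (suc i) Rs (proj₂ parts)
      where
      split : ∀ R {u : List ℕ} {m v} → map (valueBlock sh) R ++ u ≡ replicate (length R) m ++ v →
        (map (valueBlock sh) R ≡ replicate (length R) m) × u ≡ v
      split []      eq = refl , eq
      split (x ∷ R) eq with LP.∷-injective eq
      ... | h , t with split R t
      ...   | p , q = cong₂ _∷_ h p , q
      parts = split R eq′
      allEq : ∀ R → map (valueBlock sh) R ≡ replicate (length R) i → All (λ x → valueBlock sh x ≡ i) R
      allEq []      _  = []
      allEq (x ∷ R) eq with LP.∷-injective eq
      ... | h , t = h ∷ allEq R t
    rows : RowsInBlocks 0 (standardRows 0 sh)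
    rows = rowsIn 0 (standardRows 0 sh) (trans (cong (map (valueBlock sh)) (standardRows-concat 0 sh))
      (trans (LP.map-applyUpTo suc (valueBlock sh) n) (trans (applyUpTo-block 0 sh) (cong (expand 0) (sym (standardRows-lengths 0 sh))))))

-- Fundamental quasisymmetric functions

indᵇ : Bool → ℤ
indᵇ b = if b then 1ℤ else 0ℤ

pos-count : {A : Set} (p : A → Bool) (xs : List A) → pos (count p xs) ≡ ∑ xs (λ x → indᵇ (p x))
pos-count p []       = refl
pos-count p (x ∷ xs) with p x
... | true  = cong (_+_ 1ℤ) (pos-count p xs)
... | false = trans (pos-count p xs) (sym (ℤP.+-identityˡ _))

∈-allWords⁺ : ∀ {m} s → All (_< m) s → s ∈ allWords m (length s)
∈-allWords⁺ []      []        = here refl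
∈-allWords⁺ {m} (a ∷ s) (a<m ∷ s<) =
  MP.∈-concatMap⁺ (λ v → map (v ∷_) (allWords m (length s))) (lose (MP.∈-upTo⁺ a<m) (MP.∈-map⁺ (a ∷_) (∈-allWords⁺ s s<)))

allWords-bounded : ∀ m n → All (λ s → length s ≡ n × All (_< m) s) (allWords m n)
allWords-bounded m zero    = (refl , []) ∷ []
allWords-bounded m (suc n) = All-concatMap (λ v → map (v ∷_) (allWords m n))
  (All.tabulate (λ v∈ → AllP.map⁺ (All.map (λ (len , s<) → cong suc len , MP.∈-upTo⁻ v∈ ∷ s<) (allWords-bounded m n))))

allWords-unique : ∀ m n → Unique (allWords m n)
allWords-unique m zero    = [] ∷ []
allWords-unique m (suc n) = unique-concatMap (λ v → map (v ∷_) (allWords m n)) (UP.upTo⁺ m)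
  (λ _ → UP.map⁺ LP.∷-injectiveʳ (allWords-unique m n)) (λ _ _ → same)
  where
  same : ∀ {u v : ℕ} {s : List ℕ} → s ∈ map (u ∷_) (allWords m n) → s ∈ map (v ∷_) (allWords m n) → u ≡ v
  same p q with ∈-map-∷ p | ∈-map-∷ q
  ... | _ , refl , _ | _ , refl , _ = refl

Ascending : List ℕ → Set
Ascending = AllPairs _≤_

∧-true : ∀ {a b} → a ∧ b ≡ true → a ≡ true × b ≡ true
∧-true {true} {true} _ = refl , refl

weakInc⇒ascending : ∀ s → weakInc s ≡ true → Ascending s
weakInc⇒ascending []          _  = []
weakInc⇒ascending (a ∷ [])    _  = [] ∷ []
weakInc⇒ascending (a ∷ b ∷ s) eq = prepend (weakInc⇒ascending (b ∷ s) (proj₂ (∧-true {a ≤ᵇ b} eq)))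
  where
  a≤b : a ≤ b
  a≤b = ℕP.≤ᵇ⇒≤ a b (subst T (sym (proj₁ (∧-true {a ≤ᵇ b} eq))) tt)
  prepend : Ascending (b ∷ s) → Ascending (a ∷ b ∷ s)
  prepend (b≤ ∷ asc) = (a≤b ∷ All.map (ℕP.≤-trans a≤b) b≤) ∷ b≤ ∷ asc

ascending⇒weakInc : ∀ {s} → Ascending s → weakInc s ≡ true
ascending⇒weakInc []                      = refl
ascending⇒weakInc ([] ∷ [])               = refl
ascending⇒weakInc ((a≤b ∷ _) ∷ b≤ ∷ asc) = cong₂ _∧_ (≤⇒≤ᵇ≡ a≤b) (ascending⇒weakInc (b≤ ∷ asc))

expand-ascending : ∀ v α → Ascending (expand v α)
expand-ascending v []      = []
expand-ascending v (a ∷ α) = APP.++⁺ (const a) (expand-ascending (suc v) α)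
  (AllP.replicate⁺ a (All.map ℕP.<⇒≤ (expand-≥ (suc v) α)))
  where
  const : ∀ a → Ascending (replicate a v)
  const zero    = []
  const (suc a) = AllP.replicate⁺ a ℕP.≤-refl ∷ const a

expand-< : ∀ v α → All (_< v ℕ.+ length α) (expand v α)
expand-< v []      = []
expand-< v (a ∷ α) = AllP.++⁺ (AllP.replicate⁺ a (ℕP.m<m+n v (s≤s z≤n)))
  (subst (λ m → All (_< m) (expand (suc v) α)) (sym (ℕP.+-suc v (length α))) (expand-< (suc v) α))

contentFrom-cong : ∀ {s t} v α → (∀ u → v ≤ u → occ u s ≡ occ u t) → contentFrom s v α ≡ contentFrom t v α
contentFrom-cong v []      eq = refl
contentFrom-cong v (a ∷ α) eq = cong₂ (λ o c → (o ≡ᵇ a) ∧ c) (eq v ℕP.≤-refl) (contentFrom-cong (suc v) α (λ u v<u → eq u (ℕP.<⇒≤ v<u)))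

occ-skip : ∀ u v b s → v < u → occ u (replicate b v ++ s) ≡ occ u s
occ-skip u v b s v<u = trans (count-++ (u ≡ᵇ_) (replicate b v) s)
  (cong (ℕ._+ occ u s) (count-none (u ≡ᵇ_) (AllP.replicate⁺ b (≢⇒≡ᵇ≡ (ℕP.>⇒≢ v<u)))))

contentFrom-expand : ∀ v α → contentFrom (expand v α) v α ≡ true
contentFrom-expand v []      = refl
contentFrom-expand v (a ∷ α) = cong₂ _∧_ (trans (cong (_≡ᵇ a) (occ-expand v a α)) (≡ᵇ-refl a))
  (trans (contentFrom-cong (suc v) α (λ u v<u → occ-skip u v a (expand (suc v) α) v<u)) (contentFrom-expand (suc v) α))

split-ascending : ∀ v s → Ascending s → All (v ≤_) s → ∃ λ b → ∃ λ s′ → s ≡ replicate b v ++ s′ × All (suc v ≤_) s′ × Ascending s′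
split-ascending v []      _ _ = 0 , [] , refl , [] , []
split-ascending v (x ∷ s) (x≤ ∷ asc) (v≤x ∷ v≤) with ℕP.m≤n⇒m<n∨m≡n v≤x
... | inj₁ v<x = 0 , x ∷ s , refl , v<x ∷ All.map (ℕP.≤-trans v<x) x≤ , x≤ ∷ asc
... | inj₂ refl with split-ascending v s asc v≤
...   | b , s′ , refl , v< , asc′ = suc b , s′ , refl , v< , asc′

expand-unique : ∀ v α s → Ascending s → All (v ≤_) s → All (_< v ℕ.+ length α) s → contentFrom s v α ≡ true → s ≡ expand v α
expand-unique v []      []      _   _         _         _ = refl
expand-unique v []      (x ∷ s) _   (v≤x ∷ _) (x<v ∷ _) _ =
  ⊥-elim (ℕP.<⇒≱ (subst (x <_) (ℕP.+-identityʳ v) x<v) v≤x)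
expand-unique v (a ∷ α) s asc v≤ s< eq with split-ascending v s asc v≤ | ∧-true {occ v s ≡ᵇ a} eq
... | b , s′ , refl , v< , asc′ | p , q = cong₂ (λ c t → replicate c v ++ t) b≡a
  (expand-unique (suc v) α s′ asc′ v<
    (subst (λ m → All (_< m) s′) (ℕP.+-suc v (length α)) (AllP.++⁻ʳ (replicate b v) s<))
    (trans (sym (contentFrom-cong (suc v) α (λ u v<u → occ-skip u v b s′ v<u))) q))
  where
  b≡a : b ≡ a
  b≡a = trans (sym (trans (count-++ (v ≡ᵇ_) (replicate b v) s′) (trans (cong₂ ℕ._+_
      (trans (count-all (v ≡ᵇ_) (AllP.replicate⁺ b (≡ᵇ-refl v))) (LP.length-replicate b))
      (count-none (v ≡ᵇ_) (All.map (λ lt → ≢⇒≡ᵇ≡ (ℕP.<⇒≢ lt)) v<))) (ℕP.+-identityʳ b))))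
    (ℕP.≡ᵇ⇒≡ _ _ (subst T (sym p) tt))

-- Only one weakly increasing word has content α, so the coefficient is 0 or 1.
coeffF-eval : ∀ n σ α → pos (coeffF n σ α) ≡ ind (n ℕP.≟ sum α) * indᵇ (sigOK (expand 0 α) σ)
coeffF-eval n σ α = trans (pos-count p (allWords m n)) eval
  where
  m = length α
  E = expand 0 α
  p : List ℕ → Bool
  p s = weakInc s ∧ sigOK s σ ∧ hasContent s α
  pE : p E ≡ sigOK E σ
  pE = trans (cong₂ (λ a b → a ∧ sigOK E σ ∧ b) (ascending⇒weakInc (expand-ascending 0 α))
         (trans (hasContent-unfold E α) (contentFrom-expand 0 α))) (lemma (sigOK E σ))
    where
    lemma : ∀ b → true ∧ b ∧ true ≡ b
    lemma true  = refl
    lemma false = refl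
  vanish : ∀ {s} → s ∈ allWords m n → s ≢ E → indᵇ (p s) ≡ 0ℤ
  vanish {s} s∈ ≢E with p s in eq
  ... | false = refl
  ... | true with ∧-true {weakInc s} eq
  ...   | w , r = ⊥-elim (≢E (expand-unique 0 α s (weakInc⇒ascending s w) (All.universal (λ _ → z≤n) s)
    (proj₂ (All.lookup (allWords-bounded m n) s∈)) (trans (sym (hasContent-unfold s α)) (proj₂ (∧-true {sigOK s σ} r)))))
  eval : ∑ (allWords m n) (λ s → indᵇ (p s)) ≡ ind (n ℕP.≟ sum α) * indᵇ (sigOK E σ)
  eval = go (n ℕP.≟ sum α)
    where
    go : (d : Dec (n ≡ sum α)) → ∑ (allWords m n) (λ s → indᵇ (p s)) ≡ ind d * indᵇ (sigOK E σ)
    go (yes refl) = trans (∑-single (λ s → indᵇ (p s)) (allWords-unique m n)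
      (subst (λ l → E ∈ allWords m l) (length-expand 0 α) (∈-allWords⁺ E (expand-< 0 α))) vanish)
      (trans (cong indᵇ pE) (sym (ℤP.*-identityˡ _)))
    go (no ≢) = ∑-zero-∈ (allWords m n) (λ {s} s∈ → vanish s∈ (λ { refl → ≢
      (trans (sym (proj₁ (All.lookup (allWords-bounded m n) s∈))) (length-expand 0 α)) }))

ascents : Word → List Bool
ascents (x ∷ y ∷ v) = (x <ᵇ y) ∷ ascents (y ∷ v)
ascents _           = []

linked⇒increasing : ∀ {v} → Linked _<_ v → Increasing v
linked⇒increasing []             = []
linked⇒increasing [-]            = [] ∷ []
linked⇒increasing (x<y ∷ l) with linked⇒increasing l
... | y< ∷ inc = (x<y ∷ All.map (ℕP.<-trans x<y) y<) ∷ y< ∷ inc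

sigOK⇒increasing : ∀ u α v → length v ≡ sum α → sigOK (expand u α) (ascents v) ≡ true → All (Linked _<_) (chop α v)
sigOK⇒increasing u []                _  _   _  = []
sigOK⇒increasing u (zero ∷ α)        v  len ok = [] ∷ sigOK⇒increasing (suc u) α v len ok
sigOK⇒increasing u (suc zero ∷ α)    (x ∷ v) len ok = [-] ∷ sigOK⇒increasing (suc u) α v (ℕP.suc-injective len)
  (drop-first (expand (suc u) α) v (trans (ℕP.suc-injective len) (sym (length-expand (suc u) α))) ok)
  where
  drop-first : ∀ E v → length v ≡ length E → sigOK (u ∷ E) (ascents (x ∷ v)) ≡ true → sigOK E (ascents v) ≡ true
  drop-first []      []      _ _  = refl
  drop-first (e ∷ E) (y ∷ v) _ ok = proj₂ (∧-true {not (u ≡ᵇ e) ∨ (x <ᵇ y)} ok)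
sigOK⇒increasing u (suc (suc a) ∷ α) (x ∷ y ∷ v) len ok =
  prepend (sigOK⇒increasing u (suc a ∷ α) (y ∷ v) (ℕP.suc-injective len) (proj₂ (∧-true {not (u ≡ᵇ u) ∨ (x <ᵇ y)} ok)))
  where
  x<y : x < y
  x<y = ℕP.<ᵇ⇒< x y (subst T (sym (trans (cong (λ b → not b ∨ (x <ᵇ y)) (sym (≡ᵇ-refl u)))
    (proj₁ (∧-true {not (u ≡ᵇ u) ∨ (x <ᵇ y)} ok)))) tt)
  prepend : All (Linked _<_) (chop (suc a ∷ α) (y ∷ v)) → All (Linked _<_) (chop (suc (suc a) ∷ α) (x ∷ y ∷ v))
  prepend (l ∷ ls) = (x<y ∷ l) ∷ ls

increasing⇒sigOK : ∀ u α v → length v ≡ sum α → All Increasing (chop α v) → sigOK (expand u α) (ascents v) ≡ true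
increasing⇒sigOK u []                _  _   _        = refl
increasing⇒sigOK u (zero ∷ α)        v  len (_ ∷ is) = increasing⇒sigOK (suc u) α v len is
increasing⇒sigOK u (suc zero ∷ α)    (x ∷ v) len (_ ∷ is) =
  step (expand (suc u) α) v (expand-≥ (suc u) α) (increasing⇒sigOK (suc u) α v (ℕP.suc-injective len) is)
  where
  step : ∀ E v → All (suc u ≤_) E → sigOK E (ascents v) ≡ true → sigOK (u ∷ E) (ascents (x ∷ v)) ≡ true
  step []      v       _         ok = refl
  step (e ∷ E) []      _         ok = refl
  step (e ∷ E) (y ∷ v) (u<e ∷ _) ok = cong₂ _∧_ (cong (λ b → not b ∨ (x <ᵇ y)) (≢⇒≡ᵇ≡ (ℕP.<⇒≢ u<e))) ok
increasing⇒sigOK u (suc (suc a) ∷ α) (x ∷ y ∷ v) len (((x<y ∷ _) ∷ i) ∷ is) =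
  cong₂ _∧_ (trans (cong (λ b → not b ∨ (x <ᵇ y)) (≡ᵇ-refl u)) (<⇒<ᵇ≡ x<y))
    (increasing⇒sigOK u (suc a ∷ α) (y ∷ v) (ℕP.suc-injective len) (i ∷ is))

-- Equal letters of `expand 0 α` mark neighbours inside one block, and there the signature has to be
-- +1, which is an ascent of `v`.
coeffF-ascents : ∀ α v → pos (coeffF (length v) (ascents v) α) ≡ ind (runs? α v)
coeffF-ascents α v = trans (coeffF-eval (length v) (ascents v) α) (go (length v ℕP.≟ sum α))
  where
  ok = sigOK (expand 0 α) (ascents v)
  go : (d : Dec (length v ≡ sum α)) → ind d * indᵇ ok ≡ ind (runs? α v)
  go (no ≢)    = sym (ind-no (runs? α v) (≢ ∘ proj₁))
  go (yes len) with ok in eq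
  ... | true  = sym (ind-yes (runs? α v) (len , All.map linked⇒increasing (sigOK⇒increasing 0 α v len eq)))
  ... | false = sym (ind-no (runs? α v) (λ (_ , inc) → true≢false (trans (sym (increasing⇒sigOK 0 α v len inc)) eq)))

-- Fillings and reading words

AllPairs-map-∈ : {A : Set} {R S : A → A → Set} {xs : List A} → (∀ {x y} → x ∈ xs → y ∈ xs → R x y → S x y) →
  AllPairs R xs → AllPairs S xs
AllPairs-map-∈ f []        = []
AllPairs-map-∈ f (rs ∷ ps) =
  All.tabulate (λ y∈ → f (here refl) (there y∈) (All.lookup rs y∈)) ∷ AllPairs-map-∈ (λ x∈ y∈ → f (there x∈) (there y∈)) ps

unique-map-∈ : {A B : Set} (h : A → B) {xs : List A} → Unique xs →
  (∀ {x y} → x ∈ xs → y ∈ xs → h x ≡ h y → x ≡ y) → Unique (map h xs)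
unique-map-∈ h u inj = APP.map⁺ (AllPairs-map-∈ (λ x∈ y∈ x≢y eq → x≢y (inj x∈ y∈ eq)) u)

map-cong-∈ : {A B : Set} {f g : A → B} (xs : List A) → (∀ {x} → x ∈ xs → f x ≡ g x) → map f xs ≡ map g xs
map-cong-∈ []       eq = refl
map-cong-∈ (x ∷ xs) eq = cong₂ _∷_ (eq (here refl)) (map-cong-∈ xs (eq ∘ there))

zip-map : {A B : Set} (f : A → B) (xs : List A) → zip xs (map f xs) ≡ map (λ x → x , f x) xs
zip-map f []       = refl
zip-map f (x ∷ xs) = cong (_ ∷_) (zip-map f xs)

zip-proj₁ : {A B : Set} (xs : List A) (ys : List B) → length xs ≡ length ys → map proj₁ (zip xs ys) ≡ xs
zip-proj₁ []       []       _  = refl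
zip-proj₁ (x ∷ xs) (y ∷ ys) eq = cong (x ∷_) (zip-proj₁ xs ys (ℕP.suc-injective eq))

zip-proj₂ : {A B : Set} (xs : List A) (ys : List B) → length xs ≡ length ys → map proj₂ (zip xs ys) ≡ ys
zip-proj₂ []       []       _  = refl
zip-proj₂ (x ∷ xs) (y ∷ ys) eq = cong (y ∷_) (zip-proj₂ xs ys (ℕP.suc-injective eq))

-- Orderings as inverses of fillings

module Indexing {A : Set} (_≟_ : (x y : A) → Dec (x ≡ y)) where

  index : A → List A → ℕ
  index x []      = 0
  index x (y ∷ o) = if does (x ≟ y) then 0 else suc (index x o)

  index-head : ∀ x o → index x (x ∷ o) ≡ 0
  index-head x o with x ≟ x
  ... | yes _ = refl
  ... | no ≢  = ⊥-elim (≢ refl)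

  index-tail : ∀ {x y} o → x ≢ y → index x (y ∷ o) ≡ suc (index x o)
  index-tail {x} {y} o x≢y with x ≟ y
  ... | yes eq = ⊥-elim (x≢y eq)
  ... | no _   = refl

  index-++ : ∀ {x} X {Y} → All (x ≢_) X → index x (X ++ x ∷ Y) ≡ length X
  index-++ {x} []      {Y} []         = index-head x Y
  index-++ {x} (z ∷ X) {Y} (x≢z ∷ x∉) = trans (index-tail (X ++ x ∷ Y) x≢z) (cong suc (index-++ X x∉))

  index-increasing : ∀ {o} → Unique o → AllPairs (λ x y → index x o < index y o) o
  index-increasing []                       = []
  index-increasing {z ∷ o} (z∉ ∷ u) =
    All.map (λ z≢y → subst₂ _<_ (sym (index-head z o)) (sym (index-tail o (z≢y ∘ sym))) (s≤s z≤n)) z∉ ∷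
    AllPairs-map-∈ (λ x∈ y∈ lt → subst₂ _<_ (sym (index-tail o (All.lookup z∉ x∈ ∘ sym))) (sym (index-tail o (All.lookup z∉ y∈ ∘ sym))) (s≤s lt))
      (index-increasing u)

  index-<⇒ : ∀ {R : A → A → Set} {o x y} → AllPairs R o → x ∈ o → y ∈ o → index x o < index y o → R x y
  index-<⇒ {o = z ∷ o} {x} {y} (rs ∷ ps) x∈ y∈ lt with y ≟ z | x ≟ z | lt
  ... | no y≢z | yes refl | _       = All.lookup rs (tail y≢z y∈)
    where
    tail : ∀ {y z} → y ≢ z → y ∈ z ∷ o → y ∈ o
    tail ≢ (here eq)  = ⊥-elim (≢ eq)
    tail ≢ (there y∈) = y∈
  ... | no y≢z | no x≢z   | s≤s lt′ = index-<⇒ ps (tail x≢z x∈) (tail y≢z y∈) lt′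
    where
    tail : ∀ {y z} → y ≢ z → y ∈ z ∷ o → y ∈ o
    tail ≢ (here eq)  = ⊥-elim (≢ eq)
    tail ≢ (there y∈) = y∈

  index-injective : ∀ {o x y} → x ∈ o → y ∈ o → index x o ≡ index y o → x ≡ y
  index-injective {z ∷ o} {x} {y} x∈ y∈ eq with x ≟ z | y ≟ z | eq
  ... | yes refl | yes refl | _ = refl
  ... | no x≢z   | no y≢z   | e = index-injective (tail x≢z x∈) (tail y≢z y∈) (ℕP.suc-injective e)
    where
    tail : ∀ {y z} → y ≢ z → y ∈ z ∷ o → y ∈ o
    tail ≢ (here eq)  = ⊥-elim (≢ eq)
    tail ≢ (there y∈) = y∈

  index-⇐ : ∀ {R : A → A → Set} {o x y} → (∀ {x y} → R x y → ¬ R y x) → AllPairs R o → x ∈ o → y ∈ o → R x y → index x o < index y o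
  index-⇐ {R} {o} {x} {y} asym ps x∈ y∈ r with ℕP.<-cmp (index x o) (index y o)
  ... | tri< lt _ _ = lt
  ... | tri≈ _ eq _ = ⊥-elim (asym r (subst₂ R (index-injective x∈ y∈ eq) (sym (index-injective x∈ y∈ eq)) r))
  ... | tri> _ _ gt = ⊥-elim (asym r (index-<⇒ ps y∈ x∈ gt))

  map-index : ∀ {o} → Unique o → map (λ x → suc (index x o)) o ≡ applyUpTo suc (length o)
  map-index []                 = refl
  map-index {z ∷ o} (z∉ ∷ u) = cong₂ _∷_ (cong suc (index-head z o)) (trans
    (map-cong-∈ o (λ x∈ → cong suc (index-tail o (All.lookup z∉ x∈ ∘ sym))))
    (trans (LP.map-∘ {g = suc} {f = λ x → suc (index x o)} o) (trans (cong (map suc) (map-index u)) (LP.map-applyUpTo suc suc (length o)))))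

  map-block : ∀ α {o} → Unique o → length o ≡ sum α → map (λ x → block α (index x o)) o ≡ expand 0 α
  map-block α {o} u |o| = begin
    map (λ x → block α (index x o)) o                      ≡⟨ LP.map-∘ o ⟩
    map (block α ∘ ℕ.pred) (map (λ x → suc (index x o)) o) ≡⟨ cong (map (block α ∘ ℕ.pred)) (map-index u) ⟩
    map (block α ∘ ℕ.pred) (applyUpTo suc (length o))      ≡⟨ LP.map-applyUpTo suc (block α ∘ ℕ.pred) (length o) ⟩
    applyUpTo (block α) (length o)                         ≡⟨ cong (applyUpTo (block α)) |o| ⟩
    applyUpTo (block α) (sum α)                            ≡⟨ applyUpTo-block 0 α ⟩
    expand 0 α                                             ∎
    where open ≡-Reasoning

  module _ {C : List A} (C-unique : Unique C) where

    filling : List A → List ℕ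
    filling o = map (λ x → suc (index x o)) C

    private
      n = length C

      filling-↭ : ∀ {o} → o ↭ C → filling o ↭ applyUpTo suc n
      filling-↭ {o} p = ↭-trans (PP.map⁺ (λ x → suc (index x o)) (↭-sym p))
        (subst (_↭ applyUpTo suc n) (sym (map-index (unique-↭ (↭-sym p) C-unique)))
          (subst (λ m → applyUpTo suc (length o) ↭ applyUpTo suc m) (PP.↭-length p) ↭-refl))

      filling-injective : ∀ {o o′} → o ↭ C → o′ ↭ C → filling o ≡ filling o′ → o ≡ o′
      filling-injective {o} {o′} p p′ eq = sorted-↭⇒≡ ℕP.<-asym (index-increasing (unique-↭ (↭-sym p) C-unique))
        (AllPairs-map-∈ (λ x∈ y∈ lt → subst₂ _<_ (same (PP.∈-resp-↭ p′ x∈)) (same (PP.∈-resp-↭ p′ y∈)) lt)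
          (index-increasing (unique-↭ (↭-sym p′) C-unique)))
        (↭-trans p (↭-sym p′))
        where
        pointwise : ∀ {f g : A → ℕ} xs → map f xs ≡ map g xs → ∀ {x} → x ∈ xs → f x ≡ g x
        pointwise (x ∷ xs) eq (here refl) = LP.∷-injectiveˡ eq
        pointwise (x ∷ xs) eq (there x∈)  = pointwise xs (LP.∷-injectiveʳ eq) x∈
        same : ∀ {x} → x ∈ C → index x o′ ≡ index x o
        same x∈ = ℕP.suc-injective (sym (pointwise C eq x∈))

      filling-surjective : ∀ {T} → T ↭ applyUpTo suc n → ∃ λ o → o ↭ C × filling o ≡ T
      filling-surjective {T} p = o , o↭C , (begin
        map (λ x → suc (index x o)) C
          ≡⟨ cong (map (λ x → suc (index x o))) (sym (zip-proj₁ C T |C|≡|T|)) ⟩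
        map (λ x → suc (index x o)) (map proj₁ L)
          ≡⟨ sym (LP.map-∘ L) ⟩
        map (λ xa → suc (index (proj₁ xa) o)) L
          ≡⟨ map-cong-∈ L (λ xa∈ → value (PP.∈-resp-↭ L↭L′ xa∈)) ⟩
        map proj₂ L
          ≡⟨ zip-proj₂ C T |C|≡|T| ⟩
        T ∎)
        where
        open ≡-Reasoning
        L = zip C T
        |C|≡|T| : length C ≡ length T
        |C|≡|T| = trans (sym (LP.length-applyUpTo suc n)) (sym (PP.↭-length p))
        -- The rearrangement of `T` into 1, ..., n is lifted to the labelled cells; the cells in the
        -- new order form the ordering.
        lifted = PP.↭-map-inv proj₂ (subst (_↭ applyUpTo suc n) (sym (zip-proj₂ C T |C|≡|T|)) p)
        L′ = proj₁ lifted
        L↭L′ : L ↭ L′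
        L↭L′ = proj₂ (proj₂ lifted)
        values : applyUpTo suc n ≡ map proj₂ L′
        values = proj₁ (proj₂ lifted)
        o = map proj₁ L′
        o↭C : o ↭ C
        o↭C = ↭-trans (PP.map⁺ proj₁ (↭-sym L↭L′)) (subst (_↭ C) (sym (zip-proj₁ C T |C|≡|T|)) ↭-refl)
        nth : ∀ f m (X : List ℕ) {a Y} → applyUpTo f m ≡ X ++ a ∷ Y → a ≡ f (length X)
        nth f (suc m) []      eq = sym (LP.∷-injectiveˡ eq)
        nth f (suc m) (x ∷ X) eq = nth (f ∘ suc) m X (LP.∷-injectiveʳ eq)
        nth f zero    []      ()
        nth f zero    (x ∷ X) ()
        value : ∀ {xa} → xa ∈ L′ → suc (index (proj₁ xa) o) ≡ proj₂ xa
        value {x , a} xa∈ with MP.∈-∃++ xa∈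
        ... | X , Y , eq = begin
          suc (index x o)
            ≡⟨ cong (suc ∘ index x) o≡ ⟩
          suc (index x (map proj₁ X ++ x ∷ map proj₁ Y))
            ≡⟨ cong suc (index-++ (map proj₁ X) (All.map (λ p eq → All.head p (sym eq))
                 (proj₂ (proj₂ (AllPairs-++⁻ (map proj₁ X) (subst Unique o≡ (unique-↭ (↭-sym o↭C) C-unique))))))) ⟩
          suc (length (map proj₁ X))
            ≡⟨ cong suc (trans (LP.length-map proj₁ X) (sym (LP.length-map proj₂ X))) ⟩
          suc (length (map proj₂ X))
            ≡⟨ sym (nth suc n (map proj₂ X) (trans values (trans (cong (map proj₂) eq) (LP.map-++ proj₂ X ((x , a) ∷ Y))))) ⟩
          a ∎
          where
          o≡ : o ≡ map proj₁ X ++ x ∷ map proj₁ Y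
          o≡ = trans (cong (map proj₁) eq) (LP.map-++ proj₁ X ((x , a) ∷ Y))

    ∑-fillings : ∀ (F : List ℕ → ℤ) → ∑ (perms (applyUpTo suc n)) F ≡ ∑ (perms C) (F ∘ filling)
    ∑-fillings F = trans (∑-↭ F (↭-sym bijection)) (∑-map filling (perms C) F)
      where
      bijection : map filling (perms C) ↭ perms (applyUpTo suc n)
      bijection = unique-≈⇒↭
        (unique-map-∈ filling (perms-unique C-unique) (λ o∈ o′∈ → filling-injective (perms⇒↭ C o∈) (perms⇒↭ C o′∈)))
        (perms-unique (UP.applyUpTo⁺₁ suc n (λ i<j _ eq → ℕP.<⇒≢ i<j (ℕP.suc-injective eq))))
        (λ T∈ → let (o , o∈ , eq) = MP.∈-map⁻ filling T∈ in
          ↭⇒perms _ (subst (_↭ applyUpTo suc n) (sym eq) (filling-↭ (perms⇒↭ C o∈))))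
        (λ T∈ → let (o , p , eq) = filling-surjective (perms⇒↭ _ T∈) in
          subst (_∈ map filling (perms C)) eq (MP.∈-map⁺ filling (↭⇒perms C p)))

count-false-∈ : {A : Set} (p : A → Bool) (xs : List A) → (∀ {x} → x ∈ xs → p x ≡ false) → count p xs ≡ 0
count-false-∈ p xs f = count-none p (All.tabulate f)

count-cong-∈ : {A : Set} {p q : A → Bool} (xs : List A) → (∀ {x} → x ∈ xs → p x ≡ q x) → count p xs ≡ count q xs
count-cong-∈         []       eq = refl
count-cong-∈ {p = p} {q} (x ∷ xs) eq with p x | q x | eq (here refl)
... | true  | _ | refl = cong suc (count-cong-∈ xs (eq ∘ there))
... | false | _ | refl = count-cong-∈ xs (eq ∘ there)

count-∷ : {A : Set} (p : A → Bool) (x : A) (xs : List A) → count p (x ∷ xs) ≡ (if p x then 1 else 0) ℕ.+ count p xs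
count-∷ p x xs with p x
... | true  = refl
... | false = refl

count-↭ : {A : Set} (p : A → Bool) {xs ys : List A} → xs ↭ ys → count p xs ≡ count p ys
count-↭ p Perm.refl         = refl
count-↭ p (Perm.prep {xs} {ys} x q) = trans (count-∷ p x xs) (trans (cong (_ ℕ.+_) (count-↭ p q)) (sym (count-∷ p x ys)))
count-↭ p (Perm.swap {xs} {ys} x y q) = begin
  count p (x ∷ y ∷ xs)          ≡⟨ trans (count-∷ p x (y ∷ xs)) (cong (bx ℕ.+_) (count-∷ p y xs)) ⟩
  bx ℕ.+ (by ℕ.+ count p xs)    ≡⟨ rearrange bx by (count p xs) ⟩
  by ℕ.+ (bx ℕ.+ count p xs)    ≡⟨ cong (λ c → by ℕ.+ (bx ℕ.+ c)) (count-↭ p q) ⟩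
  by ℕ.+ (bx ℕ.+ count p ys)    ≡⟨ sym (trans (count-∷ p y (x ∷ ys)) (cong (by ℕ.+_) (count-∷ p x ys))) ⟩
  count p (y ∷ x ∷ ys)          ∎
  where
  open ≡-Reasoning
  bx = if p x then 1 else 0
  by = if p y then 1 else 0
  rearrange : ∀ a b c → a ℕ.+ (b ℕ.+ c) ≡ b ℕ.+ (a ℕ.+ c)
  rearrange = ℕSolver.solve-∀
count-↭ p (Perm.trans q r)  = trans (count-↭ p q) (count-↭ p r)

count-map : {A B : Set} (p : B → Bool) (h : A → B) (xs : List A) → count p (map h xs) ≡ count (p ∘ h) xs
count-map p h []       = refl
count-map p h (x ∷ xs) with p (h x)
... | true  = cong suc (count-map p h xs)
... | false = count-map p h xs

<ᵇ-cong : ∀ {a b c d} → (a < b → c < d) → (c < d → a < b) → (a <ᵇ b) ≡ (c <ᵇ d)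
<ᵇ-cong {a} {b} f g with a ℕP.<? b
... | yes lt = trans (<⇒<ᵇ≡ lt) (sym (<⇒<ᵇ≡ (f lt)))
... | no ¬lt = trans (≮⇒<ᵇ≡ ¬lt) (sym (≮⇒<ᵇ≡ (¬lt ∘ g)))

-- The inductive form of `map b o ≡ expand v sh`, along which `chop` can be followed block by block.
data Blocks {A : Set} (b : A → ℕ) (v : ℕ) : List ℕ → List A → Set where
  []   : Blocks b v [] []
  cons : ∀ o₁ {o₂ sh} → All (λ x → b x ≡ v) o₁ → Blocks b (suc v) sh o₂ → Blocks b v (length o₁ ∷ sh) (o₁ ++ o₂)

module _ {A : Set} (b : A → ℕ) (idx : A → ℕ) where

  toBlocks : ∀ v sh o → map b o ≡ expand v sh → Blocks b v sh o
  toBlocks v []       []      eq = []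
  toBlocks v (a ∷ sh) o       eq with map-split b o (replicate a v) eq
  ... | o₁ , o₂ , refl , eq₁ , eq₂ =
    subst (λ m → Blocks b v (m ∷ sh) (o₁ ++ o₂)) (trans (sym (LP.length-map b o₁)) (trans (cong length eq₁) (LP.length-replicate a)))
      (cons o₁ (AllP.map⁻ (subst (All (_≡ v)) (sym eq₁) (AllP.replicate⁺ a refl))) (toBlocks (suc v) sh o₂ eq₂))

  blocks-≥ : ∀ {v sh o} → Blocks b v sh o → All (λ x → v ≤ b x) o
  blocks-≥ []              = []
  blocks-≥ (cons o₁ eqs bs) = AllP.++⁺ (All.map (ℕP.≤-reflexive ∘ sym) eqs) (All.map ℕP.<⇒≤ (blocks-≥ bs))

  chop-cons : ∀ o₁ o₂ sh → chop (length o₁ ∷ sh) (map idx (o₁ ++ o₂)) ≡ map idx o₁ ∷ chop sh (map idx o₂)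
  chop-cons o₁ o₂ sh = cong₂ (λ u w → u ∷ chop sh w)
    (trans (cong₂ List.take (sym (LP.length-map idx o₁)) (LP.map-++ idx o₁ o₂)) (take-++ (map idx o₁) (map idx o₂)))
    (trans (cong₂ List.drop (sym (LP.length-map idx o₁)) (LP.map-++ idx o₁ o₂)) (drop-++ (map idx o₁) (map idx o₂)))

  SameBlockIncrease : A → A → Set
  SameBlockIncrease x y = b x ≡ b y → idx x < idx y

  sameBlock⇒runs : ∀ {v sh o} → Blocks b v sh o → AllPairs SameBlockIncrease o → All Increasing (chop sh (map idx o))
  sameBlock⇒runs []                              _  = []
  sameBlock⇒runs (cons o₁ {o₂} {sh} eqs bs) ps with AllPairs-++⁻ o₁ ps
  ... | p₁ , p₂ , _ = subst (All Increasing) (sym (chop-cons o₁ o₂ sh))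
    (APP.map⁺ (AllPairs-map-∈ (λ x∈ y∈ f → f (trans (All.lookup eqs x∈) (sym (All.lookup eqs y∈)))) p₁) ∷ sameBlock⇒runs bs p₂)

  runs⇒sameBlock : ∀ {v sh o} → Blocks b v sh o → All Increasing (chop sh (map idx o)) → AllPairs SameBlockIncrease o
  runs⇒sameBlock []                         _  = []
  runs⇒sameBlock (cons o₁ {o₂} {sh} eqs bs) is with subst (All Increasing) (chop-cons o₁ o₂ sh) is
  ... | i ∷ is′ = APP.++⁺ (AllPairs.map (λ lt _ → lt) (APP.map⁻ i)) (runs⇒sameBlock bs is′)
    (All.map (λ { refl → All.map (λ lt eq → ⊥-elim (ℕP.<⇒≢ lt eq)) (blocks-≥ bs) }) eqs)

  ge gt : ℕ → ℕ → List A → ℕ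
  ge j c = count (λ y → does (b y ℕP.≟ j) ∧ (c ≤ᵇ idx y))
  gt j c = count (λ y → does (b y ℕP.≟ j) ∧ (c <ᵇ idx y))

  private
    does-no : ∀ {m n} → m ≢ n → does (m ℕP.≟ n) ≡ false
    does-no ≢ = ≢⇒≡ᵇ≡ ≢
    does-yes : ∀ {m n} → m ≡ n → does (m ℕP.≟ n) ≡ true
    does-yes {m} refl = ≡ᵇ-refl m

    count-other : ∀ j (q : A → Bool) {o} → All (λ y → b y ≢ j) o → count (λ y → does (b y ℕP.≟ j) ∧ q y) o ≡ 0
    count-other j q ≢s = count-none _ (All.map (λ {y} ≢ → cong (_∧ q y) (does-no ≢)) ≢s)

    count-same : ∀ j (q : A → Bool) {o} → All (λ y → b y ≡ j) o → count (λ y → does (b y ℕP.≟ j) ∧ q y) o ≡ count q o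
    count-same j q {o} eqs = count-cong-∈ o (λ {y} y∈ → cong (_∧ q y) (does-yes (All.lookup eqs y∈)))

    count-++-left : ∀ j (q : A → Bool) o₁ {o₂} → All (λ y → b y ≡ j) o₁ → All (λ y → b y ≢ j) o₂ →
      count (λ y → does (b y ℕP.≟ j) ∧ q y) (o₁ ++ o₂) ≡ count q o₁
    count-++-left j q o₁ {o₂} eqs ≢s = trans (count-++ _ o₁ o₂) (trans (cong₂ ℕ._+_ (count-same j q eqs) (count-other j q ≢s)) (ℕP.+-identityʳ _))

    count-++-right : ∀ j (q : A → Bool) o₁ {o₂} → All (λ y → b y ≢ j) o₁ →
      count (λ y → does (b y ℕP.≟ j) ∧ q y) (o₁ ++ o₂) ≡ count (λ y → does (b y ℕP.≟ j) ∧ q y) o₂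
    count-++-right j q o₁ {o₂} ≢s = trans (count-++ _ o₁ o₂) (cong (ℕ._+ count (λ y → does (b y ℕP.≟ j) ∧ q y) o₂) (count-other j q ≢s))

  -- `Good` expressed by counting cells of the whole ordering. Such counts are invariant under
  -- permutation, so they can be compared with counts in the reading order. The bound `v ≤ j` allows
  -- the first block to be dropped.
  Dominated : ℕ → List A → Set
  Dominated v o = ∀ {x} → x ∈ o → ∀ j → v ≤ j → b x ≡ suc j → ge (suc j) (idx x) o ≤ gt j (idx x) o

  private
    first-block : ∀ {v sh o} → Blocks b v sh o → ∃ λ o₃ → ∃ λ o₄ → o ≡ o₃ ++ o₄ × hd (chop sh (map idx o)) ≡ map idx o₃ ×
      All (λ x → b x ≡ v) o₃ × All (λ x → v < b x) o₄
    first-block []                         = [] , [] , refl , refl , [] , []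
    first-block (cons o₁ {o₂} {sh} eqs bs) = o₁ , o₂ , refl , cong hd (chop-cons o₁ o₂ sh) , eqs , blocks-≥ bs

    tail-counts : ∀ {v} o₁ o₂ → All (λ x → b x ≡ v) o₁ → ∀ j c → suc v ≤ j →
      ge (suc j) c (o₁ ++ o₂) ≡ ge (suc j) c o₂ × gt j c (o₁ ++ o₂) ≡ gt j c o₂
    tail-counts o₁ o₂ eqs j c v<j =
      count-++-right (suc j) _ o₁ (All.map (λ { refl → ℕP.<⇒≢ (ℕP.m<n⇒m<1+n v<j) }) eqs) ,
      count-++-right j _ o₁ (All.map (λ { refl → ℕP.<⇒≢ v<j }) eqs)

    head-counts : ∀ {v} o₁ o₃ o₄ → All (λ x → b x ≡ v) o₁ → All (λ x → b x ≡ suc v) o₃ → All (λ x → suc v < b x) o₄ → ∀ c →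
      ge (suc v) c (o₁ ++ o₃ ++ o₄) ≡ count (c ≤ᵇ_) (map idx o₃) × gt v c (o₁ ++ o₃ ++ o₄) ≡ count (c <ᵇ_) (map idx o₁)
    head-counts {v} o₁ o₃ o₄ e₁ e₃ e₄ c =
      trans (count-++-right (suc v) _ o₁ (All.map (λ { refl → ℕP.<⇒≢ (ℕP.n<1+n _) }) e₁))
        (trans (count-++-left (suc v) _ o₃ e₃ (All.map ℕP.>⇒≢ e₄)) (sym (count-map (c ≤ᵇ_) idx o₃))) ,
      trans (count-++-left v _ o₁ e₁ (AllP.++⁺ (All.map (λ eq → ℕP.>⇒≢ (ℕP.≤-reflexive (sym eq))) e₃)
          (All.map (λ lt → ℕP.>⇒≢ (ℕP.<-trans (ℕP.n<1+n v) lt)) e₄)))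
        (sym (count-map (c <ᵇ_) idx o₁))

  dominated⇒good : ∀ {v sh o} → Blocks b v sh o → Dominated v o → Good (chop sh (map idx o))
  dominated⇒good []                             _   = []
  dominated⇒good {v} (cons o₁ {o₂} {sh} e₁ bs) dom with first-block bs
  ... | o₃ , o₄ , refl , hd≡ , e₃ , e₄ = subst Good (sym (chop-cons o₁ (o₃ ++ o₄) sh))
    (subst (Fits (map idx o₁)) (sym hd≡) (AllP.map⁺ (All.tabulate fit)) ∷ dominated⇒good bs dom′)
    where
    fit : ∀ {x} → x ∈ o₃ → count (idx x ≤ᵇ_) (map idx o₃) ≤ count (idx x <ᵇ_) (map idx o₁)
    fit {x} x∈ = subst₂ _≤_ (proj₁ counts) (proj₂ counts) (dom (MP.∈-++⁺ʳ o₁ (MP.∈-++⁺ˡ x∈)) v ℕP.≤-refl (All.lookup e₃ x∈))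
      where counts = head-counts o₁ o₃ o₄ e₁ e₃ e₄ (idx x)
    dom′ : Dominated (suc v) (o₃ ++ o₄)
    dom′ {x} x∈ j v<j eq = subst₂ _≤_ (proj₁ counts) (proj₂ counts) (dom (MP.∈-++⁺ʳ o₁ x∈) j (ℕP.<⇒≤ v<j) eq)
      where counts = tail-counts o₁ (o₃ ++ o₄) e₁ j (idx x) v<j

  good⇒dominated : ∀ {v sh o} → Blocks b v sh o → Good (chop sh (map idx o)) → Dominated v o
  good⇒dominated []                             _    ()
  good⇒dominated {v} (cons o₁ {o₂} {sh} e₁ bs) good {x} x∈ j v≤j eq
    with first-block bs | subst Good (chop-cons o₁ o₂ sh) good
  ... | o₃ , o₄ , refl , hd≡ , e₃ , e₄ | fits ∷ good′ with ℕP.m≤n⇒m<n∨m≡n v≤j | MP.∈-++⁻ o₁ x∈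
  ...   | _         | inj₁ x∈₁ = ⊥-elim (ℕP.<⇒≱ (ℕP.≤-reflexive (sym eq)) (subst (_≤ j) (sym (All.lookup e₁ x∈₁)) v≤j))
  ...   | inj₁ v<j  | inj₂ x∈₂ = subst₂ _≤_ (sym (proj₁ counts)) (sym (proj₂ counts)) (good⇒dominated bs good′ x∈₂ j v<j eq)
    where counts = tail-counts o₁ (o₃ ++ o₄) e₁ j (idx x) v<j
  ...   | inj₂ refl | inj₂ x∈₂ with MP.∈-++⁻ o₃ x∈₂
  ...     | inj₂ x∈₄ = ⊥-elim (ℕP.<⇒≢ (All.lookup e₄ x∈₄) (sym eq))
  ...     | inj₁ x∈₃ = subst₂ _≤_ (sym (proj₁ counts)) (sym (proj₂ counts))
    (All.lookup (AllP.map⁻ (subst (Fits (map idx o₁)) hd≡ fits)) x∈₃)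
    where counts = head-counts o₁ o₃ o₄ e₁ e₃ e₄ (idx x)

-- Reading words of standard orderings

module ReadingWord (P : Poset) (S : Switchable P) (_≟_ : (x y : Poset.A P) → Dec (x ≡ y)) where
  open Poset P
  open Switchable S
  open Indexing _≟_

  infix 4 _≪_
  _≪_ : A → A → Set
  x ≪ y = idx x < idx y ⊎ (idx x ≡ idx y × x ≺ y)

  ≪-asym : ∀ {x y} → x ≪ y → ¬ y ≪ x
  ≪-asym (inj₁ p)       (inj₁ q)       = ℕP.<-asym p q
  ≪-asym (inj₁ p)       (inj₂ (e , _)) = ℕP.<⇒≢ p (sym e)
  ≪-asym (inj₂ (e , _)) (inj₁ q)       = ℕP.<⇒≢ q (sym e)
  ≪-asym (inj₂ (_ , p)) (inj₂ (_ , q)) = ≺-irrefl (≺-trans p q)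

  ≪-idx : ∀ {x y} → x ≪ y → idx x ≤ idx y
  ≪-idx (inj₁ p)       = ℕP.<⇒≤ p
  ≪-idx (inj₂ (e , _)) = ℕP.≤-reflexive e

  module _ {R : List A} (R↭ : R ↭ C) (R-sorted : AllPairs _≪_ R) {o : List A} (o↭ : o ↭ C) (std : Standard o) where

    private
      n = length C
      g : A → ℕ
      g x = suc (index x o)
      o-unique : Unique o
      o-unique = unique-↭ (↭-sym o↭) C-unique
      C⇒o : ∀ {x} → x ∈ C → x ∈ o
      C⇒o = PP.∈-resp-↭ (↭-sym o↭)
      o⇒C : ∀ {x} → x ∈ o → x ∈ C
      o⇒C = PP.∈-resp-↭ o↭
      R⇒C : ∀ {x} → x ∈ R → x ∈ C
      R⇒C = PP.∈-resp-↭ R↭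
      C⇒R : ∀ {x} → x ∈ C → x ∈ R
      C⇒R = PP.∈-resp-↭ (↭-sym R↭)

    ≺⇒index : ∀ {x y} → x ∈ C → y ∈ C → x ≺ y → index x o < index y o
    ≺⇒index {x} {y} x∈ y∈ x≺y with ℕP.<-cmp (index x o) (index y o)
    ... | tri< lt _ _ = lt
    ... | tri> _ _ gt = ⊥-elim (index-<⇒ std (C⇒o y∈) (C⇒o x∈) gt x≺y)
    ... | tri≈ _ eq _ with index-injective (C⇒o x∈) (C⇒o y∈) eq
    ...   | refl = ⊥-elim (≺-irrefl x≺y)

    private
      indexOf-map : ∀ {x} R′ → x ∈ C → (∀ {z} → z ∈ R′ → z ∈ C) → indexOf (g x) (map g R′) ≡ index x R′
      indexOf-map []       x∈ R′⊆ = refl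
      indexOf-map {x} (z ∷ R′) x∈ R′⊆ with x ≟ z
      ... | yes refl = cong (λ t → if t then 0 else suc (indexOf (g x) (map g R′))) (≡ᵇ-refl (index x o))
      ... | no x≢z   = trans
        (cong (λ t → if t then 0 else suc (indexOf (g x) (map g R′)))
          (≢⇒≡ᵇ≡ (λ eq → x≢z (index-injective (C⇒o x∈) (C⇒o (R′⊆ (here refl))) eq))))
        (cong suc (indexOf-map R′ x∈ (R′⊆ ∘ there)))

      -- Neighbours of the ordering never tie: a sandwich would place a cell strictly between them.
      -- This makes a comparison of reading positions a comparison of letters.
      adjacent-≪ : ∀ X {x y s} → o ≡ X ++ x ∷ y ∷ s → x ≪ y → idx x < idx y
      adjacent-≪ X eq (inj₁ lt)        = lt
      adjacent-≪ X {x} {y} {s} eq (inj₂ (e , x≺y))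
        with sandwich (o⇒C (subst (x ∈_) (sym eq) (MP.∈-insert X))) (o⇒C (subst (y ∈_) (sym eq) (MP.∈-++⁺ʳ X (there (here refl)))))
               (λ { refl → ≺-irrefl x≺y }) e
      ... | inj₂ ((r , _ , y≺r , r≺x , _) , _) = ⊥-elim (≺-irrefl (≺-trans x≺y (≺-trans y≺r r≺x)))
      ... | inj₁ ((r , r∈ , x≺r , r≺y , _) , _)
        with standard-between P X {x} {y} [] {s} (subst Standard eq std) (subst (r ∈_) eq (C⇒o r∈)) x≺r r≺y
      ...   | ()

      body : ℕ → Bool
      body i = indexOf (suc i) (map g R) <ᵇ indexOf (suc (suc i)) (map g R)

      body-≡ : ∀ X {x y s} → o ≡ X ++ x ∷ y ∷ s → body (length X ℕ.+ 0) ≡ (idx x <ᵇ idx y)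
      body-≡ X {x} {y} {s} eq = trans (cong₂ _<ᵇ_ (trans (cong (λ i → indexOf i (map g R)) gx) (indexOf-map R x∈ R⇒C))
                                       (trans (cong (λ i → indexOf i (map g R)) gy) (indexOf-map R y∈ R⇒C)))
        (<ᵇ-cong (λ lt → adjacent-≪ X eq (index-<⇒ R-sorted (C⇒R x∈) (C⇒R y∈) lt))
                 (λ lt → index-⇐ ≪-asym R-sorted (C⇒R x∈) (C⇒R y∈) (inj₁ lt)))
        where
        x∈ : x ∈ C
        x∈ = o⇒C (subst (x ∈_) (sym eq) (MP.∈-insert X))
        y∈ : y ∈ C
        y∈ = o⇒C (subst (y ∈_) (sym eq) (MP.∈-++⁺ʳ X (there (here refl))))
        uX = AllPairs-++⁻ X (subst Unique eq o-unique)
        eq′ : o ≡ (X ∷ʳ x) ++ y ∷ s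
        eq′ = trans eq (sym (LP.++-assoc X [ x ] (y ∷ s)))
        uX′ = AllPairs-++⁻ (X ∷ʳ x) (subst Unique eq′ o-unique)
        gx : suc (length X ℕ.+ 0) ≡ g x
        gx = cong suc (trans (ℕP.+-identityʳ _) (sym (trans (cong (index x) eq)
          (index-++ X (All.map (λ p q → All.head p (sym q)) (proj₂ (proj₂ uX)))))))
        gy : suc (suc (length X ℕ.+ 0)) ≡ g y
        gy = cong suc (trans (cong suc (ℕP.+-identityʳ _)) (sym (trans (cong (index y) eq′)
          (trans (index-++ (X ∷ʳ x) (All.map (λ p q → All.head p (sym q)) (proj₂ (proj₂ uX′))))
            (trans (LP.length-++ X) (ℕP.+-comm (length X) 1))))))

      signature-suffix : ∀ X s → o ≡ X ++ s → applyUpTo (λ i → body (length X ℕ.+ i)) (length s ∸ 1) ≡ ascents (map idx s)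
      signature-suffix X []          eq = refl
      signature-suffix X (x ∷ [])    eq = refl
      signature-suffix X (x ∷ y ∷ s) eq = cong₂ _∷_ (body-≡ X eq) (trans
        (applyUpTo-cong (λ i → cong body (trans (ℕP.+-suc (length X) i) (cong (ℕ._+ i) (sym (trans (LP.length-++ X) (ℕP.+-comm (length X) 1)))))) (length s))
        (signature-suffix (X ∷ʳ x) (y ∷ s) (trans eq (sym (LP.++-assoc X [ x ] (y ∷ s))))))

    signature-ascents : signature (length o) (map g R) ≡ ascents (map idx o)
    signature-ascents = trans (LP.map-applyUpTo id body (length o ∸ 1)) (signature-suffix [] o refl)

    module _ (sh : List ℕ) (|o| : length o ≡ sum sh) where
      open Knuth (valueBlock sh) (valueBlock-mono sh)

      private
        b : A → ℕ
        b x = block sh (index x o)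

        b-mono : ∀ {x y} → index x o ≤ index y o → b x ≤ b y
        b-mono = block-mono sh

        blocks : Blocks b 0 sh o
        blocks = toBlocks b idx 0 sh o (map-block sh o-unique |o|)

        RunsInside : Set
        RunsInside = ∀ {x y} → x ∈ C → y ∈ C → b x ≡ b y → index x o < index y o → idx x < idx y

        -- The delicate case is a tie of letters. The sandwich then gives `r` with a smaller letter,
        -- listed between `x` and `y` and so in their block; it is read before `x` but has the
        -- larger entry.
        increase⇒runsInside : BlocksIncrease (map g R) → RunsInside
        increase⇒runsInside bi {x} {y} x∈ y∈ eq lt = go (ℕP.<-cmp (idx x) (idx y))
          where
          ordered : ∀ {u v} → u ∈ C → v ∈ C → u ≪ v → b u ≡ b v → index u o < index v o
          ordered u∈ v∈ u≪v eq = ℕP.≤-pred (index-<⇒ (APP.map⁻ bi) (C⇒R u∈) (C⇒R v∈) (index-⇐ ≪-asym R-sorted (C⇒R u∈) (C⇒R v∈) u≪v) eq)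
          go : _ → idx x < idx y
          go (tri< p _ _) = p
          go (tri> _ _ q) = ⊥-elim (ℕP.<-asym lt (ordered y∈ x∈ (inj₁ q) (sym eq)))
          go (tri≈ _ e _) with sandwich x∈ y∈ (λ { refl → ℕP.<-irrefl refl lt }) e
          ... | inj₂ ((r , r∈ , y≺r , r≺x , _) , _) = ⊥-elim (ℕP.<-asym lt (≺⇒index y∈ x∈ (≺-trans y≺r r≺x)))
          ... | inj₁ (_ , (r , r∈ , x≺r , r≺y , r<x)) = ⊥-elim (ℕP.<-asym x<r (ordered r∈ x∈ (inj₁ r<x) br≡bx))
            where
            x<r = ≺⇒index x∈ r∈ x≺r
            r<y = ≺⇒index r∈ y∈ r≺y
            br≡bx : b r ≡ b x
            br≡bx = ℕP.≤-antisym (subst (b r ≤_) (sym eq) (b-mono (ℕP.<⇒≤ r<y))) (b-mono (ℕP.<⇒≤ x<r))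

        runsInside⇒increase : RunsInside → BlocksIncrease (map g R)
        runsInside⇒increase ri = APP.map⁺ (AllPairs-map-∈ pair R-sorted)
          where
          pair : ∀ {x y} → x ∈ R → y ∈ R → x ≪ y → b x ≡ b y → g x < g y
          pair {x} {y} x∈ y∈ x≪y eq with ℕP.<-cmp (index x o) (index y o)
          ... | tri< lt _ _ = s≤s lt
          ... | tri> _ _ gt = ⊥-elim (ℕP.<⇒≱ (ri (R⇒C y∈) (R⇒C x∈) (sym eq) gt) (≪-idx x≪y))
          ... | tri≈ _ e _ with index-injective (C⇒o (R⇒C x∈)) (C⇒o (R⇒C y∈)) e
          ...   | refl = ⊥-elim (≪-asym x≪y x≪y)

        runsInside⇒runs : RunsInside → Runs sh (map idx o)
        runsInside⇒runs ri = trans (LP.length-map idx o) |o| ,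
          sameBlock⇒runs b idx blocks (AllPairs-map-∈ (λ x∈ y∈ lt eq → ri (o⇒C x∈) (o⇒C y∈) eq lt) (index-increasing o-unique))

        runs⇒runsInside : Runs sh (map idx o) → RunsInside
        runs⇒runsInside (_ , inc) x∈ y∈ eq lt = index-<⇒ (runs⇒sameBlock b idx blocks inc) (C⇒o x∈) (C⇒o y∈) lt eq

        cnt-map : ∀ j s → cnt j (map g s) ≡ count (λ y → does (b y ℕP.≟ j)) s
        cnt-map j []      = refl
        cnt-map j (x ∷ s) = trans (cong (bit (b x ℕP.≟ j) ℕ.+_) (cnt-map j s)) (sym (count-∷ (λ y → does (b y ℕP.≟ j)) x s))

        module _ (ri : RunsInside) (X : List A) {x s} (R≡ : R ≡ X ++ x ∷ s) j (bx : b x ≡ suc j) where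
          private
            sorted = AllPairs-++⁻ X (subst (AllPairs _≪_) R≡ R-sorted)
            x∈ : x ∈ C
            x∈ = R⇒C (subst (x ∈_) (sym R≡) (MP.∈-insert X))
            X∈ : ∀ {z} → z ∈ X → z ∈ C
            X∈ z∈ = R⇒C (subst (_ ∈_) (sym R≡) (MP.∈-++⁺ˡ z∈))
            s∈ : ∀ {z} → z ∈ s → z ∈ C
            s∈ z∈ = R⇒C (subst (_ ∈_) (sym R≡) (MP.∈-++⁺ʳ X (there z∈)))
            X≪x : ∀ {z} → z ∈ X → z ≪ x
            X≪x z∈ = All.head (All.lookup (proj₂ (proj₂ sorted)) z∈)
            x≪s : ∀ {z} → z ∈ s → x ≪ z
            x≪s z∈ = All.lookup (AllPairs.head (proj₁ (proj₂ sorted))) z∈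

            off : ∀ (p q : Bool) → (p ≡ true → q ≡ false) → p ∧ q ≡ false
            off true  q f = f refl
            off false q f = refl

            on : ∀ (p q : Bool) → (p ≡ true → q ≡ true) → p ∧ q ≡ p
            on true  q f = f refl
            on false q f = refl

            ≡-does : ∀ {m k} → does (m ℕP.≟ k) ≡ true → m ≡ k
            ≡-does {m} {k} eq = ℕP.≡ᵇ⇒≡ m k (subst T (sym eq) tt)

            restrict : ∀ (p q : A → Bool) → (∀ {z} → z ∈ X → p z ∧ q z ≡ false) →
              count (λ z → p z ∧ q z) C ≡ count (λ z → p z ∧ q z) (x ∷ s)
            restrict p q f = trans (count-↭ _ (↭-sym R↭)) (trans (cong (count _) R≡)
              (trans (count-++ _ X (x ∷ s)) (cong (ℕ._+ count (λ z → p z ∧ q z) (x ∷ s)) (count-false-∈ _ X f))))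

          -- Within one block the letters are distinct, so a letter at least that of `x` means being
          -- read at `x` or later.
          cnt-ge : ge b idx (suc j) (idx x) o ≡ suc (cnt (suc j) (map g s))
          cnt-ge = begin
            ge b idx (suc j) (idx x) o
              ≡⟨ count-↭ _ o↭ ⟩
            ge b idx (suc j) (idx x) C
              ≡⟨ restrict (λ z → does (b z ℕP.≟ suc j)) (λ z → idx x ≤ᵇ idx z) (λ {z} z∈ → off (does (b z ℕP.≟ suc j)) _
                   (λ eq → ≰⇒≤ᵇ≡ (ℕP.<⇒≱ (before z∈ (≡-does eq))))) ⟩
            count (λ z → does (b z ℕP.≟ suc j) ∧ (idx x ≤ᵇ idx z)) (x ∷ s)
              ≡⟨ count-cong-∈ (x ∷ s) (λ {z} z∈ → on (does (b z ℕP.≟ suc j)) _ (λ _ → ≤⇒≤ᵇ≡ (after z∈))) ⟩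
            count (λ z → does (b z ℕP.≟ suc j)) (x ∷ s)
              ≡⟨ sym (cnt-map (suc j) (x ∷ s)) ⟩
            cnt (suc j) (map g (x ∷ s))
              ≡⟨ cnt-same {x = g x} (map g s) bx ⟩
            suc (cnt (suc j) (map g s)) ∎
            where
            open ≡-Reasoning
            after : ∀ {z} → z ∈ x ∷ s → idx x ≤ idx z
            after (here refl) = ℕP.≤-refl
            after (there z∈)  = ≪-idx (x≪s z∈)
            before : ∀ {z} → z ∈ X → b z ≡ suc j → idx z < idx x
            before {z} z∈ bz with ℕP.<-cmp (index z o) (index x o)
            ... | tri< lt _ _ = ri (X∈ z∈) x∈ (trans bz (sym bx)) lt
            ... | tri> _ _ gt = ⊥-elim (ℕP.<⇒≱ (ri x∈ (X∈ z∈) (trans bx (sym bz)) gt) (≪-idx (X≪x z∈)))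
            ... | tri≈ _ e _ with index-injective (C⇒o (X∈ z∈)) (C⇒o x∈) e
            ...   | refl = ⊥-elim (≪-asym (X≪x z∈) (X≪x z∈))

          -- A cell read after `x` with the same letter lies above `x` in the poset, hence later in
          -- the ordering, and cannot belong to the lower block `j`. So the strict comparison loses
          -- nothing.
          cnt-gt : gt b idx j (idx x) o ≡ cnt j (map g s)
          cnt-gt = begin
            gt b idx j (idx x) o
              ≡⟨ count-↭ _ o↭ ⟩
            gt b idx j (idx x) C
              ≡⟨ restrict (λ z → does (b z ℕP.≟ j)) (λ z → idx x <ᵇ idx z) (λ {z} z∈ → off (does (b z ℕP.≟ j)) _
                   (λ _ → ≮⇒<ᵇ≡ (ℕP.≤⇒≯ (≪-idx (X≪x z∈))))) ⟩
            count (λ z → does (b z ℕP.≟ j) ∧ (idx x <ᵇ idx z)) (x ∷ s)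
              ≡⟨ count-false _ s (off (does (b x ℕP.≟ j)) _ (λ eq → ⊥-elim (ℕP.1+n≢n (trans (sym bx) (≡-does eq))))) ⟩
            count (λ z → does (b z ℕP.≟ j) ∧ (idx x <ᵇ idx z)) s
              ≡⟨ count-cong-∈ s (λ {z} z∈ → on (does (b z ℕP.≟ j)) _ (λ eq → <⇒<ᵇ≡ (after z∈ (≡-does eq)))) ⟩
            count (λ z → does (b z ℕP.≟ j)) s
              ≡⟨ sym (cnt-map j s) ⟩
            cnt j (map g s) ∎
            where
            open ≡-Reasoning
            after : ∀ {z} → z ∈ s → b z ≡ j → idx x < idx z
            after z∈ bz with x≪s z∈
            ... | inj₁ lt        = lt
            ... | inj₂ (_ , x≺z) = ⊥-elim (ℕP.<⇒≱ (ℕP.≤-reflexive (sym bx))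
              (subst (b x ≤_) bz (b-mono (ℕP.<⇒≤ (≺⇒index x∈ (s∈ z∈) x≺z)))))

        dominated⇒lattice : RunsInside → Dominated b idx 0 o → ∀ X s → R ≡ X ++ s → Lattice (map g s)
        dominated⇒lattice ri dom X []      R≡ = tt
        dominated⇒lattice ri dom X (x ∷ s) R≡ =
          (λ j bx → subst₂ _≤_ (cnt-ge ri X R≡ j bx) (cnt-gt ri X R≡ j bx)
            (dom (C⇒o (R⇒C (subst (x ∈_) (sym R≡) (MP.∈-insert X)))) j z≤n bx)) ,
          dominated⇒lattice ri dom (X ∷ʳ x) s (trans R≡ (sym (LP.++-assoc X [ x ] s)))

        lattice⇒dominated : RunsInside → Lattice (map g R) → Dominated b idx 0 o
        lattice⇒dominated ri la {x} x∈ j _ bx with MP.∈-∃++ (C⇒R (o⇒C x∈))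
        ... | X , s , R≡ = subst₂ _≤_ (sym (cnt-ge ri X R≡ j bx)) (sym (cnt-gt ri X R≡ j bx))
          (proj₁ (suffix (map g X) (subst Lattice (trans (cong (map g) R≡) (LP.map-++ g X (x ∷ s))) la)) j bx)
          where
          suffix : ∀ Y {u} → Lattice (Y ++ u) → Lattice u
          suffix []      l       = l
          suffix (y ∷ Y) (_ , l) = suffix Y l

      yam⇒runs-good : Yam (map g R) → Runs sh (map idx o) × Good (chop sh (map idx o))
      yam⇒runs-good (bi , la) = runsInside⇒runs ri , dominated⇒good b idx blocks (lattice⇒dominated ri la)
        where
        ri : RunsInside
        ri = increase⇒runsInside bi

      runs-good⇒yam : Runs sh (map idx o) → Good (chop sh (map idx o)) → Yam (map g R)
      runs-good⇒yam runs good = runsInside⇒increase ri , dominated⇒lattice ri (good⇒dominated b idx blocks good) [] R refl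
        where
        ri : RunsInside
        ri = runs⇒runsInside runs

    inSYam-runs-good : ∀ sh → All (0 <_) sh → Descending sh → sum sh ≡ length C →
      indᵇ (inSYam sh (map g R)) ≡ ind (runs? sh (map idx o)) * ind (good? (chop sh (map idx o)))
    inSYam-runs-good sh positive descending |sh| = go (LP.≡-dec (LP.≡-dec ℕ._≟_) (Ptab (map g R)) (Utab sh))
      where
      v = map idx o
      |o| : length o ≡ sum sh
      |o| = trans (PP.↭-length o↭) (sym |sh|)
      w↭ : map g R ↭ applyUpTo suc (sum sh)
      w↭ = ↭-trans (PP.map⁺ g (↭-trans R↭ (↭-sym o↭)))
        (subst (_↭ applyUpTo suc (sum sh)) (sym (map-index o-unique)) (subst (λ m → applyUpTo suc m ↭ applyUpTo suc (sum sh)) (sym |o|) ↭-refl))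
      go : (d : Dec (Ptab (map g R) ≡ Utab sh)) → ind d ≡ ind (runs? sh v) * ind (good? (chop sh v))
      go (yes eq) with yam⇒runs-good sh |o| (Ptab⇒yam sh positive descending w↭ eq)
      ... | runs , good = sym (cong₂ _*_ (ind-yes (runs? sh v) runs) (ind-yes (good? (chop sh v)) good))
      go (no ≢) with runs? sh v | good? (chop sh v)
      ... | no _     | _        = refl
      ... | yes _    | no _     = refl
      ... | yes runs | yes good = ⊥-elim (≢ (yam⇒Ptab sh positive descending w↭ (runs-good⇒yam sh |o| runs good)))

-- Tuples of skew shapes

gap : ∀ {i j} → i ℤ.≤ j → ∃ λ m → j ≡ i + pos m
gap {i} {j} i≤j = ∣ j - i ∣ , trans (shift i j) (cong (_+_ i) (sym (ℤP.0≤i⇒+∣i∣≡i (ℤP.i≤j⇒0≤j-i i≤j))))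
  where
  shift : ∀ i j → j ≡ i + (j - i)
  shift = solve-∀

+-pos-injective : ∀ i {m n} → i + pos m ≡ i + pos n → m ≡ n
+-pos-injective i {m} {n} eq = ℤP.+-injective (trans (cancel i (pos m)) (trans (cong (_- i) eq) (sym (cancel i (pos n)))))
  where
  cancel : ∀ i j → j ≡ (i + j) - i
  cancel = solve-∀

+-pos-≤ : ∀ i {m n} → i + pos m ℤ.≤ i + pos n → m ≤ n
+-pos-≤ i {m} {n} le with gap le
... | d , eq = subst (m ≤_) (sym (+-pos-injective i {n} {m ℕ.+ d} (trans eq (assoc i (pos m) (pos d))))) (ℕP.m≤m+n m d)
  where
  assoc : ∀ i m d → (i + m) + d ≡ i + (m + d)
  assoc = solve-∀

≤-+-pos : ∀ i {m n} → m ≤ n → i + pos m ℤ.≤ i + pos n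
≤-+-pos i m≤n = ℤP.+-monoʳ-≤ i (ℤ.+≤+ m≤n)

part-positive : ∀ l r {j} → j < part l r → r < length l
part-positive (x ∷ l) zero    _  = s≤s z≤n
part-positive (x ∷ l) (suc r) lt = s≤s (part-positive l r lt)

part-antitone : ∀ {l r r′} → Linked _≥_ l → r ≤ r′ → part l r′ ≤ part l r
part-antitone {[]}        {r} {r′} _       _ = z≤n
part-antitone {x ∷ l}     {zero}  {zero}   _ _ = ℕP.≤-refl
part-antitone {x ∷ []}    {zero}  {suc r′} _ _ = z≤n
part-antitone {x ∷ y ∷ l} {zero}  {suc r′} (x≥y ∷ d) _ = ℕP.≤-trans (part-antitone {y ∷ l} {zero} {r′} d z≤n) x≥y
part-antitone {x ∷ []}    {suc r} {suc r′} _ _ = z≤n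
part-antitone {x ∷ y ∷ l} {suc r} {suc r′} (_ ∷ d) (s≤s le) = part-antitone {y ∷ l} {r} {r′} d le

InShape : SkewShape → ℕ → ℕ → Set
InShape s r j = part (inner s) r ≤ j × j < part (outer s) r

place : SkewShape → ℕ → ℕ → ℤ × ℤ
place s r j = dy s + pos r , dx s + pos j

∈-shapeCells⁻ : ∀ s {rc} → rc ∈ shapeCells s → ∃ λ r → ∃ λ j → rc ≡ place s r j × InShape s r j
∈-shapeCells⁻ s rc∈ with find (MP.∈-concatMap⁻ (λ r → map (place s r) (applyUpTo (λ t → part (inner s) r ℕ.+ t) (part (outer s) r ∸ part (inner s) r))) {xs = upTo (length (outer s))} rc∈)
... | r , _ , rc∈r with MP.∈-map⁻ (place s r) rc∈r
...   | j , j∈ , eq with MP.∈-applyUpTo⁻ (λ t → part (inner s) r ℕ.+ t) j∈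
...     | t , t< , refl = r , part (inner s) r ℕ.+ t , eq , ℕP.m≤m+n _ t ,
  subst (part (inner s) r ℕ.+ t <_) (ℕP.m+[n∸m]≡n (contained s r)) (ℕP.+-monoʳ-< (part (inner s) r) t<)

∈-shapeCells⁺ : ∀ s {r j} → InShape s r j → place s r j ∈ shapeCells s
∈-shapeCells⁺ s {r} {j} (in≤ , <out) = MP.∈-concatMap⁺ (λ r → map (place s r) (applyUpTo (λ t → part (inner s) r ℕ.+ t) (part (outer s) r ∸ part (inner s) r)))
  (lose (MP.∈-upTo⁺ (part-positive (outer s) r <out)) (MP.∈-map⁺ (place s r)
    (subst (_∈ applyUpTo (λ t → part (inner s) r ℕ.+ t) (part (outer s) r ∸ part (inner s) r)) (ℕP.m+[n∸m]≡n in≤)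
      (MP.∈-applyUpTo⁺ (λ t → part (inner s) r ℕ.+ t) (ℕP.∸-monoˡ-< <out in≤)))))

inShape-convex : ∀ s {r₁ j₁ r₂ j₂ r j} → InShape s r₁ j₁ → InShape s r₂ j₂ → r₁ ≤ r → r ≤ r₂ → j₁ ≤ j → j ≤ j₂ → InShape s r j
inShape-convex s {r₁} {j₁} {r₂} {j₂} {r} {j} (in₁ , _) (_ , out₂) r₁≤r r≤r₂ j₁≤j j≤j₂ =
  ℕP.≤-trans (part-antitone {inner s} (innerDec s) r₁≤r) (ℕP.≤-trans in₁ j₁≤j) ,
  ℕP.≤-<-trans j≤j₂ (ℕP.<-≤-trans out₂ (part-antitone {outer s} (outerDec s) r≤r₂))

shapeCells-unique : ∀ s → Unique (shapeCells s)
shapeCells-unique s = unique-concatMap (λ r → map (place s r) (applyUpTo (λ t → part (inner s) r ℕ.+ t) (part (outer s) r ∸ part (inner s) r)))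
  (UP.upTo⁺ (length (outer s)))
  (λ {r} _ → UP.map⁺ (λ eq → +-pos-injective (dx s) (cong proj₂ eq))
    (UP.applyUpTo⁺₁ _ _ (λ i<j _ eq → ℕP.<⇒≢ i<j (ℕP.+-cancelˡ-≡ (part (inner s) r) _ _ eq))))
  (λ {r} {r′} _ _ → same r r′)
  where
  same : ∀ r r′ {rc js js′} → rc ∈ map (place s r) js → rc ∈ map (place s r′) js′ → r ≡ r′
  same r r′ p q with MP.∈-map⁻ (place s r) p | MP.∈-map⁻ (place s r′) q
  ... | _ , _ , refl | _ , _ , eq = +-pos-injective (dy s) (cong proj₁ eq)

module Diagram (k : ℕ) (ν : Fin k → SkewShape) where

  C : List (Cell k)
  C = cells k ν

  sc : Cell k → ℤ
  sc = scont k

  at : Fin k → ℕ → ℕ → Cell k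
  at i r j = i , place (ν i) r j

  ∈-cells⁻ : ∀ {x} → x ∈ C → ∃ λ i → ∃ λ r → ∃ λ j → x ≡ at i r j × InShape (ν i) r j
  ∈-cells⁻ x∈ with find (MP.∈-concatMap⁻ (λ i → map (i ,_) (shapeCells (ν i))) {xs = allFin k} x∈)
  ... | i , _ , x∈i with MP.∈-map⁻ (i ,_) x∈i
  ...   | rc , rc∈ , refl with ∈-shapeCells⁻ (ν i) rc∈
  ...     | r , j , refl , p = i , r , j , refl , p

  ∈-cells⁺ : ∀ {i r j} → InShape (ν i) r j → at i r j ∈ C
  ∈-cells⁺ {i} p = MP.∈-concatMap⁺ (λ i → map (i ,_) (shapeCells (ν i))) (lose (MP.∈-allFin i) (MP.∈-map⁺ (i ,_) (∈-shapeCells⁺ (ν i) p)))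

  C-unique : Unique C
  C-unique = unique-concatMap (λ i → map (i ,_) (shapeCells (ν i))) (UP.allFin⁺ k)
    (λ {i} _ → UP.map⁺ (cong proj₂) (shapeCells-unique (ν i))) (λ {i} {i′} _ _ → same i i′)
    where
    same : ∀ i i′ {x rcs rcs′} → x ∈ map (i ,_) rcs → x ∈ map (i′ ,_) rcs′ → i ≡ i′
    same i i′ p q with MP.∈-map⁻ (i ,_) p | MP.∈-map⁻ (i′ ,_) q
    ... | _ , _ , refl | _ , _ , eq = cong proj₁ eq

  infix 4 _≟ᶜ_ _≺_ _≺?_
  _≟ᶜ_ : (x y : Cell k) → Dec (x ≡ y)
  _≟ᶜ_ = ×P.≡-dec Fin._≟_ (×P.≡-dec ℤ._≟_ ℤ._≟_)

  _≺_ : Cell k → Cell k → Set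
  x ≺ y = proj₁ x ≡ proj₁ y × row x ℤ.≤ row y × col x ℤ.≤ col y × x ≢ y

  _≺?_ : ∀ x y → Dec (x ≺ y)
  x ≺? y = (proj₁ x Fin.≟ proj₁ y) ×-dec (row x ℤ.≤? row y) ×-dec (col x ℤ.≤? col y) ×-dec ¬? (x ≟ᶜ y)

  ≺-trans : ∀ {x y z} → x ≺ y → y ≺ z → x ≺ z
  ≺-trans (refl , r , c , ≢) (refl , r′ , c′ , _) = refl , ℤP.≤-trans r r′ , ℤP.≤-trans c c′ ,
    λ { refl → ≢ (cong₂ (λ a b → _ , a , b) (ℤP.≤-antisym r r′) (ℤP.≤-antisym c c′)) }

  ≺-at : ∀ {i r j r′ j′} → r ≤ r′ → j ≤ j′ → r < r′ ⊎ j < j′ → at i r j ≺ at i r′ j′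
  ≺-at {i} r≤ j≤ strict = refl , ≤-+-pos (dy (ν i)) r≤ , ≤-+-pos (dx (ν i)) j≤ , λ eq → distinct strict
    (+-pos-injective (dy (ν i)) (cong row eq)) (+-pos-injective (dx (ν i)) (cong col eq))
    where
    distinct : ∀ {r j r′ j′} → r < r′ ⊎ j < j′ → r ≡ r′ → j ≡ j′ → ⊥
    distinct (inj₁ lt) eq _ = ℕP.<⇒≢ lt eq
    distinct (inj₂ lt) _ eq = ℕP.<⇒≢ lt eq

  sc-right : ∀ i r j → sc (at i r (suc j)) ≡ sc (at i r j) + pos k
  sc-right i r j = shift (pos k) (dy (ν i)) (dx (ν i)) (pos r) (pos j) (pos (toℕ i))
    where
    shift : ∀ k y x r j c → k * ((x + (1ℤ + j)) - (y + r)) + c ≡ k * ((x + j) - (y + r)) + c + k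
    shift = solve-∀

  sc-up : ∀ i r j → sc (at i r j) ≡ sc (at i (suc r) j) + pos k
  sc-up i r j = shift (pos k) (dy (ν i)) (dx (ν i)) (pos r) (pos j) (pos (toℕ i))
    where
    shift : ∀ k y x r j c → k * ((x + j) - (y + r)) + c ≡ k * ((x + j) - (y + (1ℤ + r))) + c + k
    shift = solve-∀

  -- Component numbers are remainders modulo `k`: two of them differ by less than `k`, and here by a
  -- multiple of `k`.
  sc-injective : ∀ {x y} → sc x ≡ sc y → proj₁ x ≡ proj₁ y × content x ≡ content y
  sc-injective {x} {y} eq = FinP.toℕ-injective (ℤP.+-injective comp≡) , content≡
    where
    i₁ = toℕ (proj₁ x)
    i₂ = toℕ (proj₁ y)
    difference : pos k * (content x - content y) ≡ pos i₂ - pos i₁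
    difference = trans (expand′ (pos k) (content x) (content y) (pos i₁)) (trans (cong (_- (pos k * content y + pos i₁)) eq) (cancel (pos k * content y) (pos i₁) (pos i₂)))
      where
      expand′ : ∀ k a b i → k * (a - b) ≡ (k * a + i) - (k * b + i)
      expand′ = solve-∀
      cancel : ∀ b i i′ → (b + i′) - (b + i) ≡ i′ - i
      cancel = solve-∀
    small : k ℕ.* ∣ content x - content y ∣ < k
    small = ℕP.≤-<-trans (ℕP.≤-reflexive (trans (sym (ℤP.abs-* (pos k) (content x - content y))) (cong ∣_∣ (trans difference (ℤP.m-n≡m⊖n i₂ i₁)))))
      (ℕP.≤-<-trans (ℤP.∣m⊝n∣≤m⊔n i₂ i₁) (ℕP.⊔-lub (FinP.toℕ<n (proj₁ y)) (FinP.toℕ<n (proj₁ x))))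
    zero-of : ∀ m → k ℕ.* m < k → m ≡ 0
    zero-of zero    _  = refl
    zero-of (suc m) lt = ⊥-elim (ℕP.<⇒≱ lt (ℕP.m≤m*n k (suc m)))
    content≡ : content x ≡ content y
    content≡ = ℤP.i-j≡0⇒i≡j (content x) (content y) (ℤP.∣i∣≡0⇒i≡0 (zero-of _ small))
    comp≡ : pos i₁ ≡ pos i₂
    comp≡ = trans (isolate (pos k * content x) (pos i₁)) (trans (cong₂ _-_ eq (cong (pos k *_) content≡)) (sym (isolate (pos k * content y) (pos i₂))))
      where
      isolate : ∀ a i → i ≡ (a + i) - a
      isolate = solve-∀

  Between : Cell k → Cell k → Cell k → Set
  Between x z y = z ∈ C × x ≺ z × z ≺ y

  -- By convexity of skew shapes, two comparable cells have another cell between them unless they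
  -- share an edge; across an edge the shifted content changes by exactly `k`.
  cover : ∀ {x y} → x ∈ C → y ∈ C → x ≺ y → (∃ λ z → Between x z y) ⊎ (sc y ≡ sc x + pos k ⊎ sc x ≡ sc y + pos k)
  cover x∈ y∈ x≺y with ∈-cells⁻ x∈ | ∈-cells⁻ y∈
  cover x∈ y∈ (refl , r≤ , c≤ , ≢) | i , r₁ , j₁ , refl , in₁ | _ , r₂ , j₂ , refl , in₂
    with ℕP.m≤n⇒m<n∨m≡n (+-pos-≤ (dy (ν i)) r≤) | ℕP.m≤n⇒m<n∨m≡n (+-pos-≤ (dx (ν i)) c≤)
  ... | inj₁ r< | inj₁ j< = inj₁ (at i r₁ j₂ , ∈-cells⁺ (inShape-convex (ν i) in₁ in₂ ℕP.≤-refl (ℕP.<⇒≤ r<) (ℕP.<⇒≤ j<) ℕP.≤-refl) ,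
        ≺-at ℕP.≤-refl (ℕP.<⇒≤ j<) (inj₂ j<) , ≺-at (ℕP.<⇒≤ r<) ℕP.≤-refl (inj₁ r<))
  ... | inj₂ refl | inj₂ refl = ⊥-elim (≢ refl)
  ... | inj₂ refl | inj₁ j< with ℕP.m≤n⇒m<n∨m≡n j<
  ...   | inj₂ refl = inj₂ (inj₁ (sc-right i r₁ j₁))
  ...   | inj₁ j<<  = inj₁ (at i r₁ (suc j₁) , ∈-cells⁺ (inShape-convex (ν i) in₁ in₂ ℕP.≤-refl ℕP.≤-refl (ℕP.n≤1+n j₁) j<) ,
        ≺-at ℕP.≤-refl (ℕP.n≤1+n j₁) (inj₂ (ℕP.n<1+n j₁)) , ≺-at ℕP.≤-refl j< (inj₂ j<<))
  cover x∈ y∈ (refl , r≤ , c≤ , ≢) | i , r₁ , j₁ , refl , in₁ | _ , r₂ , j₂ , refl , in₂ | inj₁ r< | inj₂ refl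
    with ℕP.m≤n⇒m<n∨m≡n r<
  ... | inj₂ refl = inj₂ (inj₂ (sc-up i r₁ j₁))
  ... | inj₁ r<<  = inj₁ (at i (suc r₁) j₁ , ∈-cells⁺ (inShape-convex (ν i) in₁ in₂ (ℕP.n≤1+n r₁) r< ℕP.≤-refl ℕP.≤-refl) ,
        ≺-at (ℕP.n≤1+n r₁) ℕP.≤-refl (inj₁ (ℕP.n<1+n r₁)) , ≺-at r< ℕP.≤-refl (inj₁ r<<))

  Surround : Cell k → Cell k → Set
  Surround u v = (∃ λ z → Between u z v × sc z ≡ sc u + pos k) × (∃ λ z → Between u z v × sc u ≡ sc z + pos k)

  private
    same-diagonal : ∀ {i r₁ j₁ r₂ j₂} → content (at i r₁ j₁) ≡ content (at i r₂ j₂) → r₂ ℕ.+ j₁ ≡ r₁ ℕ.+ j₂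
    same-diagonal {i} {r₁} {j₁} {r₂} {j₂} eq = ℤP.+-injective (trans (lemma (dx (ν i)) (dy (ν i)) (pos r₁) (pos j₁) (pos r₂))
      (trans (cong (λ c → (c + (pos r₁ + pos r₂)) - (dx (ν i) - dy (ν i))) eq) (lemma′ (dx (ν i)) (dy (ν i)) (pos r₁) (pos j₂) (pos r₂))))
      where
      lemma : ∀ x y r j r′ → r′ + j ≡ (((x + j) - (y + r)) + (r + r′)) - (x - y)
      lemma = solve-∀
      lemma′ : ∀ x y r j r′ → (((x + j) - (y + r′)) + (r + r′)) - (x - y) ≡ r + j
      lemma′ = solve-∀

    surround : ∀ {i r₁ j₁ r₂ j₂} → r₁ < r₂ → r₂ ℕ.+ j₁ ≡ r₁ ℕ.+ j₂ → InShape (ν i) r₁ j₁ → InShape (ν i) r₂ j₂ →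
      Surround (at i r₁ j₁) (at i r₂ j₂)
    surround {i} {r₁} {j₁} {r₂} {j₂} r< sum≡ in₁ in₂ =
      (at i r₁ (suc j₁) , (∈-cells⁺ (inShape-convex (ν i) in₁ in₂ ℕP.≤-refl (ℕP.<⇒≤ r<) (ℕP.n≤1+n j₁) j<) ,
        ≺-at ℕP.≤-refl (ℕP.n≤1+n j₁) (inj₂ (ℕP.n<1+n j₁)) , ≺-at (ℕP.<⇒≤ r<) j< (inj₁ r<)) , sc-right i r₁ j₁) ,
      (at i (suc r₁) j₁ , (∈-cells⁺ (inShape-convex (ν i) in₁ in₂ (ℕP.n≤1+n r₁) r< ℕP.≤-refl (ℕP.<⇒≤ j<)) ,
        ≺-at (ℕP.n≤1+n r₁) ℕP.≤-refl (inj₁ (ℕP.n<1+n r₁)) , ≺-at r< (ℕP.<⇒≤ j<) (inj₂ j<)) , sc-up i r₁ j₁)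
      where
      j< : j₁ < j₂
      j< = ℕP.+-cancelˡ-< r₂ _ _ (subst (_< r₂ ℕ.+ j₂) (sym sum≡) (ℕP.+-monoˡ-< j₂ r<))

  -- For two cells of one diagonal, convexity puts the right and the upper neighbour of the
  -- southwestern cell into the shape, with contents larger and smaller by `k`.
  diagonal : ∀ {x y} → x ∈ C → y ∈ C → x ≢ y → sc x ≡ sc y →
    (row x ℤ.< row y × Surround x y) ⊎ (row y ℤ.< row x × Surround y x)
  diagonal {x} {y} x∈ y∈ ≢ eq with ∈-cells⁻ x∈ | ∈-cells⁻ y∈ | sc-injective {x} {y} eq
  ... | i , r₁ , j₁ , refl , in₁ | _ , r₂ , j₂ , refl , in₂ | refl , content≡ with ℕP.<-cmp r₁ r₂
  ...   | tri< r< _ _ = inj₁ (ℤP.+-monoʳ-< (dy (ν i)) (ℤ.+<+ r<) , surround r< (same-diagonal {i} {r₁} {j₁} {r₂} {j₂} content≡) in₁ in₂)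
  ...   | tri> _ _ r> = inj₂ (ℤP.+-monoʳ-< (dy (ν i)) (ℤ.+<+ r>) , surround r> (same-diagonal {i} {r₂} {j₂} {r₁} {j₁} (sym content≡)) in₂ in₁)
  ...   | tri≈ _ refl _ = ⊥-elim (≢ (cong (at i r₁) (ℕP.+-cancelˡ-≡ r₁ _ _ (same-diagonal {i} {r₁} {j₁} {r₁} {j₂} content≡))))

does⇒ : {P : Set} (d : Dec P) → does d ≡ true → P
does⇒ (yes p) _ = p

does-true : {P : Set} (d : Dec P) → P → does d ≡ true
does-true (yes _) p = refl
does-true (no ¬p) p = ⊥-elim (¬p p)

does-false : {P : Set} (d : Dec P) → ¬ P → does d ≡ false
does-false (yes p) ¬p = ⊥-elim (¬p p)
does-false (no _)  ¬p = refl

count-split : {A : Set} (p q : A → Bool) → (∀ u → p u ≡ true → q u ≡ true) → ∀ xs →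
  count q xs ≡ count p xs ℕ.+ count (λ u → not (p u) ∧ q u) xs
count-split p q imp []       = refl
count-split p q imp (x ∷ xs) with p x in px | q x in qx
... | true  | true  = cong suc (count-split p q imp xs)
... | true  | false with trans (sym (imp x px)) qx
...   | ()
count-split p q imp (x ∷ xs) | false | true  = trans (cong suc (count-split p q imp xs)) (sym (ℕP.+-suc (count p xs) _))
count-split p q imp (x ∷ xs) | false | false = count-split p q imp xs

count-positive : {A : Set} (p : A → Bool) {xs : List A} {x : A} → x ∈ xs → p x ≡ true → 0 < count p xs
count-positive p {x ∷ xs} (here refl) eq = subst (0 <_) (sym (count-true p xs eq)) (s≤s z≤n)
count-positive p {x ∷ xs} (there x∈)  eq = ℕP.<-≤-trans (count-positive p x∈ eq) (count-∷-≤ p x xs)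

-- Shifted contents as letters

module Ranked (k : ℕ) (ν : Fin k → SkewShape) (diam : Diam≤3 k ν) where
  open Diagram k ν public

  Z : List ℤ
  Z = List.deduplicate ℤ._≟_ (map sc C)

  sc∈Z : ∀ {x} → x ∈ C → sc x ∈ Z
  sc∈Z x∈ = MP.∈-deduplicate⁺ ℤ._≟_ (MP.∈-map⁺ sc x∈)

  -- Contents that actually occur are numbered without gaps, so that neighbouring contents become
  -- consecutive letters, whatever their distance.
  rank : ℤ → ℕ
  rank z = count (λ u → u <ℤ z) Z

  idx : Cell k → ℕ
  idx x = rank (sc x)

  private
    inside : ℤ → ℤ → ℤ → Bool
    inside z z′ u = not (u <ℤ z) ∧ (u <ℤ z′)

    rank-split : ∀ {z z′} → z ℤ.≤ z′ → rank z′ ≡ rank z ℕ.+ count (inside z z′) Z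
    rank-split {z} {z′} z≤z′ = count-split (_<ℤ z) (_<ℤ z′)
      (λ u lt → does-true (u ℤ.<? z′) (ℤP.<-≤-trans (does⇒ (u ℤ.<? z) lt) z≤z′)) Z

  idx-< : ∀ x y → x ∈ C → sc x ℤ.< sc y → idx x < idx y
  idx-< x y x∈ lt = subst (idx x <_) (sym (rank-split (ℤP.<⇒≤ lt)))
    (ℕP.m<m+n (idx x) (count-positive (inside (sc x) (sc y)) (sc∈Z x∈)
      (cong₂ (λ a b → not a ∧ b) (does-false (sc x ℤ.<? sc x) (ℤP.<-irrefl refl)) (does-true (sc x ℤ.<? sc y) lt))))

  idx-<⁻ : ∀ x y → y ∈ C → idx x < idx y → sc x ℤ.< sc y
  idx-<⁻ x y y∈ lt with ℤP.<-cmp (sc x) (sc y)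
  ... | tri< p _ _  = p
  ... | tri≈ _ eq _ = ⊥-elim (ℕP.<⇒≢ lt (cong rank eq))
  ... | tri> _ _ q  = ⊥-elim (ℕP.<-asym lt (idx-< y x y∈ q))

  idx-≡⁻ : ∀ x y → x ∈ C → y ∈ C → idx x ≡ idx y → sc x ≡ sc y
  idx-≡⁻ x y x∈ y∈ eq with ℤP.<-cmp (sc x) (sc y)
  ... | tri< p _ _  = ⊥-elim (ℕP.<⇒≢ (idx-< x y x∈ p) eq)
  ... | tri≈ _ e _  = e
  ... | tri> _ _ q  = ⊥-elim (ℕP.<⇒≢ (idx-< y x y∈ q) (sym eq))

  idx-bound : ∀ {x} → x ∈ C → idx x < length C
  idx-bound {x} x∈ = ℕP.<-≤-trans
    (subst (idx x <_) (sym total) (ℕP.m<m+n (idx x) (count-positive (λ u → not (u <ℤ sc x) ∧ true) (sc∈Z x∈)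
      (cong (λ a → not a ∧ true) (does-false (sc x ℤ.<? sc x) (ℤP.<-irrefl refl))))))
    (ℕP.≤-trans (LP.length-deduplicate ℤ._≟_ (map sc C)) (ℕP.≤-reflexive (LP.length-map sc C)))
    where
    total : length Z ≡ idx x ℕ.+ count (λ u → not (u <ℤ sc x) ∧ true) Z
    total = trans (sym (count-all (λ _ → true) (All.universal (λ _ → refl) Z))) (count-split (_<ℤ sc x) (λ _ → true) (λ _ _ → refl) Z)

  -- Diam≤3 is used here: four distinct contents in a window of width k are excluded.
  idx-far : ∀ x y → x ∈ C → y ∈ C → 3 ℕ.+ idx x ≤ idx y → sc x + pos k ℤ.< sc y
  idx-far x y x∈ y∈ far = ℤP.≰⇒> λ near →
    let X = sc x
        Y = sc y
        X<Y : X ℤ.< Y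
        X<Y = idx-<⁻ x y y∈ (ℕP.<-≤-trans (ℕP.m<n+m (idx x) (s≤s z≤n)) far)
        p = inside X Y
        W = filterᵇ p Z
        4≤ : 4 ≤ suc (length W)
        4≤ = s≤s (ℕP.+-cancelˡ-≤ (idx x) _ _ (subst₂ _≤_ (ℕP.+-comm 3 (idx x)) (rank-split (ℤP.<⇒≤ X<Y)) far))
        inZ : ∀ {u} → u ∈ W → u ∈ Z × T (p u)
        inZ u∈ = MP.∈-filter⁻ (T? ∘ p) {xs = Z} u∈
        bounds : ∀ {u} → u ∈ W → X ℤ.≤ u × u ℤ.< Y
        bounds {u} u∈ =
          let tt′ = T⇒≡ (proj₂ (inZ u∈))
              lo = proj₁ (∧-true {not (u <ℤ X)} tt′)
              up = proj₂ (∧-true {not (u <ℤ X)} tt′)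
          in ℤP.≮⇒≥ (λ lt → true≢false (trans (sym lo) (cong not (does-true (u ℤ.<? X) lt)))) , does⇒ (u ℤ.<? Y) up
        window : ∀ {u} → u ∈ Y ∷ W → ∃ λ m → u ≡ X + pos m × m ≤ k
        window = λ { (here refl) → offset (ℤP.<⇒≤ X<Y) near
                   ; (there u∈)  → offset (proj₁ (bounds u∈)) (ℤP.≤-trans (ℤP.<⇒≤ (proj₂ (bounds u∈))) near) }
    in ℕP.<⇒≱ 4≤ (diam (Y ∷ W)
         (All.tabulate (λ u∈ eq → ℤP.<-irrefl (sym eq) (proj₂ (bounds u∈))) ∷ UP.filter⁺ (T? ∘ p) (DecU.deduplicate-! (map sc C)))
         (All.tabulate (λ { (here refl) → MP.∈-map⁺ sc y∈ ; (there u∈) → MP.∈-deduplicate⁻ ℤ._≟_ (map sc C) (proj₁ (inZ u∈)) }))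
         (All.tabulate (λ a∈ → All.tabulate (λ b∈ → distance (window a∈) (window b∈)))))
    where
    offset : ∀ {u} → sc x ℤ.≤ u → u ℤ.≤ sc x + pos k → ∃ λ m → u ≡ sc x + pos m × m ≤ k
    offset lo up with gap lo
    ... | m , refl = m , refl , +-pos-≤ (sc x) up
    distance : ∀ {a b} → (∃ λ m → a ≡ sc x + pos m × m ≤ k) → (∃ λ m → b ≡ sc x + pos m × m ≤ k) → ∣ a - b ∣ ≤ k
    distance (m , refl , m≤k) (n , refl , n≤k) = ℕP.≤-trans
      (ℕP.≤-reflexive (cong ∣_∣ (trans (cancel (sc x) (pos m) (pos n)) (ℤP.m-n≡m⊖n m n))))
      (ℕP.≤-trans (ℤP.∣m⊝n∣≤m⊔n m n) (ℕP.⊔-lub m≤k n≤k))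
      where
      cancel : ∀ i m n → (i + m) - (i + n) ≡ m - n
      cancel = solve-∀

  -- `x` comes first and so has the smaller entry; in an inversion it is the cell of larger content.
  w : Cell k → Cell k → ℕ
  w x y = if (0ℤ <ℤ (sc x - sc y)) ∧ ((sc x - sc y) <ℤ pos k) then 1 else 0

  private
    ahead : ∀ {x y} → sc x ℤ.< sc y → ∃ λ m → sc y ≡ sc x + pos (suc m)
    ahead lt with gap (ℤP.<⇒≤ lt)
    ... | zero  , eq = ⊥-elim (ℤP.<-irrefl (sym (trans eq (ℤP.+-identityʳ _))) lt)
    ... | suc m , eq = m , eq

    w-back : ∀ {x y} → sc x ℤ.< sc y → w x y ≡ 0
    w-back {x} {y} lt with ahead {x} {y} lt
    ... | m , eq = cong (λ d → if (0ℤ <ℤ d) ∧ (d <ℤ pos k) then 1 else 0) (trans (cong (_-_ (sc x)) eq) (cancel (sc x) (pos (suc m))))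
      where
      cancel : ∀ i m → i - (i + m) ≡ - m
      cancel = solve-∀

    w-ahead : ∀ {x y} m → sc y ≡ sc x + pos (suc m) → w y x ≡ (if does (pos (suc m) ℤ.<? pos k) then 1 else 0)
    w-ahead {x} {y} m eq = cong (λ d → if (0ℤ <ℤ d) ∧ (d <ℤ pos k) then 1 else 0) (trans (cong (_- sc x) eq) (cancel (sc x) (pos (suc m))))
      where
      cancel : ∀ i m → (i + m) - i ≡ m
      cancel = solve-∀

    w-near : ∀ {x y} → sc x ℤ.< sc y → sc y ℤ.< sc x + pos k → w y x ≡ 1
    w-near {x} {y} lt near with ahead {x} {y} lt
    ... | m , eq = trans (w-ahead {x} {y} m eq) (cong (λ b → if b then 1 else 0) (does-true (pos (suc m) ℤ.<? pos k)
      (ℤP.≰⇒> (λ k≤m → ℤP.<⇒≱ near (subst (sc x + pos k ℤ.≤_) (sym eq) (ℤP.+-monoʳ-≤ (sc x) k≤m))))))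

    w-far : ∀ {x y} → sc x ℤ.< sc y → sc x + pos k ℤ.< sc y → w y x ≡ 0
    w-far {x} {y} lt far with ahead {x} {y} lt
    ... | m , eq = trans (w-ahead {x} {y} m eq) (cong (λ b → if b then 1 else 0) (does-false (pos (suc m) ℤ.<? pos k)
      (λ m<k → ℤP.<-asym far (subst (ℤ._< sc x + pos k) (sym eq) (ℤP.+-monoʳ-< (sc x) m<k)))))

    x≤x+k : ∀ x → sc x ℤ.≤ sc x + pos k
    x≤x+k x = ℤP.i≤i+j (sc x) (pos k)

  P : Poset
  P = record
    { A = Cell k ; C = C ; C-unique = C-unique ; _≺_ = _≺_ ; _≺?_ = _≺?_
    ; ≺-irrefl = λ (_ , _ , _ , ≢) → ≢ refl ; ≺-trans = ≺-trans ; idx = idx ; w = w }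

  private
    noncover : ∀ x y → x ∈ C → y ∈ C → sc x ℤ.< sc y → sc y ≢ sc x + pos k → Poset.NonCover P x y × Poset.NonCover P y x
    noncover x y x∈ y∈ lt ≢k =
      (λ x≺y → pick (cover x∈ y∈ x≺y)) , (λ y≺x → pick′ (cover y∈ x∈ y≺x))
      where
      absurd : sc x ≢ sc y + pos k
      absurd eq = ℤP.<⇒≱ lt (subst (sc y ℤ.≤_) (sym eq) (x≤x+k y))
      pick : _ → ∃ λ z → z ∈ C × x ≺ z × z ≺ y
      pick (inj₁ b)         = b
      pick (inj₂ (inj₁ eq)) = ⊥-elim (≢k eq)
      pick (inj₂ (inj₂ eq)) = ⊥-elim (absurd eq)
      pick′ : _ → ∃ λ z → z ∈ C × y ≺ z × z ≺ x
      pick′ (inj₁ b)         = b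
      pick′ (inj₂ (inj₁ eq)) = ⊥-elim (absurd eq)
      pick′ (inj₂ (inj₂ eq)) = ⊥-elim (≢k eq)

    far-pair : ∀ x y → x ∈ C → y ∈ C → sc x + pos k ℤ.< sc y →
      Poset.NonCover P x y × Poset.NonCover P y x × w x y ≡ 0 × w y x ≡ 0
    far-pair x y x∈ y∈ far = proj₁ nc , proj₂ nc , w-back {x} {y} lt , w-far {x} {y} lt far
      where
      lt : sc x ℤ.< sc y
      lt = ℤP.≤-<-trans (x≤x+k x) far
      nc = noncover x y x∈ y∈ lt (λ eq → ℤP.<-irrefl (sym eq) far)

    near-pair : ∀ x y → x ∈ C → y ∈ C → sc x ℤ.< sc y → sc y ℤ.< sc x + pos k →
      Poset.NonCover P x y × Poset.NonCover P y x × w x y ≡ 0 × w y x ≡ 1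
    near-pair x y x∈ y∈ lt near = proj₁ nc , proj₂ nc , w-back {x} {y} lt , w-near {x} {y} lt near
      where
      nc = noncover x y x∈ y∈ lt (λ eq → ℤP.<-irrefl eq near)

    Close : ℕ → Cell k → Cell k → Set
    Close i x z = idx x ≡ i × idx z ≡ suc (suc i) × sc z ℤ.≤ sc x + pos k

    close? : ∀ i → Dec (Any (λ x → Any (Close i x) C) C)
    close? i = Any.any? (λ x → Any.any? (λ z → (idx x ℕP.≟ i) ×-dec (idx z ℕP.≟ suc (suc i)) ×-dec (sc z ℤ.≤? sc x + pos k)) C) C

  switchable : Switchable P
  switchable = record
    { commute  = λ 3+i≤j {x} {y} x∈ y∈ ex ey → far-pair x y x∈ y∈ (idx-far x y x∈ y∈ (subst₂ (λ a b → 3 ℕ.+ a ≤ b) (sym ex) (sym ey) 3+i≤j))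
    ; triple   = triple
    ; sandwich = sandwich
    }
    where
    triple : ∀ i → Poset.SwappableLetters P i (suc (suc i)) 0 0 ⊎
      (Poset.SwappableLetters P i (suc i) 0 1 × Poset.SwappableLetters P (suc i) (suc (suc i)) 0 1)
    triple i with close? i
    ... | no ¬close = inj₁ λ {x} {z} x∈ z∈ ex ez → far-pair x z x∈ z∈ (ℤP.≰⇒> (λ near → ¬close (lose x∈ (lose z∈ (ex , ez , near)))))
    -- One close pair decides for all, since a letter determines its shifted content. The middle
    -- content lies strictly between the outer ones and is therefore at distance less than `k` from
    -- both.
    ... | yes close with find close
    ...   | x₀ , x₀∈ , close′ with find close′
    ...     | z₀ , z₀∈ , ex₀ , ez₀ , near₀ = inj₂
      ( (λ {x} {y} x∈ y∈ ex ey →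
          let X≡ = idx-≡⁻ x x₀ x∈ x₀∈ (trans ex (sym ex₀)) in
          near-pair x y x∈ y∈ (idx-<⁻ x y y∈ (ℕP.≤-reflexive (trans (cong suc ex) (sym ey))))
            (ℤP.<-≤-trans (idx-<⁻ y z₀ z₀∈ (ℕP.≤-reflexive (trans (cong suc ey) (sym ez₀)))) (subst (λ a → sc z₀ ℤ.≤ a + pos k) (sym X≡) near₀)))
      , (λ {y} {z} y∈ z∈ ey ez →
          let Z≡ = idx-≡⁻ z z₀ z∈ z₀∈ (trans ez (sym ez₀)) in
          near-pair y z y∈ z∈ (idx-<⁻ y z z∈ (ℕP.≤-reflexive (trans (cong suc ey) (sym ez))))
            (ℤP.≤-<-trans (subst (ℤ._≤ sc x₀ + pos k) (sym Z≡) near₀)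
              (ℤP.+-monoˡ-< (pos k) (idx-<⁻ x₀ y y∈ (ℕP.≤-reflexive (trans (cong suc ex₀) (sym ey))))))) )

    k-positive : ∀ {x : Cell k} → 0 < k
    k-positive {x} = ℕP.≤-<-trans z≤n (FinP.toℕ<n (proj₁ x))

    sandwich-of : ∀ {p q} → p ∈ C → Surround p q → Poset.Sandwich P p q
    sandwich-of {p} {q} p∈ ((r , (r∈ , p≺r , r≺q) , eq) , (r′ , (r′∈ , p≺r′ , r′≺q) , eq′)) =
      (r , r∈ , p≺r , r≺q , idx-< p r p∈ (subst (sc p ℤ.<_) (sym eq) (grow (sc p)))) ,
      (r′ , r′∈ , p≺r′ , r′≺q , idx-< r′ p r′∈ (subst (sc r′ ℤ.<_) (sym eq′) (grow (sc r′))))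
      where
      grow : ∀ i → i ℤ.< i + pos k
      grow i = subst (ℤ._< i + pos k) (ℤP.+-identityʳ i) (ℤP.+-monoʳ-< i (ℤ.+<+ (k-positive {p})))

    sandwich : ∀ {p q} → p ∈ C → q ∈ C → p ≢ q → idx p ≡ idx q → Poset.Sandwich P p q ⊎ Poset.Sandwich P q p
    sandwich {p} {q} p∈ q∈ p≢q eq with diagonal p∈ q∈ p≢q (idx-≡⁻ p q p∈ q∈ eq)
    ... | inj₁ (_ , s) = inj₁ (sandwich-of p∈ s)
    ... | inj₂ (_ , s) = inj₂ (sandwich-of q∈ s)

allᵇ⇒ : {A : Set} (p : A → Bool) {xs : List A} {x : A} → allᵇ p xs ≡ true → x ∈ xs → p x ≡ true
allᵇ⇒ p {y ∷ xs} eq (here refl) = proj₁ (∧-true {p y} eq)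
allᵇ⇒ p {y ∷ xs} eq (there x∈)  = allᵇ⇒ p (proj₂ (∧-true {p y} eq)) x∈

⇒allᵇ : {A : Set} (p : A → Bool) (xs : List A) → (∀ {x} → x ∈ xs → p x ≡ true) → allᵇ p xs ≡ true
⇒allᵇ p []       f = refl
⇒allᵇ p (x ∷ xs) f = cong₂ _∧_ (f (here refl)) (⇒allᵇ p xs (f ∘ there))

implies⇒ : ∀ {b c} → not b ∨ c ≡ true → b ≡ true → c ≡ true
implies⇒ {true} eq refl = eq

⇒implies : ∀ {b c} → (b ≡ true → c ≡ true) → not b ∨ c ≡ true
⇒implies {true}  f = f refl
⇒implies {false} f = refl

∈-pairs⁺ : {A : Set} {xs : List A} {x y : A} → x ∈ xs → y ∈ xs → (x , y) ∈ pairs xs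
∈-pairs⁺ {xs = xs} {x} x∈ y∈ = MP.∈-concatMap⁺ (λ x → map (λ y → (x , y)) xs) (lose x∈ (MP.∈-map⁺ (x ,_) y∈))

∈-pairs⁻ : {A : Set} {xs : List A} {p : A × A} → p ∈ pairs xs → proj₁ p ∈ xs × proj₂ p ∈ xs
∈-pairs⁻ {xs = xs} p∈ with find (MP.∈-concatMap⁻ (λ x → map (λ y → (x , y)) xs) {xs = xs} p∈)
... | x , x∈ , p∈′ with MP.∈-map⁻ (x ,_) p∈′
...   | y , y∈ , refl = x∈ , y∈

count-concatMap : {A B : Set} (p : B → Bool) (h : A → List B) (xs : List A) → count p (concatMap h xs) ≡ sum (map (λ x → count p (h x)) xs)
count-concatMap p h []       = refl
count-concatMap p h (x ∷ xs) = trans (count-++ p (h x) (concatMap h xs)) (cong (count p (h x) ℕ.+_) (count-concatMap p h xs))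

count-pairs : {A : Set} (p : A × A → Bool) (xs : List A) → count p (pairs xs) ≡ sum (map (λ x → count (λ y → p (x , y)) xs) xs)
count-pairs p xs = trans (count-concatMap p (λ x → map (λ y → (x , y)) xs) xs)
  (cong sum (LP.map-cong (λ x → count-map p (x ,_) xs) xs))

sum-map-+ : {A : Set} (f g : A → ℕ) (xs : List A) → sum (map (λ x → f x ℕ.+ g x) xs) ≡ sum (map f xs) ℕ.+ sum (map g xs)
sum-map-+ f g []       = refl
sum-map-+ f g (x ∷ xs) = trans (cong (f x ℕ.+ g x ℕ.+_) (sum-map-+ f g xs)) (rearrange (f x) (g x) (sum (map f xs)) (sum (map g xs)))
  where
  rearrange : ∀ a b c d → (a ℕ.+ b) ℕ.+ (c ℕ.+ d) ≡ (a ℕ.+ c) ℕ.+ (b ℕ.+ d)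
  rearrange = ℕSolver.solve-∀

pos-sum-filter : {A : Set} (p : A → Bool) (f : A → ℕ) (xs : List A) → pos (sum (map f (filterᵇ p xs))) ≡ ∑ xs (λ x → indᵇ (p x) * pos (f x))
pos-sum-filter p f []       = refl
pos-sum-filter p f (x ∷ xs) with p x
... | true  = trans (ℤP.pos-+ (f x) _) (cong₂ _+_ (sym (ℤP.*-identityˡ (pos (f x)))) (pos-sum-filter p f xs))
... | false = trans (pos-sum-filter p f xs) (sym (ℤP.+-identityˡ _))

∑-filterᵇ : {A : Set} (p : A → Bool) (xs : List A) (G : A → ℤ) → ∑ (filterᵇ p xs) G ≡ ∑ xs (λ x → indᵇ (p x) * G x)
∑-filterᵇ p []       G = refl
∑-filterᵇ p (x ∷ xs) G with p x
... | true  = cong₂ _+_ (sym (ℤP.*-identityˡ (G x))) (∑-filterᵇ p xs G)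
... | false = trans (∑-filterᵇ p xs G) (sym (ℤP.+-identityˡ _))

pos-if : ∀ b a → pos (if b then a else 0) ≡ indᵇ b * pos a
pos-if true  a = sym (ℤP.*-identityˡ (pos a))
pos-if false a = refl

statistic : ℕ → ℕ → ℤ
statistic d m = indᵇ (m ≡ᵇ d)

-- Fillings, their statistics and the LLT coefficients

module LLT (k : ℕ) (ν : Fin k → SkewShape) (diam : Diam≤3 k ν) where
  open Ranked k ν diam public
  open Indexing _≟ᶜ_
  open ReadingWord P switchable _≟ᶜ_
  open Poset P using (Standard; standard?; inv; weightAfter; words)

  private
    n = length C

    ≪-trans : ∀ {x y z} → x ≪ y → y ≪ z → x ≪ z
    ≪-trans {x} {y} {z} (inj₁ p)       q              = inj₁ (ℕP.<-≤-trans p (≪-idx {y} {z} q))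
    ≪-trans {x} {y} {z} (inj₂ (e , _)) (inj₁ q)       = inj₁ (subst (_< idx z) (sym e) q)
    ≪-trans {x} {y} {z} (inj₂ (e , p)) (inj₂ (f , q)) = inj₂ (trans e f , ≺-trans p q)

    readsBefore⇒ : ∀ {x y} → x ∈ C → y ∈ C → readsBefore k x y ≡ true → x ≪ y
    readsBefore⇒ {x} {y} x∈ y∈ eq with sc x ℤ.<? sc y
    ... | yes lt = inj₁ (idx-< x y x∈ lt)
    ... | no _ with ∧-true {sc x ==ℤ sc y} eq
    ...   | e , r with does⇒ (sc x ℤ.≟ sc y) e | does⇒ (row x ℤ.<? row y) r
    ...     | sc≡ | row< with diagonal x∈ y∈ (λ { refl → ℤP.<-irrefl refl row< }) sc≡
    ...       | inj₁ (_ , (_ , (_ , x≺z , z≺y) , _) , _) = inj₂ (cong rank sc≡ , ≺-trans x≺z z≺y)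
    ...       | inj₂ (row> , _) = ⊥-elim (ℤP.<-asym row< row>)

    readsBefore⇐ : ∀ {x y} → x ∈ C → y ∈ C → x ≢ y → readsBefore k x y ≡ false → y ≪ x
    readsBefore⇐ {x} {y} x∈ y∈ x≢y eq with ℤP.<-cmp (sc x) (sc y)
    ... | tri< lt _ _ = ⊥-elim (true≢false (trans (sym (cong (_∨ ((sc x ==ℤ sc y) ∧ (row x <ℤ row y))) (does-true (sc x ℤ.<? sc y) lt))) eq))
    ... | tri> _ _ gt = inj₁ (idx-< y x y∈ gt)
    ... | tri≈ _ sc≡ _ with diagonal x∈ y∈ x≢y sc≡
    ...   | inj₂ (_ , (_ , (_ , y≺z , z≺x) , _) , _) = inj₂ (cong rank (sym sc≡) , ≺-trans y≺z z≺x)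
    ...   | inj₁ (row< , _) = ⊥-elim (true≢false (trans (sym (trans
        (cong₂ (λ e r → (sc x <ℤ sc y) ∨ (e ∧ r)) (does-true (sc x ℤ.≟ sc y) sc≡) (does-true (row x ℤ.<? row y) row<)) (∨-true (sc x <ℤ sc y)))) eq))
      where
      ∨-true : ∀ b → b ∨ true ≡ true
      ∨-true true  = refl
      ∨-true false = refl

    Reads : Cell k × ℕ → Cell k × ℕ → Set
    Reads p q = proj₁ p ≪ proj₁ q

    insertCell-↭ : ∀ p ps → insertCell k p ps ↭ p ∷ ps
    insertCell-↭ p []       = ↭-refl
    insertCell-↭ p (q ∷ qs) with readsBefore k (proj₁ p) (proj₁ q)
    ... | true  = ↭-refl
    ... | false = ↭-trans (Perm.prep q (insertCell-↭ p qs)) (Perm.swap q p ↭-refl)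

    sortCells-↭ : ∀ ps → sortCells k ps ↭ ps
    sortCells-↭ []       = ↭-refl
    sortCells-↭ (p ∷ ps) = ↭-trans (insertCell-↭ p (sortCells k ps)) (Perm.prep p (sortCells-↭ ps))

    insertCell-sorted : ∀ p ps → proj₁ p ∈ C → All (λ q → proj₁ q ∈ C × proj₁ p ≢ proj₁ q) ps → AllPairs Reads ps → AllPairs Reads (insertCell k p ps)
    insertCell-sorted p []       p∈ _ _ = [] ∷ []
    insertCell-sorted p (q ∷ qs) p∈ ((q∈ , p≢q) ∷ qs∈) (q≪ ∷ sorted) with readsBefore k (proj₁ p) (proj₁ q) in eq
    ... | true  = (p≪q ∷ All.map (λ {r} q≪r → ≪-trans {proj₁ p} {proj₁ q} {proj₁ r} p≪q q≪r) q≪) ∷ q≪ ∷ sorted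
      where
      p≪q : proj₁ p ≪ proj₁ q
      p≪q = readsBefore⇒ p∈ q∈ eq
    ... | false = PP.All-resp-↭ (↭-sym (insertCell-↭ p qs)) (readsBefore⇐ p∈ q∈ p≢q eq ∷ q≪) ∷ insertCell-sorted p qs p∈ qs∈ sorted

    sortCells-sorted : ∀ ps → All (λ q → proj₁ q ∈ C) ps → Unique (map proj₁ ps) → AllPairs Reads (sortCells k ps)
    sortCells-sorted []       _          _         = []
    sortCells-sorted (p ∷ ps) (p∈ ∷ ps∈) (p∉ ∷ u) = insertCell-sorted p (sortCells k ps) p∈
      (PP.All-resp-↭ (↭-sym (sortCells-↭ ps)) (All.zipWith id (ps∈ , AllP.map⁻ p∉))) (sortCells-sorted ps ps∈ u)

  module _ {o : List (Cell k)} (o↭ : o ↭ C) where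
    private
      g : Cell k → ℕ
      g x = suc (index x o)
      lab : Cell k → Cell k × ℕ
      lab x = x , g x
      T₀ = filling C-unique o
      labelled≡ : labelled k ν T₀ ≡ map lab C
      labelled≡ = zip-map g C
      o-unique : Unique o
      o-unique = unique-↭ (↭-sym o↭) C-unique
      C⇒o : ∀ {x} → x ∈ C → x ∈ o
      C⇒o = PP.∈-resp-↭ (↭-sym o↭)
      o⇒C : ∀ {x} → x ∈ o → x ∈ C
      o⇒C = PP.∈-resp-↭ o↭

      reading-order = sortCells k (map lab C)
      R = map proj₁ reading-order

      cells-lab : map proj₁ (map lab C) ≡ C
      cells-lab = trans (sym (LP.map-∘ C)) (LP.map-id C)

      R↭ : R ↭ C
      R↭ = subst (R ↭_) cells-lab (PP.map⁺ proj₁ (sortCells-↭ (map lab C)))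

      R-sorted : AllPairs _≪_ R
      R-sorted = APP.map⁺ (sortCells-sorted (map lab C) (AllP.map⁺ (All.tabulate id)) (subst Unique (sym cells-lab) C-unique))

      scWord≡ : scWord k ν T₀ ≡ map g R
      scWord≡ = trans (cong (map proj₂ ∘ sortCells k) labelled≡)
        (trans (map-cong-∈ reading-order (λ p∈ → All.lookup values p∈)) (LP.map-∘ reading-order))
        where
        values : All (λ p → proj₂ p ≡ g (proj₁ p)) reading-order
        values = PP.All-resp-↭ (↭-sym (sortCells-↭ (map lab C))) (AllP.map⁺ (All.universal (λ _ → refl) C))

    isStandardB-filling : indᵇ (isStandardB k ν T₀) ≡ ind (standard? o)
    isStandardB-filling = trans (cong indᵇ (trans (isStandardB-unfold k ν T₀) (cong (allᵇ okStandard ∘ pairs) labelled≡))) (go (standard? o))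
      where
      fwd : Standard o → allᵇ okStandard (pairs (map lab C)) ≡ true
      fwd std = ⇒allᵇ okStandard (pairs (map lab C)) ok
        where
        comp≡ : ∀ {x y : Cell k} → sameComp x y ≡ true → proj₁ x ≡ proj₁ y
        comp≡ {x} {y} eq = FinP.toℕ-injective (ℕP.≡ᵇ⇒≡ (comp x) (comp y) (subst T (sym eq) tt))
        ok : ∀ {p} → p ∈ pairs (map lab C) → okStandard p ≡ true
        ok p∈ with MP.∈-map⁻ lab {xs = C} (proj₁ (∈-pairs⁻ {xs = map lab C} p∈)) | MP.∈-map⁻ lab {xs = C} (proj₂ (∈-pairs⁻ {xs = map lab C} p∈))
        ... | x , x∈ , refl | y , y∈ , refl = cong₂ _∧_
          (⇒implies λ c → let (s , rc) = ∧-true {sameComp x y} c ; (r , l) = ∧-true {row x ==ℤ row y} rc ; lt = does⇒ (col x ℤ.<? col y) l in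
            <⇒<ᵇ≡ (s≤s (≺⇒index R↭ R-sorted o↭ std x∈ y∈ (comp≡ {x} {y} s , ℤP.≤-reflexive (does⇒ (row x ℤ.≟ row y) r) , ℤP.<⇒≤ lt ,
              λ { refl → ℤP.<-irrefl refl lt }))))
          (⇒implies λ c → let (s , rc) = ∧-true {sameComp x y} c ; (r , l) = ∧-true {col x ==ℤ col y} rc ; lt = does⇒ (row x ℤ.<? row y) l in
            <⇒<ᵇ≡ (s≤s (≺⇒index R↭ R-sorted o↭ std x∈ y∈ (comp≡ {x} {y} s , ℤP.<⇒≤ lt , ℤP.≤-reflexive (does⇒ (col x ℤ.≟ col y) r) ,
              λ { refl → ℤP.<-irrefl refl lt }))))
      bwd : allᵇ okStandard (pairs (map lab C)) ≡ true → Standard o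
      bwd all = AllPairs-map-∈ (λ x∈ y∈ lt y≺x → ℕP.<-asym lt (ordered (o⇒C y∈) (o⇒C x∈) y≺x)) (index-increasing o-unique)
        where
        pair-ok : ∀ {x y} → x ∈ C → y ∈ C → okStandard (lab x , lab y) ≡ true
        pair-ok x∈ y∈ = allᵇ⇒ okStandard all (∈-pairs⁺ (MP.∈-map⁺ lab x∈) (MP.∈-map⁺ lab y∈))
        along : ∀ {i r j r′ j′} → at i r j ∈ C → at i r′ j′ ∈ C → (r ≡ r′ × j < j′) ⊎ (j ≡ j′ × r < r′) → index (at i r j) o < index (at i r′ j′) o
        along {i} {r} {j} {r′} {j′} x∈ y∈ (inj₁ (refl , j<)) = ℕP.≤-pred (ℕP.<ᵇ⇒< _ _ (subst T (sym (implies⇒ (proj₁ (∧-true (pair-ok x∈ y∈)))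
          (cong₂ _∧_ (≡ᵇ-refl (toℕ i)) (cong₂ _∧_ (does-true (dy (ν i) + pos r ℤ.≟ dy (ν i) + pos r) refl)
            (does-true (dx (ν i) + pos j ℤ.<? dx (ν i) + pos j′) (ℤP.+-monoʳ-< (dx (ν i)) (ℤ.+<+ j<))))))) tt))
        along {i} {r} {j} {r′} {j′} x∈ y∈ (inj₂ (refl , r<)) = ℕP.≤-pred (ℕP.<ᵇ⇒< _ _ (subst T (sym (implies⇒ (proj₂ (∧-true {not (sameComp (at i r j) (at i r′ j) ∧ (row (at i r j) ==ℤ row (at i r′ j)) ∧ (col (at i r j) <ℤ col (at i r′ j))) ∨ _} (pair-ok x∈ y∈)))
          (cong₂ _∧_ (≡ᵇ-refl (toℕ i)) (cong₂ _∧_ (does-true (dx (ν i) + pos j ℤ.≟ dx (ν i) + pos j) refl)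
            (does-true (dy (ν i) + pos r ℤ.<? dy (ν i) + pos r′) (ℤP.+-monoʳ-< (dy (ν i)) (ℤ.+<+ r<))))))) tt))
        ordered : ∀ {x y} → x ∈ C → y ∈ C → x ≺ y → index x o < index y o
        ordered x∈ y∈ x≺y with ∈-cells⁻ x∈ | ∈-cells⁻ y∈
        ordered x∈ y∈ (refl , r≤ , c≤ , x≢y) | i , r₁ , j₁ , refl , in₁ | _ , r₂ , j₂ , refl , in₂
          with ℕP.m≤n⇒m<n∨m≡n (+-pos-≤ (dy (ν i)) r≤) | ℕP.m≤n⇒m<n∨m≡n (+-pos-≤ (dx (ν i)) c≤)
        ... | inj₂ refl | inj₂ refl = ⊥-elim (x≢y refl)
        ... | inj₂ refl | inj₁ j<   = along x∈ y∈ (inj₁ (refl , j<))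
        ... | inj₁ r<   | inj₂ refl = along x∈ y∈ (inj₂ (refl , r<))
        -- The definition compares cells only along rows and columns; a corner cell, present by
        -- convexity, joins the two.
        ... | inj₁ r<   | inj₁ j<   = ℕP.<-trans (along x∈ corner∈ (inj₁ (refl , j<))) (along corner∈ y∈ (inj₂ (refl , r<)))
          where
          corner∈ : at i r₁ j₂ ∈ C
          corner∈ = ∈-cells⁺ (inShape-convex (ν i) in₁ in₂ ℕP.≤-refl (ℕP.<⇒≤ r<) (ℕP.<⇒≤ j<) ℕP.≤-refl)
      go : (d : Dec (Standard o)) → indᵇ (allᵇ okStandard (pairs (map lab C))) ≡ ind d
      go (yes std) = cong indᵇ (fwd std)
      go (no ¬std) with allᵇ okStandard (pairs (map lab C)) in eq
      ... | true  = ⊥-elim (¬std (bwd eq))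
      ... | false = refl

    invk-filling : invk k ν T₀ ≡ inv o
    invk-filling = begin
      invk k ν T₀
        ≡⟨ cong (count okInv ∘ pairs) labelled≡ ⟩
      count okInv (pairs (map lab C))
        ≡⟨ count-pairs okInv (map lab C) ⟩
      sum (map (λ p → count (λ q → okInv (p , q)) (map lab C)) (map lab C))
        ≡⟨ cong sum (sym (LP.map-∘ C)) ⟩
      sum (map (λ x → count (λ q → okInv (lab x , q)) (map lab C)) C)
        ≡⟨ cong sum (LP.map-cong (λ x → trans (count-map (λ q → okInv (lab x , q)) lab C) (count-↭ (E x) (↭-sym o↭))) C) ⟩
      sum (map (λ x → count (E x) o) C)
        ≡⟨ sum-↭ (PP.map⁺ (λ x → count (E x) o) (↭-sym o↭)) ⟩
      sum (map (λ x → count (E x) o) o)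
        ≡⟨ inversions o (index-increasing o-unique) ⟩
      inv o ∎
      where
      open ≡-Reasoning
      E : Cell k → Cell k → Bool
      E x y = okInv (lab x , lab y)
      ∧-falseʳ : ∀ a b → a ∧ b ∧ false ≡ false
      ∧-falseʳ true  true  = refl
      ∧-falseʳ true  false = refl
      ∧-falseʳ false _     = refl
      E-after : ∀ {x y} → ¬ index y o < index x o → E x y ≡ false
      E-after {x} {y} ≮ = trans (cong (λ b → (0ℤ <ℤ (sc y - sc x)) ∧ ((sc y - sc x) <ℤ pos k) ∧ b) (≮⇒<ᵇ≡ {suc (index y o)} (λ lt → ≮ (ℕP.≤-pred lt)))) (∧-falseʳ (0ℤ <ℤ (sc y - sc x)) _)
      ∧-trueʳ : ∀ a b → a ∧ b ∧ true ≡ a ∧ b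
      ∧-trueʳ true  true  = refl
      ∧-trueʳ true  false = refl
      ∧-trueʳ false _     = refl
      E-before : ∀ {x y} → index y o < index x o → (if E x y then 1 else 0) ≡ w y x
      E-before {x} {y} lt = cong (λ b → if b then 1 else 0) (trans
        (cong (λ b → (0ℤ <ℤ (sc y - sc x)) ∧ ((sc y - sc x) <ℤ pos k) ∧ b) (<⇒<ᵇ≡ (s≤s lt))) (∧-trueʳ (0ℤ <ℤ (sc y - sc x)) _))
      weights : ∀ z s → weightAfter z s ≡ sum (map (w z) s)
      weights z []      = refl
      weights z (x ∷ s) = cong (w z x ℕ.+_) (weights z s)
      inversions : ∀ s → AllPairs (λ x y → index x o < index y o) s → sum (map (λ x → count (E x) s) s) ≡ inv s
      inversions []      _           = refl
      inversions (z ∷ s) (z< ∷ incr) = cong₂ ℕ._+_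
        (count-none (E z) (E-after (ℕP.<-irrefl refl) ∷ All.map (λ lt → E-after (ℕP.<-asym lt)) z<))
        (begin
          sum (map (λ x → count (E x) (z ∷ s)) s)
            ≡⟨ cong sum (map-cong-∈ s (λ {x} x∈ → trans (count-∷ (E x) z s) (cong (ℕ._+ count (E x) s) (E-before (All.lookup z< x∈))))) ⟩
          sum (map (λ x → w z x ℕ.+ count (E x) s) s)
            ≡⟨ sum-map-+ (w z) (λ x → count (E x) s) s ⟩
          sum (map (w z) s) ℕ.+ sum (map (λ x → count (E x) s) s)
            ≡⟨ cong₂ ℕ._+_ (sym (weights z s)) (inversions s incr) ⟩
          weightAfter z s ℕ.+ inv s ∎)

    coeffF-filling : Standard o → ∀ α → pos (coeffF (size k ν) (signature (size k ν) (scWord k ν T₀)) α) ≡ ind (runs? α (map idx o))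
    coeffF-filling std α = trans (cong pos (cong₂ (λ m σ → coeffF m σ α) size≡
        (trans (cong₂ signature (sym (PP.↭-length o↭)) scWord≡) (signature-ascents R↭ R-sorted o↭ std))))
      (coeffF-ascents α (map idx o))
      where
      size≡ : length C ≡ length (map idx o)
      size≡ = trans (sym (PP.↭-length o↭)) (sym (LP.length-map idx o))

    inSYam-filling : Standard o → ∀ sh → All (0 <_) sh → Descending sh → sum sh ≡ n →
      indᵇ (inSYam sh (scWord k ν T₀)) ≡ ind (runs? sh (map idx o)) * ind (good? (chop sh (map idx o)))
    inSYam-filling std sh positive descending |sh| =
      trans (cong (indᵇ ∘ inSYam sh) scWord≡) (inSYam-runs-good R↭ R-sorted o↭ std sh positive descending |sh|)

  private
    when-standard : ∀ o {a b : ℤ} → (Standard o → a ≡ b) → ind (standard? o) * a ≡ ind (standard? o) * b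
    when-standard o f with standard? o
    ... | yes std = cong (1ℤ *_) (f std)
    ... | no _    = refl

  LLTcoeff-coefficient : ∀ α d → pos (LLTcoeff k ν α d) ≡ coefficient n (words (statistic d)) α
  LLTcoeff-coefficient α d = begin
    pos (LLTcoeff k ν α d)
      ≡⟨ pos-sum-filter (isStandardB k ν) term (perms (applyUpTo suc n)) ⟩
    ∑ (perms (applyUpTo suc n)) (λ T → indᵇ (isStandardB k ν T) * pos (term T))
      ≡⟨ ∑-fillings C-unique (λ T → indᵇ (isStandardB k ν T) * pos (term T)) ⟩
    ∑ (perms C) (λ o → indᵇ (isStandardB k ν (filling C-unique o)) * pos (term (filling C-unique o)))
      ≡⟨ ∑-cong-∈ (perms C) (λ o∈ → pointwise (perms⇒↭ C o∈)) ⟩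
    ∑ (perms C) (λ o → ind (standard? o) * statistic d (inv o) * ind (runs? α (map idx o)))
      ≡⟨ sym (coefficient-words P (statistic d) idx-bound α) ⟩
    coefficient n (words (statistic d)) α ∎
    where
    open ≡-Reasoning
    term : List ℕ → ℕ
    term T = if invk k ν T ≡ᵇ d then coeffF (size k ν) (signature (size k ν) (scWord k ν T)) α else 0
    pointwise : ∀ {o} → o ↭ C → indᵇ (isStandardB k ν (filling C-unique o)) * pos (term (filling C-unique o))
      ≡ ind (standard? o) * statistic d (inv o) * ind (runs? α (map idx o))
    pointwise {o} p = trans (cong₂ _*_ (isStandardB-filling p)
        (trans (pos-if (invk k ν T₀ ≡ᵇ d) _) (cong (λ m → indᵇ (m ≡ᵇ d) * pos (coeffF (size k ν) (signature (size k ν) (scWord k ν T₀)) α)) (invk-filling p))))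
      (trans (when-standard o (λ std → cong (statistic d (inv o) *_) (coeffF-filling p std α)))
        (sym (ℤP.*-assoc (ind (standard? o)) (statistic d (inv o)) (ind (runs? α (map idx o))))))
      where T₀ = filling C-unique o

  Tνλ-goodCoefficient : ∀ sh → All (0 <_) sh → Descending sh → sum sh ≡ n → ∀ d (c : ℕ) →
    pos (sum (map (λ T → if invk k ν T ≡ᵇ d then c else 0) (Tνλ k ν sh))) ≡ goodCoefficient n (words (statistic d)) sh * pos c
  Tνλ-goodCoefficient sh positive descending |sh| d c = begin
    pos (sum (map term (Tνλ k ν sh)))
      ≡⟨ pos-sum-filter (λ T → inSYam sh (scWord k ν T)) term (SYT k ν) ⟩
    ∑ (SYT k ν) (λ T → indᵇ (inSYam sh (scWord k ν T)) * pos (term T))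
      ≡⟨ ∑-filterᵇ (isStandardB k ν) (perms (applyUpTo suc n)) (λ T → indᵇ (inSYam sh (scWord k ν T)) * pos (term T)) ⟩
    ∑ (perms (applyUpTo suc n)) F
      ≡⟨ ∑-fillings C-unique F ⟩
    ∑ (perms C) (F ∘ filling C-unique)
      ≡⟨ ∑-cong-∈ (perms C) (λ o∈ → pointwise (perms⇒↭ C o∈)) ⟩
    ∑ (perms C) (λ o → ind (standard? o) * statistic d (inv o) * (ind (runs? sh (map idx o)) * ind (good? (chop sh (map idx o)))) * pos c)
      ≡⟨ ∑-*ʳ (perms C) (pos c) (λ o → ind (standard? o) * statistic d (inv o) * (ind (runs? sh (map idx o)) * ind (good? (chop sh (map idx o))))) ⟩
    ∑ (perms C) (λ o → ind (standard? o) * statistic d (inv o) * (ind (runs? sh (map idx o)) * ind (good? (chop sh (map idx o))))) * pos c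
      ≡⟨ cong (_* pos c) (sym (goodCoefficient-words P (statistic d) idx-bound sh)) ⟩
    goodCoefficient n (words (statistic d)) sh * pos c ∎
    where
    open ≡-Reasoning
    term : List ℕ → ℕ
    term T = if invk k ν T ≡ᵇ d then c else 0
    F : List ℕ → ℤ
    F T = indᵇ (isStandardB k ν T) * (indᵇ (inSYam sh (scWord k ν T)) * pos (term T))
    pointwise : ∀ {o} → o ↭ C → F (filling C-unique o)
      ≡ ind (standard? o) * statistic d (inv o) * (ind (runs? sh (map idx o)) * ind (good? (chop sh (map idx o)))) * pos c
    pointwise {o} p = trans (cong₂ (λ s t → s * (indᵇ (inSYam sh (scWord k ν T₀)) * t)) (isStandardB-filling p)
        (trans (pos-if (invk k ν T₀ ≡ᵇ d) c) (cong (λ m → indᵇ (m ≡ᵇ d) * pos c) (invk-filling p))))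
      (trans (when-standard o (λ std → cong (_* (statistic d (inv o) * pos c)) (inSYam-filling p std sh positive descending |sh|)))
        (rearrange (ind (standard? o)) (ind (runs? sh (map idx o)) * ind (good? (chop sh (map idx o)))) (statistic d (inv o)) (pos c)))
      where
      T₀ = filling C-unique o
      rearrange : ∀ s y t c → s * (y * (t * c)) ≡ s * t * y * c
      rearrange = solve-∀

-- Schur functions

linked-descending : ∀ {l} → Descending l → Linked _≥_ l
linked-descending []                      = []
linked-descending ([] ∷ [])               = [-]
linked-descending ((a≥b ∷ _) ∷ b≥ ∷ d) = a≥b ∷ linked-descending (b≥ ∷ d)

module Young (sh : List ℕ) (positive : All (0 <_) sh) (descending : Descending sh) where

  Y : List (ℕ × ℕ)
  Y = youngCells sh

  len = length sh

  -- The content `j - r` raised by the number of rows minus one, which makes it a natural number.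
  idx : ℕ × ℕ → ℕ
  idx (r , j) = j ℕ.+ (len ∸ suc r)

  ∈-Y⁻ : ∀ {r j} → (r , j) ∈ Y → j < part sh r
  ∈-Y⁻ x∈ with find (MP.∈-concatMap⁻ (λ r → map (r ,_) (upTo (part sh r))) {xs = upTo len} x∈)
  ... | r , _ , x∈r with MP.∈-map⁻ (r ,_) x∈r
  ...   | j , j∈ , refl = MP.∈-upTo⁻ j∈

  row-< : ∀ {r j} → j < part sh r → r < len
  row-< {r} = part-positive sh r

  ∈-Y⁺ : ∀ {r j} → j < part sh r → (r , j) ∈ Y
  ∈-Y⁺ {r} {j} lt = MP.∈-concatMap⁺ (λ r → map (r ,_) (upTo (part sh r)))
    (lose (MP.∈-upTo⁺ (row-< lt)) (MP.∈-map⁺ (r ,_) (MP.∈-upTo⁺ lt)))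

  antitone : ∀ {r r′} → r ≤ r′ → part sh r′ ≤ part sh r
  antitone = part-antitone {sh} (linked-descending descending)

  corner : ∀ {r₁ j₁ r₂ j₂ r j} → (r₁ , j₁) ∈ Y → (r₂ , j₂) ∈ Y → r ≤ r₂ → j ≤ j₂ → (r , j) ∈ Y
  corner _ y∈ r≤ j≤ = ∈-Y⁺ (ℕP.≤-<-trans j≤ (ℕP.<-≤-trans (∈-Y⁻ y∈) (antitone r≤)))

  RowOrder : ℕ × ℕ → ℕ × ℕ → Set
  RowOrder (r , j) (r′ , j′) = r < r′ ⊎ (r ≡ r′ × j < j′)

  RowOrder-asym : ∀ {x y} → RowOrder x y → ¬ RowOrder y x
  RowOrder-asym (inj₁ p)          (inj₁ q)       = ℕP.<-asym p q
  RowOrder-asym (inj₁ p)          (inj₂ (e , _)) = ℕP.<⇒≢ p (sym e)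
  RowOrder-asym (inj₂ (e , _))    (inj₁ q)       = ℕP.<⇒≢ q (sym e)
  RowOrder-asym (inj₂ (_ , p))    (inj₂ (_ , q)) = ℕP.<-asym p q

  Y-sorted : AllPairs RowOrder Y
  Y-sorted = APP.concat⁺
    (AllP.map⁺ (All.universal (λ r → APP.map⁺ (AllPairs.map (λ lt → inj₂ (refl , lt)) (applyUpTo-increasing id (part sh r)))) (upTo len)))
    (APP.map⁺ (AllPairs.map (λ lt → AllP.map⁺ (All.universal (λ _ → AllP.map⁺ (All.universal (λ _ → inj₁ lt) _)) _)) (applyUpTo-increasing id len)))

  Y-unique : Unique Y
  Y-unique = AllPairs.map (λ {x} {y} r eq → RowOrder-asym {x} {y} r (subst₂ RowOrder eq (sym eq) r)) Y-sorted

  map-row : map proj₁ Y ≡ expand 0 sh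
  map-row = trans (go sh (upTo len)) (go′ 0 sh (λ i → i) (λ _ → refl) sh refl)
    where
    go : ∀ sh rs → map proj₁ (concatMap (λ r → map (r ,_) (upTo (part sh r))) rs) ≡ concatMap (λ r → replicate (part sh r) r) rs
    go sh []       = refl
    go sh (r ∷ rs) = trans (LP.map-++ proj₁ (map (r ,_) (upTo (part sh r))) _) (cong₂ _++_
      (trans (sym (LP.map-∘ (upTo (part sh r)))) (trans (LP.map-applyUpTo id (λ _ → r) (part sh r)) (applyUpTo-const r (part sh r)))) (go sh rs))
    go′ : ∀ v s (h : ℕ → ℕ) → (∀ i → h i ≡ v ℕ.+ i) → ∀ t → t ≡ s →
      concatMap (λ r → replicate (part s (r ∸ v)) r) (applyUpTo h (length t)) ≡ expand v s
    go′ v []       h eq t refl = refl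
    go′ v (a ∷ as) h eq t refl = cong₂ _++_
      (trans (cong (λ r → replicate (part (a ∷ as) (r ∸ v)) r) (trans (eq 0) (ℕP.+-identityʳ v))) (cong (λ m → replicate (part (a ∷ as) m) v) (ℕP.n∸n≡0 v)))
      (trans (cong concat (map-cong-∈ (applyUpTo (h ∘ suc) (length as)) shifted)) (go′ (suc v) as (h ∘ suc) (λ i → trans (eq (suc i)) (ℕP.+-suc v i)) as refl))
      where
      shifted : ∀ {r} → r ∈ applyUpTo (h ∘ suc) (length as) → replicate (part (a ∷ as) (r ∸ v)) r ≡ replicate (part as (r ∸ suc v)) r
      shifted r∈ with MP.∈-applyUpTo⁻ (h ∘ suc) r∈
      ... | i , _ , refl = cong (λ m → replicate m (h (suc i))) (trans (cong (part (a ∷ as)) (trans (cong (_∸ v) (eq (suc i))) (ℕP.m+n∸m≡n v (suc i))))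
        (cong (part as) (sym (trans (cong (_∸ suc v) (trans (eq (suc i)) (ℕP.+-suc v i))) (ℕP.m+n∸m≡n (suc v) i)))))

  length-Y : length Y ≡ sum sh
  length-Y = trans (sym (LP.length-map proj₁ Y)) (trans (cong length map-row) (length-expand 0 sh))

  infix 4 _≺_
  _≺_ : ℕ × ℕ → ℕ × ℕ → Set
  (r , j) ≺ (r′ , j′) = (r ≤ r′ × j ≤ j′) × (r < r′ ⊎ j < j′)

  _≺?_ : ∀ x y → Dec (x ≺ y)
  (r , j) ≺? (r′ , j′) = ((r ℕP.≤? r′) ×-dec (j ℕP.≤? j′)) ×-dec ((r ℕP.<? r′) ⊎-dec (j ℕP.<? j′))

  ≺-irrefl : ∀ {x} → ¬ x ≺ x
  ≺-irrefl (_ , inj₁ lt) = ℕP.<-irrefl refl lt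
  ≺-irrefl (_ , inj₂ lt) = ℕP.<-irrefl refl lt

  ≺-trans : ∀ {x y z} → x ≺ y → y ≺ z → x ≺ z
  ≺-trans ((r , j) , inj₁ lt) ((r′ , j′) , _) = (ℕP.≤-trans r r′ , ℕP.≤-trans j j′) , inj₁ (ℕP.<-≤-trans lt r′)
  ≺-trans ((r , j) , inj₂ lt) ((r′ , j′) , _) = (ℕP.≤-trans r r′ , ℕP.≤-trans j j′) , inj₂ (ℕP.<-≤-trans lt j′)

  P : Poset
  P = record
    { A = ℕ × ℕ ; C = Y ; C-unique = Y-unique ; _≺_ = _≺_ ; _≺?_ = _≺?_
    ; ≺-irrefl = λ {x} → ≺-irrefl {x} ; ≺-trans = λ {x} {y} {z} → ≺-trans {x} {y} {z} ; idx = idx ; w = λ _ _ → 0 }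

  idx-up : ∀ {r j} → suc r < len → idx (r , j) ≡ suc (idx (suc r , j))
  idx-up {r} {j} r< = trans (cong (j ℕ.+_) (sym (ℕP.suc-pred (len ∸ suc r) ⦃ ℕ.>-nonZero (ℕP.m<n⇒0<n∸m r<) ⦄)))
    (trans (ℕP.+-suc j _) (cong (λ m → suc (j ℕ.+ m)) (ℕP.pred[m∸n]≡m∸[1+n] len (suc r))))

  idx-bound : ∀ {x} → x ∈ Y → idx x < length Y
  idx-bound {r , j} x∈ = subst (idx (r , j) <_) (sym length-Y) (go sh positive refl)
    where
    j<₀ : j < part sh 0
    j<₀ = ℕP.<-≤-trans (∈-Y⁻ x∈) (antitone z≤n)
    length≤sum : ∀ {l} → All (0 <_) l → length l ≤ sum l
    length≤sum []       = z≤n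
    length≤sum (p ∷ ps) = ℕP.+-mono-≤ p (length≤sum ps)
    go : ∀ l → All (0 <_) l → l ≡ sh → idx (r , j) < sum l
    go []      _        refl = ⊥-elim (ℕP.n≮0 (∈-Y⁻ x∈))
    go (a ∷ l) (_ ∷ ps) refl = ℕP.+-mono-<-≤ j<₀ (ℕP.≤-trans (ℕP.m∸n≤m (length l) r) (length≤sum ps))

  private
    Between : ℕ × ℕ → ℕ × ℕ → Set
    Between x y = ∃ λ z → z ∈ Y × x ≺ z × z ≺ y

    cover : ∀ x y → x ∈ Y → y ∈ Y → x ≺ y → Between x y ⊎ (idx y ≡ suc (idx x) ⊎ idx x ≡ suc (idx y))
    cover (r₁ , j₁) (r₂ , j₂) x∈ y∈ ((r≤ , j≤) , strict) with ℕP.m≤n⇒m<n∨m≡n r≤ | ℕP.m≤n⇒m<n∨m≡n j≤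
    ... | inj₁ r< | inj₁ j< = inj₁ ((r₁ , j₂) , corner x∈ y∈ r≤ ℕP.≤-refl , ((ℕP.≤-refl , j≤) , inj₂ j<) , ((r≤ , ℕP.≤-refl) , inj₁ r<))
    ... | inj₂ refl | inj₂ refl = ⊥-elim (≺-irrefl {r₁ , j₁} ((r≤ , j≤) , strict))
    ... | inj₂ refl | inj₁ j< with ℕP.m≤n⇒m<n∨m≡n j<
    ...   | inj₂ refl = inj₂ (inj₁ refl)
    ...   | inj₁ j<<  = inj₁ ((r₁ , suc j₁) , corner x∈ y∈ r≤ j< , ((ℕP.≤-refl , ℕP.n≤1+n j₁) , inj₂ (ℕP.n<1+n j₁)) , ((ℕP.≤-refl , j<) , inj₂ j<<))
    cover (r₁ , j₁) (r₂ , j₂) x∈ y∈ ((r≤ , j≤) , strict) | inj₁ r< | inj₂ refl with ℕP.m≤n⇒m<n∨m≡n r<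
    ... | inj₂ refl = inj₂ (inj₂ (idx-up {r₁} {j₁} (row-< (∈-Y⁻ y∈))))
    ... | inj₁ r<<  = inj₁ ((suc r₁ , j₁) , corner x∈ y∈ r< j≤ , ((ℕP.n≤1+n r₁ , ℕP.≤-refl) , inj₁ (ℕP.n<1+n r₁)) , ((r< , ℕP.≤-refl) , inj₁ r<<))

    apart : ∀ {i j} → 2 ℕ.+ i ≤ j → Poset.SwappableLetters P i j 0 0
    apart far {x} {y} x∈ y∈ refl refl =
      (λ x≺y → pick (cover x y x∈ y∈ x≺y)) , (λ y≺x → pick′ (cover y x y∈ x∈ y≺x)) , refl , refl
      where
      up : idx y ≢ suc (idx x)
      up eq = ℕP.<⇒≢ far (sym eq)
      down : idx x ≢ suc (idx y)
      down eq = ℕP.<⇒≱ (ℕP.≤-trans (ℕP.n≤1+n _) far) (ℕP.≤-trans (ℕP.n≤1+n _) (ℕP.≤-reflexive (sym eq)))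
      pick : _ → Between x y
      pick (inj₁ b)        = b
      pick (inj₂ (inj₁ e)) = ⊥-elim (up e)
      pick (inj₂ (inj₂ e)) = ⊥-elim (down e)
      pick′ : _ → Between y x
      pick′ (inj₁ b)        = b
      pick′ (inj₂ (inj₁ e)) = ⊥-elim (down e)
      pick′ (inj₂ (inj₂ e)) = ⊥-elim (up e)

  same-diagonal : ∀ {r₁ j₁ r₂ j₂} → (r₂ , j₂) ∈ Y → r₁ < r₂ → idx (r₁ , j₁) ≡ idx (r₂ , j₂) → j₁ < j₂
  same-diagonal {r₁} {j₁} {r₂} {j₂} y∈ r< eq = ℕP.≰⇒> λ j₂≤j₁ → ℕP.<⇒≢
    (ℕP.≤-<-trans (ℕP.+-monoˡ-≤ (len ∸ suc r₂) j₂≤j₁) (ℕP.+-monoʳ-< j₁ (ℕP.∸-monoʳ-< (s≤s r<) (row-< (∈-Y⁻ y∈))))) (sym eq)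

  private
    surround : ∀ {r₁ j₁ r₂ j₂} → (r₁ , j₁) ∈ Y → (r₂ , j₂) ∈ Y → r₁ < r₂ → idx (r₁ , j₁) ≡ idx (r₂ , j₂) →
      Poset.Sandwich P (r₁ , j₁) (r₂ , j₂)
    surround {r₁} {j₁} {r₂} {j₂} x∈ y∈ r< eq =
      ((r₁ , suc j₁) , corner x∈ y∈ (ℕP.<⇒≤ r<) j< , ((ℕP.≤-refl , ℕP.n≤1+n j₁) , inj₂ (ℕP.n<1+n j₁)) , ((ℕP.<⇒≤ r< , j<) , inj₁ r<) , ℕP.n<1+n _) ,
      ((suc r₁ , j₁) , corner x∈ y∈ r< (ℕP.<⇒≤ j<) , ((ℕP.n≤1+n r₁ , ℕP.≤-refl) , inj₁ (ℕP.n<1+n r₁)) , ((r< , ℕP.<⇒≤ j<) , inj₂ j<) ,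
        ℕP.≤-reflexive (sym (idx-up {r₁} {j₁} (ℕP.≤-<-trans r< (row-< (∈-Y⁻ y∈))))))
      where
      j< : j₁ < j₂
      j< = same-diagonal y∈ r< eq

  -- All covers change the content by 1 and there are no inversions, so letters at distance 2
  -- commute and every triple is of Knuth type.
  switchable : Switchable P
  switchable = record
    { commute  = λ 3+i≤j → apart (ℕP.≤-trans (ℕP.n≤1+n _) 3+i≤j)
    ; triple   = λ i → inj₁ (apart ℕP.≤-refl)
    ; sandwich = sandwich
    }
    where
    sandwich : ∀ {p q} → p ∈ Y → q ∈ Y → p ≢ q → idx p ≡ idx q → Poset.Sandwich P p q ⊎ Poset.Sandwich P q p
    sandwich {r₁ , j₁} {r₂ , j₂} p∈ q∈ p≢q eq with ℕP.<-cmp r₁ r₂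
    ... | tri< r< _ _ = inj₁ (surround p∈ q∈ r< eq)
    ... | tri> _ _ r> = inj₂ (surround q∈ p∈ r> (sym eq))
    ... | tri≈ _ refl _ = ⊥-elim (p≢q (cong (r₁ ,_) (ℕP.+-cancelʳ-≡ (len ∸ suc r₁) j₁ j₂ eq)))

nth : List ℕ → ℕ → ℕ
nth []       i       = 0
nth (x ∷ xs) zero    = x
nth (x ∷ xs) (suc i) = nth xs i

map-≡⇒∈ : {A B : Set} {f g : A → B} (xs : List A) → map f xs ≡ map g xs → ∀ {x} → x ∈ xs → f x ≡ g x
map-≡⇒∈ (x ∷ xs) eq (here refl) = LP.∷-injectiveˡ eq
map-≡⇒∈ (x ∷ xs) eq (there x∈)  = map-≡⇒∈ xs (LP.∷-injectiveʳ eq) x∈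

sorted-exists : {A : Set} {R : A → A → Set} (xs : List A) → Unique xs →
  (∀ {x y} → x ∈ xs → y ∈ xs → x ≢ y → R x y ⊎ R y x) → (∀ {x y z} → R x y → R y z → R x z) →
  ∃ λ o → o ↭ xs × AllPairs R o
sorted-exists []       _         total tr = [] , ↭-refl , []
sorted-exists {R = R} (x ∷ xs) (x∉ ∷ u) total tr with sorted-exists xs u (λ p q → total (there p) (there q)) tr
... | o , p , sorted with insert o (PP.All-resp-↭ (↭-sym p) (All.tabulate (λ y∈ → total (here refl) (there y∈) (All.lookup x∉ y∈)))) sorted
  where
  insert : ∀ o → All (λ y → R x y ⊎ R y x) o → AllPairs R o → ∃ λ o′ → o′ ↭ x ∷ o × AllPairs R o′
  insert []      _                _          = x ∷ [] , ↭-refl , [] ∷ []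
  insert (y ∷ o) (inj₁ r ∷ _)     (ry ∷ rs)  = x ∷ y ∷ o , ↭-refl , (r ∷ All.map (tr r) ry) ∷ ry ∷ rs
  insert (y ∷ o) (inj₂ r ∷ cmps)  (ry ∷ rs) with insert o cmps rs
  ... | o′ , q , s = y ∷ o′ , ↭-trans (Perm.prep y q) (Perm.swap y x ↭-refl) , PP.All-resp-↭ (↭-sym q) (r ∷ ry) ∷ s
...   | o′ , q , sorted′ = o′ , ↭-trans q (Perm.prep x p) , sorted′

∑-bijection : {A B : Set} (p : A → Bool) (q : B → Bool) {xs : List A} {ys : List B} (h : A → B) → Unique xs → Unique ys →
  (∀ {x} → x ∈ xs → p x ≡ true → h x ∈ ys × q (h x) ≡ true) →
  (∀ {x x′} → x ∈ xs → x′ ∈ xs → p x ≡ true → p x′ ≡ true → h x ≡ h x′ → x ≡ x′) →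
  (∀ {y} → y ∈ ys → q y ≡ true → ∃ λ x → x ∈ xs × p x ≡ true × h x ≡ y) →
  ∑ xs (λ x → indᵇ (p x)) ≡ ∑ ys (λ y → indᵇ (q y))
∑-bijection {A} {B} p q {xs} {ys} h ux uy maps inj surj = begin
  ∑ xs (λ x → indᵇ (p x))                ≡⟨ sym (count-as-sum p xs) ⟩
  ∑ (filterᵇ p xs) (λ _ → 1ℤ)            ≡⟨ sym (∑-map h (filterᵇ p xs) (λ _ → 1ℤ)) ⟩
  ∑ (map h (filterᵇ p xs)) (λ _ → 1ℤ)    ≡⟨ ∑-↭ (λ _ → 1ℤ) same ⟩
  ∑ (filterᵇ q ys) (λ _ → 1ℤ)            ≡⟨ count-as-sum q ys ⟩
  ∑ ys (λ y → indᵇ (q y))                ∎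
  where
  open ≡-Reasoning
  count-as-sum : {D : Set} (r : D → Bool) (zs : List D) → ∑ (filterᵇ r zs) (λ _ → 1ℤ) ≡ ∑ zs (λ z → indᵇ (r z))
  count-as-sum r zs = trans (∑-filterᵇ r zs (λ _ → 1ℤ)) (∑-cong zs (λ z → ℤP.*-identityʳ (indᵇ (r z))))
  kept : {D : Set} (r : D → Bool) {zs : List D} {z : D} → z ∈ filterᵇ r zs → z ∈ zs × r z ≡ true
  kept r {zs} z∈ with MP.∈-filter⁻ (T? ∘ r) {xs = zs} z∈
  ... | z∈′ , t = z∈′ , T⇒≡ t
  keep : {D : Set} (r : D → Bool) {zs : List D} {z : D} → z ∈ zs → r z ≡ true → z ∈ filterᵇ r zs
  keep r z∈ eq = MP.∈-filter⁺ (T? ∘ r) z∈ (subst T (sym eq) tt)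
  same : map h (filterᵇ p xs) ↭ filterᵇ q ys
  same = unique-≈⇒↭
    (unique-map-∈ h (UP.filter⁺ (T? ∘ p) ux) (λ x∈ x′∈ → inj (proj₁ (kept p {xs} x∈)) (proj₁ (kept p {xs} x′∈)) (proj₂ (kept p {xs} x∈)) (proj₂ (kept p {xs} x′∈))))
    (UP.filter⁺ (T? ∘ q) uy)
    (λ y∈ → let (x , x∈ , eq) = MP.∈-map⁻ h y∈ ; (x∈′ , px) = kept p {xs} x∈ ; (hx∈ , qhx) = maps x∈′ px in
      subst (_∈ filterᵇ q ys) (sym eq) (keep q hx∈ qhx))
    (λ {y} y∈ → let (y∈′ , qy) = kept q {ys} y∈ ; (x , x∈ , px , eq) = surj y∈′ qy in
      subst (_∈ map h (filterᵇ p xs)) eq (MP.∈-map⁺ h (keep p x∈ px)))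

-- Semistandard tableaux and standardisation

module Tableaux (sh : List ℕ) (positive : All (0 <_) sh) (descending : Descending sh) where
  open Young sh positive descending public
  open Poset P using (Standard; standard?; inv; words)

  _≟ᵖ_ : (x y : ℕ × ℕ) → Dec (x ≡ y)
  _≟ᵖ_ = ×P.≡-dec ℕ._≟_ ℕ._≟_

  open Indexing _≟ᵖ_ public

  module Numbered (α : List ℕ) {o : List (ℕ × ℕ)} (o↭ : o ↭ Y) (|o| : length o ≡ sum α) where

    b : ℕ × ℕ → ℕ
    b x = block α (index x o)

    o-unique : Unique o
    o-unique = unique-↭ (↭-sym o↭) Y-unique

    Y⇒o : ∀ {x} → x ∈ Y → x ∈ o
    Y⇒o = PP.∈-resp-↭ (↭-sym o↭)

    o⇒Y : ∀ {x} → x ∈ o → x ∈ Y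
    o⇒Y = PP.∈-resp-↭ o↭

    map-b : map b o ≡ expand 0 α
    map-b = map-block α o-unique |o|

    blocks : Blocks b 0 α o
    blocks = toBlocks b idx 0 α o map-b

    b-bound : ∀ {x} → x ∈ o → b x < length α
    b-bound x∈ with MP.∈-map⁺ b x∈
    ... | bx∈ = All.lookup (expand-< 0 α) (subst (b _ ∈_) map-b bx∈)

    module _ (std : Standard o) (inc : All Increasing (chop α (map idx o))) where

      ≺⇒index : ∀ x y → x ∈ Y → y ∈ Y → x ≺ y → index x o < index y o
      ≺⇒index x y x∈ y∈ x≺y with ℕP.<-cmp (index x o) (index y o)
      ... | tri< lt _ _ = lt
      ... | tri> _ _ gt = ⊥-elim (index-<⇒ std (Y⇒o y∈) (Y⇒o x∈) gt x≺y)
      ... | tri≈ _ eq _ with index-injective (Y⇒o x∈) (Y⇒o y∈) eq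
      ...   | refl = ⊥-elim (≺-irrefl {x} x≺y)

      b-≤ : ∀ x y → x ∈ Y → y ∈ Y → x ≺ y → b x ≤ b y
      b-≤ x y x∈ y∈ x≺y = block-mono α (ℕP.<⇒≤ (≺⇒index x y x∈ y∈ x≺y))

      -- Up a column the letter falls, whereas inside a block it rises along the ordering; two cells
      -- of a column cannot share a block.
      b-up : ∀ r j r′ → (r , j) ∈ Y → (r′ , j) ∈ Y → r < r′ → b (r , j) < b (r′ , j)
      b-up r j r′ x∈ y∈ r< = ℕP.≤∧≢⇒< (b-≤ (r , j) (r′ , j) x∈ y∈ x≺y) (λ eq → ℕP.<-asym (idx-down r<)
          (index-<⇒ (runs⇒sameBlock b idx blocks inc) (Y⇒o x∈) (Y⇒o y∈) (≺⇒index (r , j) (r′ , j) x∈ y∈ x≺y) eq))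
        where
        x≺y : (r , j) ≺ (r′ , j)
        x≺y = (ℕP.<⇒≤ r< , ℕP.≤-refl) , inj₁ r<
        idx-down : r < r′ → idx (r′ , j) < idx (r , j)
        idx-down r< = ℕP.+-monoʳ-< j (ℕP.∸-monoʳ-< (s≤s r<) (row-< (∈-Y⁻ y∈)))

      b-sorted : AllPairs (λ x y → b x < b y ⊎ (b x ≡ b y × idx x < idx y)) o
      b-sorted = AllPairs-map-∈ (λ {x} {y} x∈ y∈ lt → pick x y (ℕP.m≤n⇒m<n∨m≡n (block-mono α (ℕP.<⇒≤ lt)))
          (index-<⇒ (runs⇒sameBlock b idx blocks inc) x∈ y∈ lt)) (index-increasing o-unique)
        where
        pick : ∀ x y → b x < b y ⊎ b x ≡ b y → (b x ≡ b y → idx x < idx y) → b x < b y ⊎ (b x ≡ b y × idx x < idx y)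
        pick x y (inj₁ lt) _ = inj₁ lt
        pick x y (inj₂ eq) f = inj₂ (eq , f eq)

  KeyOrder : (ℕ × ℕ → ℕ) → ℕ × ℕ → ℕ × ℕ → Set
  KeyOrder v x y = v x < v y ⊎ (v x ≡ v y × idx x < idx y)

  KeyOrder-asym : ∀ v {x y} → KeyOrder v x y → ¬ KeyOrder v y x
  KeyOrder-asym v (inj₁ p)       (inj₁ q)       = ℕP.<-asym p q
  KeyOrder-asym v (inj₁ p)       (inj₂ (e , _)) = ℕP.<⇒≢ p (sym e)
  KeyOrder-asym v (inj₂ (e , _)) (inj₁ q)       = ℕP.<⇒≢ q (sym e)
  KeyOrder-asym v (inj₂ (_ , p)) (inj₂ (_ , q)) = ℕP.<-asym p q

  KeyOrder-trans : ∀ v {x y z} → KeyOrder v x y → KeyOrder v y z → KeyOrder v x z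
  KeyOrder-trans v         (inj₁ p)       (inj₁ q)       = inj₁ (ℕP.<-trans p q)
  KeyOrder-trans v {x}     (inj₁ p)       (inj₂ (e , _)) = inj₁ (subst (v x <_) e p)
  KeyOrder-trans v {z = z} (inj₂ (e , _)) (inj₁ q)       = inj₁ (subst (_< v z) (sym e) q)
  KeyOrder-trans v         (inj₂ (e , p)) (inj₂ (f , q)) = inj₂ (trans e f , ℕP.<-trans p q)

  module _ (α : List ℕ) where

    Valid : List (ℕ × ℕ) → Set
    Valid o = Standard o × Runs α (map idx o)

    valid? : ∀ o → Dec (Valid o)
    valid? o = standard? o ×-dec runs? α (map idx o)

    -- Destandardisation: the entry of a cell is the number of the run in which the ordering lists
    -- it.
    tableau : List (ℕ × ℕ) → List ℕ
    tableau o = map (λ x → block α (index x o)) Y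

    private
      |o|≡ : ∀ {o} → Runs α (map idx o) → length o ≡ sum α
      |o|≡ {o} (eq , _) = trans (sym (LP.length-map idx o)) eq

      okTableau-all : ∀ (v : ℕ × ℕ → ℕ) → allᵇ okTableau (pairs (map (λ x → x , v x) Y)) ≡ true →
        (∀ r j j′ → (r , j) ∈ Y → (r , j′) ∈ Y → j < j′ → v (r , j) ≤ v (r , j′)) ×
        (∀ r r′ j → (r , j) ∈ Y → (r′ , j) ∈ Y → r < r′ → v (r , j) < v (r′ , j))
      okTableau-all v all =
        (λ r j j′ x∈ y∈ j< → ℕP.≤ᵇ⇒≤ _ _ (subst T (sym (implies⇒ (proj₁ (∧-true (ok x∈ y∈))) (cong₂ _∧_ (≡ᵇ-refl r) (<⇒<ᵇ≡ j<)))) tt)) ,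
        (λ r r′ j x∈ y∈ r< → ℕP.<ᵇ⇒< _ _ (subst T (sym (implies⇒ (proj₂ (∧-true {not ((r ≡ᵇ r′) ∧ (j <ᵇ j)) ∨ (v (r , j) ≤ᵇ v (r′ , j))} (ok x∈ y∈)))
          (cong₂ _∧_ (≡ᵇ-refl j) (<⇒<ᵇ≡ r<)))) tt))
        where
        ok : ∀ {x y} → x ∈ Y → y ∈ Y → okTableau ((x , v x) , (y , v y)) ≡ true
        ok x∈ y∈ = allᵇ⇒ okTableau all (∈-pairs⁺ (MP.∈-map⁺ (λ x → x , v x) x∈) (MP.∈-map⁺ (λ x → x , v x) y∈))

      maps : ∀ {o} → o ∈ perms Y → does (valid? o) ≡ true →
        tableau o ∈ allWords (length α) (length Y) × isTableau sh α (tableau o) ≡ true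
      maps {o} o∈ val with does⇒ (valid? o) val
      ... | std , runs = subst (λ l → tableau o ∈ allWords (length α) l) (LP.length-map _ Y)
            (∈-allWords⁺ (tableau o) (AllP.map⁺ (All.tabulate (λ x∈ → N.b-bound (N.Y⇒o x∈))))) ,
          cong₂ _∧_ (trans (cong (allᵇ okTableau ∘ pairs) (zip-map N.b Y)) (⇒allᵇ okTableau _ ok)) content≡
        where
        module N = Numbered α (perms⇒↭ Y o∈) (|o|≡ {o} runs)
        content≡ : contentFrom (tableau o) 0 α ≡ true
        content≡ = trans (contentFrom-cong 0 α (λ u _ → count-↭ (u ≡ᵇ_) (subst (tableau o ↭_) N.map-b (PP.map⁺ N.b (↭-sym (perms⇒↭ Y o∈))))))
          (contentFrom-expand 0 α)
        ok : ∀ {p} → p ∈ pairs (map (λ x → x , N.b x) Y) → okTableau p ≡ true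
        ok p∈ with MP.∈-map⁻ (λ x → x , N.b x) {xs = Y} (proj₁ (∈-pairs⁻ {xs = map (λ x → x , N.b x) Y} p∈))
                 | MP.∈-map⁻ (λ x → x , N.b x) {xs = Y} (proj₂ (∈-pairs⁻ {xs = map (λ x → x , N.b x) Y} p∈))
        ... | (r , j) , x∈ , refl | (r′ , j′) , y∈ , refl = cong₂ _∧_
          (⇒implies λ c → let (e , l) = ∧-true {r ≡ᵇ r′} c in rowOk (ℕP.≡ᵇ⇒≡ r r′ (subst T (sym e) tt)) (ℕP.<ᵇ⇒< j j′ (subst T (sym l) tt)))
          (⇒implies λ c → let (e , l) = ∧-true {j ≡ᵇ j′} c in colOk (ℕP.≡ᵇ⇒≡ j j′ (subst T (sym e) tt)) (ℕP.<ᵇ⇒< r r′ (subst T (sym l) tt)))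
          where
          rowOk : r ≡ r′ → j < j′ → (N.b (r , j) ≤ᵇ N.b (r′ , j′)) ≡ true
          rowOk refl j< = ≤⇒≤ᵇ≡ (N.b-≤ std (proj₂ runs) (r , j) (r , j′) x∈ y∈ ((ℕP.≤-refl , ℕP.<⇒≤ j<) , inj₂ j<))
          colOk : j ≡ j′ → r < r′ → (N.b (r , j) <ᵇ N.b (r′ , j′)) ≡ true
          colOk refl r< = <⇒<ᵇ≡ (N.b-up std (proj₂ runs) r j r′ x∈ y∈ r<)

      injective : ∀ {o o′} → o ∈ perms Y → o′ ∈ perms Y → does (valid? o) ≡ true → does (valid? o′) ≡ true → tableau o ≡ tableau o′ → o ≡ o′
      injective {o} {o′} o∈ o′∈ val val′ eq with does⇒ (valid? o) val | does⇒ (valid? o′) val′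
      ... | std , runs | std′ , runs′ = sorted-↭⇒≡ (λ {x} {y} → KeyOrder-asym N.b {x} {y}) (N.b-sorted std (proj₂ runs))
        (AllPairs-map-∈ (λ {x} {y} x∈ y∈ → subst₂ (λ u v → u < v ⊎ (u ≡ v × idx x < idx y)) (same x∈) (same y∈)) (N′.b-sorted std′ (proj₂ runs′)))
        (↭-trans (perms⇒↭ Y o∈) (↭-sym (perms⇒↭ Y o′∈)))
        where
        module N = Numbered α (perms⇒↭ Y o∈) (|o|≡ {o} runs)
        module N′ = Numbered α (perms⇒↭ Y o′∈) (|o|≡ {o′} runs′)
        same : ∀ {x} → x ∈ o′ → N′.b x ≡ N.b x
        same x∈ = sym (map-≡⇒∈ Y eq (N′.o⇒Y x∈))

      -- Standardisation: the cells are listed by entry and, among equal entries, by increasing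
      -- content.
      surjective : ∀ {f} → f ∈ allWords (length α) (length Y) → isTableau sh α f ≡ true → ∃ λ o → o ∈ perms Y × does (valid? o) ≡ true × tableau o ≡ f
      surjective {f} f∈ ok = o , ↭⇒perms Y o↭ , does-true (valid? o) (std , runs) ,
          trans (map-cong-∈ Y (λ x∈ → b≡v (N.Y⇒o x∈))) map-v
        where
        bounded = All.lookup (allWords-bounded (length α) (length Y)) f∈
        v : ℕ × ℕ → ℕ
        v x = nth f (index x Y)
        map-v : map v Y ≡ f
        map-v = begin
          map v Y                                                       ≡⟨ LP.map-∘ Y ⟩
          map (nth f ∘ ℕ.pred) (map (λ x → suc (index x Y)) Y)          ≡⟨ cong (map (nth f ∘ ℕ.pred)) (map-index Y-unique) ⟩
          map (nth f ∘ ℕ.pred) (applyUpTo suc (length Y))               ≡⟨ LP.map-applyUpTo suc (nth f ∘ ℕ.pred) (length Y) ⟩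
          applyUpTo (nth f) (length Y)                                  ≡⟨ cong (applyUpTo (nth f)) (sym (proj₁ bounded)) ⟩
          applyUpTo (nth f) (length f)                                  ≡⟨ applyUpTo-nth f ⟩
          f                                                             ∎
          where
          open ≡-Reasoning
          applyUpTo-nth : ∀ f → applyUpTo (nth f) (length f) ≡ f
          applyUpTo-nth []      = refl
          applyUpTo-nth (x ∷ f) = cong (x ∷_) (applyUpTo-nth f)
        conditions = okTableau-all v (trans (cong (allᵇ okTableau ∘ pairs) (trans (sym (zip-map v Y)) (cong (zip Y) map-v)))
          (proj₁ (∧-true {allᵇ okTableau (pairs (zip Y f))} ok)))
        rowWeak = proj₁ conditions
        colStrict = proj₂ conditions
        row≤ : ∀ r {j j′} → (r , j′) ∈ Y → j ≤ j′ → v (r , j) ≤ v (r , j′)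
        row≤ r {j} {j′} y∈ j≤ with ℕP.m≤n⇒m<n∨m≡n j≤
        ... | inj₁ j<   = rowWeak r j j′ (corner y∈ y∈ ℕP.≤-refl j≤) y∈ j<
        ... | inj₂ refl = ℕP.≤-refl
        steep : ∀ {r j r′ j′} → (r′ , j′) ∈ Y → r < r′ → j ≤ j′ → v (r , j) < v (r′ , j′)
        steep {r} {j} {r′} {j′} y∈ r< j≤ = ℕP.≤-<-trans (row≤ r (corner y∈ y∈ (ℕP.<⇒≤ r<) ℕP.≤-refl) j≤)
          (colStrict r r′ j′ (corner y∈ y∈ (ℕP.<⇒≤ r<) ℕP.≤-refl) y∈ r<)
        total : ∀ {x y} → x ∈ Y → y ∈ Y → x ≢ y → KeyOrder v x y ⊎ KeyOrder v y x
        total {r₁ , j₁} {r₂ , j₂} x∈ y∈ x≢y with ℕP.<-cmp (v (r₁ , j₁)) (v (r₂ , j₂))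
        ... | tri< lt _ _ = inj₁ (inj₁ lt)
        ... | tri> _ _ gt = inj₂ (inj₁ gt)
        ... | tri≈ _ e _ with ℕP.<-cmp (idx (r₁ , j₁)) (idx (r₂ , j₂))
        ...   | tri< lt _ _ = inj₁ (inj₂ (e , lt))
        ...   | tri> _ _ gt = inj₂ (inj₂ (sym e , gt))
        -- Equal entries on one diagonal are excluded: a row step followed by a column step makes
        -- the upper entry strictly larger.
        ...   | tri≈ _ d _ with ℕP.<-cmp r₁ r₂
        ...     | tri< r< _ _ = ⊥-elim (ℕP.<⇒≢ (steep y∈ r< (ℕP.<⇒≤ (same-diagonal y∈ r< d))) e)
        ...     | tri> _ _ r> = ⊥-elim (ℕP.<⇒≢ (steep x∈ r> (ℕP.<⇒≤ (same-diagonal x∈ r> (sym d)))) (sym e))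
        ...     | tri≈ _ refl _ = ⊥-elim (x≢y (cong (r₁ ,_) (ℕP.+-cancelʳ-≡ (len ∸ suc r₁) j₁ j₂ d)))
        ordering = sorted-exists Y Y-unique total (λ {x} {y} {z} → KeyOrder-trans v {x} {y} {z})
        o = proj₁ ordering
        o↭ : o ↭ Y
        o↭ = proj₁ (proj₂ ordering)
        o-sorted : AllPairs (KeyOrder v) o
        o-sorted = proj₂ (proj₂ ordering)
        std : Standard o
        std = AllPairs-map-∈ (λ {x} {y} x∈ y∈ r y≺x → notBelow x y (PP.∈-resp-↭ o↭ x∈) r y≺x) o-sorted
          where
          notBelow : ∀ x y → x ∈ Y → KeyOrder v x y → ¬ y ≺ x
          notBelow (r₁ , j₁) (r₂ , j₂) x∈ r ((r≤ , j≤) , strict) with ℕP.m≤n⇒m<n∨m≡n r≤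
          ... | inj₁ r< = before r (steep x∈ r< j≤)
            where
            before : KeyOrder v (r₁ , j₁) (r₂ , j₂) → v (r₂ , j₂) < v (r₁ , j₁) → ⊥
            before (inj₁ lt)      gt = ℕP.<-asym lt gt
            before (inj₂ (e , _)) gt = ℕP.<⇒≢ gt (sym e)
          ... | inj₂ refl with r
          ...   | inj₁ lt       = ℕP.<⇒≱ lt (row≤ r₁ x∈ j≤)
          ...   | inj₂ (_ , lt) = ℕP.<⇒≱ lt (ℕP.+-monoˡ-≤ (len ∸ suc r₁) j≤)
        sorted-v : map v o ≡ expand 0 α
        sorted-v = expand-unique 0 α (map v o)
          (APP.map⁺ (AllPairs.map (λ { (inj₁ lt) → ℕP.<⇒≤ lt ; (inj₂ (e , _)) → ℕP.≤-reflexive e }) o-sorted))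
          (All.universal (λ _ → z≤n) _)
          (PP.All-resp-↭ (PP.map⁺ v (↭-sym o↭)) (subst (All (_< length α)) (sym map-v) (proj₂ bounded)))
          (trans (contentFrom-cong 0 α (λ u _ → count-↭ (u ≡ᵇ_) (subst (map v o ↭_) map-v (PP.map⁺ v o↭))))
                 (proj₂ (∧-true {allᵇ okTableau (pairs (zip Y f))} ok)))
        |o| : length o ≡ sum α
        |o| = trans (sym (LP.length-map v o)) (trans (cong length sorted-v) (length-expand 0 α))
        module N = Numbered α o↭ |o|
        b≡v : ∀ {x} → x ∈ o → N.b x ≡ v x
        b≡v = map-≡⇒∈ o (trans N.map-b (sym sorted-v))
        runs : Runs α (map idx o)
        runs = trans (LP.length-map idx o) |o| , sameBlock⇒runs N.b idx N.blocks
          (AllPairs-map-∈ (λ {x} {y} x∈ y∈ r eq → within x y r (trans (sym (b≡v x∈)) (trans eq (b≡v y∈)))) o-sorted)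
          where
          within : ∀ x y → KeyOrder v x y → v x ≡ v y → idx x < idx y
          within x y (inj₁ lt)       e = ⊥-elim (ℕP.<⇒≢ lt e)
          within x y (inj₂ (_ , lt)) e = lt

    coeffS-coefficient : ∀ {N} → length Y ≤ N → pos (coeffS sh α) ≡ coefficient N (words (λ _ → 1ℤ)) α
    coeffS-coefficient {N} |Y|≤N = begin
      pos (coeffS sh α)
        ≡⟨ cong pos (coeffS-unfold sh α) ⟩
      pos (count (isTableau sh α) (allWords (length α) (length Y)))
        ≡⟨ pos-count (isTableau sh α) (allWords (length α) (length Y)) ⟩
      ∑ (allWords (length α) (length Y)) (λ f → indᵇ (isTableau sh α f))
        ≡⟨ sym (∑-bijection (λ o → does (valid? o)) (isTableau sh α) tableau (perms-unique Y-unique) (allWords-unique (length α) (length Y)) maps injective surjective) ⟩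
      ∑ (perms Y) (λ o → ind (valid? o))
        ≡⟨ ∑-cong (perms Y) (λ o → split o) ⟩
      ∑ (perms Y) (λ o → ind (standard? o) * 1ℤ * ind (runs? α (map idx o)))
        ≡⟨ sym (coefficient-words P (λ _ → 1ℤ) (λ x∈ → ℕP.<-≤-trans (idx-bound x∈) |Y|≤N) α) ⟩
      coefficient N (words (λ _ → 1ℤ)) α ∎
      where
      open ≡-Reasoning
      split : ∀ o → ind (valid? o) ≡ ind (standard? o) * 1ℤ * ind (runs? α (map idx o))
      split o with standard? o | runs? α (map idx o)
      ... | yes _ | yes _ = refl
      ... | yes _ | no _  = refl
      ... | no _  | yes _ = refl
      ... | no _  | no _  = refl

expand-zeros : ∀ v α m → expand v (α ++ replicate m 0) ≡ expand v α
expand-zeros v []      zero    = refl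
expand-zeros v []      (suc m) = expand-zeros (suc v) [] m
expand-zeros v (a ∷ α) m       = cong (replicate a v ++_) (expand-zeros (suc v) α m)

expand-padded : ∀ v {α} → All (0 <_) α → ∀ β → expand v α ≡ expand v β → ∃ λ m → β ≡ α ++ replicate m 0
expand-padded v []      []          eq = 0 , refl
expand-padded v []      (zero ∷ β)  eq with expand-padded (suc v) [] β eq
... | m , refl = suc m , refl
expand-padded v (_∷_ {suc a} _ _) [] ()
expand-padded v (_∷_ {a} {α} _ pα) (b ∷ β) eq with expand-∷ v {a} {b} {α} {β} eq
... | refl , eq′ with expand-padded (suc v) pα β eq′
...   | m , refl = m , refl

count-witness : {A : Set} (p : A → Bool) (xs : List A) → 0 < count p xs → ∃ λ x → x ∈ xs × p x ≡ true
count-witness p (x ∷ xs) lt with p x in eq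
... | true  = x , here refl , eq
... | false with count-witness p xs lt
...   | y , y∈ , py = y , there y∈ , py

unique-⊆-length : {A : Set} {xs ys : List A} → Unique xs → (∀ {x} → x ∈ xs → x ∈ ys) → length xs ≤ length ys
unique-⊆-length []                       f = z≤n
unique-⊆-length {xs = x ∷ xs} (x∉ ∷ u) f with MP.∈-∃++ (f (here refl))
... | Y₁ , Y₂ , refl = ℕP.≤-trans (s≤s (unique-⊆-length u f′)) (ℕP.≤-reflexive (sym (PP.↭-length (PP.shift x Y₁ Y₂))))
  where
  f′ : ∀ {z} → z ∈ xs → z ∈ Y₁ ++ Y₂
  f′ z∈ with PP.∈-resp-↭ (PP.shift x Y₁ Y₂) (f (there z∈))
  ... | here refl = ⊥-elim (All.lookup x∉ z∈ refl)
  ... | there z∈′ = z∈′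

-- The only good tuple of a straight shape

module Superstandard (sh : List ℕ) (positive : All (0 <_) sh) (descending : Descending sh) where
  open Tableaux sh positive descending public
  open Poset P using (Standard; standard?; words)

  private
    module Unique-Good (β : List ℕ) {o : List (ℕ × ℕ)} (o↭ : o ↭ Y) (std : Standard o) (runs : Runs β (map idx o))
      (good : Good (chop β (map idx o))) where

      open Numbered β o↭ (trans (sym (LP.length-map idx o)) (proj₁ runs))
      inc = proj₂ runs

      dominated : Dominated b idx 0 o
      dominated = good⇒dominated b idx blocks good

      lower : ∀ r j → (r , j) ∈ Y → r ≤ b (r , j)
      lower zero    j _  = z≤n
      lower (suc r) j x∈ = ℕP.≤-<-trans (lower r j up∈) (b-up std inc r j (suc r) up∈ x∈ (ℕP.n<1+n r))
        where
        up∈ : (r , j) ∈ Y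
        up∈ = corner x∈ x∈ (ℕP.n≤1+n r) ℕP.≤-refl

      -- Downward induction on content: a cell above its row would be the last of its row, and the
      -- lattice condition would need a cell of larger content in a row that is no longer.
      upper : ∀ fuel r j → (r , j) ∈ Y → length Y ≤ idx (r , j) ℕ.+ fuel → b (r , j) ≤ r
      upper zero       r j x∈ le = ⊥-elim (ℕP.<⇒≱ (idx-bound x∈) (subst (length Y ≤_) (ℕP.+-identityʳ _) le))
      upper (suc fuel) r j x∈ le with b (r , j) ℕP.≤? r
      ... | yes b≤r = b≤r
      ... | no  b≰r with suc j ℕP.<? part sh r
      ...   | yes inside = ⊥-elim (b≰r (ℕP.≤-trans
                (b-≤ std inc (r , j) (r , suc j) x∈ (∈-Y⁺ inside) ((ℕP.≤-refl , ℕP.n≤1+n j) , inj₂ (ℕP.n<1+n j)))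
                (upper fuel r (suc j) (∈-Y⁺ inside) (subst (length Y ≤_) (ℕP.+-suc (idx (r , j)) fuel) le))))
      ...   | no  outside with b (r , j) in eq
      ...     | zero  = ⊥-elim (b≰r z≤n)
      ...     | suc i with count-witness _ o (ℕP.<-≤-trans
                (count-positive (λ y → does (b y ℕP.≟ suc i) ∧ (idx (r , j) ≤ᵇ idx y)) (Y⇒o x∈)
                  (cong₂ _∧_ (does-true (b (r , j) ℕP.≟ suc i) eq) (≤⇒≤ᵇ≡ {idx (r , j)} ℕP.≤-refl)))
                (dominated (Y⇒o x∈) i z≤n eq))
      ...       | (r′ , j′) , z∈ , hit = ⊥-elim (ℕP.<⇒≱ larger smaller)
        where
        bz : b (r′ , j′) ≡ i
        bz = does⇒ (b (r′ , j′) ℕP.≟ i) (proj₁ (∧-true {does (b (r′ , j′) ℕP.≟ i)} hit))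
        larger : idx (r , j) < idx (r′ , j′)
        larger = ℕP.<ᵇ⇒< _ _ (subst T (sym (proj₂ (∧-true {does (b (r′ , j′) ℕP.≟ i)} hit))) tt)
        z≤row : i ≤ r′
        z≤row = subst (_≤ r′) bz (upper fuel r′ j′ (o⇒Y z∈) (ℕP.≤-trans le
          (subst (_≤ idx (r′ , j′) ℕ.+ fuel) (sym (ℕP.+-suc (idx (r , j)) fuel)) (ℕP.+-monoˡ-≤ fuel larger))))
        r≤r′ : r ≤ r′
        r≤r′ = ℕP.≤-trans (ℕP.≤-pred (ℕP.≰⇒> b≰r)) z≤row
        smaller : idx (r′ , j′) ≤ idx (r , j)
        smaller = ℕP.+-mono-≤ (ℕP.≤-pred (ℕP.<-≤-trans (∈-Y⁻ (o⇒Y z∈)) (ℕP.≤-trans (antitone r≤r′) (ℕP.≮⇒≥ outside))))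
          (ℕP.∸-monoʳ-≤ len (s≤s r≤r′))

      b≡row : ∀ {x} → x ∈ Y → b x ≡ proj₁ x
      b≡row {r , j} x∈ = ℕP.≤-antisym (upper (length Y) r j x∈ (ℕP.m≤n+m _ _)) (lower r j x∈)

      o≡Y : o ≡ Y
      o≡Y = sorted-↭⇒≡ (λ {x} {y} → KeyOrder-asym proj₁ {x} {y})
        (AllPairs-map-∈ (λ {x} {y} x∈ y∈ → subst₂ (λ u v → u < v ⊎ (u ≡ v × idx x < idx y)) (b≡row (o⇒Y x∈)) (b≡row (o⇒Y y∈))) (b-sorted std inc))
        (AllPairs.map rowKey Y-sorted) o↭
        where
        rowKey : ∀ {x y} → RowOrder x y → KeyOrder proj₁ x y
        rowKey (inj₁ lt)          = inj₁ lt
        rowKey (inj₂ (refl , lt)) = inj₂ (refl , ℕP.+-monoˡ-< _ lt)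

      padded : ∃ λ m → β ≡ sh ++ replicate m 0
      padded = expand-padded 0 positive β (trans (sym map-row) (trans (cong (map proj₁) (sym o≡Y))
        (trans (sym (map-cong-∈ o (λ x∈ → b≡row (o⇒Y x∈)))) map-b)))

    module Row-Filling (m : ℕ) where

      β : List ℕ
      β = sh ++ replicate m 0

      std : Standard Y
      std = AllPairs.map notBelow Y-sorted
        where
        notBelow : ∀ {x y} → RowOrder x y → ¬ y ≺ x
        notBelow (inj₁ r<)          ((r≥ , _) , _) = ℕP.<⇒≱ r< r≥
        notBelow (inj₂ (refl , j<)) ((_ , j≥) , _) = ℕP.<⇒≱ j< j≥

      blocks : Blocks proj₁ 0 β Y
      blocks = toBlocks proj₁ idx 0 β Y (trans map-row (sym (expand-zeros 0 sh m)))

      runs : Runs β (map idx Y)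
      runs = trans (LP.length-map idx Y) (trans length-Y (trans (sym (length-expand 0 sh))
          (trans (cong length (sym (expand-zeros 0 sh m))) (length-expand 0 β)))) ,
        sameBlock⇒runs proj₁ idx blocks (AllPairs.map sameRow Y-sorted)
        where
        sameRow : ∀ {x y} → RowOrder x y → proj₁ x ≡ proj₁ y → idx x < idx y
        sameRow (inj₁ r<)          eq = ⊥-elim (ℕP.<⇒≢ r< eq)
        sameRow (inj₂ (refl , j<)) _  = ℕP.+-monoˡ-< _ j<

      good : Good (chop β (map idx Y))
      good = dominated⇒good proj₁ idx blocks dominated
        where
        -- Moving a cell of row `j + 1` straight down into row `j` is injective and raises the
        -- content by one, which gives the strict bound.
        dominated : Dominated proj₁ idx 0 Y
        dominated {_ , t₀} x∈ j _ refl = subst (_≤ gt proj₁ idx j c Y) (LP.length-map (λ y → j , proj₂ y) (filterᵇ p Y))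
          (unique-⊆-length (unique-map-∈ (λ y → j , proj₂ y) (UP.filter⁺ (T? ∘ p) Y-unique) injective) contained′)
          where
          c = idx (suc j , t₀)
          p q : ℕ × ℕ → Bool
          p y = does (proj₁ y ℕP.≟ suc j) ∧ (c ≤ᵇ idx y)
          q y = does (proj₁ y ℕP.≟ j) ∧ (c <ᵇ idx y)
          kept : ∀ {y} → y ∈ filterᵇ p Y → y ∈ Y × proj₁ y ≡ suc j × c ≤ idx y
          kept {y} y∈ with MP.∈-filter⁻ (T? ∘ p) {xs = Y} y∈
          ... | y∈Y , py with ∧-true {does (proj₁ y ℕP.≟ suc j)} (T⇒≡ py)
          ...   | e , le = y∈Y , does⇒ (proj₁ y ℕP.≟ suc j) e , ℕP.≤ᵇ⇒≤ _ _ (subst T (sym le) tt)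
          injective : ∀ {y y′} → y ∈ filterᵇ p Y → y′ ∈ filterᵇ p Y → (j , proj₂ y) ≡ (j , proj₂ y′) → y ≡ y′
          injective y∈ y′∈ eq = cong₂ _,_ (trans (proj₁ (proj₂ (kept y∈))) (sym (proj₁ (proj₂ (kept y′∈))))) (cong proj₂ eq)
          contained′ : ∀ {z} → z ∈ map (λ y → j , proj₂ y) (filterᵇ p Y) → z ∈ filterᵇ q Y
          contained′ z∈ with MP.∈-map⁻ (λ y → j , proj₂ y) z∈
          ... | (_ , t) , y∈ , refl with kept y∈
          ...   | y∈Y , refl , c≤ = MP.∈-filter⁺ (T? ∘ q) (corner y∈Y y∈Y (ℕP.n≤1+n j) ℕP.≤-refl) (subst T (sym (cong₂ _∧_
            (does-true (j ℕP.≟ j) refl)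
            (<⇒<ᵇ≡ (ℕP.≤-trans (s≤s c≤) (ℕP.≤-reflexive (sym (idx-up {j} {t} (row-< (∈-Y⁻ y∈Y))))))))) tt)

  module _ {N : ℕ} (|Y|≤N : length Y ≤ N) where
    private
      bound : ∀ {x} → x ∈ Y → idx x < N
      bound x∈ = ℕP.<-≤-trans (idx-bound x∈) |Y|≤N
      term : List ℕ → List (ℕ × ℕ) → ℤ
      term β o = ind (standard? o) * 1ℤ * (ind (runs? β (map idx o)) * ind (good? (chop β (map idx o))))

      term-zero : ∀ β o → (Standard o → Runs β (map idx o) → Good (chop β (map idx o)) → ⊥) → term β o ≡ 0ℤ
      term-zero β o contra with standard? o | runs? β (map idx o) | good? (chop β (map idx o))
      ... | no _  | yes _ | yes _ = refl
      ... | no _  | yes _ | no _  = refl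
      ... | no _  | no _  | _     = refl
      ... | yes _ | no _  | _     = refl
      ... | yes _ | yes _ | no _  = refl
      ... | yes s | yes r | yes g = ⊥-elim (contra s r g)

    goodCoefficient-padded : ∀ m → goodCoefficient N (words (λ _ → 1ℤ)) (sh ++ replicate m 0) ≡ 1ℤ
    goodCoefficient-padded m = trans (goodCoefficient-words P (λ _ → 1ℤ) bound β)
      (trans (∑-single (term β) (perms-unique Y-unique) (↭⇒perms Y ↭-refl)
        (λ {o} o∈ o≢Y → term-zero β o (λ s r g → o≢Y (Unique-Good.o≡Y β (perms⇒↭ Y o∈) s r g))))
      (trans (cong (λ s → s * 1ℤ * (ind (runs? β (map idx Y)) * ind (good? (chop β (map idx Y))))) (ind-yes (standard? Y) std))
        (cong₂ (λ r g → 1ℤ * 1ℤ * (r * g)) (ind-yes (runs? β (map idx Y)) runs) (ind-yes (good? (chop β (map idx Y))) good))))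
      where open Row-Filling m

    goodCoefficient-other : ∀ β → (∀ m → β ≢ sh ++ replicate m 0) → goodCoefficient N (words (λ _ → 1ℤ)) β ≡ 0ℤ
    goodCoefficient-other β ≢ = trans (goodCoefficient-words P (λ _ → 1ℤ) bound β)
      (∑-zero-∈ (perms Y) (λ {o} o∈ → term-zero β o (λ s r g →
        let (m , eq) = Unique-Good.padded β (perms⇒↭ Y o∈) s r g in ≢ m eq)))

-- The Schur expansion

switchboard-+ : ∀ {f g} → Switchboard f → Switchboard g → Switchboard (λ v → f v + g v)
switchboard-+ {f} {g} S S′ = record
  { far  = λ x y i≤j → cong₂ _+_ (far S x y i≤j) (far S′ x y i≤j)
  ; four = λ x y i → trans (+-interchange (f (x ++ suc (suc i) ∷ i ∷ suc i ∷ y)) _ (f (x ++ suc i ∷ i ∷ suc (suc i) ∷ y)) _)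
      (trans (cong₂ _+_ (four S x y i) (four S′ x y i))
        (+-interchange (f (x ++ i ∷ suc (suc i) ∷ suc i ∷ y)) _ (g (x ++ i ∷ suc (suc i) ∷ suc i ∷ y)) _))
  ; sq≤  = λ x y a Y p → cong₂ _+_ (sq≤ S x y a Y p) (sq≤ S′ x y a Y p)
  ; sq≥  = λ x y a Y p → cong₂ _+_ (sq≥ S x y a Y p) (sq≥ S′ x y a Y p)
  }

switchboard-* : ∀ {f} c → Switchboard f → Switchboard (λ v → c * f v)
switchboard-* c S = record
  { far  = λ x y i≤j → cong (c *_) (far S x y i≤j)
  ; four = λ x y i → trans (sym (ℤP.*-distribˡ-+ c _ _)) (trans (cong (c *_) (four S x y i)) (ℤP.*-distribˡ-+ c _ _))
  ; sq≤  = λ x y a Y p → trans (cong (c *_) (sq≤ S x y a Y p)) (ℤP.*-zeroʳ c)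
  ; sq≥  = λ x y a Y p → trans (cong (c *_) (sq≥ S x y a Y p)) (ℤP.*-zeroʳ c)
  }

switchboard-0 : Switchboard (λ _ → 0ℤ)
switchboard-0 = record
  { far = λ _ _ _ → refl ; four = λ _ _ _ → refl ; sq≤ = λ _ _ _ _ _ → refl ; sq≥ = λ _ _ _ _ _ → refl }

switchboard-∑ : {A : Set} (xs : List A) {h : A → Word → ℤ} → (∀ x → Switchboard (h x)) → Switchboard (λ v → ∑ xs (λ x → h x v))
switchboard-∑ []       S = switchboard-0
switchboard-∑ (x ∷ xs) S = switchboard-+ (S x) (switchboard-∑ xs S)

onGood-ind : ∀ (f : Word → ℤ) Bs → onGood (f ∘ concat) Bs ≡ f (concat Bs) * ind (good? Bs)
onGood-ind f Bs with good? Bs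
... | yes _ = sym (ℤP.*-identityʳ (f (concat Bs)))
... | no _  = sym (ℤP.*-zeroʳ (f (concat Bs)))

module _ {A : Set} (xs : List A) (f : Word → ℤ) (c : A → ℤ) (h : A → Word → ℤ) (N : ℕ) (α : List ℕ) where

  private
    combination : Word → ℤ
    combination v = f v + ∑ xs (λ x → - c x * h x v)

    ∑-combination : (e : List Word → ℤ) → ∑ (tuples N α) (λ Bs → combination (concat Bs) * e Bs)
      ≡ ∑ (tuples N α) (λ Bs → f (concat Bs) * e Bs) + ∑ xs (λ x → - c x * ∑ (tuples N α) (λ Bs → h x (concat Bs) * e Bs))
    ∑-combination e = begin
      ∑ (tuples N α) (λ Bs → combination (concat Bs) * e Bs)
        ≡⟨ ∑-cong (tuples N α) (λ Bs → trans (ℤP.*-distribʳ-+ (e Bs) (f (concat Bs)) (∑ xs (λ x → - c x * h x (concat Bs))))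
             (cong (_+_ (f (concat Bs) * e Bs)) (trans (sym (∑-*ʳ xs (e Bs) (λ x → - c x * h x (concat Bs))))
               (∑-cong xs (λ x → ℤP.*-assoc (- c x) (h x (concat Bs)) (e Bs)))))) ⟩
      ∑ (tuples N α) (λ Bs → f (concat Bs) * e Bs + ∑ xs (λ x → - c x * (h x (concat Bs) * e Bs)))
        ≡⟨ ∑-+ (tuples N α) (λ Bs → f (concat Bs) * e Bs) (λ Bs → ∑ xs (λ x → - c x * (h x (concat Bs) * e Bs))) ⟩
      ∑ (tuples N α) (λ Bs → f (concat Bs) * e Bs) + ∑ (tuples N α) (λ Bs → ∑ xs (λ x → - c x * (h x (concat Bs) * e Bs)))
        ≡⟨ cong (_+_ (∑ (tuples N α) (λ Bs → f (concat Bs) * e Bs)))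
             (trans (∑-swap (tuples N α) xs (λ Bs x → - c x * (h x (concat Bs) * e Bs)))
               (∑-cong xs (λ x → ∑-*ˡ (tuples N α) (- c x) (λ Bs → h x (concat Bs) * e Bs)))) ⟩
      ∑ (tuples N α) (λ Bs → f (concat Bs) * e Bs) + ∑ xs (λ x → - c x * ∑ (tuples N α) (λ Bs → h x (concat Bs) * e Bs)) ∎
      where open ≡-Reasoning

    unit : ∀ g → coefficient N g α ≡ ∑ (tuples N α) (λ Bs → g (concat Bs) * 1ℤ)
    unit g = ∑-cong (tuples N α) (λ Bs → sym (ℤP.*-identityʳ (g (concat Bs))))

    good-unit : ∀ g → goodCoefficient N g α ≡ ∑ (tuples N α) (λ Bs → g (concat Bs) * ind (good? Bs))
    good-unit g = ∑-cong (tuples N α) (onGood-ind g)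

  coefficient-combination : coefficient N combination α ≡ coefficient N f α + ∑ xs (λ x → - c x * coefficient N (h x) α)
  coefficient-combination = trans (unit combination) (trans (∑-combination (λ _ → 1ℤ))
    (sym (cong₂ _+_ (unit f) (∑-cong xs (λ x → cong (- c x *_) (unit (h x)))))))

  goodCoefficient-combination : goodCoefficient N combination α ≡ goodCoefficient N f α + ∑ xs (λ x → - c x * goodCoefficient N (h x) α)
  goodCoefficient-combination = trans (good-unit combination) (trans (∑-combination (λ Bs → ind (good? Bs)))
    (sym (cong₂ _+_ (good-unit f) (∑-cong xs (λ x → cong (- c x *_) (good-unit (h x)))))))

-- At the smallest letter of a block the condition counts the whole block against part of the
-- preceding one.
good-descending : ∀ {Bs} → Good Bs → All Increasing Bs → Descending (map length Bs)
good-descending []                    []           = []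
good-descending (_∷_ {A} {Bs} fits good) (_ ∷ incs) with good-descending good incs
... | d = shorter Bs fits incs d ∷ d
  where
  fits-length : ∀ B → Fits A B → Increasing B → length B ≤ length A
  fits-length []      _          _        = z≤n
  fits-length (c ∷ B) (le ∷ _) (c< ∷ _) = ℕP.≤-trans
    (ℕP.≤-reflexive (sym (count-all (c ≤ᵇ_) (≤⇒≤ᵇ≡ {c} ℕP.≤-refl ∷ All.map (≤⇒≤ᵇ≡ ∘ ℕP.<⇒≤) c<))))
    (ℕP.≤-trans le (count-≤-length (c <ᵇ_) A))
  shorter : ∀ Bs → Fits A (hd Bs) → All Increasing Bs → Descending (map length Bs) → All (length A ≥_) (map length Bs)
  shorter []       _    _         _        = []
  shorter (B ∷ Bs) fits (inc ∷ _) (B≥ ∷ _) = fits-length B fits inc ∷ All.map (λ le → ℕP.≤-trans le (fits-length B fits inc)) B≥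

chop-zeros : ∀ (sh : List ℕ) m (v : Word) → length v ≡ sum sh → chop (sh ++ replicate m 0) v ≡ chop sh v ++ replicate m []
chop-zeros []       zero    []      _   = refl
chop-zeros []       (suc m) []      eq  = cong ([] ∷_) (chop-zeros [] m [] eq)
chop-zeros (a ∷ sh) m       v       eq  = cong (List.take a v ∷_) (chop-zeros sh m (List.drop a v)
  (trans (LP.length-drop a v) (trans (cong (_∸ a) eq) (ℕP.m+n∸m≡n a (sum sh)))))

good-++-[] : ∀ Bs m → Good Bs → Good (Bs ++ replicate m [])
good-++-[] []           zero    []         = []
good-++-[] []           (suc zero)    []   = [] ∷ []
good-++-[] []           (suc (suc m)) []   = [] ∷ good-++-[] [] (suc m) []
good-++-[] (A ∷ [])     zero    (f ∷ g)    = f ∷ g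
good-++-[] (A ∷ [])     (suc m) (_ ∷ g)    = [] ∷ good-++-[] [] (suc m) []
good-++-[] (A ∷ B ∷ Bs) m       (f ∷ g)    = f ∷ good-++-[] (B ∷ Bs) m g

good-++-[]⁻ : ∀ Bs m → Good (Bs ++ replicate m []) → Good Bs
good-++-[]⁻ []           m _       = []
good-++-[]⁻ (A ∷ [])     m _       = [] ∷ []
good-++-[]⁻ (A ∷ B ∷ Bs) m (f ∷ g) = f ∷ good-++-[]⁻ (B ∷ Bs) m g

sum-zeros : ∀ sh m → sum (sh ++ replicate m 0) ≡ sum sh
sum-zeros sh m = trans (sym (length-expand 0 (sh ++ replicate m 0))) (trans (cong length (expand-zeros 0 sh m)) (length-expand 0 sh))

-- The number of variables may exceed the number of rows; the extra blocks are empty, and empty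
-- blocks satisfy every condition.
runs-good-zeros : ∀ sh m v → ind (runs? (sh ++ replicate m 0) v) * ind (good? (chop (sh ++ replicate m 0) v))
  ≡ ind (runs? sh v) * ind (good? (chop sh v))
runs-good-zeros sh m v = go (length v ℕP.≟ sum sh)
  where
  go : Dec (length v ≡ sum sh) → ind (runs? (sh ++ replicate m 0) v) * ind (good? (chop (sh ++ replicate m 0) v))
    ≡ ind (runs? sh v) * ind (good? (chop sh v))
  go (no ≢) = trans
    (cong (_* ind (good? (chop (sh ++ replicate m 0) v))) (ind-no (runs? (sh ++ replicate m 0) v) (λ r → ≢ (trans (proj₁ r) (sum-zeros sh m)))))
    (sym (cong (_* ind (good? (chop sh v))) (ind-no (runs? sh v) (λ r → ≢ (proj₁ r)))))
  go (yes len) = cong₂ _*_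
    (ind-iff (runs? (sh ++ replicate m 0) v) (runs? sh v)
      (λ (_ , inc) → len , AllP.++⁻ˡ (chop sh v) (subst (All Increasing) split inc))
      (λ (_ , inc) → trans len (sym (sum-zeros sh m)) , subst (All Increasing) (sym split) (AllP.++⁺ inc (AllP.replicate⁺ m []))))
    (ind-iff (good? (chop (sh ++ replicate m 0) v)) (good? (chop sh v))
      (λ g → good-++-[]⁻ (chop sh v) m (subst Good split g))
      (λ g → subst Good (sym split) (good-++-[] (chop sh v) m g)))
    where
    split : chop (sh ++ replicate m 0) v ≡ chop sh v ++ replicate m []
    split = chop-zeros sh m v len

-- Partitions and their Schur functionals

record IsPartition (n : ℕ) (sh : List ℕ) : Set where
  constructor partition
  field
    positive   : All (0 <_) sh
    descending : Descending sh
    total      : sum sh ≡ n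

descendingᵇ⇒ : ∀ l → descendingᵇ l ≡ true → Descending l
descendingᵇ⇒ []          _  = []
descendingᵇ⇒ (a ∷ [])    _  = [] ∷ []
descendingᵇ⇒ (a ∷ b ∷ l) eq = prepend (descendingᵇ⇒ (b ∷ l) (proj₂ (∧-true {b ≤ᵇ a} eq)))
  where
  b≤a : b ≤ a
  b≤a = ℕP.≤ᵇ⇒≤ b a (subst T (sym (proj₁ (∧-true {b ≤ᵇ a} eq))) tt)
  prepend : Descending (b ∷ l) → Descending (a ∷ b ∷ l)
  prepend (b≥ ∷ d) = (b≤a ∷ All.map (λ le → ℕP.≤-trans le b≤a) b≥) ∷ b≥ ∷ d

⇒descendingᵇ : ∀ {l} → Descending l → descendingᵇ l ≡ true
⇒descendingᵇ []                      = refl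
⇒descendingᵇ ([] ∷ [])               = refl
⇒descendingᵇ ((b≤a ∷ _) ∷ b≥ ∷ d) = cong₂ _∧_ (≤⇒≤ᵇ≡ b≤a) (⇒descendingᵇ (b≥ ∷ d))

∈-partitions⁻ : ∀ {n sh} → sh ∈ partitions n → IsPartition n sh
∈-partitions⁻ {n} {sh} sh∈ with MP.∈-filter⁻ (T? ∘ isPartitionOf n) {xs = concatMap (allWords (suc n)) (upTo (suc n))} sh∈
... | _ , t with ∧-true {sum sh ≡ᵇ n} (trans (sym (isPartitionOf-unfold n sh)) (T⇒≡ t))
...   | s , r with ∧-true {allᵇ (0 <ᵇ_) sh} r
...     | p , d = partition (All.tabulate (λ x∈ → ℕP.<ᵇ⇒< 0 _ (subst T (sym (allᵇ⇒ (0 <ᵇ_) p x∈)) tt)))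
                            (descendingᵇ⇒ sh d) (ℕP.≡ᵇ⇒≡ _ _ (subst T (sym s) tt))

∈-partitions⁺ : ∀ {n sh} → IsPartition n sh → sh ∈ partitions n
∈-partitions⁺ {n} {sh} (partition positive descending refl) = MP.∈-filter⁺ (T? ∘ isPartitionOf n)
  (MP.∈-concatMap⁺ (allWords (suc n)) (lose (MP.∈-upTo⁺ (s≤s (length≤ positive))) (∈-allWords⁺ sh (parts≤ sh))))
  (subst T (sym (trans (isPartitionOf-unfold n sh) (cong₂ _∧_ (≡ᵇ-refl n)
    (cong₂ _∧_ (⇒allᵇ (0 <ᵇ_) sh (λ x∈ → <⇒<ᵇ≡ (All.lookup positive x∈))) (⇒descendingᵇ descending))))) tt)
  where
  length≤ : ∀ {l} → All (0 <_) l → length l ≤ sum l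
  length≤ []       = z≤n
  length≤ (p ∷ ps) = ℕP.+-mono-≤ p (length≤ ps)
  parts≤ : ∀ l → All (_< suc (sum l)) l
  parts≤ []      = []
  parts≤ (a ∷ l) = s≤s (ℕP.m≤m+n a (sum l)) ∷ All.map (λ lt → ℕP.<-≤-trans lt (s≤s (ℕP.m≤n+m (sum l) a))) (parts≤ l)

partitions-unique : ∀ n → Unique (partitions n)
partitions-unique n = UP.filter⁺ (T? ∘ isPartitionOf n) (unique-concatMap (allWords (suc n)) (UP.upTo⁺ (suc n))
  (λ {l} _ → allWords-unique (suc n) l)
  (λ {l} {l′} _ _ s∈ s∈′ → trans (sym (proj₁ (All.lookup (allWords-bounded (suc n) l) s∈))) (proj₁ (All.lookup (allWords-bounded (suc n) l′) s∈′))))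

trim : ∀ β → Descending β → ∃ λ sh → ∃ λ m → β ≡ sh ++ replicate m 0 × All (0 <_) sh × Descending sh
trim []          _        = [] , 0 , refl , [] , []
trim (zero ∷ β)  (b≥ ∷ _) = [] , suc (length β) , cong (0 ∷_) (all-zero b≥) , [] , []
  where
  all-zero : ∀ {β} → All (0 ≥_) β → β ≡ replicate (length β) 0
  all-zero []           = refl
  all-zero (z≤n ∷ zs) = cong (0 ∷_) (all-zero zs)
trim (suc a ∷ β) (b≥ ∷ d) with trim β d
... | sh , m , refl , p , d′ = suc a ∷ sh , m , refl , s≤s z≤n ∷ p , AllP.++⁻ˡ sh b≥ ∷ d′

padded-descending : ∀ {sh} m → Descending sh → Descending (sh ++ replicate m 0)
padded-descending {sh} m d = APP.++⁺ d (zeros m) (All.universal (λ _ → AllP.replicate⁺ m z≤n) sh)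
  where
  zeros : ∀ m → Descending (replicate m 0)
  zeros zero    = []
  zeros (suc m) = AllP.replicate⁺ m z≤n ∷ zeros m

positive? : ∀ sh → Dec (All (0 <_) sh × Descending sh)
positive? sh = All.all? (0 ℕP.<?_) sh ×-dec AllPairs.allPairs? ℕP._≥?_ sh

-- Defined on all lists, with value 0 where no straight shape exists, so that it can be summed over
-- a plain list of partitions.
schurWords : List ℕ → Word → ℤ
schurWords sh v with positive? sh
... | yes (p , d) = Poset.words (Young.P sh p d) (λ _ → 1ℤ) v
... | no _        = 0ℤ

schurWords-partition : ∀ {n sh} → IsPartition n sh → ∃ λ p → ∃ λ d → schurWords sh ≡ Poset.words (Young.P sh p d) (λ _ → 1ℤ)
schurWords-partition {n} {sh} (partition p d _) with positive? sh
... | yes (p′ , d′) = p′ , d′ , refl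
... | no ¬pd        = ⊥-elim (¬pd (p , d))

schurWords-switchboard : ∀ sh → Switchboard (schurWords sh)
schurWords-switchboard sh with positive? sh
... | yes (p , d) = words-switchboard (Young.P sh p d) (Young.switchable sh p d) (λ _ → 1ℤ)
... | no _        = switchboard-0

-- Subtraction of the Schur functions

module _ (k : ℕ) (ν : Fin k → SkewShape) (diam : Diam≤3 k ν) (d : ℕ) where
  open LLT k ν diam
  open Poset P using (words; Standard; standard?; inv)

  private
    n = length C
    f : Word → ℤ
    f = words (statistic d)
    multiplicity : List ℕ → ℤ
    multiplicity = goodCoefficient n f

    F : Word → ℤ
    F v = f v + ∑ (partitions n) (λ sh → - multiplicity sh * schurWords sh v)

    F-switchboard : Switchboard F
    F-switchboard = switchboard-+ (words-switchboard P switchable (statistic d))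
      (switchboard-∑ (partitions n) (λ sh → switchboard-* (- multiplicity sh) (schurWords-switchboard sh)))

    |Y|≤n : ∀ {sh} (p : All (0 <_) sh) (e : Descending sh) → IsPartition n sh → length (Young.Y sh p e) ≤ n
    |Y|≤n {sh} p e is = ℕP.≤-reflexive (trans (Young.length-Y sh p e) (IsPartition.total is))

    schur-coefficient : ∀ {sh} → IsPartition n sh → ∀ α → coefficient n (schurWords sh) α ≡ pos (coeffS sh α)
    schur-coefficient {sh} is α with schurWords-partition is
    ... | p , e , eq = trans (cong (λ g → coefficient n g α) eq) (sym (Tableaux.coeffS-coefficient sh p e α (|Y|≤n p e is)))

    schur-padded : ∀ {sh} → IsPartition n sh → ∀ m → goodCoefficient n (schurWords sh) (sh ++ replicate m 0) ≡ 1ℤ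
    schur-padded {sh} is m with schurWords-partition is
    ... | p , e , eq = trans (cong (λ g → goodCoefficient n g (sh ++ replicate m 0)) eq)
      (Superstandard.goodCoefficient-padded sh p e (|Y|≤n p e is) m)

    schur-other : ∀ {sh} → IsPartition n sh → ∀ β → (∀ m → β ≢ sh ++ replicate m 0) → goodCoefficient n (schurWords sh) β ≡ 0ℤ
    schur-other {sh} is β ≢ with schurWords-partition is
    ... | p , e , eq = trans (cong (λ g → goodCoefficient n g β) eq) (Superstandard.goodCoefficient-other sh p e (|Y|≤n p e is) β ≢)

    multiplicity-padded : ∀ sh m → goodCoefficient n f (sh ++ replicate m 0) ≡ multiplicity sh
    multiplicity-padded sh m = trans (goodCoefficient-words P (statistic d) idx-bound (sh ++ replicate m 0))
      (trans (∑-cong (perms C) (λ o → cong (ind (standard? o) * statistic d (inv o) *_) (runs-good-zeros sh m (map idx o))))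
        (sym (goodCoefficient-words P (statistic d) idx-bound sh)))

    multiplicity-zero : ∀ β → ¬ (Descending β × sum β ≡ n) → goodCoefficient n f β ≡ 0ℤ
    multiplicity-zero β ¬part = trans (goodCoefficient-words P (statistic d) idx-bound β)
      (∑-zero-∈ (perms C) (λ {o} o∈ → vanish o (perms⇒↭ C o∈)))
      where
      vanish : ∀ o → o ↭ C → ind (standard? o) * statistic d (inv o) * (ind (runs? β (map idx o)) * ind (good? (chop β (map idx o)))) ≡ 0ℤ
      vanish o p with runs? β (map idx o) | good? (chop β (map idx o))
      ... | no _  | _    = ℤP.*-zeroʳ (ind (standard? o) * statistic d (inv o))
      ... | yes _ | no _ = ℤP.*-zeroʳ (ind (standard? o) * statistic d (inv o))
      ... | yes (len , inc) | yes good = ⊥-elim (¬part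
        ( subst Descending (proj₂ (concat-chop β (map idx o) len)) (good-descending good inc)
        , trans (sym len) (trans (LP.length-map idx o) (PP.↭-length p))))

    -- At a partition padded with zeros exactly one Schur function has a good tuple, and only one
    -- such tuple, so the sum returns the multiplicity. At any other β both sides are 0.
    balance : ∀ β → goodCoefficient n f β ≡ ∑ (partitions n) (λ sh → multiplicity sh * goodCoefficient n (schurWords sh) β)
    balance β with AllPairs.allPairs? ℕP._≥?_ β ×-dec (sum β ℕP.≟ n)
    ... | no ¬part = trans (multiplicity-zero β ¬part) (sym (∑-zero-∈ (partitions n) (λ {sh} sh∈ →
        trans (cong (multiplicity sh *_) (schur-other (∈-partitions⁻ {n} sh∈) β
          (λ { m refl → let is = ∈-partitions⁻ {n} sh∈ in
            ¬part (padded-descending m (IsPartition.descending is) , trans (sum-zeros sh m) (IsPartition.total is)) })))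
          (ℤP.*-zeroʳ (multiplicity sh)))))
    ... | yes (desc , |β|) with trim β desc
    ...   | sh , m , refl , p , e = trans (multiplicity-padded sh m) (sym (trans
        (∑-single (λ sh′ → multiplicity sh′ * goodCoefficient n (schurWords sh′) (sh ++ replicate m 0)) (partitions-unique n) (∈-partitions⁺ {n} is)
          (λ {sh′} sh′∈ sh′≢ → trans (cong (multiplicity sh′ *_) (schur-other (∈-partitions⁻ {n} sh′∈) (sh ++ replicate m 0)
              (λ m′ eq → sh′≢ (expand-injective 0 (IsPartition.positive (∈-partitions⁻ {n} sh′∈)) p
                (trans (sym (expand-zeros 0 sh′ m′)) (trans (cong (expand 0) (sym eq)) (expand-zeros 0 sh m)))))))
            (ℤP.*-zeroʳ (multiplicity sh′))))
        (trans (cong (multiplicity sh *_) (schur-padded is m)) (ℤP.*-identityʳ (multiplicity sh)))))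
      where
      is : IsPartition n sh
      is = partition p e (trans (sym (sum-zeros sh m)) |β|)

    ∑-cancel : ∀ {A : Set} (xs : List A) (c g : A → ℤ) t → t ≡ ∑ xs (λ x → c x * g x) → t + ∑ xs (λ x → - c x * g x) ≡ 0ℤ
    ∑-cancel xs c g t eq = trans (cong₂ _+_ eq (trans (∑-cong xs (λ x → sym (ℤP.neg-distribˡ-* (c x) (g x)))) (∑-neg xs (λ x → c x * g x))))
      (ℤP.+-inverseʳ (∑ xs (λ x → c x * g x)))

  coefficient-schur : ∀ α → coefficient n f α ≡ ∑ (partitions n) (λ sh → multiplicity sh * pos (coeffS sh α))
  coefficient-schur α = trans (move (coefficient n f α) (∑ (partitions n) (λ sh → multiplicity sh * coefficient n (schurWords sh) α))
      (trans (cong (_+_ (coefficient n f α)) (trans (sym (∑-neg (partitions n) (λ sh → multiplicity sh * coefficient n (schurWords sh) α)))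
          (∑-cong (partitions n) (λ sh → ℤP.neg-distribˡ-* (multiplicity sh) (coefficient n (schurWords sh) α)))))
        (trans (sym (coefficient-combination (partitions n) f multiplicity schurWords n α))
          (coefficient-vanishes F-switchboard n (length α) good≡0 α refl))))
    (∑-cong-∈ (partitions n) (λ {sh} sh∈ → cong (multiplicity sh *_) (schur-coefficient (∈-partitions⁻ {n} sh∈) α)))
    where
    move : ∀ a b → a + - b ≡ 0ℤ → a ≡ b
    move a b eq = ℤP.i-j≡0⇒i≡j a b eq
    good≡0 : ∀ β → length β ≡ length α → goodCoefficient n F β ≡ 0ℤ
    good≡0 β _ = trans (goodCoefficient-combination (partitions n) f multiplicity schurWords n β)
      (∑-cancel (partitions n) multiplicity (λ sh → goodCoefficient n (schurWords sh) β) (goodCoefficient n f β) (balance β))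

  SchurSideCoeff-expansion : ∀ α → pos (SchurSideCoeff k ν α d) ≡ ∑ (partitions n) (λ sh → multiplicity sh * pos (coeffS sh α))
  SchurSideCoeff-expansion α = trans (pos-sum _ (partitions n))
    (∑-cong-∈ (partitions n) (λ {sh} sh∈ → let is = ∈-partitions⁻ {n} sh∈ in
      Tνλ-goodCoefficient sh (IsPartition.positive is) (IsPartition.descending is) (IsPartition.total is) d (coeffS sh α)))
    where
    pos-sum : {A : Set} (h : A → ℕ) (xs : List A) → pos (sum (map h xs)) ≡ ∑ xs (pos ∘ h)
    pos-sum h []       = refl
    pos-sum h (x ∷ xs) = trans (ℤP.pos-+ (h x) _) (cong (_+_ (pos (h x))) (pos-sum h xs))

theorem4p3 : (k : ℕ) (ν : Fin k → SkewShape) → Diam≤3 k ν →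
    (α : List ℕ) (d : ℕ) → LLTcoeff k ν α d ≡ SchurSideCoeff k ν α d
theorem4p3 k ν diam α d = ℤP.+-injective (trans (LLT.LLTcoeff-coefficient k ν diam α d)
  (trans (coefficient-schur k ν diam d α) (sym (SchurSideCoeff-expansion k ν diam d α))))
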